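{- For every real $k\in(0,1)$, $$\sum_{n=0}^\infty \frac{(\frac13)_n(\frac23)_n}{n!^2}\,P_n\!\left(\frac{1-4k+6k^2-4k^3+10k^4}{(1-2k-2k^2)(1-2k+4k^2)}\right)\left(\frac{(1+k+k^2)(1-2k-2k^2)(1-2k+4k^2)}{(1+2k)^3}\right)^n\bigl(C_3n^3+C_2n^2+C_1n+C_0\bigr)=\frac{\sqrt3\,(1+2k)^4(1-2k+4k^2)}{\pi},$$ where $$C_3=\frac{9(k-1)^2k^2}{1+k+k^2}(3+4k+2k^2)^2(3+2k+4k^2)^2,$$ $$C_2=27(k-1)k(9-18k+10k^2+12k^3+60k^4+160k^5+240k^6+192k^7+64k^8),$$ $$C_1=9-144k+540k^2-584k^3+314k^4-228k^5-1256k^6-1072k^7+768k^8+2560k^9+1280k^{10},$$ $$C_0=2(1-2k-2k^2)^2(1-10k+12k^2-24k^3+16k^4+32k^6).$$ At the single value $k=\frac{\sqrt3-1}{2}$ (where $1-2k-2k^2=0$), the product $P_n(\cdot)\,(\cdot)^n$ in each summand is understood as its limit as $k\to\frac{\sqrt3-1}{2}$.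
   Context: $P_n$ denotes the $n$-th Legendre polynomial, $P_n(x)={}_2F_1\bigl(-n,n+1;1;\tfrac{1-x}{2}\bigr)$, evaluated at any real $x$ (possibly $|x|>1$). $(a)_n=a(a+1)\cdots(a+n-1)$, $(a)_0=1$, is the Pochhammer symbol. -}

module Defs where

open import Data.Nat.Base as ℕ using (ℕ; zero; suc) hiding (module ℕ)
import Data.Nat.Literals as ℕ
import Data.Nat.Properties as ℕ
import Data.Nat.Solver as ℕ
open import Data.Integer.Base as ℤ using (+_; -[1+_])
import Data.Integer.Properties as ℤ
import Data.Integer.Solver as ℤ
open import Data.Rational.Base as ℚ using (ℚ; 0ℚ; 1ℚ; ½; mkℚ) hiding (module ℚ)
import Data.Rational.Literals as ℚ
import Data.Rational.Properties as ℚ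
import Data.Rational.Solver as ℚ
import Data.Rational.Unnormalised.Base as ℚᵘ
import Data.Rational.Unnormalised.Properties as ℚᵘ
open import Algebra.Bundles.Raw using (RawRing)
import Algebra.Definitions.RawSemiring as RawSemiring
open import Data.Product.Base using (_×_; _,_; ∃; proj₁; proj₂)
open import Data.Sum.Base using (inj₁; inj₂; [_,_]′)
open import Data.Unit.Base public using (⊤; tt)
open import Function.Base using (_∘_; _$_)
open import Level using (0ℓ)
open import Relation.Binary.PropositionalEquality
open import Relation.Nullary using (yes; no; contradiction)

partialSum : {A : Set} → (A → A → A) → A → (ℕ → A) → ℕ → A
partialSum _∙_ ε a zero    = ε
partialSum _∙_ ε a (suc n) = partialSum _∙_ ε a n ∙ a n

open RawSemiring ℚ.+-*-rawSemiring using () renaming (_^_ to _^ℚ_)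

module Rational where
  open import Data.Rational.Base using (_+_; _*_; _-_; -_; _≤_; _<_; ∣_∣; _/_)
  open ℚ.+-*-Solver
  open ℚ.≤-Reasoning

  0<1 : 0ℚ < 1ℚ
  0<1 = ℚ.positive⁻¹ 1ℚ

  0<½ : 0ℚ < ½
  0<½ = ℚ.positive⁻¹ ½

  *-pos : ∀ {p q} → 0ℚ < p → 0ℚ < q → 0ℚ < p * q
  *-pos {p} {q} 0<p 0<q =
    ℚ.positive⁻¹ _ {{ℚ.pos*pos⇒pos p {{ℚ.positive 0<p}} q {{ℚ.positive 0<q}}}}

  *-mono-≤ : ∀ {p q r s} → 0ℚ ≤ q → 0ℚ ≤ r → p ≤ q → r ≤ s → p * r ≤ q * s
  *-mono-≤ {q = q} {r} 0≤q 0≤r p≤q r≤s = ℚ.≤-trans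
    (ℚ.*-monoʳ-≤-nonNeg r {{ℚ.nonNegative 0≤r}} p≤q)
    (ℚ.*-monoˡ-≤-nonNeg q {{ℚ.nonNegative 0≤q}} r≤s)

  half+half : ∀ p → ½ * p + ½ * p ≡ p
  half+half = solve 1 (λ p → con ½ :* p :+ con ½ :* p := p) refl

  0≤p² : ∀ p → 0ℚ ≤ p * p
  0≤p² p with ℚ.≤-total 0ℚ p
  ... | inj₁ 0≤p = *-mono-≤ 0≤p ℚ.≤-refl 0≤p 0≤p
  ... | inj₂ p≤0 = begin
    0ℚ            ≤⟨ *-mono-≤ 0≤-p ℚ.≤-refl 0≤-p 0≤-p ⟩
    - p * - p     ≡⟨ solve 1 (λ p → :- p :* :- p := p :* p) refl p ⟩
    p * p         ∎
    where
    0≤-p : 0ℚ ≤ - p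
    0≤-p = ℚ.neg-antimono-≤ p≤0

  p≤∣p∣ : ∀ p → p ≤ ∣ p ∣
  p≤∣p∣ p with ℚ.≤-total 0ℚ p
  ... | inj₁ 0≤p = ℚ.≤-reflexive (sym (ℚ.0≤p⇒∣p∣≡p 0≤p))
  ... | inj₂ p≤0 = ℚ.≤-trans p≤0 (ℚ.0≤∣p∣ p)

  ∣∣-lub : ∀ {p r} → p ≤ r → - p ≤ r → ∣ p ∣ ≤ r
  ∣∣-lub {p} p≤r -p≤r = [ (λ e → subst (_≤ _) (sym e) p≤r)
                        , (λ e → subst (_≤ _) (sym e) -p≤r)
                        ]′ (ℚ.∣p∣≡p∨∣p∣≡-p p)

  ∣p-q∣≡∣q-p∣ : ∀ p q → ∣ p - q ∣ ≡ ∣ q - p ∣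
  ∣p-q∣≡∣q-p∣ p q = trans (sym (ℚ.∣-p∣≡∣p∣ (p - q)))
    (cong ∣_∣ (solve 2 (λ p q → :- (p :- q) := q :- p) refl p q))

  ∣p∣-∣q∣≤∣p-q∣ : ∀ p q → ∣ p ∣ - ∣ q ∣ ≤ ∣ p - q ∣
  ∣p∣-∣q∣≤∣p-q∣ p q = begin
    ∣ p ∣ - ∣ q ∣                   ≡⟨ cong (λ r → ∣ r ∣ - ∣ q ∣) (solve 2 (λ p q → p := (p :- q) :+ q) refl p q) ⟩
    ∣ (p - q) + q ∣ - ∣ q ∣         ≤⟨ ℚ.+-monoˡ-≤ (- ∣ q ∣) (ℚ.∣p+q∣≤∣p∣+∣q∣ (p - q) q) ⟩
    (∣ p - q ∣ + ∣ q ∣) - ∣ q ∣     ≡⟨ solve 2 (λ a b → (a :+ b) :- b := a) refl ∣ p - q ∣ ∣ q ∣ ⟩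
    ∣ p - q ∣                       ∎

  ∣∣p∣-∣q∣∣≤∣p-q∣ : ∀ p q → ∣ ∣ p ∣ - ∣ q ∣ ∣ ≤ ∣ p - q ∣
  ∣∣p∣-∣q∣∣≤∣p-q∣ p q = ∣∣-lub (∣p∣-∣q∣≤∣p-q∣ p q) (begin
    - (∣ p ∣ - ∣ q ∣)  ≡⟨ solve 2 (λ a b → :- (a :- b) := b :- a) refl ∣ p ∣ ∣ q ∣ ⟩
    ∣ q ∣ - ∣ p ∣      ≤⟨ ∣p∣-∣q∣≤∣p-q∣ q p ⟩
    ∣ q - p ∣          ≡⟨ ∣p-q∣≡∣q-p∣ q p ⟩
    ∣ p - q ∣          ∎)

  fromℚᵘ-mono-≤ : ∀ {p q} → p ℚᵘ.≤ q → ℚ.fromℚᵘ p ≤ ℚ.fromℚᵘ q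
  fromℚᵘ-mono-≤ {p} {q} p≤q = ℚ.toℚᵘ-cancel-≤
    (ℚᵘ.≤-respʳ-≃ (ℚᵘ.≃-sym (ℚ.toℚᵘ-fromℚᵘ q)) (ℚᵘ.≤-respˡ-≃ (ℚᵘ.≃-sym (ℚ.toℚᵘ-fromℚᵘ p)) p≤q))

  fromℚᵘ-mono-< : ∀ {p q} → p ℚᵘ.< q → ℚ.fromℚᵘ p < ℚ.fromℚᵘ q
  fromℚᵘ-mono-< {p} {q} p<q = ℚ.toℚᵘ-cancel-<
    (ℚᵘ.<-respʳ-≃ (ℚᵘ.≃-sym (ℚ.toℚᵘ-fromℚᵘ q)) (ℚᵘ.<-respˡ-≃ (ℚᵘ.≃-sym (ℚ.toℚᵘ-fromℚᵘ p)) p<q))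

  /-mono : ∀ a b m n → a ℕ.* suc n ℕ.≤ b ℕ.* suc m → + a / suc m ≤ + b / suc n
  /-mono a b m n h = fromℚᵘ-mono-≤ {ℚᵘ.mkℚᵘ (+ a) m} {ℚᵘ.mkℚᵘ (+ b) n}
    (ℚᵘ.*≤* (subst₂ ℤ._≤_ (ℤ.pos-* a (suc n)) (ℤ.pos-* b (suc m)) (ℤ.+≤+ h)))

  1/-antitone : ∀ {m n} → m ℕ.≤ n → + 1 / suc n ≤ + 1 / suc m
  1/-antitone {m} {n} m≤n = /-mono 1 1 n m (ℕ.*-monoʳ-≤ 1 (ℕ.s≤s m≤n))

  archimedean : ∀ {ε} → 0ℚ < ε → ∃ λ N → + 1 / suc N < ε
  archimedean {ε@(mkℚ -[1+ _ ] _ _)} 0<ε = contradiction (ℚ.drop-*<* 0<ε) λ ()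
  archimedean {ε@(mkℚ (+ zero) _ _)} 0<ε = contradiction (ℚ.drop-*<* 0<ε) λ { (ℤ.+<+ ()) }
  archimedean {ε@(mkℚ (+ suc a) d _)} 0<ε = suc d , (begin-strict
    + 1 / suc (suc d)  <⟨ shrink ⟩
    + 1 / suc d        ≤⟨ /-mono 1 (suc a) d d (ℕ.*-monoˡ-≤ (suc d) (ℕ.s≤s (ℕ.z≤n {a}))) ⟩
    + suc a / suc d    ≡⟨ ℚ.↥p/↧p≡p ε ⟩
    ε                  ∎)
    where
    shrink : + 1 / suc (suc d) < + 1 / suc d
    shrink = fromℚᵘ-mono-< {ℚᵘ.mkℚᵘ (+ 1) (suc d)} {ℚᵘ.mkℚᵘ (+ 1) d}
      (ℚᵘ.*<* (ℤ.+<+ (ℕ.*-monoʳ-< 1 (ℕ.n<1+n (suc d)))))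

  suc/ : ∀ k m → + suc k / suc m ≡ + k / suc m + + 1 / suc m
  suc/ k m = ℚ.toℚᵘ-injective
    (ℚᵘ.≃-trans (ℚ.toℚᵘ-fromℚᵘ (ℚᵘ.mkℚᵘ (+ suc k) m))
    (ℚᵘ.≃-trans (ℚᵘ.*≡* (ℤS.solve 2
        (λ k d → (ℤS.con (+ 1) ℤS.:+ k) ℤS.:* (d ℤS.:* d) ℤS.:= (k ℤS.:* d ℤS.:+ ℤS.con (+ 1) ℤS.:* d) ℤS.:* d)
        refl (+ k) (+ suc m)))
    (ℚᵘ.≃-trans (ℚᵘ.≃-sym (ℚᵘ.+-cong (ℚ.toℚᵘ-fromℚᵘ (ℚᵘ.mkℚᵘ (+ k) m)) (ℚ.toℚᵘ-fromℚᵘ (ℚᵘ.mkℚᵘ (+ 1) m))))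
                (ℚᵘ.≃-sym (ℚ.toℚᵘ-homo-+ (+ k / suc m) (+ 1 / suc m))))))
    where module ℤS = ℤ.+-*-Solver

  1/-nonNeg : ∀ n → 0ℚ ≤ + 1 / suc n
  1/-nonNeg n = /-mono 0 1 0 n ℕ.z≤n

  inv : ℚ → ℚ
  inv q with q ℚ.≟ 0ℚ
  ... | yes _   = 0ℚ
  ... | no  q≢0 = ℚ.1/_ q {{ℚ.≢-nonZero q≢0}}

  inv-inverse : ∀ {q} → 0ℚ < ∣ q ∣ → q * inv q ≡ 1ℚ
  inv-inverse {q} 0<∣q∣ with q ℚ.≟ 0ℚ
  ... | yes refl = contradiction 0<∣q∣ (ℚ.<-irrefl refl)
  ... | no  q≢0  = ℚ.*-inverseʳ q {{ℚ.≢-nonZero q≢0}}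

  ¾ : ℚ
  ¾ = + 3 / 4

  -- These bounds are written in the form to which the corresponding polynomial in
  -- k : ℝ (such as 1 + k + k ^ 2) reduces on rational approximants.
  ¾≤∣1-2q+4q²∣ : ∀ q → ¾ ≤ ∣ 1ℚ - ℚ.fromℤ (+ 2) * q + ℚ.fromℤ (+ 4) * (q * (q * 1ℚ)) ∣
  ¾≤∣1-2q+4q²∣ q = begin
    ¾                      ≡⟨ ℚ.+-identityʳ ¾ ⟨
    ¾ + 0ℚ                 ≤⟨ ℚ.+-monoʳ-≤ ¾ (0≤p² (ℚ.fromℤ (+ 2) * q - ½)) ⟩
    ¾ + (ℚ.fromℤ (+ 2) * q - ½) * (ℚ.fromℤ (+ 2) * q - ½)
                           ≡⟨ solve 1 (λ q → con ¾ :+ (con (ℚ.fromℤ (+ 2)) :* q :- con ½) :* (con (ℚ.fromℤ (+ 2)) :* q :- con ½)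
                                := con 1ℚ :- con (ℚ.fromℤ (+ 2)) :* q :+ con (ℚ.fromℤ (+ 4)) :* (q :* (q :* con 1ℚ))) refl q ⟩
    1ℚ - ℚ.fromℤ (+ 2) * q + ℚ.fromℤ (+ 4) * (q * (q * 1ℚ))
                           ≤⟨ p≤∣p∣ _ ⟩
    ∣ 1ℚ - ℚ.fromℤ (+ 2) * q + ℚ.fromℤ (+ 4) * (q * (q * 1ℚ)) ∣ ∎

  ¾≤∣1+q+q²∣ : ∀ q → ¾ ≤ ∣ 1ℚ + q + q * (q * 1ℚ) ∣
  ¾≤∣1+q+q²∣ q = begin
    ¾                            ≡⟨ ℚ.+-identityʳ ¾ ⟨
    ¾ + 0ℚ                       ≤⟨ ℚ.+-monoʳ-≤ ¾ (0≤p² (q + ½)) ⟩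
    ¾ + (q + ½) * (q + ½)        ≡⟨ solve 1 (λ q → con ¾ :+ (q :+ con ½) :* (q :+ con ½)
                                      := con 1ℚ :+ q :+ q :* (q :* con 1ℚ)) refl q ⟩
    1ℚ + q + q * (q * 1ℚ)        ≤⟨ p≤∣p∣ _ ⟩
    ∣ 1ℚ + q + q * (q * 1ℚ) ∣    ∎

  1≤∣1+2q∣ : ∀ {q} → 0ℚ ≤ q → 1ℚ ≤ ∣ 1ℚ + ℚ.fromℤ (+ 2) * q ∣
  1≤∣1+2q∣ {q} 0≤q = begin
    1ℚ                             ≡⟨ solve 0 (con 1ℚ := con 1ℚ :+ con (ℚ.fromℤ (+ 2)) :* con 0ℚ) refl ⟩
    1ℚ + ℚ.fromℤ (+ 2) * 0ℚ        ≤⟨ ℚ.+-monoʳ-≤ 1ℚ (ℚ.*-monoˡ-≤-nonNeg (ℚ.fromℤ (+ 2)) 0≤q) ⟩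
    1ℚ + ℚ.fromℤ (+ 2) * q         ≤⟨ p≤∣p∣ _ ⟩
    ∣ 1ℚ + ℚ.fromℤ (+ 2) * q ∣     ∎

isqrt : ℕ → ℕ
isqrt zero    = 0
isqrt (suc m) with suc (isqrt m) ℕ.* suc (isqrt m) ℕ.≤? suc m
... | yes _ = suc (isqrt m)
... | no  _ = isqrt m

module Sqrt where
  open import Data.Nat.Base
  open import Data.Nat.Properties
  open ℕ.+-*-Solver

  lower : ∀ m → isqrt m * isqrt m ≤ m
  lower zero    = z≤n
  lower (suc m) with suc (isqrt m) * suc (isqrt m) ≤? suc m
  ... | yes p = p
  ... | no  _ = m≤n⇒m≤1+n (lower m)

  upper : ∀ m → m < suc (isqrt m) * suc (isqrt m)
  upper zero    = s≤s z≤n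
  upper (suc m) with suc (isqrt m) * suc (isqrt m) ≤? suc m
  ... | yes p = ≤-<-trans (upper m) (*-mono-< (n<1+n (suc (isqrt m))) (n<1+n (suc (isqrt m))))
  ... | no ¬p = ≰⇒> ¬p

  r : ℕ → ℕ → ℕ
  r N n = isqrt (N * (suc n * suc n))

  cross : ∀ N m n → r N n * suc m ≤ suc (r N m) * suc n
  cross N m n = ≮⇒≥ λ gt → <-irrefl refl (begin-strict
    (b * suc n) * (b * suc n)            <⟨ *-mono-< gt gt ⟩
    (a * suc m) * (a * suc m)            ≡⟨ swap a (suc m) ⟩
    (a * a) * (suc m * suc m)            ≤⟨ *-monoˡ-≤ (suc m * suc m) (lower (N * (suc n * suc n))) ⟩
    (N * (suc n * suc n)) * (suc m * suc m)
                                         ≡⟨ solve 3 (λ N u v → (N :* u) :* v := (N :* v) :* u) refl N (suc n * suc n) (suc m * suc m) ⟩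
    (N * (suc m * suc m)) * (suc n * suc n)
                                         ≤⟨ *-monoˡ-≤ (suc n * suc n) (<⇒≤ (upper (N * (suc m * suc m)))) ⟩
    (b * b) * (suc n * suc n)            ≡⟨ swap b (suc n) ⟨
    (b * suc n) * (b * suc n)            ∎)
    where
    open ≤-Reasoning
    a = r N n
    b = suc (r N m)
    swap : ∀ u v → (u * v) * (u * v) ≡ (u * u) * (v * v)
    swap = solve 2 (λ u v → (u :* v) :* (u :* v) := (u :* u) :* (v :* v)) refl

  approx : ℕ → ℕ → ℚ
  approx N n = + r N n ℚ./ suc n

  approx-≤ : ∀ N m n → approx N n ℚ.≤ approx N m ℚ.+ + 1 ℚ./ suc m
  approx-≤ N m n = ℚ.≤-trans (Rational./-mono (r N n) (suc (r N m)) n m (cross N m n))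
    (ℚ.≤-reflexive (Rational.suc/ (r N m) m))

  approx-close : ∀ N m n → m ≤ n → ℚ.∣ approx N m ℚ.- approx N n ∣ ℚ.≤ + 1 ℚ./ suc m
  approx-close N m n m≤n = Rational.∣∣-lub
    (difference (approx N m) (approx N n)
      (ℚ.≤-trans (approx-≤ N n m) (ℚ.+-monoʳ-≤ (approx N n) (Rational.1/-antitone m≤n))))
    (subst (ℚ._≤ + 1 ℚ./ suc m)
      (ℚ.+-*-Solver.solve 2 (λ a b → b S.:- a S.:= S.:- (a S.:- b)) refl (approx N m) (approx N n))
      (difference (approx N n) (approx N m) (approx-≤ N m n)))
    where
    module S = ℚ.+-*-Solver
    difference : ∀ p q {d} → p ℚ.≤ q ℚ.+ d → p ℚ.- q ℚ.≤ d
    difference p q {d} h = subst (p ℚ.- q ℚ.≤_)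
      (S.solve 2 (λ q d → (q S.:+ d) S.:- q S.:= d) refl q d)
      (ℚ.+-monoˡ-≤ (ℚ.- q) h)

module Leibniz where
  open import Data.Rational.Base using (_+_; _*_; _-_; -_; _≤_; _/_) renaming (∣_∣ to abs)
  open ℚ.+-*-Solver
  open ℚ.≤-Reasoning

  a : ℕ → ℚ
  a n = + 1 / suc (2 ℕ.* n)

  sign : ℕ → ℚ
  sign n = (- 1ℚ) ^ℚ n

  S : ℕ → ℚ
  S = partialSum _+_ 0ℚ λ n → sign n * a n

  tail : ℕ → ℕ → ℚ
  tail n zero    = 0ℚ
  tail n (suc j) = a n - tail (suc n) j

  a-antitone : ∀ n → a (suc n) ≤ a n
  a-antitone n = Rational.1/-antitone (ℕ.*-monoʳ-≤ 2 (ℕ.n≤1+n n))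

  p-q≤p : ∀ p {q} → 0ℚ ≤ q → p - q ≤ p
  p-q≤p p 0≤q = ℚ.≤-trans (ℚ.+-monoʳ-≤ p (ℚ.neg-antimono-≤ 0≤q)) (ℚ.≤-reflexive (ℚ.+-identityʳ p))

  tail-bounds : ∀ n j → 0ℚ ≤ tail n j × tail n j ≤ a n
  tail-bounds n zero    = ℚ.≤-refl , Rational.1/-nonNeg (2 ℕ.* n)
  tail-bounds n (suc j) =
    let 0≤t , t≤a = tail-bounds (suc n) j
    in (begin
         0ℚ                       ≡⟨ ℚ.+-inverseʳ (a n) ⟨
         a n - a n                ≤⟨ ℚ.+-monoʳ-≤ (a n) (ℚ.neg-antimono-≤ (ℚ.≤-trans t≤a (a-antitone n))) ⟩
         a n - tail (suc n) j     ∎)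
     , p-q≤p (a n) 0≤t

  S-+ : ∀ n j → S (n ℕ.+ j) ≡ S n + sign n * tail n j
  S-+ n zero    = trans (cong S (ℕ.+-identityʳ n))
    (solve 2 (λ s t → s := s :+ t :* con 0ℚ) refl (S n) (sign n))
  S-+ n (suc j) = trans (cong S (ℕ.+-suc n j)) (trans (S-+ (suc n) j)
    (solve 4 (λ s t a r → (s :+ t :* a) :+ (:- con 1ℚ :* t) :* r := s :+ t :* (a :- r)) refl
      (S n) (sign n) (a n) (tail (suc n) j)))

  ∣sign∣ : ∀ n → abs (sign n) ≡ 1ℚ
  ∣sign∣ zero    = refl
  ∣sign∣ (suc n) = trans (ℚ.∣p*q∣≡∣p∣*∣q∣ (- 1ℚ) (sign n)) (cong (1ℚ *_) (∣sign∣ n))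

  close : ∀ m n → m ℕ.≤ n → abs (S m - S n) ≤ + 1 / suc m
  close m n m≤n = begin
    abs (S m - S n)                 ≡⟨ Rational.∣p-q∣≡∣q-p∣ (S m) (S n) ⟩
    abs (S n - S m)                 ≡⟨ cong (λ k → abs (S k - S m)) (ℕ.m+[n∸m]≡n m≤n) ⟨
    abs (S (m ℕ.+ j) - S m)         ≡⟨ cong (λ s → abs (s - S m)) (S-+ m j) ⟩
    abs ((S m + sign m * t) - S m)  ≡⟨ cong abs (solve 2 (λ s u → (s :+ u) :- s := u) refl (S m) (sign m * t)) ⟩
    abs (sign m * t)                ≡⟨ ℚ.∣p*q∣≡∣p∣*∣q∣ (sign m) t ⟩
    abs (sign m) * abs t            ≡⟨ cong₂ _*_ (∣sign∣ m) (ℚ.0≤p⇒∣p∣≡p (proj₁ (tail-bounds m j))) ⟩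
    1ℚ * t                          ≡⟨ ℚ.*-identityˡ t ⟩
    t                               ≤⟨ proj₂ (tail-bounds m j) ⟩
    a m                             ≤⟨ Rational.1/-antitone (ℕ.m≤m+n m (m ℕ.+ 0)) ⟩
    + 1 / suc m                     ∎
    where
    j = n ℕ.∸ m
    t = tail m j

  S-lower : ∀ n → 2 ℕ.≤ n → + 2 / 3 ≤ S n
  S-lower (suc (suc j)) _ = begin
    a 0 - a 1                             ≤⟨ ℚ.+-monoʳ-≤ (a 0) (ℚ.neg-antimono-≤ (proj₂ (tail-bounds 1 (suc j)))) ⟩
    tail 0 (suc (suc j))                  ≡⟨ solve 1 (λ t → t := con 0ℚ :+ con 1ℚ :* t) refl (tail 0 (suc (suc j))) ⟩
    0ℚ + 1ℚ * tail 0 (suc (suc j))        ≡⟨ S-+ 0 (suc (suc j)) ⟨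
    S (suc (suc j))                       ∎
  S-lower (suc zero) (ℕ.s≤s ())

-- The setoid of Cauchy reals. Sequences carry their modulus of convergence; all
-- arithmetic below is termwise.
IsCauchy : (ℕ → ℚ) → Set
IsCauchy s = ∀ ε → 0ℚ ℚ.< ε →
  ∃ λ N → ∀ m n → N ℕ.≤ m → N ℕ.≤ n → ℚ.∣ s m ℚ.- s n ∣ ℚ.< ε

record ℝ : Set where
  constructor mkℝ
  field
    seq    : ℕ → ℚ
    cauchy : IsCauchy seq
open ℝ public

infix 4 _≈_ _<_

_≈_ : ℝ → ℝ → Set
x ≈ y = ∀ ε → 0ℚ ℚ.< ε →
  ∃ λ N → ∀ n → N ℕ.≤ n → ℚ.∣ seq x n ℚ.- seq y n ∣ ℚ.< ε

_<_ : ℝ → ℝ → Set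
x < y = ∃ λ ε → 0ℚ ℚ.< ε ×
  ∃ λ N → ∀ n → N ℕ.≤ n → seq x n ℚ.+ ε ℚ.≤ seq y n

module Cauchy where
  open import Data.Rational.Base using (_+_; _*_; _-_; -_; _≤_; ∣_∣; _/_)
  open Rational
  open ℚ.+-*-Solver
  open ℚ.≤-Reasoning

  const : ∀ q → IsCauchy λ _ → q
  const q ε 0<ε = 0 , λ _ _ _ _ →
    subst (ℚ._< ε) (cong ∣_∣ (sym (ℚ.+-inverseʳ q))) 0<ε

  add : ∀ s t → IsCauchy s → IsCauchy t → IsCauchy λ n → s n + t n
  add s t cs ct ε 0<ε =
    let 0<½ε    = *-pos 0<½ 0<ε
        N₁ , h₁ = cs (½ * ε) 0<½ε
        N₂ , h₂ = ct (½ * ε) 0<½ε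
    in N₁ ℕ.⊔ N₂ , λ m n N≤m N≤n → begin-strict
      ∣ (s m + t m) - (s n + t n) ∣      ≡⟨ cong ∣_∣ (solve 4 (λ a b c d → (a :+ b) :- (c :+ d) := (a :- c) :+ (b :- d)) refl (s m) (t m) (s n) (t n)) ⟩
      ∣ (s m - s n) + (t m - t n) ∣      ≤⟨ ℚ.∣p+q∣≤∣p∣+∣q∣ (s m - s n) (t m - t n) ⟩
      ∣ s m - s n ∣ + ∣ t m - t n ∣      <⟨ ℚ.+-mono-< (h₁ m n (ℕ.m⊔n≤o⇒m≤o N₁ N₂ N≤m) (ℕ.m⊔n≤o⇒m≤o N₁ N₂ N≤n))
                                                       (h₂ m n (ℕ.m⊔n≤o⇒n≤o N₁ N₂ N≤m) (ℕ.m⊔n≤o⇒n≤o N₁ N₂ N≤n)) ⟩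
      ½ * ε + ½ * ε                      ≡⟨ half+half ε ⟩
      ε                                  ∎

  neg : ∀ s → IsCauchy s → IsCauchy λ n → - s n
  neg s cs ε 0<ε =
    let N , h = cs ε 0<ε
    in N , λ m n N≤m N≤n → subst (ℚ._< ε)
      (trans (∣p-q∣≡∣q-p∣ (s m) (s n))
             (cong ∣_∣ (solve 2 (λ a b → b :- a := :- a :- :- b) refl (s m) (s n))))
      (h m n N≤m N≤n)

  abs : ∀ s → IsCauchy s → IsCauchy λ n → ∣ s n ∣
  abs s cs ε 0<ε =
    let N , h = cs ε 0<ε
    in N , λ m n N≤m N≤n →
      ℚ.≤-<-trans (∣∣p∣-∣q∣∣≤∣p-q∣ (s m) (s n)) (h m n N≤m N≤n)

  bounded : ∀ s → IsCauchy s → ∃ λ B → 0ℚ ℚ.< B × ∃ λ N → ∀ n → N ℕ.≤ n → ∣ s n ∣ ≤ B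
  bounded s cs =
    let N , h = cs 1ℚ 0<1
    in 1ℚ + ∣ s N ∣ , ℚ.+-mono-<-≤ 0<1 (ℚ.0≤∣p∣ (s N)) , N , λ n N≤n → begin
      ∣ s n ∣                    ≡⟨ cong ∣_∣ (solve 2 (λ a b → a := (a :- b) :+ b) refl (s n) (s N)) ⟩
      ∣ (s n - s N) + s N ∣      ≤⟨ ℚ.∣p+q∣≤∣p∣+∣q∣ (s n - s N) (s N) ⟩
      ∣ s n - s N ∣ + ∣ s N ∣    ≤⟨ ℚ.+-monoˡ-≤ ∣ s N ∣ (ℚ.<⇒≤ (h n N N≤n ℕ.≤-refl)) ⟩
      1ℚ + ∣ s N ∣               ∎

  scale : ∀ {B ε} → 0ℚ ℚ.< B → 0ℚ ℚ.< ε → ∃ λ δ → 0ℚ ℚ.< δ × B * δ ≡ ε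
  scale {B} {ε} 0<B 0<ε = ℚ.1/ B * ε , *-pos 0<1/B 0<ε , (begin-equality
    B * (ℚ.1/ B * ε)    ≡⟨ ℚ.*-assoc B (ℚ.1/ B) ε ⟨
    (B * ℚ.1/ B) * ε    ≡⟨ cong (_* ε) (ℚ.*-inverseʳ B) ⟩
    1ℚ * ε              ≡⟨ ℚ.*-identityˡ ε ⟩
    ε                   ∎)
    where
    instance
      B>0 : ℚ.Positive B
      B>0 = ℚ.positive 0<B
      B≢0 : ℚ.NonZero B
      B≢0 = ℚ.pos⇒nonZero B
    0<1/B : 0ℚ ℚ.< ℚ.1/ B
    0<1/B = ℚ.positive⁻¹ _ {{ℚ.1/pos⇒pos B}}

  bound-* : ∀ {B δ p q} → 0ℚ ℚ.< B → ∣ p ∣ ≤ B → ∣ q ∣ ℚ.< δ → ∣ p ∣ * ∣ q ∣ ℚ.< B * δ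
  bound-* {B} {δ} {p} {q} 0<B p≤B q<δ = ℚ.≤-<-trans
    (ℚ.*-monoʳ-≤-nonNeg ∣ q ∣ {{ℚ.∣-∣-nonNeg q}} p≤B)
    (ℚ.*-monoʳ-<-pos B {{ℚ.positive 0<B}} q<δ)

  mul : ∀ s t → IsCauchy s → IsCauchy t → IsCauchy λ n → s n * t n
  mul s t cs ct ε 0<ε =
    let A , 0<A , N₁ , bs = bounded s cs
        B , 0<B , N₂ , bt = bounded t ct
        δ₁ , 0<δ₁ , e₁    = scale 0<A (*-pos 0<½ 0<ε)
        δ₂ , 0<δ₂ , e₂    = scale 0<B (*-pos 0<½ 0<ε)
        N₃ , h₁           = ct δ₁ 0<δ₁
        N₄ , h₂           = cs δ₂ 0<δ₂
        N₁₂               = N₁ ℕ.⊔ N₂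
        N₃₄               = N₃ ℕ.⊔ N₄
    in N₁₂ ℕ.⊔ N₃₄ , λ m n N≤m N≤n →
      let m₁₂ = ℕ.m⊔n≤o⇒m≤o N₁₂ N₃₄ N≤m
          m₃₄ = ℕ.m⊔n≤o⇒n≤o N₁₂ N₃₄ N≤m
          n₁₂ = ℕ.m⊔n≤o⇒m≤o N₁₂ N₃₄ N≤n
          n₃₄ = ℕ.m⊔n≤o⇒n≤o N₁₂ N₃₄ N≤n
      in begin-strict
      ∣ s m * t m - s n * t n ∣
        ≡⟨ cong ∣_∣ (solve 4 (λ a b c d → a :* b :- c :* d := a :* (b :- d) :+ d :* (a :- c)) refl (s m) (t m) (s n) (t n)) ⟩
      ∣ s m * (t m - t n) + t n * (s m - s n) ∣
        ≤⟨ ℚ.∣p+q∣≤∣p∣+∣q∣ (s m * (t m - t n)) (t n * (s m - s n)) ⟩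
      ∣ s m * (t m - t n) ∣ + ∣ t n * (s m - s n) ∣
        ≡⟨ cong₂ _+_ (ℚ.∣p*q∣≡∣p∣*∣q∣ (s m) (t m - t n)) (ℚ.∣p*q∣≡∣p∣*∣q∣ (t n) (s m - s n)) ⟩
      ∣ s m ∣ * ∣ t m - t n ∣ + ∣ t n ∣ * ∣ s m - s n ∣
        <⟨ ℚ.+-mono-<
             (bound-* {p = s m} {q = t m - t n} 0<A (bs m (ℕ.m⊔n≤o⇒m≤o N₁ N₂ m₁₂)) (h₁ m n (ℕ.m⊔n≤o⇒m≤o N₃ N₄ m₃₄) (ℕ.m⊔n≤o⇒m≤o N₃ N₄ n₃₄)))
             (bound-* {p = t n} {q = s m - s n} 0<B (bt n (ℕ.m⊔n≤o⇒n≤o N₁ N₂ n₁₂)) (h₂ m n (ℕ.m⊔n≤o⇒n≤o N₃ N₄ m₃₄) (ℕ.m⊔n≤o⇒n≤o N₃ N₄ n₃₄))) ⟩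
      A * δ₁ + B * δ₂
        ≡⟨ cong₂ _+_ e₁ e₂ ⟩
      ½ * ε + ½ * ε
        ≡⟨ half+half ε ⟩
      ε ∎

  recip : ∀ s {c N} → 0ℚ ℚ.< c → (∀ n → N ℕ.≤ n → c ≤ ∣ s n ∣) →
          IsCauchy s → IsCauchy λ n → inv (s n)
  recip s {c} {N₁} 0<c away cs ε 0<ε =
    let N₂ , h = cs (ε * (c * c)) (*-pos 0<ε (*-pos 0<c 0<c))
    in N₁ ℕ.⊔ N₂ , λ m n N≤m N≤n →
      let c≤a = away m (ℕ.m⊔n≤o⇒m≤o N₁ N₂ N≤m)
          c≤b = away n (ℕ.m⊔n≤o⇒m≤o N₁ N₂ N≤n)
      in estimate (s m) (s n) c≤a c≤b
           (h m n (ℕ.m⊔n≤o⇒n≤o N₁ N₂ N≤m) (ℕ.m⊔n≤o⇒n≤o N₁ N₂ N≤n))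
    where
    estimate : ∀ a b → c ≤ ∣ a ∣ → c ≤ ∣ b ∣ →
               ∣ a - b ∣ ℚ.< ε * (c * c) → ∣ inv a - inv b ∣ ℚ.< ε
    estimate a b c≤a c≤b close =
      ℚ.*-cancelʳ-<-nonNeg ∣ a * b ∣ {{ℚ.∣-∣-nonNeg (a * b)}} (begin-strict
      ∣ inv a - inv b ∣ * ∣ a * b ∣
        ≡⟨ ℚ.∣p*q∣≡∣p∣*∣q∣ (inv a - inv b) (a * b) ⟨
      ∣ (inv a - inv b) * (a * b) ∣
        ≡⟨ cong ∣_∣ (solve 4 (λ a b i j → (i :- j) :* (a :* b) := b :* (a :* i) :- a :* (b :* j)) refl a b (inv a) (inv b)) ⟩
      ∣ b * (a * inv a) - a * (b * inv b) ∣
        ≡⟨ cong₂ (λ u v → ∣ b * u - a * v ∣) (inv-inverse (ℚ.<-≤-trans 0<c c≤a)) (inv-inverse (ℚ.<-≤-trans 0<c c≤b)) ⟩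
      ∣ b * 1ℚ - a * 1ℚ ∣
        ≡⟨ cong₂ (λ u v → ∣ u - v ∣) (ℚ.*-identityʳ b) (ℚ.*-identityʳ a) ⟩
      ∣ b - a ∣
        ≡⟨ ∣p-q∣≡∣q-p∣ b a ⟩
      ∣ a - b ∣
        <⟨ close ⟩
      ε * (c * c)
        ≤⟨ ℚ.*-monoˡ-≤-nonNeg ε {{ℚ.nonNegative (ℚ.<⇒≤ 0<ε)}} (*-mono-≤ (ℚ.0≤∣p∣ a) (ℚ.<⇒≤ 0<c) c≤a c≤b) ⟩
      ε * (∣ a ∣ * ∣ b ∣)
        ≡⟨ cong (ε *_) (ℚ.∣p*q∣≡∣p∣*∣q∣ a b) ⟨
      ε * ∣ a * b ∣ ∎)

  fast : ∀ s → (∀ m n → m ℕ.≤ n → ∣ s m - s n ∣ ≤ + 1 / suc m) → IsCauchy s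
  fast s close ε 0<ε = N , λ m n N≤m N≤n → [ ordered m n N≤m
    , subst (ℚ._< ε) (∣p-q∣≡∣q-p∣ (s n) (s m)) ∘ ordered n m N≤n
    ]′ (ℕ.≤-total m n)
    where
    N = proj₁ (archimedean 0<ε)
    ordered : ∀ m n → N ℕ.≤ m → m ℕ.≤ n → ∣ s m - s n ∣ ℚ.< ε
    ordered m n N≤m m≤n = ℚ.≤-<-trans (close m n m≤n)
      (ℚ.≤-<-trans (1/-antitone N≤m) (proj₂ (archimedean 0<ε)))

open import Agda.Builtin.FromNat public using (Number; fromNat)

fromℚ : ℚ → ℝ
fromℚ q = mkℝ (λ _ → q) (Cauchy.const q)

instance
  number-ℕ : Number ℕ
  number-ℕ = ℕ.number

  number-ℚ : Number ℚ
  number-ℚ = ℚ.number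

  number-ℝ : Number ℝ
  number-ℝ = record { Constraint = λ _ → ⊤ ; fromNat = λ n → fromℚ (fromNat n) }

infixl 6 _+_ _-_
infixl 7 _*_
infix  8 -_

_+_ : ℝ → ℝ → ℝ
x + y = mkℝ (λ n → seq x n ℚ.+ seq y n) (Cauchy.add (seq x) (seq y) (cauchy x) (cauchy y))

-_ : ℝ → ℝ
- x = mkℝ (λ n → ℚ.- seq x n) (Cauchy.neg (seq x) (cauchy x))

_-_ : ℝ → ℝ → ℝ
x - y = x + - y

_*_ : ℝ → ℝ → ℝ
x * y = mkℝ (λ n → seq x n ℚ.* seq y n) (Cauchy.mul (seq x) (seq y) (cauchy x) (cauchy y))

∣_∣ : ℝ → ℝ
∣ x ∣ = mkℝ (λ n → ℚ.∣ seq x n ∣) (Cauchy.abs (seq x) (cauchy x))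

NonZero : ℝ → Set
NonZero x = 0 < ∣ x ∣

away-from-0 : ∀ x → NonZero x → ∃ λ c → 0ℚ ℚ.< c ×
  ∃ λ N → ∀ n → N ℕ.≤ n → c ℚ.≤ ℚ.∣ seq x n ∣
away-from-0 x (c , 0<c , N , h) = c , 0<c , N , λ n N≤n →
  subst (ℚ._≤ ℚ.∣ seq x n ∣) (ℚ.+-identityˡ c) (h n N≤n)

-- The reciprocals of the finitely many zero terms are set to 0.
recip : ∀ x → NonZero x → ℝ
recip x x≢0 =
  let _ , 0<c , _ , away = away-from-0 x x≢0
  in mkℝ (λ n → Rational.inv (seq x n)) (Cauchy.recip (seq x) 0<c away (cauchy x))

infixl 7 _/_[_]

_/_[_] : (x y : ℝ) → NonZero y → ℝ
x / y [ y≢0 ] = x * recip y y≢0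

+-*-rawRing : RawRing 0ℓ 0ℓ
+-*-rawRing = record
  { Carrier = ℝ ; _≈_ = _≈_ ; _+_ = _+_ ; _*_ = _*_ ; -_ = -_ ; 0# = 0 ; 1# = 1 }

open RawSemiring (RawRing.rawSemiring +-*-rawRing) public using (_^_)

∑< : ℕ → (ℕ → ℝ) → ℝ
∑< n a = partialSum _+_ 0 a n

infix 4 ∑_≈_

∑_≈_ : (ℕ → ℝ) → ℝ → Set
∑ a ≈ s = ∀ ε → 0 < ε → ∃ λ N → ∀ n → N ℕ.≤ n → ∣ ∑< n a - s ∣ < ε

-- √ N is the limit of ⌊√(N (n+1)²)⌋ / (n+1).
√ : ℕ → ℝ
√ N = mkℝ (Sqrt.approx N) (Cauchy.fast (Sqrt.approx N) (Sqrt.approx-close N))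

-- Leibniz's series π/4 = 1 - 1/3 + 1/5 - 1/7 + ⋯
π : ℝ
π = 4 * mkℝ Leibniz.S (Cauchy.fast Leibniz.S Leibniz.close)

module NonVanishing where
  open ℚ.≤-Reasoning
  open Rational using (p≤∣p∣; *-pos; *-mono-≤)

  nonZero : ∀ x c N → 0ℚ ℚ.< c → (∀ n → N ℕ.≤ n → c ℚ.≤ ℚ.∣ seq x n ∣) → NonZero x
  nonZero x c N 0<c h = c , 0<c , N , λ n N≤n →
    subst (ℚ._≤ ℚ.∣ seq x n ∣) (sym (ℚ.+-identityˡ c)) (h n N≤n)

  *-nonZero : ∀ x y → NonZero x → NonZero y → NonZero (x * y)
  *-nonZero x y x≢0 y≢0 =
    let c , 0<c , N₁ , h₁ = away-from-0 x x≢0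
        d , 0<d , N₂ , h₂ = away-from-0 y y≢0
    in nonZero (x * y) (c ℚ.* d) (N₁ ℕ.⊔ N₂) (*-pos 0<c 0<d) λ n N≤n → begin
      c ℚ.* d                                ≤⟨ *-mono-≤ (ℚ.0≤∣p∣ (seq x n)) (ℚ.<⇒≤ 0<d)
                                                  (h₁ n (ℕ.m⊔n≤o⇒m≤o N₁ N₂ N≤n)) (h₂ n (ℕ.m⊔n≤o⇒n≤o N₁ N₂ N≤n)) ⟩
      ℚ.∣ seq x n ∣ ℚ.* ℚ.∣ seq y n ∣        ≡⟨ ℚ.∣p*q∣≡∣p∣*∣q∣ (seq x n) (seq y n) ⟨
      ℚ.∣ seq x n ℚ.* seq y n ∣              ∎

  ^-nonZero : ∀ x n → NonZero x → NonZero (x ^ n)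
  ^-nonZero x zero    _   = nonZero 1 1ℚ 0 Rational.0<1 λ _ _ → ℚ.≤-refl
  ^-nonZero x (suc n) x≢0 = *-nonZero x (x ^ n) x≢0 (^-nonZero x n x≢0)

  1-2k+4k²≢0 : ∀ k → NonZero (1 - 2 * k + 4 * k ^ 2)
  1-2k+4k²≢0 k = nonZero (1 - 2 * k + 4 * k ^ 2) Rational.¾ 0 (ℚ.positive⁻¹ Rational.¾)
    λ n _ → Rational.¾≤∣1-2q+4q²∣ (seq k n)

  1+k+k²≢0 : ∀ k → NonZero (1 + k + k ^ 2)
  1+k+k²≢0 k = nonZero (1 + k + k ^ 2) Rational.¾ 0 (ℚ.positive⁻¹ Rational.¾)
    λ n _ → Rational.¾≤∣1+q+q²∣ (seq k n)

  1+2k≢0 : ∀ k → 0 < k → NonZero (1 + 2 * k)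
  1+2k≢0 k (ε , 0<ε , N , h) = nonZero (1 + 2 * k) 1ℚ N Rational.0<1 λ n N≤n →
    Rational.1≤∣1+2q∣ (ℚ.≤-trans (ℚ.<⇒≤ 0<ε)
      (subst (ℚ._≤ seq k n) (ℚ.+-identityˡ ε) (h n N≤n)))

  π≢0 : NonZero π
  π≢0 = nonZero π (+ 8 ℚ./ 3) 2 (ℚ.positive⁻¹ (+ 8 ℚ./ 3)) λ n 2≤n →
    ℚ.≤-trans (ℚ.*-monoˡ-≤-nonNeg 4 (Leibniz.S-lower n 2≤n)) (p≤∣p∣ _)

open NonVanishing public using (1-2k+4k²≢0; 1+k+k²≢0; 1+2k≢0; π≢0; *-nonZero; ^-nonZero)

pochhammer : ℚ → ℕ → ℚ
pochhammer a zero    = 1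
pochhammer a (suc n) = pochhammer a n ℚ.* (a ℚ.+ fromNat n)

-- (a)ₘ (b)ₘ / m!², the coefficient of zᵐ in ₂F₁(a, b; 1; z), as (1)ₘ = m!
₂F₁-coeff : ℚ → ℚ → ℕ → ℚ
₂F₁-coeff a b m =
  pochhammer a m ℚ.* pochhammer b m ℚ.* (+ 1 ℚ./ (m ℕ.! ℕ.* m ℕ.!)) {{m ℕ.!* m !≢0}}

-- ₂F₁(-n, n+1; 1; (1-x)/2), which stops at m = n because (-n)ₘ = 0 for m > n.
legendre : ℕ → ℝ → ℝ
legendre n x = ∑< (suc n) λ m →
  fromℚ (₂F₁-coeff (ℚ.- fromNat n) (fromNat (suc n)) m) * (fromℚ ½ * (1 - x)) ^ m

D : ℝ → ℝ
D k = 1 - 2 * k - 2 * k ^ 2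

E : ℝ → ℝ
E k = 1 - 2 * k + 4 * k ^ 2

argument : ∀ k → NonZero (D k) → ℝ
argument k D≢0 =
  (1 - 4 * k + 6 * k ^ 2 - 4 * k ^ 3 + 10 * k ^ 4)
    / (D k * E k) [ *-nonZero (D k) (E k) D≢0 (1-2k+4k²≢0 k) ]

base : ∀ k → 0 < k → ℝ
base k 0<k =
  ((1 + k + k ^ 2) * D k * E k) / ((1 + 2 * k) ^ 3) [ ^-nonZero (1 + 2 * k) 3 (1+2k≢0 k 0<k) ]

product : ∀ n k → 0 < k → NonZero (D k) → ℝ
product n k 0<k D≢0 = legendre n (argument k D≢0) * base k 0<k ^ n

k₀ : ℝ
k₀ = fromℚ ½ * (√ 3 - 1)

-- q is the limit of the n-th product as its argument tends to k₀. On (0,1) the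
-- product is defined exactly away from k₀, so this is a punctured limit.
IsLimitAtk₀ : ℕ → ℝ → Set
IsLimitAtk₀ n q = ∀ ε → 0 < ε → ∃ λ δ → 0 < δ ×
  (∀ j (0<j : 0 < j) → j < 1 → (D≢0 : NonZero (D j)) →
    ∣ j - k₀ ∣ < δ → ∣ product n j 0<j D≢0 - q ∣ < ε)

-- q is the value of the n-th product at k. Either clause pins q down to ≈, and
-- phrasing them as two implications avoids deciding whether k equals k₀.
IsProduct : ℕ → (k : ℝ) → 0 < k → ℝ → Set
IsProduct n k 0<k q =
  ((D≢0 : NonZero (D k)) → q ≈ product n k 0<k D≢0) ×
  (k ≈ k₀ → IsLimitAtk₀ n q)

C₃ : ℝ → ℝ
C₃ k = (9 * (k - 1) ^ 2 * k ^ 2) / (1 + k + k ^ 2) [ 1+k+k²≢0 k ]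
  * (3 + 4 * k + 2 * k ^ 2) ^ 2 * (3 + 2 * k + 4 * k ^ 2) ^ 2

C₂ : ℝ → ℝ
C₂ k = 27 * (k - 1) * k *
  (9 - 18 * k + 10 * k ^ 2 + 12 * k ^ 3 + 60 * k ^ 4 + 160 * k ^ 5
    + 240 * k ^ 6 + 192 * k ^ 7 + 64 * k ^ 8)

C₁ : ℝ → ℝ
C₁ k = 9 - 144 * k + 540 * k ^ 2 - 584 * k ^ 3 + 314 * k ^ 4 - 228 * k ^ 5
  - 1256 * k ^ 6 - 1072 * k ^ 7 + 768 * k ^ 8 + 2560 * k ^ 9 + 1280 * k ^ 10

C₀ : ℝ → ℝ
C₀ k = 2 * D k ^ 2 *
  (1 - 10 * k + 12 * k ^ 2 - 24 * k ^ 3 + 16 * k ^ 4 + 32 * k ^ 6)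

coefficient : ℝ → ℕ → ℝ
coefficient k n = C₃ k * ν ^ 3 + C₂ k * ν ^ 2 + C₁ k * ν + C₀ k
  where
  ν : ℝ
  ν = fromNat n

{-# OPTIONS --safe #-}

-- Write R(k) for the series divided by (1+2k)⁴(1-2k+4k²), and let α n = (1/3)ₙ(2/3)ₙ/n!².
-- The products q n = zⁿ Pₙ(X/z) satisfy a three-term recurrence whose characteristic roots
-- l and m are squares up to a common factor, with 0 ≤ m ≤ l < 1 on (0,1), so that
-- 0 ≤ q n ≤ lⁿ. The derivative of the n-th term of R, times k(1-k), is γ (n+1) - γ n with
-- γ n = O(n³ lⁿ), so R is constant on (0,1).
--
-- The constant is found as k → 0. There X ≈ z up to O(k⁴), so q (n+1) ≈ z q n, and
-- summation by parts reduces R to 2(1-z) ∑ n α n q n, which tends to 2 lim n α n. Finally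
-- a multiplication formula relates α to the Wallis product, and the Wallis product is
-- related to Leibniz's series by a telescoping identity, so that 2 n α n → √3/π.
--
-- Real arithmetic being termwise, all estimates are made for rational k.
module Submission where

open import Data.Nat.Base using (ℕ; zero; suc; _!)
import Data.Nat.Base as ℕ
import Data.Nat.Properties as ℕ
import Data.Nat.Solver as ℕ
import Data.Integer.Base as ℤ
import Data.Integer.Properties as ℤ
open import Data.Rational.Base using (ℚ; 0ℚ; 1ℚ; ½)
import Data.Rational.Base as ℚ
import Data.Rational.Properties as ℚ
import Data.Rational.Solver as ℚS
import Data.Rational.Unnormalised.Base as ℚᵘ
import Data.Rational.Unnormalised.Properties as ℚᵘ
open import Data.Rational.Literals using (fromℤ)
import Algebra.Definitions.RawSemiring as RawSemiring
open import Algebra.Solver.Ring.AlmostCommutativeRing using (fromCommutativeRing; _-Raw-AlmostCommutative⟶_)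
import Algebra.Solver.Ring as RingSolver
open import Data.List.Base using ([]; _∷_; List)
open import Data.Maybe.Base using (Maybe; just; nothing)
open import Data.Product.Base using (∃; _×_; _,_; proj₁; proj₂)
open import Data.Sum.Base using (inj₁; inj₂)
open import Relation.Nullary using (yes; no)
open import Relation.Binary.PropositionalEquality hiding ([_])
open import Defs using (partialSum; pochhammer; ₂F₁-coeff; module Rational; module Cauchy; module Leibniz; module Sqrt)

-- A real k is a sequence of rationals, so a statement about a partial sum at k is one about its
-- values at all late approximants of k. Hence every estimate has to be uniform over the rationals
-- of an interval [x, y] inside (0,1), and nothing can be said about R itself before convergence is
-- known. Constancy therefore takes the form that the n-th partial sum varies over [x, y] by an
-- amount tending to 0; convergence follows as soon as one value is known. That value cannot be
-- taken at k = 0, because l = 1 there and the geometric decay is lost. The reference point is a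
-- small k = κ², with an error O(κ) that is uniform in the number m of terms, plus a boundary term
-- that tends to 0 with m for fixed κ. The limit of n α n is irrational as well, so partial sums are
-- compared with 2 m α m at the same m, and only afterwards with the approximants of √3/π. Finally,
-- the argument of the Legendre polynomials has a pole at k₀, and k = k₀ is undecidable for reals;
-- the products q n, in which the pole has cancelled, treat all k alike.

module Arithmetic where

  -- Ordered-field arithmetic of the rationals and a ring solver with integer coefficients.

  open import Data.Integer.Base using (ℤ; +_; -[1+_])
  open import Data.Rational.Base

  fromℤ-+ : ∀ a b → fromℤ (a ℤ.+ b) ≡ fromℤ a + fromℤ b
  fromℤ-+ a b = ℚ.toℚᵘ-injective (ℚᵘ.≃-trans
    (ℚᵘ.*≡* (cong (ℤ._* + 1) (sym (cong₂ ℤ._+_ (ℤ.*-identityʳ a) (ℤ.*-identityʳ b)))))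
    (ℚᵘ.≃-sym (ℚ.toℚᵘ-homo-+ (fromℤ a) (fromℤ b))))

  fromℤ-* : ∀ a b → fromℤ (a ℤ.* b) ≡ fromℤ a * fromℤ b
  fromℤ-* a b = ℚ.toℚᵘ-injective (ℚᵘ.≃-sym (ℚ.toℚᵘ-homo-* (fromℤ a) (fromℤ b)))

  fromℤ-neg : ∀ a → fromℤ (ℤ.- a) ≡ - fromℤ a
  fromℤ-neg a = ℚ.toℚᵘ-injective (ℚᵘ.≃-sym (ℚ.toℚᵘ-homo‿- (fromℤ a)))

  fromℤ-eq? : ∀ a b → Maybe (fromℤ a ≡ fromℤ b)
  fromℤ-eq? a b with a ℤ.≟ b
  ... | yes p = just (cong fromℤ p)
  ... | no  _ = nothing

  fromℤ-homomorphism : ℤ.+-*-rawRing -Raw-AlmostCommutative⟶ fromCommutativeRing ℚ.+-*-commutativeRing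
  fromℤ-homomorphism = record
    { ⟦_⟧ = fromℤ ; +-homo = fromℤ-+ ; *-homo = fromℤ-* ; -‿homo = fromℤ-neg ; 0-homo = refl ; 1-homo = refl }

  -- With integer coefficients the solver's normal forms avoid gcd computations.
  module Ring = RingSolver ℤ.+-*-rawRing (fromCommutativeRing ℚ.+-*-commutativeRing) fromℤ-homomorphism fromℤ-eq?

  open Ring public using (Polynomial; solve; _:+_; _:*_; _:-_; :-_; _:=_; _:^_; con)

  infixr 9 _·_

  ♯ : ∀ {n} → ℕ → Polynomial n
  ♯ m = con (+ m)

  _·_ : ∀ {n} → ℕ → Polynomial n → Polynomial n
  m · p = ♯ m :* p

  ι : ℕ → ℚ
  ι n = fromℤ (+ n)

  ι-suc : ∀ n → ι (suc n) ≡ ι n + 1ℚ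
  ι-suc n = trans (fromℤ-+ (+ 1) (+ n)) (ℚ.+-comm 1ℚ (ι n))

  ι-+ : ∀ m n → ι (m ℕ.+ n) ≡ ι m + ι n
  ι-+ m n = fromℤ-+ (+ m) (+ n)

  ι-* : ∀ m n → ι (m ℕ.* n) ≡ ι m * ι n
  ι-* m n = trans (cong fromℤ (ℤ.pos-* m n)) (fromℤ-* (+ m) (+ n))

  ι-mono : ∀ {m n} → m ℕ.≤ n → ι m ≤ ι n
  ι-mono m≤n = *≤* (ℤ.*-monoʳ-≤-nonNeg (+ 1) (ℤ.+≤+ m≤n))

  0≤ι : ∀ n → 0ℚ ≤ ι n
  0≤ι n = ι-mono {0} {n} ℕ.z≤n

  0<ι : ∀ n → 0ℚ < ι (suc n)
  0<ι n = ℚ.positive⁻¹ (ι (suc n))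

  inv : ℚ → ℚ
  inv = Rational.inv

  0≤1 : 0ℚ ≤ 1ℚ
  0≤1 = ℚ.<⇒≤ Rational.0<1

  0≤-+ : ∀ {p q} → 0ℚ ≤ p → 0ℚ ≤ q → 0ℚ ≤ p + q
  0≤-+ = ℚ.+-mono-≤

  0≤-* : ∀ {p q} → 0ℚ ≤ p → 0ℚ ≤ q → 0ℚ ≤ p * q
  0≤-* 0≤p 0≤q = Rational.*-mono-≤ 0≤p ℚ.≤-refl 0≤p 0≤q

  0<-* : ∀ {p q} → 0ℚ < p → 0ℚ < q → 0ℚ < p * q
  0<-* = Rational.*-pos

  *-mono : ∀ {p q r s} → 0ℚ ≤ p → 0ℚ ≤ r → p ≤ q → r ≤ s → p * r ≤ q * s
  *-mono 0≤p 0≤r p≤q r≤s = Rational.*-mono-≤ (ℚ.≤-trans 0≤p p≤q) 0≤r p≤q r≤s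

  *-monoˡ : ∀ {p q r} → 0ℚ ≤ r → p ≤ q → r * p ≤ r * q
  *-monoˡ {r = r} 0≤r = ℚ.*-monoˡ-≤-nonNeg r {{nonNegative 0≤r}}

  *-monoʳ : ∀ {p q r} → 0ℚ ≤ r → p ≤ q → p * r ≤ q * r
  *-monoʳ {r = r} 0≤r = ℚ.*-monoʳ-≤-nonNeg r {{nonNegative 0≤r}}

  0≤-diff : ∀ {p q} → p ≤ q → 0ℚ ≤ q - p
  0≤-diff {p} {q} p≤q = subst (_≤ q - p) (ℚ.+-inverseʳ p) (ℚ.+-monoˡ-≤ (- p) p≤q)

  ≤-add : ∀ {p q r} → p + r ≡ q → 0ℚ ≤ r → p ≤ q
  ≤-add {p} {r = r} e 0≤r = subst₂ _≤_ (ℚ.+-identityʳ p) e (ℚ.+-monoʳ-≤ p 0≤r)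

  ≤-diff : ∀ {p q r} → p ≤ r + q → p - q ≤ r
  ≤-diff {p} {q} {r} h = subst (p - q ≤_)
    (solve 2 (λ r q → (r :+ q) :- q := r) refl r q) (ℚ.+-monoˡ-≤ (- q) h)

  *-cancelˡ-≡ : ∀ {p q} r → 0ℚ < r → r * p ≡ r * q → p ≡ q
  *-cancelˡ-≡ {p} {q} r 0<r e = ℚ.≤-antisym
    (ℚ.*-cancelˡ-≤-pos r {{positive 0<r}} (ℚ.≤-reflexive e))
    (ℚ.*-cancelˡ-≤-pos r {{positive 0<r}} (ℚ.≤-reflexive (sym e)))

  *-cancelˡ-≤ : ∀ {p q} r → 0ℚ < r → r * p ≤ r * q → p ≤ q
  *-cancelˡ-≤ r 0<r = ℚ.*-cancelˡ-≤-pos r {{positive 0<r}}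

  0≤-cancelˡ : ∀ {p} r → 0ℚ < r → 0ℚ ≤ r * p → 0ℚ ≤ p
  0≤-cancelˡ {p} r 0<r h = *-cancelˡ-≤ r 0<r (subst (_≤ r * p) (sym (ℚ.*-zeroʳ r)) h)

  *-inv : ∀ {q} → 0ℚ < q → q * inv q ≡ 1ℚ
  *-inv {q} 0<q = Rational.inv-inverse (ℚ.<-≤-trans 0<q (Rational.p≤∣p∣ q))

  inv-unique : ∀ {p q} → 0ℚ < p → p * q ≡ 1ℚ → inv p ≡ q
  inv-unique {p} 0<p e = *-cancelˡ-≡ p 0<p (trans (*-inv 0<p) (sym e))

  inv-0≤ : ∀ {q} → 0ℚ < q → 0ℚ ≤ inv q
  inv-0≤ {q} 0<q = 0≤-cancelˡ q 0<q (subst (0ℚ ≤_) (sym (*-inv 0<q)) 0≤1)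

  inv-≤ : ∀ {q r} → 0ℚ < q → 1ℚ ≤ q * r → inv q ≤ r
  inv-≤ {q} {r} 0<q h = *-cancelˡ-≤ q 0<q (subst (_≤ q * r) (sym (*-inv 0<q)) h)

  ∣∣-≤ : ∀ {p r} → p ≤ r → - p ≤ r → ∣ p ∣ ≤ r
  ∣∣-≤ = Rational.∣∣-lub

  ∣∣-* : ∀ p q → ∣ p * q ∣ ≡ ∣ p ∣ * ∣ q ∣
  ∣∣-* = ℚ.∣p*q∣≡∣p∣*∣q∣

  ∣∣-*-≤ : ∀ {p q r s} → ∣ p ∣ ≤ r → ∣ q ∣ ≤ s → ∣ p * q ∣ ≤ r * s
  ∣∣-*-≤ {p} {q} {r} {s} h₁ h₂ = subst (_≤ r * s) (sym (∣∣-* p q))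
    (*-mono (ℚ.0≤∣p∣ p) (ℚ.0≤∣p∣ q) h₁ h₂)

  ∣∣-+-≤ : ∀ {p q r s} → ∣ p ∣ ≤ r → ∣ q ∣ ≤ s → ∣ p + q ∣ ≤ r + s
  ∣∣-+-≤ {p} {q} h₁ h₂ = ℚ.≤-trans (ℚ.∣p+q∣≤∣p∣+∣q∣ p q) (ℚ.+-mono-≤ h₁ h₂)

  ∣∣-neg-≤ : ∀ {p r} → ∣ p ∣ ≤ r → ∣ - p ∣ ≤ r
  ∣∣-neg-≤ {p} {r} = subst (_≤ r) (sym (ℚ.∣-p∣≡∣p∣ p))

  ∣∣-minus-≤ : ∀ {p q r s} → ∣ p ∣ ≤ r → ∣ q ∣ ≤ s → ∣ p - q ∣ ≤ r + s
  ∣∣-minus-≤ h₁ h₂ = ∣∣-+-≤ h₁ (∣∣-neg-≤ h₂)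

  ∣∣-nonNeg : ∀ {p} → 0ℚ ≤ p → ∣ p ∣ ≡ p
  ∣∣-nonNeg = ℚ.0≤p⇒∣p∣≡p

  0≤∣∣-≤ : ∀ {p r} → ∣ p ∣ ≤ r → 0ℚ ≤ r
  0≤∣∣-≤ {p} = ℚ.≤-trans (ℚ.0≤∣p∣ p)

  0≤-² : ∀ p → 0ℚ ≤ p * p
  0≤-² = Rational.0≤p²

  archimedean : ∀ {ε} → 0ℚ < ε → ∃ λ N → ∀ n → N ℕ.≤ n → + 1 / suc n < ε
  archimedean 0<ε = let N , h = Rational.archimedean 0<ε in
    N , λ n N≤n → ℚ.≤-<-trans (Rational.1/-antitone N≤n) h

  ι*1/ : ∀ n → ι (suc n) * (+ 1 / suc n) ≡ 1ℚ
  ι*1/ n = ℚ.toℚᵘ-injective (ℚᵘ.≃-trans (ℚ.toℚᵘ-homo-* (ι (suc n)) (+ 1 / suc n))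
    (ℚᵘ.≃-trans (ℚᵘ.*-congˡ {ℚᵘ.mkℚᵘ (+ suc n) 0} (ℚ.toℚᵘ-fromℚᵘ (ℚᵘ.mkℚᵘ (+ 1) n)))
      (ℚᵘ.*≡* (trans (ℤ.*-identityʳ (+ suc n ℤ.* + 1)) (trans (ℤ.*-identityʳ (+ suc n)) (sym (trans (ℤ.*-identityˡ _) (ℤ.*-identityˡ (+ suc n)))))))))

-- The coefficients α n and the two monotone sequences n α n and (n+1) α n.

module Hypergeometric where

  open import Data.Integer.Base using (ℤ; +_; -[1+_])
  open import Data.Rational.Base
  open Arithmetic

  ι*1/d : ∀ d .{{_ : ℕ.NonZero d}} → ι d * (+ 1 / d) ≡ 1ℚ
  ι*1/d (suc n) = ι*1/ n

  1/!² : ℕ → ℚ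
  1/!² m = (+ 1 / (m ! ℕ.* m !)) {{m ℕ.!* m !≢0}}

  1/!²-suc : ∀ m → ι (suc m) * ι (suc m) * 1/!² (suc m) ≡ 1/!² m
  1/!²-suc m = begin
    s * s * 1/!² (suc m)                               ≡⟨ solve 1 (λ x → x := ♯ 1 :* x) refl (s * s * 1/!² (suc m)) ⟩
    1ℚ * (s * s * 1/!² (suc m))                        ≡⟨ cong (_* (s * s * 1/!² (suc m))) (ι*1/d (m ! ℕ.* m !) {{m ℕ.!* m !≢0}}) ⟨
    ι (m ! ℕ.* m !) * 1/!² m * (s * s * 1/!² (suc m))  ≡⟨ cong (λ x → x * 1/!² m * (s * s * 1/!² (suc m))) (ι-* (m !) (m !)) ⟩
    f * f * 1/!² m * (s * s * 1/!² (suc m))            ≡⟨ solve 4 (λ f r s r' → f :* f :* r :* (s :* s :* r') := r :* ((s :* f) :* (s :* f) :* r')) refl f (1/!² m) s (1/!² (suc m)) ⟩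
    1/!² m * (s * f * (s * f) * 1/!² (suc m))          ≡⟨ cong (λ x → 1/!² m * (x * x * 1/!² (suc m))) (ι-* (suc m) (m !)) ⟨
    1/!² m * (ι (suc m !) * ι (suc m !) * 1/!² (suc m)) ≡⟨ cong (λ x → 1/!² m * (x * 1/!² (suc m))) (ι-* (suc m !) (suc m !)) ⟨
    1/!² m * (ι (suc m ! ℕ.* suc m !) * 1/!² (suc m))  ≡⟨ cong (1/!² m *_) (ι*1/d (suc m ! ℕ.* suc m !) {{suc m ℕ.!* suc m !≢0}}) ⟩
    1/!² m * 1ℚ                                        ≡⟨ ℚ.*-identityʳ (1/!² m) ⟩
    1/!² m                                             ∎
    where
    open ≡-Reasoning
    s = ι (suc m)
    f = ι (m !)

  ₂F₁-coeff-suc : ∀ a b m → ι (suc m) * ι (suc m) * ₂F₁-coeff a b (suc m) ≡ (a + ι m) * (b + ι m) * ₂F₁-coeff a b m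
  ₂F₁-coeff-suc a b m = begin
    s * s * (p * (a + ι m) * (q * (b + ι m)) * 1/!² (suc m))
      ≡⟨ solve 6 (λ s p q x y r → s :* s :* (p :* x :* (q :* y) :* r) := x :* y :* (p :* q :* (s :* s :* r))) refl s p q (a + ι m) (b + ι m) (1/!² (suc m)) ⟩
    (a + ι m) * (b + ι m) * (p * q * (s * s * 1/!² (suc m)))
      ≡⟨ cong (λ x → (a + ι m) * (b + ι m) * (p * q * x)) (1/!²-suc m) ⟩
    (a + ι m) * (b + ι m) * (p * q * 1/!² m) ∎
    where
    open ≡-Reasoning
    s = ι (suc m)
    p = pochhammer a m
    q = pochhammer b m

  α : ℕ → ℚ
  α = ₂F₁-coeff (+ 1 / 3) (+ 2 / 3)

  -- Identities with 1/3, 2/3 or ½ among their coefficients are out of reach of the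
  -- integer-coefficient solver and go to this one.
  module QS = ℚS.+-*-Solver

  α-suc : ∀ n → ι 9 * (ι (suc n) * ι (suc n)) * α (suc n) ≡ (ι 9 * (ι n * ι n) + ι 9 * ι n + ι 2) * α n
  α-suc n = begin
    ι 9 * (s * s) * α (suc n)    ≡⟨ ℚ.*-assoc (ι 9) (s * s) (α (suc n)) ⟩
    ι 9 * (s * s * α (suc n))    ≡⟨ cong (ι 9 *_) (₂F₁-coeff-suc (+ 1 / 3) (+ 2 / 3) n) ⟩
    ι 9 * ((+ 1 / 3 + ι n) * (+ 2 / 3 + ι n) * α n)
      ≡⟨ QS.solve 2 (λ n a → QS.con (ι 9) QS.:* ((QS.con (+ 1 / 3) QS.:+ n) QS.:* (QS.con (+ 2 / 3) QS.:+ n) QS.:* a)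
           QS.:= (QS.con (ι 9) QS.:* (n QS.:* n) QS.:+ QS.con (ι 9) QS.:* n QS.:+ QS.con (ι 2)) QS.:* a) refl (ι n) (α n) ⟩
    (ι 9 * (ι n * ι n) + ι 9 * ι n + ι 2) * α n ∎
    where
    open ≡-Reasoning
    s = ι (suc n)

  0<α : ∀ n → 0ℚ < α n
  0<α zero    = ℚ.positive⁻¹ (α 0)
  0<α (suc n) = *-cancelˡ-<0 (0<-* (0<ι 8) (0<-* (0<ι n) (0<ι n))) (subst (0ℚ <_) (sym (α-suc n))
    (0<-* (ℚ.+-mono-≤-< (0≤-+ (0≤-* (0≤ι 9) (0≤-* (0≤ι n) (0≤ι n))) (0≤-* (0≤ι 9) (0≤ι n))) (0<ι 1)) (0<α n)))
    where
    *-cancelˡ-<0 : ∀ {r p} → 0ℚ < r → 0ℚ < r * p → 0ℚ < p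
    *-cancelˡ-<0 {r} {p} 0<r h = ℚ.*-cancelˡ-<-nonNeg r {{nonNegative (ℚ.<⇒≤ 0<r)}} (subst (_< r * p) (sym (ℚ.*-zeroʳ r)) h)

  0≤α : ∀ n → 0ℚ ≤ α n
  0≤α n = ℚ.<⇒≤ (0<α n)

  -- Cleared of denominators, the two sides differ by (7n+5) α n. This supplies a decreasing upper
  -- companion to the increasing sequence n α n.
  [1+n]α-decreasing : ∀ n → ι (suc (suc n)) * α (suc n) ≤ ι (suc n) * α n
  [1+n]α-decreasing n = *-cancelˡ-≤ (ι 9 * (s * s)) (0<-* (0<ι 8) (0<-* (0<ι n) (0<ι n))) (≤-add {r = (ι 7 * ι n + ι 5) * α n}
    (begin
      ι 9 * (s * s) * (ι (suc (suc n)) * α (suc n)) + (ι 7 * ι n + ι 5) * α n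
        ≡⟨ cong (_+ (ι 7 * ι n + ι 5) * α n) (solve 3 (λ s t a → 9 · (s :* s) :* (t :* a) := t :* (9 · (s :* s) :* a)) refl s (ι (suc (suc n))) (α (suc n))) ⟩
      ι (suc (suc n)) * (ι 9 * (s * s) * α (suc n)) + (ι 7 * ι n + ι 5) * α n
        ≡⟨ cong₂ (λ x y → x * y + (ι 7 * ι n + ι 5) * α n) (trans (ι-suc (suc n)) (cong (_+ 1ℚ) (ι-suc n))) (α-suc n) ⟩
      (ι n + 1ℚ + 1ℚ) * ((ι 9 * (ι n * ι n) + ι 9 * ι n + ι 2) * α n) + (ι 7 * ι n + ι 5) * α n
        ≡⟨ solve 2 (λ n a → (n :+ ♯ 1 :+ ♯ 1) :* ((9 · (n :* n) :+ 9 · n :+ ♯ 2) :* a) :+ (7 · n :+ ♯ 5) :* a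
             := 9 · ((n :+ ♯ 1) :* (n :+ ♯ 1)) :* ((n :+ ♯ 1) :* a)) refl (ι n) (α n) ⟩
      ι 9 * ((ι n + 1ℚ) * (ι n + 1ℚ)) * ((ι n + 1ℚ) * α n)
        ≡⟨ cong (λ x → ι 9 * (x * x) * (x * α n)) (ι-suc n) ⟨
      ι 9 * (s * s) * (s * α n) ∎)
    (0≤-* (0≤-+ (0≤-* (0≤ι 7) (0≤ι n)) (0≤ι 5)) (0≤α n)))
    where
    open ≡-Reasoning
    s = ι (suc n)

  nα-increasing : ∀ n → ι n * α n ≤ ι (suc n) * α (suc n)
  nα-increasing n = *-cancelˡ-≤ (ι 9 * s) (0<-* (0<ι 8) (0<ι n)) (≤-add {r = ι 2 * α n}
    (begin
      ι 9 * s * (ι n * α n) + ι 2 * α n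
        ≡⟨ cong (λ x → ι 9 * x * (ι n * α n) + ι 2 * α n) (ι-suc n) ⟩
      ι 9 * (ι n + 1ℚ) * (ι n * α n) + ι 2 * α n
        ≡⟨ solve 2 (λ n a → 9 · (n :+ ♯ 1) :* (n :* a) :+ 2 · a := (9 · (n :* n) :+ 9 · n :+ ♯ 2) :* a) refl (ι n) (α n) ⟩
      (ι 9 * (ι n * ι n) + ι 9 * ι n + ι 2) * α n
        ≡⟨ α-suc n ⟨
      ι 9 * (s * s) * α (suc n)
        ≡⟨ solve 2 (λ s a → 9 · (s :* s) :* a := 9 · s :* (s :* a)) refl s (α (suc n)) ⟩
      ι 9 * s * (s * α (suc n)) ∎)
    (0≤-* (0≤ι 2) (0≤α n)))
    where
    open ≡-Reasoning
    s = ι (suc n)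

  [1+n]α≤1 : ∀ n → ι (suc n) * α n ≤ 1ℚ
  [1+n]α≤1 zero    = ℚ.≤-refl
  [1+n]α≤1 (suc n) = ℚ.≤-trans ([1+n]α-decreasing n) ([1+n]α≤1 n)

  α≤1/[1+n] : ∀ n → α n ≤ + 1 / suc n
  α≤1/[1+n] n = *-cancelˡ-≤ (ι (suc n)) (0<ι n) (ℚ.≤-trans ([1+n]α≤1 n) (ℚ.≤-reflexive (sym (ι*1/ n))))

  nα : ℕ → ℚ
  nα n = ι n * α n

  0≤nα : ∀ n → 0ℚ ≤ nα n
  0≤nα n = 0≤-* (0≤ι n) (0≤α n)

  nα≤1 : ∀ n → nα n ≤ 1ℚ
  nα≤1 n = ℚ.≤-trans (*-monoʳ (0≤α n) (ι-mono (ℕ.n≤1+n n))) ([1+n]α≤1 n)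

  ∣nα∣≤1 : ∀ n → ∣ nα n ∣ ≤ 1ℚ
  ∣nα∣≤1 n = subst (_≤ 1ℚ) (sym (∣∣-nonNeg (0≤nα n))) (nα≤1 n)

  nα-mono : ∀ {m n} → m ℕ.≤ n → ι m * α m ≤ ι n * α n
  nα-mono {m} {n} m≤n = subst (λ n → ι m * α m ≤ ι n * α n) (ℕ.m+[n∸m]≡n m≤n) (go (n ℕ.∸ m))
    where
    go : ∀ j → ι m * α m ≤ ι (m ℕ.+ j) * α (m ℕ.+ j)
    go zero    = ℚ.≤-reflexive (cong (λ n → ι n * α n) (sym (ℕ.+-identityʳ m)))
    go (suc j) = subst (λ n → ι m * α m ≤ ι n * α n) (sym (ℕ.+-suc m j)) (ℚ.≤-trans (go j) (nα-increasing (m ℕ.+ j)))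

  [1+n]α-mono : ∀ {m n} → m ℕ.≤ n → ι (suc n) * α n ≤ ι (suc m) * α m
  [1+n]α-mono {m} {n} m≤n = subst (λ n → ι (suc n) * α n ≤ ι (suc m) * α m) (ℕ.m+[n∸m]≡n m≤n) (go (n ℕ.∸ m))
    where
    go : ∀ j → ι (suc (m ℕ.+ j)) * α (m ℕ.+ j) ≤ ι (suc m) * α m
    go zero    = ℚ.≤-reflexive (cong (λ n → ι (suc n) * α n) (ℕ.+-identityʳ m))
    go (suc j) = subst (λ n → ι (suc n) * α n ≤ ι (suc m) * α m) (sym (ℕ.+-suc m j)) (ℚ.≤-trans ([1+n]α-decreasing (m ℕ.+ j)) (go j))

  -- A rate of convergence that does not mention the limit: by the two monotonicities every later
  -- value lies between m α m and (m+1) α m.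
  nα-increment≤α : ∀ {m n} → m ℕ.≤ n → nα n - nα m ≤ α m
  nα-increment≤α {m} {n} m≤n = ≤-diff (begin
    nα n                 ≤⟨ *-monoʳ (0≤α n) (ι-mono (ℕ.n≤1+n n)) ⟩
    ι (suc n) * α n      ≤⟨ [1+n]α-mono m≤n ⟩
    ι (suc m) * α m      ≡⟨ cong (_* α m) (ι-suc m) ⟩
    (ι m + 1ℚ) * α m     ≡⟨ solve 2 (λ m a → (m :+ ♯ 1) :* a := a :+ m :* a) refl (ι m) (α m) ⟩
    α m + nα m           ∎)
    where open ℚ.≤-Reasoning

-- Null sequences, finite sums, and sums of powers against a geometric sequence.

module Sequences where

  open import Data.Integer.Base using (ℤ; +_; -[1+_])
  open import Data.Rational.Base
  open Arithmetic
  open RawSemiring ℚ.+-*-rawSemiring public using (_^_)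

  -- The limits in question, such as π and √3, are irrational, so a limit statement about rational
  -- sequences is phrased as the vanishing of a difference.
  Null : (ℕ → ℚ) → Set
  Null u = ∀ ε → 0ℚ < ε → ∃ λ N → ∀ n → N ℕ.≤ n → ∣ u n ∣ ≤ ε

  null-cong : ∀ {u v} → (∀ n → u n ≡ v n) → Null u → Null v
  null-cong {u} {v} e h ε 0<ε = let N , f = h ε 0<ε in
    N , λ n N≤n → subst (λ x → ∣ x ∣ ≤ ε) (e n) (f n N≤n)

  null-+ : ∀ {u v} → Null u → Null v → Null (λ n → u n + v n)
  null-+ {u} {v} h₁ h₂ ε 0<ε =
    let 0<½ε    = 0<-* Rational.0<½ 0<ε
        N₁ , f₁ = h₁ (½ * ε) 0<½ε
        N₂ , f₂ = h₂ (½ * ε) 0<½ε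
    in N₁ ℕ.⊔ N₂ , λ n N≤n → ℚ.≤-trans
         (∣∣-+-≤ {u n} {v n} (f₁ n (ℕ.m⊔n≤o⇒m≤o N₁ N₂ N≤n)) (f₂ n (ℕ.m⊔n≤o⇒n≤o N₁ N₂ N≤n)))
         (ℚ.≤-reflexive (Rational.half+half ε))

  null-* : ∀ {u} (b : ℕ → ℚ) {B} → (∀ n → ∣ b n ∣ ≤ B) → Null u → Null (λ n → b n * u n)
  null-* {u} b {B} hb h ε 0<ε =
    -- The bound is enlarged to 1+B because `Cauchy.scale` divides by it and B may be 0.
    let 0<1+B       = ℚ.<-≤-trans Rational.0<1 (≤-add {1ℚ} {1ℚ + B} refl (0≤∣∣-≤ {b 0} (hb 0)))
        δ , 0<δ , e = Cauchy.scale 0<1+B 0<ε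
        N , f       = h δ 0<δ
    in N , λ n N≤n → ℚ.≤-trans
         (∣∣-*-≤ {b n} {u n} (ℚ.≤-trans (hb n) (≤-add (ℚ.+-comm B 1ℚ) 0≤1)) (f n N≤n))
         (ℚ.≤-reflexive e)

  null-scale : ∀ {u} c → Null u → Null (λ n → c * u n)
  null-scale {u} c = null-* {u} (λ _ → c) (λ _ → ℚ.≤-refl)

  null-neg : ∀ {u} → Null u → Null (λ n → - u n)
  null-neg {u} h ε 0<ε = let N , f = h ε 0<ε in N , λ n N≤n → ∣∣-neg-≤ {u n} (f n N≤n)

  null-dominated : ∀ {u v} N → (∀ n → N ℕ.≤ n → ∣ u n ∣ ≤ v n) → Null v → Null u
  null-dominated {u} {v} N₁ d h ε 0<ε = let N₂ , f = h ε 0<ε in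
    N₁ ℕ.⊔ N₂ , λ n N≤n → ℚ.≤-trans (d n (ℕ.m⊔n≤o⇒m≤o N₁ N₂ N≤n))
      (ℚ.≤-trans (Rational.p≤∣p∣ (v n)) (f n (ℕ.m⊔n≤o⇒n≤o N₁ N₂ N≤n)))

  null-∘ : ∀ {u} (f : ℕ → ℕ) → (∀ n → n ℕ.≤ f n) → Null u → Null (λ n → u (f n))
  null-∘ f n≤f h ε 0<ε = let N , g = h ε 0<ε in
    N , λ n N≤n → g (f n) (ℕ.≤-trans N≤n (n≤f n))

  1/≥0 : ∀ n → 0ℚ ≤ + 1 / suc n
  1/≥0 = Rational.1/-nonNeg

  null-1/ : Null (λ n → + 1 / suc n)
  null-1/ ε 0<ε = let N , h = archimedean 0<ε in
    N , λ n N≤n → subst (_≤ ε) (sym (∣∣-nonNeg (1/≥0 n))) (ℚ.<⇒≤ (h n N≤n))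

  -- The order of ℚ is decidable, so one may argue from q < p: for some n the error term is at most
  -- half of p - q, a contradiction. This disposes of the discretisation error in `mean-value`.
  ≤-limit : ∀ {p q} B → (∀ n → p ≤ q + B * (+ 1 / suc n)) → p ≤ q
  ≤-limit {p} {q} B h = ℚ.≮⇒≥ λ q<p →
    let 0<d     = subst (_< p - q) (ℚ.+-inverseʳ q) (ℚ.+-monoˡ-< (- q) q<p)
        N , f   = null-scale {λ n → + 1 / suc n} B null-1/ (½ * (p - q)) (0<-* Rational.0<½ 0<d)
    in ℚ.<-irrefl refl (begin-strict
      ½ * (p - q)                        ≡⟨ ℚ.+-identityʳ (½ * (p - q)) ⟨
      ½ * (p - q) + 0ℚ                   <⟨ ℚ.+-monoʳ-< (½ * (p - q)) (0<-* Rational.0<½ 0<d) ⟩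
      ½ * (p - q) + ½ * (p - q)          ≡⟨ Rational.half+half (p - q) ⟩
      p - q                              ≤⟨ ≤-diff (subst (p ≤_) (ℚ.+-comm q (B * (+ 1 / suc N))) (h N)) ⟩
      B * (+ 1 / suc N)                  ≤⟨ ℚ.≤-trans (Rational.p≤∣p∣ _) (f N ℕ.≤-refl) ⟩
      ½ * (p - q)                        ∎)
    where open ℚ.≤-Reasoning

  null-∣∣ : ∀ {u} → Null u → Null (λ n → ∣ u n ∣)
  null-∣∣ {u} h ε 0<ε = let N , f = h ε 0<ε in
    N , λ n N≤n → subst (_≤ ε) (sym (ℚ.∣∣p∣∣≡∣p∣ (u n))) (f n N≤n)

  ∑ : ℕ → (ℕ → ℚ) → ℚ
  ∑ n f = partialSum _+_ 0ℚ f n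

  ∑-cong : ∀ {f g} n → (∀ i → f i ≡ g i) → ∑ n f ≡ ∑ n g
  ∑-cong zero    e = refl
  ∑-cong (suc n) e = cong₂ _+_ (∑-cong n e) (e n)

  ∑-+ : ∀ n {f g} → ∑ n (λ i → f i + g i) ≡ ∑ n f + ∑ n g
  ∑-+ zero    = refl
  ∑-+ (suc n) {f} {g} = trans (cong (_+ (f n + g n)) (∑-+ n))
    (solve 4 (λ a b c d → (a :+ b) :+ (c :+ d) := (a :+ c) :+ (b :+ d)) refl (∑ n f) (∑ n g) (f n) (g n))

  ∑-* : ∀ n c {f} → ∑ n (λ i → c * f i) ≡ c * ∑ n f
  ∑-* zero    c = sym (ℚ.*-zeroʳ c)
  ∑-* (suc n) c {f} = trans (cong (_+ c * f n) (∑-* n c)) (sym (ℚ.*-distribˡ-+ c (∑ n f) (f n)))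

  ∑-neg : ∀ n {f} → ∑ n (λ i → - f i) ≡ - ∑ n f
  ∑-neg zero    = refl
  ∑-neg (suc n) {f} = trans (cong (_+ - f n) (∑-neg n)) (sym (ℚ.neg-distrib-+ (∑ n f) (f n)))

  ∑-≤ : ∀ n {f g} → (∀ i → i ℕ.< n → f i ≤ g i) → ∑ n f ≤ ∑ n g
  ∑-≤ zero    h = ℚ.≤-refl
  ∑-≤ (suc n) h = ℚ.+-mono-≤ (∑-≤ n λ i i<n → h i (ℕ.m<n⇒m<1+n i<n)) (h n ℕ.≤-refl)

  ∑-0≤ : ∀ n {f} → (∀ i → 0ℚ ≤ f i) → 0ℚ ≤ ∑ n f
  ∑-0≤ zero    h = ℚ.≤-refl
  ∑-0≤ (suc n) h = 0≤-+ (∑-0≤ n h) (h n)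

  ∑-∣∣ : ∀ n {f g} → (∀ i → i ℕ.< n → ∣ f i ∣ ≤ g i) → ∣ ∑ n f ∣ ≤ ∑ n g
  ∑-∣∣ zero    h = ℚ.≤-refl
  ∑-∣∣ (suc n) {f} h = ∣∣-+-≤ {∑ n f} {f n} (∑-∣∣ n λ i i<n → h i (ℕ.m<n⇒m<1+n i<n)) (h n ℕ.≤-refl)

  ∑-telescope : ∀ n (g : ℕ → ℚ) → ∑ n (λ i → g (suc i) - g i) ≡ g n - g 0
  ∑-telescope zero    g = sym (ℚ.+-inverseʳ (g 0))
  ∑-telescope (suc n) g = trans (cong (_+ (g (suc n) - g n)) (∑-telescope n g))
    (solve 3 (λ a b c → (a :- b) :+ (c :- a) := c :- b) refl (g n) (g 0) (g (suc n)))

  ^-0≤ : ∀ {x} n → 0ℚ ≤ x → 0ℚ ≤ x ^ n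
  ^-0≤ zero    _   = 0≤1
  ^-0≤ (suc n) 0≤x = 0≤-* 0≤x (^-0≤ n 0≤x)

  ^-0< : ∀ {x} n → 0ℚ < x → 0ℚ < x ^ n
  ^-0< zero    _   = Rational.0<1
  ^-0< (suc n) 0<x = 0<-* 0<x (^-0< n 0<x)

  ∣^∣-≤ : ∀ {x b} n → ∣ x ∣ ≤ b → ∣ x ^ n ∣ ≤ b ^ n
  ∣^∣-≤ zero    _ = ℚ.≤-refl
  ∣^∣-≤ {x} (suc n) h = ∣∣-*-≤ {x} h (∣^∣-≤ n h)

  ^-mono : ∀ {x y} n → 0ℚ ≤ x → x ≤ y → x ^ n ≤ y ^ n
  ^-mono zero    _   _   = ℚ.≤-refl
  ^-mono (suc n) 0≤x x≤y = *-mono 0≤x (^-0≤ n 0≤x) x≤y (^-mono n 0≤x x≤y)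

  -- The discrete counterpart of the derivative of n^(j+1), by induction on j in place of the
  -- binomial theorem; it bounds the increments of the weight in `by-parts`.
  ι-^-step : ∀ j n → ι (suc n) ^ suc j ≤ ι n ^ suc j + ι (suc j) * ι (suc n) ^ j
  ι-^-step zero n = ℚ.≤-reflexive (trans (cong (_* 1ℚ) (ι-suc n))
    (solve 1 (λ n → (n :+ ♯ 1) :* ♯ 1 := n :* ♯ 1 :+ 1 · ♯ 1) refl (ι n)))
  ι-^-step (suc j) n = begin
    s * s ^ suc j                                    ≡⟨ cong (_* s ^ suc j) (ι-suc n) ⟩
    (ι n + 1ℚ) * s ^ suc j                           ≡⟨ ℚ.*-distribʳ-+ (s ^ suc j) (ι n) 1ℚ ⟩
    ι n * s ^ suc j + 1ℚ * s ^ suc j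
      ≤⟨ ℚ.+-monoˡ-≤ (1ℚ * s ^ suc j) (*-monoˡ (0≤ι n) (ι-^-step j n)) ⟩
    ι n * (ι n ^ suc j + ι (suc j) * s ^ j) + 1ℚ * s ^ suc j
      ≡⟨ solve 5 (λ n p j q r → n :* (p :+ j :* q) :+ ♯ 1 :* r := n :* p :+ (j :* (n :* q) :+ r)) refl (ι n) (ι n ^ suc j) (ι (suc j)) (s ^ j) (s ^ suc j) ⟩
    ι n * ι n ^ suc j + (ι (suc j) * (ι n * s ^ j) + s ^ suc j)
      ≤⟨ ℚ.+-monoʳ-≤ (ι n * ι n ^ suc j) (ℚ.+-monoˡ-≤ (s ^ suc j) (*-monoˡ (0≤ι (suc j)) (*-monoʳ (^-0≤ j (0≤ι (suc n))) (ι-mono (ℕ.n≤1+n n))))) ⟩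
    ι n * ι n ^ suc j + (ι (suc j) * s ^ suc j + s ^ suc j)
      ≡⟨ cong (λ x → ι n * ι n ^ suc j + x) (solve 2 (λ j r → j :* r :+ r := (j :+ ♯ 1) :* r) refl (ι (suc j)) (s ^ suc j)) ⟩
    ι n * ι n ^ suc j + (ι (suc j) + 1ℚ) * s ^ suc j
      ≡⟨ cong (λ x → ι n * ι n ^ suc j + x * s ^ suc j) (ι-suc (suc j)) ⟨
    ι n ^ suc (suc j) + ι (suc (suc j)) * s ^ suc j  ∎
    where
    open ℚ.≤-Reasoning
    s = ι (suc n)

  -- ∑ (n+1)ʲ xⁿ ≤ j!/(1-x)ʲ⁺¹, by summation by parts on j.
  module WeightedGeometric {x : ℚ} (0≤x : 0ℚ ≤ x) where

    weighted : ℕ → ℕ → ℚ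
    weighted j N = ∑ N λ n → ι (suc n) ^ j * x ^ n

    0≤weighted : ∀ j N → 0ℚ ≤ weighted j N
    0≤weighted j N = ∑-0≤ N λ n → 0≤-* (^-0≤ j (0≤ι (suc n))) (^-0≤ n 0≤x)

    by-parts : ∀ j N → (1ℚ - x) * weighted (suc j) N + ι N ^ suc j * x ^ N ≤ ι (suc j) * weighted j N
    by-parts j zero    = ℚ.≤-reflexive (solve 3 (λ x p j → (♯ 1 :- x) :* ♯ 0 :+ ♯ 0 :* p :* ♯ 1 := j :* ♯ 0) refl x (0ℚ ^ j) (ι (suc j)))
    by-parts j (suc N) = begin
      (1ℚ - x) * (g + a * y) + a * (x * y)
        ≡⟨ solve 4 (λ x g a y → (♯ 1 :- x) :* (g :+ a :* y) :+ a :* (x :* y) := (♯ 1 :- x) :* g :+ a :* y) refl x g a y ⟩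
      (1ℚ - x) * g + a * y
        ≤⟨ ℚ.+-monoʳ-≤ ((1ℚ - x) * g) (*-monoʳ (^-0≤ N 0≤x) (ι-^-step j N)) ⟩
      (1ℚ - x) * g + (ι N ^ suc j + ι (suc j) * b) * y
        ≡⟨ solve 6 (λ x g n j b y → (♯ 1 :- x) :* g :+ (n :+ j :* b) :* y := ((♯ 1 :- x) :* g :+ n :* y) :+ j :* (b :* y)) refl x g (ι N ^ suc j) (ι (suc j)) b y ⟩
      ((1ℚ - x) * g + ι N ^ suc j * y) + ι (suc j) * (b * y)
        ≤⟨ ℚ.+-monoˡ-≤ (ι (suc j) * (b * y)) (by-parts j N) ⟩
      ι (suc j) * weighted j N + ι (suc j) * (b * y)
        ≡⟨ ℚ.*-distribˡ-+ (ι (suc j)) (weighted j N) (b * y) ⟨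
      ι (suc j) * (weighted j N + b * y) ∎
      where
      open ℚ.≤-Reasoning
      g = weighted (suc j) N
      a = ι (suc N) ^ suc j
      b = ι (suc N) ^ j
      y = x ^ N

    geometric : ∀ N → (1ℚ - x) * weighted 0 N + x ^ N ≡ 1ℚ
    geometric zero    = solve 1 (λ x → (♯ 1 :- x) :* ♯ 0 :+ ♯ 1 := ♯ 1) refl x
    geometric (suc N) = trans
      (solve 3 (λ x g y → (♯ 1 :- x) :* (g :+ ♯ 1 :* y) :+ x :* y := (♯ 1 :- x) :* g :+ y) refl x (weighted 0 N) (x ^ N))
      (geometric N)

    -- The parameter d leaves room for a simpler lower bound of 1-x: near k = 0 it is k itself, in
    -- `null-power` it is 1-x.
    module _ {d : ℚ} (0≤d : 0ℚ ≤ d) (d≤1-x : d ≤ 1ℚ - x) where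

      weighted-≤ : ∀ j N → d ^ suc j * weighted j N ≤ ι (j !)
      weighted-≤ zero N = begin
        d * 1ℚ * weighted 0 N             ≡⟨ cong (_* weighted 0 N) (ℚ.*-identityʳ d) ⟩
        d * weighted 0 N                  ≤⟨ *-monoʳ (0≤weighted 0 N) d≤1-x ⟩
        (1ℚ - x) * weighted 0 N           ≤⟨ ≤-add (geometric N) (^-0≤ N 0≤x) ⟩
        1ℚ                                ∎
        where open ℚ.≤-Reasoning
      weighted-≤ (suc j) N = begin
        d * d ^ suc j * weighted (suc j) N
          ≡⟨ solve 3 (λ d p g → d :* p :* g := p :* (d :* g)) refl d (d ^ suc j) (weighted (suc j) N) ⟩
        d ^ suc j * (d * weighted (suc j) N)
          ≤⟨ *-monoˡ (^-0≤ (suc j) 0≤d) (*-monoʳ (0≤weighted (suc j) N) d≤1-x) ⟩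
        d ^ suc j * ((1ℚ - x) * weighted (suc j) N)
          ≤⟨ *-monoˡ (^-0≤ (suc j) 0≤d) (ℚ.≤-trans (≤-add refl (0≤-* (^-0≤ (suc j) (0≤ι N)) (^-0≤ N 0≤x))) (by-parts j N)) ⟩
        d ^ suc j * (ι (suc j) * weighted j N)
          ≡⟨ solve 3 (λ p j g → p :* (j :* g) := j :* (p :* g)) refl (d ^ suc j) (ι (suc j)) (weighted j N) ⟩
        ι (suc j) * (d ^ suc j * weighted j N)
          ≤⟨ *-monoˡ (0≤ι (suc j)) (weighted-≤ j N) ⟩
        ι (suc j) * ι (j !)
          ≡⟨ ι-* (suc j) (j !) ⟨
        ι (suc j ℕ.* j !) ∎
        where open ℚ.≤-Reasoning

      private
        0≤1-x : 0ℚ ≤ 1ℚ - x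
        0≤1-x = ℚ.≤-trans 0≤d d≤1-x

      -- `by-parts` bounds a sum and a boundary term together. `weighted-≤` keeps the sum; here the
      -- boundary term is kept.
      power-≤ : ∀ j N → d ^ suc j * (ι N ^ suc j * x ^ N) ≤ ι (suc j !)
      power-≤ j N = begin
        d ^ suc j * (ι N ^ suc j * x ^ N)
          ≤⟨ *-monoˡ (^-0≤ (suc j) 0≤d) (ℚ.≤-trans (≤-add (ℚ.+-comm (ι N ^ suc j * x ^ N) ((1ℚ - x) * weighted (suc j) N)) (0≤-* 0≤1-x (0≤weighted (suc j) N))) (by-parts j N)) ⟩
        d ^ suc j * (ι (suc j) * weighted j N)
          ≡⟨ solve 3 (λ p j g → p :* (j :* g) := j :* (p :* g)) refl (d ^ suc j) (ι (suc j)) (weighted j N) ⟩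
        ι (suc j) * (d ^ suc j * weighted j N)
          ≤⟨ *-monoˡ (0≤ι (suc j)) (weighted-≤ j N) ⟩
        ι (suc j) * ι (j !)
          ≡⟨ ι-* (suc j) (j !) ⟨
        ι (suc j ℕ.* j !) ∎
        where open ℚ.≤-Reasoning

  -- `power-≤` bounds even n^(j+2) xⁿ, and n² ≥ n+1 for n ≥ 2 turns the two spare powers into a
  -- factor 1/(n+1).
  null-power : ∀ {x} j → 0ℚ ≤ x → x < 1ℚ → Null (λ n → ι n ^ j * x ^ n)
  null-power {x} j 0≤x x<1 =
    null-dominated {λ n → ι n ^ j * x ^ n} 2 bound (null-scale {λ n → + 1 / suc n} (ι (suc (suc j) !) * inv (d ^ suc (suc j))) null-1/)
    where
    d = 1ℚ - x
    0<d : 0ℚ < d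
    0<d = subst (_< d) (ℚ.+-inverseʳ x) (ℚ.+-monoˡ-< (- x) x<1)
    open WeightedGeometric 0≤x
    bound : ∀ n → 2 ℕ.≤ n → ∣ ι n ^ j * x ^ n ∣ ≤ ι (suc (suc j) !) * inv (d ^ suc (suc j)) * (+ 1 / suc n)
    bound n 2≤n = subst (_≤ F * inv D * (+ 1 / suc n)) (sym (∣∣-nonNeg 0≤p)) (*-cancelˡ-≤ D 0<D (*-cancelˡ-≤ (ι (suc n)) (0<ι n) (begin
      ι (suc n) * (D * p)
        ≤⟨ *-monoʳ (0≤-* (ℚ.<⇒≤ 0<D) 0≤p) 1+n≤n² ⟩
      ι n * ι n * (D * p)
        ≡⟨ solve 4 (λ n D q y → n :* n :* (D :* (q :* y)) := D :* (n :* (n :* q) :* y)) refl (ι n) D (ι n ^ j) (x ^ n) ⟩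
      D * (ι n ^ suc (suc j) * x ^ n)
        ≤⟨ power-≤ (ℚ.<⇒≤ 0<d) ℚ.≤-refl (suc j) n ⟩
      F
        ≡⟨ solve 1 (λ F → F := F :* ♯ 1 :* ♯ 1) refl F ⟩
      F * 1ℚ * 1ℚ
        ≡⟨ cong₂ (λ a b → F * a * b) (*-inv 0<D) (ι*1/ n) ⟨
      F * (D * inv D) * (ι (suc n) * (+ 1 / suc n))
        ≡⟨ solve 5 (λ F D i s r → F :* (D :* i) :* (s :* r) := s :* (D :* (F :* i :* r))) refl F D (inv D) (ι (suc n)) (+ 1 / suc n) ⟩
      ι (suc n) * (D * (F * inv D * (+ 1 / suc n))) ∎)))
      where
      open ℚ.≤-Reasoning
      D = d ^ suc (suc j)
      0<D = ^-0< (suc (suc j)) 0<d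
      F = ι (suc (suc j) !)
      p = ι n ^ j * x ^ n
      0≤p = 0≤-* (^-0≤ j (0≤ι n)) (^-0≤ n 0≤x)
      1+n≤n² : ι (suc n) ≤ ι n * ι n
      1+n≤n² = ℚ.≤-trans (ι-mono (ℕ.≤-trans (ℕ.+-monoˡ-≤ n (ℕ.<⇒≤ 2≤n))
        (ℕ.≤-trans (ℕ.≤-reflexive (cong (n ℕ.+_) (sym (ℕ.+-identityʳ n)))) (ℕ.*-monoˡ-≤ n 2≤n))))
        (ℚ.≤-reflexive (ι-* n n))

-- From Leibniz's series through Wallis's product to the limit √3/π of 2 n α n.

module Wallis where

  open import Data.Integer.Base using (ℤ; +_; -[1+_])
  open import Data.Rational.Base
  open Arithmetic
  open Hypergeometric
  open Sequences
  open Leibniz using (sign; S) renaming (a to 1/odd)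

  -- v n j = n! (n+1)! / ((n-j)! (n+1+j)!), the binomial coefficient (2n+1 choose n+1+j)
  -- divided by the central one.
  v : ℕ → ℕ → ℚ
  v n zero    = 1ℚ
  v n (suc j) = v n j * (ι n - ι j) * (+ 1 / suc (suc (n ℕ.+ j)))

  v-suc : ∀ n j → (ι n + ι j + ι 2) * v n (suc j) ≡ (ι n - ι j) * v n j
  v-suc n j = begin
    (ι n + ι j + ι 2) * (v n j * (ι n - ι j) * r)
      ≡⟨ cong (_* (v n j * (ι n - ι j) * r)) (trans (solve 2 (λ n j → n :+ j :+ ♯ 2 := n :+ j :+ ♯ 1 :+ ♯ 1) refl (ι n) (ι j)) (sym ι2+)) ⟩
    ι (suc (suc (n ℕ.+ j))) * (v n j * (ι n - ι j) * r)
      ≡⟨ solve 4 (λ s v d r → s :* (v :* d :* r) := d :* v :* (s :* r)) refl (ι (suc (suc (n ℕ.+ j)))) (v n j) (ι n - ι j) r ⟩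
    (ι n - ι j) * v n j * (ι (suc (suc (n ℕ.+ j))) * r)
      ≡⟨ cong ((ι n - ι j) * v n j *_) (ι*1/ (suc (n ℕ.+ j))) ⟩
    (ι n - ι j) * v n j * 1ℚ
      ≡⟨ ℚ.*-identityʳ _ ⟩
    (ι n - ι j) * v n j ∎
    where
    open ≡-Reasoning
    r = + 1 / suc (suc (n ℕ.+ j))
    ι2+ : ι (suc (suc (n ℕ.+ j))) ≡ ι n + ι j + 1ℚ + 1ℚ
    ι2+ = trans (ι-suc (suc (n ℕ.+ j))) (cong (_+ 1ℚ) (trans (ι-suc (n ℕ.+ j)) (cong (_+ 1ℚ) (ι-+ n j))))

  v-vanishes : ∀ n i → v n (suc (n ℕ.+ i)) ≡ 0ℚ
  v-vanishes n zero    = begin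
    v n (n ℕ.+ 0) * (ι n - ι (n ℕ.+ 0)) * r ≡⟨ cong (λ m → v n (n ℕ.+ 0) * (ι n - ι m) * r) (ℕ.+-identityʳ n) ⟩
    v n (n ℕ.+ 0) * (ι n - ι n) * r         ≡⟨ solve 3 (λ v n r → v :* (n :- n) :* r := ♯ 0) refl (v n (n ℕ.+ 0)) (ι n) r ⟩
    0ℚ ∎
    where
    open ≡-Reasoning
    r = + 1 / suc (suc (n ℕ.+ (n ℕ.+ 0)))
  v-vanishes n (suc i) = trans
    (cong (λ x → x * (ι n - ι (n ℕ.+ suc i)) * (+ 1 / suc (suc (n ℕ.+ (n ℕ.+ suc i)))))
      (trans (cong (v n) (ℕ.+-suc n i)) (v-vanishes n i)))
    (solve 2 (λ d r → ♯ 0 :* d :* r := ♯ 0) refl (ι n - ι (n ℕ.+ suc i)) (+ 1 / suc (suc (n ℕ.+ (n ℕ.+ suc i)))))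

  v-end : ∀ n → v n (suc n) ≡ 0ℚ
  v-end n = trans (cong (λ m → v n (suc m)) (sym (ℕ.+-identityʳ n))) (v-vanishes n 0)

  0≤v : ∀ n j → 0ℚ ≤ v n j
  0≤v n zero    = 0≤1
  0≤v n (suc j) with ℕ.≤-total j n
  ... | inj₁ j≤n = 0≤-* (0≤-* (0≤v n j) (0≤-diff (ι-mono j≤n))) (1/≥0 (suc (n ℕ.+ j)))
  ... | inj₂ n≤j = ℚ.≤-reflexive (sym (trans (cong (λ m → v n (suc m)) (sym (ℕ.m+[n∸m]≡n n≤j))) (v-vanishes n (j ℕ.∸ n))))

  t : ℕ → ℕ → ℚ
  t n j = v n j - v n (suc j)

  0<n+j+2 : ∀ n j → 0ℚ < ι n + ι j + ι 2
  0<n+j+2 n j = ℚ.+-mono-≤-< (0≤-+ (0≤ι n) (0≤ι j)) (0<ι 1)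

  t-formula : ∀ n j → (ι n + ι j + ι 2) * t n j ≡ (ι 2 * (ι j + 1ℚ)) * v n j
  t-formula n j = begin
    s * (v n j - v n (suc j))      ≡⟨ solve 3 (λ s a b → s :* (a :- b) := s :* a :- s :* b) refl s (v n j) (v n (suc j)) ⟩
    s * v n j - s * v n (suc j)    ≡⟨ cong (λ x → s * v n j - x) (v-suc n j) ⟩
    s * v n j - (ι n - ι j) * v n j
      ≡⟨ solve 3 (λ n j a → (n :+ j :+ ♯ 2) :* a :- (n :- j) :* a := 2 · (j :+ ♯ 1) :* a) refl (ι n) (ι j) (v n j) ⟩
    (ι 2 * (ι j + 1ℚ)) * v n j ∎
    where
    open ≡-Reasoning
    s = ι n + ι j + ι 2

  0≤t : ∀ n j → 0ℚ ≤ t n j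
  0≤t n j = 0≤-cancelˡ (ι n + ι j + ι 2) (0<n+j+2 n j) (subst (0ℚ ≤_) (sym (t-formula n j))
    (0≤-* (0≤-* (0≤ι 2) (0≤-+ (0≤ι j) 0≤1)) (0≤v n j)))

  v≤1 : ∀ n j → v n j ≤ 1ℚ
  v≤1 n zero    = ℚ.≤-refl
  v≤1 n (suc j) = ℚ.≤-trans (≤-add (solve 2 (λ a b → b :+ (a :- b) := a) refl (v n j) (v n (suc j))) (0≤t n j)) (v≤1 n j)

  -- In the factorial form of `v` this is a comparison of a few factorials. For `v` as defined it is
  -- an induction on j, with `v-suc` applied once at n and once at n+1.
  v-shift : ∀ n j → (ι n + ι 1) * (ι n + ι 2) * v n j ≡ (ι n + ι 1 - ι j) * (ι n + ι 2 + ι j) * v (suc n) j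
  v-shift n zero    = solve 1 (λ n → (n :+ ♯ 1) :* (n :+ ♯ 2) :* ♯ 1 := (n :+ ♯ 1 :- ♯ 0) :* (n :+ ♯ 2 :+ ♯ 0) :* ♯ 1) refl (ι n)
  v-shift n (suc j) = *-cancelˡ-≡ (ι n + ι j + ι 2) (0<n+j+2 n j) (begin
    (n' + j' + ι 2) * ((n' + ι 1) * (n' + ι 2) * v n (suc j))
      ≡⟨ solve 3 (λ n j v → (n :+ j :+ ♯ 2) :* ((n :+ ♯ 1) :* (n :+ ♯ 2) :* v) := (n :+ ♯ 1) :* (n :+ ♯ 2) :* ((n :+ j :+ ♯ 2) :* v)) refl n' j' (v n (suc j)) ⟩
    (n' + ι 1) * (n' + ι 2) * ((n' + j' + ι 2) * v n (suc j))
      ≡⟨ cong ((n' + ι 1) * (n' + ι 2) *_) (v-suc n j) ⟩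
    (n' + ι 1) * (n' + ι 2) * ((n' - j') * v n j)
      ≡⟨ solve 3 (λ n j v → (n :+ ♯ 1) :* (n :+ ♯ 2) :* ((n :- j) :* v) := (n :- j) :* ((n :+ ♯ 1) :* (n :+ ♯ 2) :* v)) refl n' j' (v n j) ⟩
    (n' - j') * ((n' + ι 1) * (n' + ι 2) * v n j)
      ≡⟨ cong ((n' - j') *_) (v-shift n j) ⟩
    (n' - j') * ((n' + ι 1 - j') * (n' + ι 2 + j') * v (suc n) j)
      ≡⟨ solve 3 (λ n j v → (n :- j) :* ((n :+ ♯ 1 :- j) :* (n :+ ♯ 2 :+ j) :* v) := (n :- j) :* (n :+ j :+ ♯ 2) :* ((n :+ ♯ 1 :- j) :* v)) refl n' j' (v (suc n) j) ⟩
    (n' - j') * (n' + j' + ι 2) * ((n' + ι 1 - j') * v (suc n) j)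
      ≡⟨ cong (λ m → (n' - j') * (n' + j' + ι 2) * ((m - j') * v (suc n) j)) (ι-suc n) ⟨
    (n' - j') * (n' + j' + ι 2) * ((ι (suc n) - j') * v (suc n) j)
      ≡⟨ cong ((n' - j') * (n' + j' + ι 2) *_) (v-suc (suc n) j) ⟨
    (n' - j') * (n' + j' + ι 2) * ((ι (suc n) + j' + ι 2) * v (suc n) (suc j))
      ≡⟨ cong (λ m → (n' - j') * (n' + j' + ι 2) * ((m + j' + ι 2) * v (suc n) (suc j))) (ι-suc n) ⟩
    (n' - j') * (n' + j' + ι 2) * ((n' + ι 1 + j' + ι 2) * v (suc n) (suc j))
      ≡⟨ solve 3 (λ n j v → (n :- j) :* (n :+ j :+ ♯ 2) :* ((n :+ ♯ 1 :+ j :+ ♯ 2) :* v)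
           := (n :+ j :+ ♯ 2) :* ((n :+ ♯ 1 :- (j :+ ♯ 1)) :* (n :+ ♯ 2 :+ (j :+ ♯ 1)) :* v)) refl n' j' (v (suc n) (suc j)) ⟩
    (n' + j' + ι 2) * ((n' + ι 1 - (j' + ι 1)) * (n' + ι 2 + (j' + ι 1)) * v (suc n) (suc j))
      ≡⟨ cong (λ m → (n' + j' + ι 2) * ((n' + ι 1 - m) * (n' + ι 2 + m) * v (suc n) (suc j))) (ι-suc j) ⟨
    (n' + j' + ι 2) * ((n' + ι 1 - ι (suc j)) * (n' + ι 2 + ι (suc j)) * v (suc n) (suc j)) ∎)
    where
    open ≡-Reasoning
    n' = ι n
    j' = ι j

  odd*1/odd : ∀ j → (ι 2 * ι j + 1ℚ) * 1/odd j ≡ 1ℚ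
  odd*1/odd j = trans (cong (_* 1/odd j) (sym (trans (ι-suc (2 ℕ.* j)) (cong (_+ 1ℚ) (ι-* 2 j))))) (ι*1/ (2 ℕ.* j))

  -- Leibniz's series with convergence factors that tend to 1 for fixed j as n grows. In contrast to
  -- the partial sums of the series itself, the sums `W n` have a closed form, given by `bW`.
  W-term : ℕ → ℕ → ℚ
  W-term n j = sign j * 1/odd j * v n j

  W : ℕ → ℚ
  W n = ∑ (suc n) (W-term n)

  -- By `v-suc`, m times each summand is an increment of the right-hand side. From J = m+1 on, that
  -- side vanishes together with v; dividing by m then takes m > 0, whence `suc m` in the next
  -- lemma.
  alternating-odd-sum : ∀ m J → ι m * ∑ J (λ j → sign j * ((ι 2 * ι j + 1ℚ) * v m j))
                              ≡ - (sign J * (ι J * (ι m + ι 1 + ι J) * v m J))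
  alternating-odd-sum m zero    = solve 1 (λ m → m :* ♯ 0 := :- (♯ 1 :* (♯ 0 :* (m :+ ♯ 1 :+ ♯ 0) :* ♯ 1))) refl (ι m)
  alternating-odd-sum m (suc J) = begin
    m' * (Σ + s * ((ι 2 * J' + 1ℚ) * v m J))
      ≡⟨ solve 5 (λ m Σ s J v → m :* (Σ :+ s :* ((2 · J :+ ♯ 1) :* v)) := m :* Σ :+ m :* (s :* ((2 · J :+ ♯ 1) :* v))) refl m' Σ s J' (v m J) ⟩
    m' * Σ + m' * (s * ((ι 2 * J' + 1ℚ) * v m J))
      ≡⟨ cong (_+ m' * (s * ((ι 2 * J' + 1ℚ) * v m J))) (alternating-odd-sum m J) ⟩
    - (s * (J' * (m' + ι 1 + J') * v m J)) + m' * (s * ((ι 2 * J' + 1ℚ) * v m J))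
      ≡⟨ solve 4 (λ m s J v → :- (s :* (J :* (m :+ ♯ 1 :+ J) :* v)) :+ m :* (s :* ((2 · J :+ ♯ 1) :* v)) := s :* ((J :+ ♯ 1) :* ((m :- J) :* v))) refl m' s J' (v m J) ⟩
    s * ((J' + ι 1) * ((m' - J') * v m J))
      ≡⟨ cong (λ x → s * ((J' + ι 1) * x)) (v-suc m J) ⟨
    s * ((J' + ι 1) * ((m' + J' + ι 2) * v m (suc J)))
      ≡⟨ solve 4 (λ m s J v → s :* ((J :+ ♯ 1) :* ((m :+ J :+ ♯ 2) :* v)) := :- (:- ♯ 1 :* s :* ((J :+ ♯ 1) :* (m :+ ♯ 1 :+ (J :+ ♯ 1)) :* v))) refl m' s J' (v m (suc J)) ⟩
    - (- 1ℚ * s * ((J' + ι 1) * (m' + ι 1 + (J' + ι 1)) * v m (suc J)))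
      ≡⟨ cong (λ x → - (- 1ℚ * s * (x * (m' + ι 1 + x) * v m (suc J)))) (ι-suc J) ⟨
    - (- 1ℚ * s * (ι (suc J) * (m' + ι 1 + ι (suc J)) * v m (suc J))) ∎
    where
    open ≡-Reasoning
    m' = ι m
    J' = ι J
    s  = sign J
    Σ  = ∑ J (λ j → sign j * ((ι 2 * ι j + 1ℚ) * v m j))

  alternating-odd-sum-0 : ∀ m → ∑ (suc (suc m)) (λ j → sign j * ((ι 2 * ι j + 1ℚ) * v (suc m) j)) ≡ 0ℚ
  alternating-odd-sum-0 m = *-cancelˡ-≡ (ι (suc m)) (0<ι m) (begin
    ι (suc m) * ∑ (suc (suc m)) _    ≡⟨ alternating-odd-sum (suc m) (suc (suc m)) ⟩
    - (s * (p * v (suc m) (suc (suc m))))  ≡⟨ cong (λ x → - (s * (p * x))) (v-end (suc m)) ⟩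
    - (s * (p * 0ℚ))                 ≡⟨ solve 3 (λ s p m → :- (s :* (p :* ♯ 0)) := m :* ♯ 0) refl s p (ι (suc m)) ⟩
    ι (suc m) * 0ℚ                   ∎)
    where
    open ≡-Reasoning
    s = sign (suc (suc m))
    p = ι (suc (suc m)) * (ι (suc m) + ι 1 + ι (suc (suc m)))

  -- Rests on (2n+3)² - (2j+1)² = 4(n+1-j)(n+2+j) and `v-shift`. In the last term one factor of
  -- (2j+1)² has cancelled the reciprocal of 2j+1, which is why that term can be summed.
  W-term-shift : ∀ n j → (ι 2 * ι n + ι 3) * (ι 2 * ι n + ι 3) * W-term (suc n) j
    ≡ ι 4 * ((ι n + ι 1) * (ι n + ι 2)) * W-term n j + sign j * ((ι 2 * ι j + 1ℚ) * v (suc n) j)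
  W-term-shift n j = sym (begin
    ι 4 * ((n' + ι 1) * (n' + ι 2)) * (s * o * v n j) + s * ((ι 2 * j' + 1ℚ) * v' )
      ≡⟨ solve 6 (λ n j s o v v' → 4 · ((n :+ ♯ 1) :* (n :+ ♯ 2)) :* (s :* o :* v) :+ s :* ((2 · j :+ ♯ 1) :* v')
           := 4 · (s :* o :* ((n :+ ♯ 1) :* (n :+ ♯ 2) :* v)) :+ s :* (♯ 1 :* ((2 · j :+ ♯ 1) :* v'))) refl n' j' s o (v n j) v' ⟩
    ι 4 * (s * o * ((n' + ι 1) * (n' + ι 2) * v n j)) + s * (1ℚ * ((ι 2 * j' + 1ℚ) * v'))
      ≡⟨ cong₂ (λ x y → ι 4 * (s * o * x) + s * (y * ((ι 2 * j' + 1ℚ) * v'))) (v-shift n j) (sym (odd*1/odd j)) ⟩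
    ι 4 * (s * o * ((n' + ι 1 - j') * (n' + ι 2 + j') * v')) + s * ((ι 2 * j' + 1ℚ) * o * ((ι 2 * j' + 1ℚ) * v'))
      ≡⟨ solve 5 (λ n j s o v' → 4 · (s :* o :* ((n :+ ♯ 1 :- j) :* (n :+ ♯ 2 :+ j) :* v')) :+ s :* ((2 · j :+ ♯ 1) :* o :* ((2 · j :+ ♯ 1) :* v'))
           := (2 · n :+ ♯ 3) :* (2 · n :+ ♯ 3) :* (s :* o :* v')) refl n' j' s o v' ⟩
    (ι 2 * n' + ι 3) * (ι 2 * n' + ι 3) * (s * o * v') ∎)
    where
    open ≡-Reasoning
    n' = ι n
    j' = ι j
    s = sign j
    o = 1/odd j
    v' = v (suc n) j

  W-suc : ∀ n → (ι 2 * ι n + ι 3) * (ι 2 * ι n + ι 3) * W (suc n) ≡ ι 4 * ((ι n + ι 1) * (ι n + ι 2)) * W n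
  W-suc n = begin
    p * W (suc n)                                         ≡⟨ ∑-* (suc (suc n)) p ⟨
    ∑ (suc (suc n)) (λ j → p * W-term (suc n) j)          ≡⟨ ∑-cong (suc (suc n)) (W-term-shift n) ⟩
    ∑ (suc (suc n)) (λ j → q * W-term n j + sign j * ((ι 2 * ι j + 1ℚ) * v (suc n) j))
                                                          ≡⟨ ∑-+ (suc (suc n)) ⟩
    ∑ (suc (suc n)) (λ j → q * W-term n j) + ∑ (suc (suc n)) (λ j → sign j * ((ι 2 * ι j + 1ℚ) * v (suc n) j))
                                                          ≡⟨ cong₂ _+_ (∑-* (suc (suc n)) q) (alternating-odd-sum-0 n) ⟩
    -- The range has one term more than `W n`, and v n (n+1) = 0 there.
    q * (W n + sign (suc n) * 1/odd (suc n) * v n (suc n)) + 0ℚ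
                                                          ≡⟨ cong (λ x → q * (W n + sign (suc n) * 1/odd (suc n) * x) + 0ℚ) (v-end n) ⟩
    q * (W n + sign (suc n) * 1/odd (suc n) * 0ℚ) + 0ℚ    ≡⟨ solve 3 (λ q w s → q :* (w :+ s :* ♯ 0) :+ ♯ 0 := q :* w) refl q (W n) (sign (suc n) * 1/odd (suc n)) ⟩
    q * W n                                               ∎
    where
    open ≡-Reasoning
    p = (ι 2 * ι n + ι 3) * (ι 2 * ι n + ι 3)
    q = ι 4 * ((ι n + ι 1) * (ι n + ι 2))

  -- The square of (2n choose n)/4ⁿ.
  b : ℕ → ℚ
  b = ₂F₁-coeff ½ ½

  b-suc : ∀ n → ι 4 * ((ι n + 1ℚ) * (ι n + 1ℚ)) * b (suc n) ≡ (ι 2 * ι n + 1ℚ) * (ι 2 * ι n + 1ℚ) * b n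
  b-suc n = begin
    ι 4 * ((ι n + 1ℚ) * (ι n + 1ℚ)) * b (suc n)   ≡⟨ cong (λ x → ι 4 * (x * x) * b (suc n)) (ι-suc n) ⟨
    ι 4 * (s * s) * b (suc n)    ≡⟨ ℚ.*-assoc (ι 4) (s * s) (b (suc n)) ⟩
    ι 4 * (s * s * b (suc n))    ≡⟨ cong (ι 4 *_) (₂F₁-coeff-suc ½ ½ n) ⟩
    ι 4 * ((½ + ι n) * (½ + ι n) * b n)
      ≡⟨ QS.solve 2 (λ n a → QS.con (ι 4) QS.:* ((QS.con ½ QS.:+ n) QS.:* (QS.con ½ QS.:+ n) QS.:* a)
           QS.:= (QS.con (ι 2) QS.:* n QS.:+ QS.con 1ℚ) QS.:* (QS.con (ι 2) QS.:* n QS.:+ QS.con 1ℚ) QS.:* a) refl (ι n) (b n) ⟩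
    (ι 2 * ι n + 1ℚ) * (ι 2 * ι n + 1ℚ) * b n ∎
    where
    open ≡-Reasoning
    s = ι (suc n)

  0<4[n+1]² : ∀ n → 0ℚ < ι 4 * ((ι n + 1ℚ) * (ι n + 1ℚ))
  0<4[n+1]² n = 0<-* (0<ι 3) (0<-* 0<n+1 0<n+1)
    where
    0<n+1 : 0ℚ < ι n + 1ℚ
    0<n+1 = subst (0ℚ <_) (ι-suc n) (0<ι n)

  0≤2n+1 : ∀ n → 0ℚ ≤ ι 2 * ι n + 1ℚ
  0≤2n+1 n = 0≤-+ (0≤-* (0≤ι 2) (0≤ι n)) 0≤1

  0≤b : ∀ n → 0ℚ ≤ b n
  0≤b zero    = 0≤1
  0≤b (suc n) = 0≤-cancelˡ _ (0<4[n+1]² n) (subst (0ℚ ≤_) (sym (b-suc n)) (0≤-* (0≤-* (0≤2n+1 n) (0≤2n+1 n)) (0≤b n)))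

  [2n+1]b≤1 : ∀ n → (ι 2 * ι n + 1ℚ) * b n ≤ 1ℚ
  [2n+1]b≤1 zero    = ℚ.≤-refl
  [2n+1]b≤1 (suc n) = ℚ.≤-trans (*-cancelˡ-≤ _ (0<4[n+1]² n) (≤-add {r = (ι 2 * ι n + 1ℚ) * b n}
    (begin
      q * ((ι 2 * ι (suc n) + 1ℚ) * b (suc n)) + p * b n
        ≡⟨ cong (λ x → q * ((ι 2 * x + 1ℚ) * b (suc n)) + p * b n) (ι-suc n) ⟩
      q * ((ι 2 * (ι n + 1ℚ) + 1ℚ) * b (suc n)) + p * b n
        ≡⟨ solve 4 (λ q n b' r → q :* ((2 · (n :+ ♯ 1) :+ ♯ 1) :* b') :+ r := (2 · n :+ ♯ 3) :* (q :* b') :+ r) refl q (ι n) (b (suc n)) (p * b n) ⟩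
      (ι 2 * ι n + ι 3) * (q * b (suc n)) + p * b n
        ≡⟨ cong (λ x → (ι 2 * ι n + ι 3) * x + p * b n) (b-suc n) ⟩
      (ι 2 * ι n + ι 3) * (p * p * b n) + p * b n
        ≡⟨ solve 2 (λ n b → (2 · n :+ ♯ 3) :* ((2 · n :+ ♯ 1) :* (2 · n :+ ♯ 1) :* b) :+ (2 · n :+ ♯ 1) :* b
             := 4 · ((n :+ ♯ 1) :* (n :+ ♯ 1)) :* ((2 · n :+ ♯ 1) :* b)) refl (ι n) (b n) ⟩
      q * (p * b n) ∎)
    (0≤-* (0≤2n+1 n) (0≤b n)))) ([2n+1]b≤1 n)
    where
    open ≡-Reasoning
    q = ι 4 * ((ι n + 1ℚ) * (ι n + 1ℚ))
    p = ι 2 * ι n + 1ℚ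

  bW : ∀ n → (ι 2 * ι n + 1ℚ) * (ι 2 * ι n + 1ℚ) * (b n * W n) ≡ ι n + 1ℚ
  bW zero    = refl
  bW (suc n) = *-cancelˡ-≡ q (0<4[n+1]² n) (begin
    q * ((ι 2 * ι (suc n) + 1ℚ) * (ι 2 * ι (suc n) + 1ℚ) * (b (suc n) * W (suc n)))
      ≡⟨ cong (λ x → q * ((ι 2 * x + 1ℚ) * (ι 2 * x + 1ℚ) * (b (suc n) * W (suc n)))) (ι-suc n) ⟩
    q * ((ι 2 * (ι n + 1ℚ) + 1ℚ) * (ι 2 * (ι n + 1ℚ) + 1ℚ) * (b (suc n) * W (suc n)))
      ≡⟨ solve 4 (λ q n b w → q :* ((2 · (n :+ ♯ 1) :+ ♯ 1) :* (2 · (n :+ ♯ 1) :+ ♯ 1) :* (b :* w))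
           := (q :* b) :* ((2 · n :+ ♯ 3) :* (2 · n :+ ♯ 3) :* w)) refl q (ι n) (b (suc n)) (W (suc n)) ⟩
    (q * b (suc n)) * ((ι 2 * ι n + ι 3) * (ι 2 * ι n + ι 3) * W (suc n))
      ≡⟨ cong₂ _*_ (b-suc n) (W-suc n) ⟩
    (p * p * b n) * (ι 4 * ((ι n + ι 1) * (ι n + ι 2)) * W n)
      ≡⟨ solve 4 (λ p b n w → (p :* p :* b) :* (4 · ((n :+ ♯ 1) :* (n :+ ♯ 2)) :* w) := 4 · ((n :+ ♯ 1) :* (n :+ ♯ 2)) :* (p :* p :* (b :* w))) refl p (b n) (ι n) (W n) ⟩
    ι 4 * ((ι n + ι 1) * (ι n + ι 2)) * (p * p * (b n * W n))
      ≡⟨ cong (ι 4 * ((ι n + ι 1) * (ι n + ι 2)) *_) (bW n) ⟩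
    ι 4 * ((ι n + ι 1) * (ι n + ι 2)) * (ι n + 1ℚ)
      ≡⟨ solve 1 (λ n → 4 · ((n :+ ♯ 1) :* (n :+ ♯ 2)) :* (n :+ ♯ 1) := 4 · ((n :+ ♯ 1) :* (n :+ ♯ 1)) :* (n :+ ♯ 1 :+ ♯ 1)) refl (ι n) ⟩
    q * (ι n + 1ℚ + 1ℚ)
      ≡⟨ cong (λ x → q * (x + 1ℚ)) (ι-suc n) ⟨
    q * (ι (suc n) + 1ℚ) ∎)
    where
    open ≡-Reasoning
    q = ι 4 * ((ι n + 1ℚ) * (ι n + 1ℚ))
    p = ι 2 * ι n + 1ℚ

  -- Summation by parts makes W n an average of the partial sums S (j+1) with weights t n j.
  W-average : ∀ n m → ∑ m (W-term n) ≡ S m * v n m + ∑ m (λ j → t n j * S (suc j))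
  W-average n zero    = refl
  W-average n (suc m) = begin
    ∑ m (W-term n) + x * v n m
      ≡⟨ cong (_+ x * v n m) (W-average n m) ⟩
    S m * v n m + T + x * v n m
      ≡⟨ solve 5 (λ s x v v' T → s :* v :+ T :+ x :* v := (s :+ x) :* v' :+ (T :+ (v :- v') :* (s :+ x))) refl (S m) x (v n m) (v n (suc m)) T ⟩
    S (suc m) * v n (suc m) + (T + t n m * S (suc m)) ∎
    where
    open ≡-Reasoning
    x = sign m * 1/odd m
    T = ∑ m (λ j → t n j * S (suc j))

  ∑t : ∀ n m → ∑ m (t n) ≡ 1ℚ - v n m
  ∑t n zero    = refl
  ∑t n (suc m) = trans (cong (_+ t n m) (∑t n m))
    (solve 2 (λ v v' → (♯ 1 :- v) :+ (v :- v') := ♯ 1 :- v') refl (v n m) (v n (suc m)))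

  ∑t≤1 : ∀ n m → ∑ m (t n) ≤ 1ℚ
  ∑t≤1 n m = ≤-add {r = v n m} (trans (cong (_+ v n m) (∑t n m)) (solve 1 (λ v → (♯ 1 :- v) :+ v := ♯ 1) refl (v n m))) (0≤v n m)

  ∑-split : ∀ m r f → ∑ (m ℕ.+ r) f ≡ ∑ m f + ∑ r (λ i → f (m ℕ.+ i))
  ∑-split m zero    f = trans (cong (λ k → ∑ k f) (ℕ.+-identityʳ m)) (sym (ℚ.+-identityʳ (∑ m f)))
  ∑-split m (suc r) f = trans (cong (λ k → ∑ k f) (ℕ.+-suc m r))
    (trans (cong (_+ f (m ℕ.+ r)) (∑-split m r f)) (ℚ.+-assoc (∑ m f) _ (f (m ℕ.+ r))))

  ∑-const : ∀ n c → ∑ n (λ _ → c) ≡ ι n * c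
  ∑-const zero    c = sym (ℚ.*-zeroˡ c)
  ∑-const (suc n) c = trans (cong (_+ c) (∑-const n c))
    (trans (solve 2 (λ n c → n :* c :+ c := (n :+ ♯ 1) :* c) refl (ι n) c) (cong (_* c) (sym (ι-suc n))))

  -- A weighted average of the S (j+1) is compared with S (n+1) in two pieces. For j < J a weight is
  -- at most 2(j+2)/(n+j+2), and j+2 cancels against the distance 1/(j+2); for j ≥ J the distance is
  -- at most 1/(J+1) and the weights sum to at most 1.
  W-close : ∀ J n → J ℕ.≤ n → ∣ W n - S (suc n) ∣ ≤ ι J * (ι 2 * (+ 1 / suc n)) + (+ 1 / suc J)
  W-close J n J≤n = begin
    ∣ W n - S (suc n) ∣                               ≡⟨ cong ∣_∣ expand ⟩
    ∣ ∑ (suc n) d ∣                                   ≡⟨ cong (λ m → ∣ ∑ m d ∣) (ℕ.m+[n∸m]≡n (ℕ.m≤n⇒m≤1+n J≤n)) ⟨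
    ∣ ∑ (J ℕ.+ r) d ∣                                 ≡⟨ cong ∣_∣ (∑-split J r d) ⟩
    ∣ ∑ J d + ∑ r (λ i → d (J ℕ.+ i)) ∣               ≤⟨ ∣∣-+-≤ {∑ J d} head-≤ tail-≤ ⟩
    ι J * (ι 2 * (+ 1 / suc n)) + (+ 1 / suc J)       ∎
    where
    open ℚ.≤-Reasoning
    r = suc n ℕ.∸ J
    d : ℕ → ℚ
    d j = t n j * (S (suc j) - S (suc n))
    expand : W n - S (suc n) ≡ ∑ (suc n) d
    expand = begin-equality
      W n - s                                ≡⟨ cong (_- s) (W-average n (suc n)) ⟩
      s * v n (suc n) + T - s                ≡⟨ solve 3 (λ s v T → s :* v :+ T :- s := T :+ :- (s :* (♯ 1 :- v))) refl s (v n (suc n)) T ⟩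
      T + - (s * (1ℚ - v n (suc n)))         ≡⟨ cong (λ x → T + - (s * x)) (∑t n (suc n)) ⟨
      T + - (s * ∑ (suc n) (t n))            ≡⟨ cong (λ x → T + - x) (∑-* (suc n) s {t n}) ⟨
      T + - ∑ (suc n) (λ j → s * t n j)      ≡⟨ cong (λ x → T + x) (∑-neg (suc n) {λ j → s * t n j}) ⟨
      T + ∑ (suc n) (λ j → - (s * t n j))    ≡⟨ ∑-+ (suc n) ⟨
      ∑ (suc n) (λ j → t n j * S (suc j) + - (s * t n j))
                                             ≡⟨ ∑-cong (suc n) (λ j → solve 3 (λ t s s' → t :* s :+ :- (s' :* t) := t :* (s :- s')) refl (t n j) (S (suc j)) s) ⟩
      ∑ (suc n) d                            ∎
      where
      s = S (suc n)
      T = ∑ (suc n) (λ j → t n j * S (suc j))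
    close : ∀ j → j ℕ.≤ n → ∣ S (suc j) - S (suc n) ∣ ≤ + 1 / suc (suc j)
    close j j≤n = Leibniz.close (suc j) (suc n) (ℕ.s≤s j≤n)
    head-≤ : ∣ ∑ J d ∣ ≤ ι J * (ι 2 * (+ 1 / suc n))
    head-≤ = subst (∣ ∑ J d ∣ ≤_) (∑-const J (ι 2 * (+ 1 / suc n))) (∑-∣∣ J λ j j<J →
      let j≤n = ℕ.≤-trans (ℕ.<⇒≤ j<J) J≤n in begin
      ∣ d j ∣
        ≤⟨ ∣∣-*-≤ {t n j} (ℚ.≤-reflexive (∣∣-nonNeg (0≤t n j))) (close j j≤n) ⟩
      t n j * (+ 1 / suc (suc j))
        ≤⟨ *-cancelˡ-≤ (ι n + ι j + ι 2) (0<n+j+2 n j) (begin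
          (ι n + ι j + ι 2) * (t n j * (+ 1 / suc (suc j)))
            ≡⟨ ℚ.*-assoc (ι n + ι j + ι 2) (t n j) (+ 1 / suc (suc j)) ⟨
          (ι n + ι j + ι 2) * t n j * (+ 1 / suc (suc j))
            ≡⟨ cong (_* (+ 1 / suc (suc j))) (t-formula n j) ⟩
          ι 2 * (ι j + 1ℚ) * v n j * (+ 1 / suc (suc j))
            ≤⟨ *-monoʳ (1/≥0 (suc j)) (*-mono (0≤-* (0≤ι 2) (0≤-+ (0≤ι j) 0≤1)) (0≤v n j)
                 (*-monoˡ (0≤ι 2) (≤-add {ι j + 1ℚ} {r = 1ℚ} refl 0≤1)) (v≤1 n j)) ⟩
          ι 2 * (ι j + 1ℚ + 1ℚ) * 1ℚ * (+ 1 / suc (suc j))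
            ≡⟨ cong (λ x → ι 2 * x * 1ℚ * (+ 1 / suc (suc j))) (trans (cong (_+ 1ℚ) (sym (ι-suc j))) (sym (ι-suc (suc j)))) ⟩
          ι 2 * ι (suc (suc j)) * 1ℚ * (+ 1 / suc (suc j))
            ≡⟨ solve 2 (λ s r → 2 · s :* ♯ 1 :* r := 2 · (s :* r)) refl (ι (suc (suc j))) (+ 1 / suc (suc j)) ⟩
          ι 2 * (ι (suc (suc j)) * (+ 1 / suc (suc j)))
            ≡⟨ cong (ι 2 *_) (trans (ι*1/ (suc j)) (sym (ι*1/ n))) ⟩
          ι 2 * (ι (suc n) * (+ 1 / suc n))
            ≡⟨ cong (λ x → ι 2 * (x * (+ 1 / suc n))) (ι-suc n) ⟩
          ι 2 * ((ι n + 1ℚ) * (+ 1 / suc n))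
            ≤⟨ *-monoˡ (0≤ι 2) (*-monoʳ (1/≥0 n) (≤-add {ι n + 1ℚ} {r = ι j + 1ℚ} (solve 2 (λ n j → (n :+ ♯ 1) :+ (j :+ ♯ 1) := n :+ j :+ ♯ 2) refl (ι n) (ι j)) (0≤-+ (0≤ι j) 0≤1))) ⟩
          ι 2 * ((ι n + ι j + ι 2) * (+ 1 / suc n))
            ≡⟨ solve 2 (λ s r → 2 · (s :* r) := s :* (2 · r)) refl (ι n + ι j + ι 2) (+ 1 / suc n) ⟩
          (ι n + ι j + ι 2) * (ι 2 * (+ 1 / suc n)) ∎) ⟩
      ι 2 * (+ 1 / suc n) ∎)
    tail-≤ : ∣ ∑ r (λ i → d (J ℕ.+ i)) ∣ ≤ + 1 / suc J
    tail-≤ = begin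
      ∣ ∑ r (λ i → d (J ℕ.+ i)) ∣
        ≤⟨ ∑-∣∣ r {g = λ i → (+ 1 / suc J) * t n (J ℕ.+ i)} (λ i i<r → ℚ.≤-trans
             (∣∣-*-≤ {t n (J ℕ.+ i)} (ℚ.≤-reflexive (∣∣-nonNeg (0≤t n (J ℕ.+ i))))
               (ℚ.≤-trans (close (J ℕ.+ i) (ℕ.s≤s⁻¹ (subst (J ℕ.+ i ℕ.<_) (ℕ.m+[n∸m]≡n (ℕ.m≤n⇒m≤1+n J≤n)) (ℕ.+-monoʳ-< J i<r))))
                 (Rational.1/-antitone (ℕ.≤-trans (ℕ.m≤m+n J i) (ℕ.n≤1+n _)))))
             (ℚ.≤-reflexive (ℚ.*-comm (t n (J ℕ.+ i)) (+ 1 / suc J)))) ⟩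
      ∑ r (λ i → (+ 1 / suc J) * t n (J ℕ.+ i))
        ≡⟨ ∑-* r (+ 1 / suc J) ⟩
      (+ 1 / suc J) * ∑ r (λ i → t n (J ℕ.+ i))
        ≤⟨ *-monoˡ (1/≥0 J) (ℚ.≤-trans (≤-add {r = ∑ J (t n)} (trans (ℚ.+-comm _ (∑ J (t n))) (sym (∑-split J r (t n)))) (∑-0≤ J (0≤t n))) (∑t≤1 n (J ℕ.+ r))) ⟩
      (+ 1 / suc J) * 1ℚ
        ≡⟨ ℚ.*-identityʳ (+ 1 / suc J) ⟩
      + 1 / suc J ∎

  W-S-null : Null (λ n → W n - S (suc n))
  W-S-null ε 0<ε =
    let 0<½ε   = 0<-* Rational.0<½ 0<ε
        J , hJ = archimedean 0<½ε
        N , hN = null-scale {λ n → + 1 / suc n} (ι J * ι 2) null-1/ (½ * ε) 0<½ε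
    in J ℕ.⊔ N , λ n N≤n → begin
      ∣ W n - S (suc n) ∣
        ≤⟨ W-close J n (ℕ.m⊔n≤o⇒m≤o J N N≤n) ⟩
      ι J * (ι 2 * (+ 1 / suc n)) + (+ 1 / suc J)
        ≡⟨ cong (_+ (+ 1 / suc J)) (ℚ.*-assoc (ι J) (ι 2) (+ 1 / suc n)) ⟨
      ι J * ι 2 * (+ 1 / suc n) + (+ 1 / suc J)
        ≤⟨ ℚ.+-mono-≤ (ℚ.≤-trans (Rational.p≤∣p∣ _) (hN n (ℕ.m⊔n≤o⇒n≤o J N N≤n))) (ℚ.<⇒≤ (hJ J ℕ.≤-refl)) ⟩
      ½ * ε + ½ * ε
        ≡⟨ Rational.half+half ε ⟩
      ε ∎
    where open ℚ.≤-Reasoning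

  -- Defined by recursion so that `triple (suc n)` unfolds to three successors and the ratio
  -- recurrences apply one after another.
  double triple : ℕ → ℕ
  double zero    = 0
  double (suc n) = suc (suc (double n))
  triple zero    = 0
  triple (suc n) = suc (suc (suc (triple n)))

  ι-double : ∀ n → ι (double n) ≡ ι 2 * ι n
  ι-double zero    = refl
  ι-double (suc n) = trans (trans (ι-suc (suc (double n))) (cong (_+ 1ℚ) (trans (ι-suc (double n)) (cong (_+ 1ℚ) (ι-double n)))))
    (trans (solve 1 (λ n → 2 · n :+ ♯ 1 :+ ♯ 1 := 2 · (n :+ ♯ 1)) refl (ι n)) (cong (ι 2 *_) (sym (ι-suc n))))

  ι-triple : ∀ n → ι (triple n) ≡ ι 3 * ι n
  ι-triple zero    = refl
  ι-triple (suc n) = trans (trans (ι-suc (suc (suc (triple n)))) (cong (_+ 1ℚ) (trans (ι-suc (suc (triple n))) (cong (_+ 1ℚ) (trans (ι-suc (triple n)) (cong (_+ 1ℚ) (ι-triple n)))))))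
    (trans (solve 1 (λ n → 3 · n :+ ♯ 1 :+ ♯ 1 :+ ♯ 1 := 3 · (n :+ ♯ 1)) refl (ι n)) (cong (ι 3 *_) (sym (ι-suc n))))

  n≤double : ∀ n → n ℕ.≤ double n
  n≤double zero    = ℕ.z≤n
  n≤double (suc n) = ℕ.s≤s (ℕ.m≤n⇒m≤1+n (n≤double n))

  n≤triple : ∀ n → n ℕ.≤ triple n
  n≤triple zero    = ℕ.z≤n
  n≤triple (suc n) = ℕ.s≤s (ℕ.m≤n⇒m≤1+n (ℕ.m≤n⇒m≤1+n (n≤triple n)))

  -- Denominators and numerators of the ratios α (n+1)/α n and b (n+1)/b n as functions of a
  -- rational, since they are also evaluated around 2n and 3n.
  αd αn bd bn : ℚ → ℚ
  αd x = ι 9 * ((x + 1ℚ) * (x + 1ℚ))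
  αn x = ι 9 * (x * x) + ι 9 * x + ι 2
  bd x = ι 4 * ((x + 1ℚ) * (x + 1ℚ))
  bn x = (ι 2 * x + 1ℚ) * (ι 2 * x + 1ℚ)

  α-step : ∀ n x → ι n ≡ x → αd x * α (suc n) ≡ αn x * α n
  α-step n _ refl = trans (cong (λ x → ι 9 * (x * x) * α (suc n)) (sym (ι-suc n))) (α-suc n)

  b-step : ∀ n x → ι n ≡ x → bd x * b (suc n) ≡ bn x * b n
  b-step n _ refl = b-suc n

  -- Both sides are (6n)!² / (n!¹² 27⁴ⁿ 16³ⁿ); it is the triplication formula for Γ
  -- combined with its duplication formula.
  α⁴b≡α²b³ : ∀ n → α n ^ 4 * b (triple n) ≡ α (double n) ^ 2 * b n ^ 3
  α⁴b≡α²b³ zero    = refl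
  α⁴b≡α²b³ (suc n) = *-cancelˡ-≡ (D₁ * D₂) (0<-* 0<D₁ 0<D₂) (begin
    D₁ * D₂ * (α (suc n) ^ 4 * b (suc (suc (suc m₃))))
      ≡⟨ solve 7 (λ p s₁ s₂ s₃ d a b → (p :^ 4 :* (s₁ :* s₂ :* s₃)) :* d :* (a :^ 4 :* b) := d :* ((p :* a) :^ 4 :* (s₁ :* (s₂ :* (s₃ :* b))))) refl
           (αd x) (bd y) (bd (y + 1ℚ)) (bd (y + 1ℚ + 1ℚ)) D₂ (α (suc n)) (b (suc (suc (suc m₃)))) ⟩
    D₂ * ((αd x * α (suc n)) ^ 4 * (bd y * (bd (y + 1ℚ) * (bd (y + 1ℚ + 1ℚ) * b (suc (suc (suc m₃)))))))
      ≡⟨ cong₂ (λ u w → D₂ * (u ^ 4 * w)) (α-step n x refl) b-chain ⟩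
    D₂ * ((αn x * α n) ^ 4 * (bn y * bn (y + 1ℚ) * bn (y + 1ℚ + 1ℚ) * b m₃))
      ≡⟨ solve 5 (λ d q a r b → d :* ((q :* a) :^ 4 :* (r :* b)) := d :* (q :^ 4 :* r) :* (a :^ 4 :* b)) refl D₂ (αn x) (α n) (bn y * bn (y + 1ℚ) * bn (y + 1ℚ + 1ℚ)) (b m₃) ⟩
    D₂ * (αn x ^ 4 * (bn y * bn (y + 1ℚ) * bn (y + 1ℚ + 1ℚ))) * (α n ^ 4 * b m₃)
      ≡⟨ cong₂ _*_ ratios (α⁴b≡α²b³ n) ⟩
    D₁ * (((αn z * αn (z + 1ℚ)) ^ 2) * bn x ^ 3) * (α m₂ ^ 2 * b n ^ 3)
      ≡⟨ solve 6 (λ d q₁ q₂ r a b → d :* ((q₁ :* q₂) :^ 2 :* r :^ 3) :* (a :^ 2 :* b :^ 3) := d :* ((q₂ :* (q₁ :* a)) :^ 2 :* (r :* b) :^ 3)) refl D₁ (αn z) (αn (z + 1ℚ)) (bn x) (α m₂) (b n) ⟩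
    D₁ * ((αn (z + 1ℚ) * (αn z * α m₂)) ^ 2 * (bn x * b n) ^ 3)
      ≡⟨ cong₂ (λ u w → D₁ * (u ^ 2 * w ^ 3)) (sym α-chain) (sym (b-step n x refl)) ⟩
    D₁ * ((αd z * (αd (z + 1ℚ) * α (suc (suc m₂)))) ^ 2 * (bd x * b (suc n)) ^ 3)
      ≡⟨ solve 6 (λ d p₁ p₂ s a b → d :* ((p₁ :* (p₂ :* a)) :^ 2 :* (s :* b) :^ 3) := d :* ((p₁ :* p₂) :^ 2 :* s :^ 3) :* (a :^ 2 :* b :^ 3)) refl D₁ (αd z) (αd (z + 1ℚ)) (bd x) (α (suc (suc m₂))) (b (suc n)) ⟩
    D₁ * D₂ * (α (suc (suc m₂)) ^ 2 * b (suc n) ^ 3) ∎)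
    where
    open ≡-Reasoning
    m₂ = double n
    m₃ = triple n
    x = ι n
    y = ι 3 * ι n
    z = ι 2 * ι n
    D₁ = αd x ^ 4 * (bd y * bd (y + 1ℚ) * bd (y + 1ℚ + 1ℚ))
    D₂ = (αd z * αd (z + 1ℚ)) ^ 2 * bd x ^ 3
    ι+1 : ∀ {n x} → ι n ≡ x → ι (suc n) ≡ x + 1ℚ
    ι+1 {n} e = trans (ι-suc n) (cong (_+ 1ℚ) e)
    b-chain : bd y * (bd (y + 1ℚ) * (bd (y + 1ℚ + 1ℚ) * b (suc (suc (suc m₃)))))
            ≡ bn y * bn (y + 1ℚ) * bn (y + 1ℚ + 1ℚ) * b m₃
    b-chain = begin
      bd y * (bd (y + 1ℚ) * (bd (y + 1ℚ + 1ℚ) * b (suc (suc (suc m₃)))))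
        ≡⟨ cong (λ u → bd y * (bd (y + 1ℚ) * u)) (b-step (suc (suc m₃)) (y + 1ℚ + 1ℚ) (ι+1 {suc m₃} (ι+1 {m₃} (ι-triple n)))) ⟩
      bd y * (bd (y + 1ℚ) * (bn (y + 1ℚ + 1ℚ) * b (suc (suc m₃))))
        ≡⟨ solve 4 (λ p q r b → p :* (q :* (r :* b)) := r :* (p :* (q :* b))) refl (bd y) (bd (y + 1ℚ)) (bn (y + 1ℚ + 1ℚ)) (b (suc (suc m₃))) ⟩
      bn (y + 1ℚ + 1ℚ) * (bd y * (bd (y + 1ℚ) * b (suc (suc m₃))))
        ≡⟨ cong (λ u → bn (y + 1ℚ + 1ℚ) * (bd y * u)) (b-step (suc m₃) (y + 1ℚ) (ι+1 {m₃} (ι-triple n))) ⟩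
      bn (y + 1ℚ + 1ℚ) * (bd y * (bn (y + 1ℚ) * b (suc m₃)))
        ≡⟨ solve 4 (λ p q r b → p :* (q :* (r :* b)) := p :* r :* (q :* b)) refl (bn (y + 1ℚ + 1ℚ)) (bd y) (bn (y + 1ℚ)) (b (suc m₃)) ⟩
      bn (y + 1ℚ + 1ℚ) * bn (y + 1ℚ) * (bd y * b (suc m₃))
        ≡⟨ cong (bn (y + 1ℚ + 1ℚ) * bn (y + 1ℚ) *_) (b-step m₃ y (ι-triple n)) ⟩
      bn (y + 1ℚ + 1ℚ) * bn (y + 1ℚ) * (bn y * b m₃)
        ≡⟨ solve 4 (λ p q r b → p :* q :* (r :* b) := r :* q :* p :* b) refl (bn (y + 1ℚ + 1ℚ)) (bn (y + 1ℚ)) (bn y) (b m₃) ⟩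
      bn y * bn (y + 1ℚ) * bn (y + 1ℚ + 1ℚ) * b m₃ ∎
    α-chain : αd z * (αd (z + 1ℚ) * α (suc (suc m₂))) ≡ αn (z + 1ℚ) * (αn z * α m₂)
    α-chain = begin
      αd z * (αd (z + 1ℚ) * α (suc (suc m₂)))
        ≡⟨ cong (αd z *_) (α-step (suc m₂) (z + 1ℚ) (ι+1 {m₂} (ι-double n))) ⟩
      αd z * (αn (z + 1ℚ) * α (suc m₂))
        ≡⟨ solve 3 (λ p q a → p :* (q :* a) := q :* (p :* a)) refl (αd z) (αn (z + 1ℚ)) (α (suc m₂)) ⟩
      αn (z + 1ℚ) * (αd z * α (suc m₂))
        ≡⟨ cong (αn (z + 1ℚ) *_) (α-step m₂ z (ι-double n)) ⟩
      αn (z + 1ℚ) * (αn z * α m₂) ∎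
    -- The induction comes down to this polynomial identity in n: both sides grow by the same ratio
    -- from n to n+1.
    ratios : D₂ * (αn x ^ 4 * (bn y * bn (y + 1ℚ) * bn (y + 1ℚ + 1ℚ))) ≡ D₁ * (((αn z * αn (z + 1ℚ)) ^ 2) * bn x ^ 3)
    ratios = solve 1 (λ x →
      let Pd = λ x → 9 · ((x :+ ♯ 1) :* (x :+ ♯ 1))
          Pn = λ x → 9 · (x :* x) :+ 9 · x :+ ♯ 2
          Bd = λ x → 4 · ((x :+ ♯ 1) :* (x :+ ♯ 1))
          Bn = λ x → (2 · x :+ ♯ 1) :* (2 · x :+ ♯ 1)
          y  = 3 · x
          z  = 2 · x
      in (Pd z :* Pd (z :+ ♯ 1)) :^ 2 :* Bd x :^ 3 :* (Pn x :^ 4 :* (Bn y :* Bn (y :+ ♯ 1) :* Bn (y :+ ♯ 1 :+ ♯ 1)))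
         := Pd x :^ 4 :* (Bd y :* Bd (y :+ ♯ 1) :* Bd (y :+ ♯ 1 :+ ♯ 1)) :* ((Pn z :* Pn (z :+ ♯ 1)) :^ 2 :* Bn x :^ 3)) refl (ι n)
    0<+1 : ∀ {x} → 0ℚ ≤ x → 0ℚ < x + 1ℚ
    0<+1 0≤x = ℚ.+-mono-≤-< 0≤x Rational.0<1
    0<αd : ∀ {x} → 0ℚ ≤ x → 0ℚ < αd x
    0<αd 0≤x = 0<-* (0<ι 8) (0<-* (0<+1 0≤x) (0<+1 0≤x))
    0<bd : ∀ {x} → 0ℚ ≤ x → 0ℚ < bd x
    0<bd 0≤x = 0<-* (0<ι 3) (0<-* (0<+1 0≤x) (0<+1 0≤x))
    0≤y = 0≤-* (0≤ι 3) (0≤ι n)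
    0≤z = 0≤-* (0≤ι 2) (0≤ι n)
    0<D₁ : 0ℚ < D₁
    0<D₁ = 0<-* (^-0< 4 (0<αd (0≤ι n))) (0<-* (0<-* (0<bd 0≤y) (0<bd (0≤-+ 0≤y 0≤1))) (0<bd (0≤-+ (0≤-+ 0≤y 0≤1) 0≤1)))
    0<D₂ : 0ℚ < D₂
    0<D₂ = 0<-* (^-0< 2 (0<-* (0<αd 0≤z) (0<αd (0≤-+ 0≤z 0≤1)))) (^-0< 3 (0<bd (0≤ι n)))

  B T : ℕ → ℚ
  B n = ι n * b n
  T n = ι 4 * S (suc n)

  ∣B∣≤1 : ∀ n → ∣ B n ∣ ≤ 1ℚ
  ∣B∣≤1 n = subst (_≤ 1ℚ) (sym (∣∣-nonNeg (0≤-* (0≤ι n) (0≤b n)))) (ℚ.≤-trans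
    (*-monoʳ (0≤b n) (≤-add {ι n} {r = ι n + 1ℚ} (solve 1 (λ n → n :+ (n :+ ♯ 1) := 2 · n :+ ♯ 1) refl (ι n)) (0≤-+ (0≤ι n) 0≤1))) ([2n+1]b≤1 n))

  ∣S∣≤1 : ∀ n → ∣ S n ∣ ≤ 1ℚ
  ∣S∣≤1 n = subst (_≤ 1ℚ) (trans (Rational.∣p-q∣≡∣q-p∣ 0ℚ (S n)) (cong ∣_∣ (solve 1 (λ s → s :- ♯ 0 := s) refl (S n)))) (Leibniz.close 0 n ℕ.z≤n)

  ∣T∣≤4 : ∀ n → ∣ T n ∣ ≤ ι 4
  ∣T∣≤4 n = ∣∣-*-≤ {ι 4} ℚ.≤-refl (∣S∣≤1 (suc n))

  nα≥2/9 : ∀ n → 1 ℕ.≤ n → ι 2 ≤ ι 9 * nα n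
  nα≥2/9 n 1≤n = *-monoˡ {nα 1} {nα n} {ι 9} (0≤ι 9) (nα-mono 1≤n)

  -- Since T n → π, this is Wallis's product n b n → 1/π.
  BT-null : Null (λ n → B n * T n - 1ℚ)
  BT-null = null-cong {u = λ n → ι 4 * B n * - (W n - S (suc n)) + - δ n}
    (λ n → solve 3 (λ B W S → 4 · B :* :- (W :- S) :+ :- (♯ 1 :- B :* (4 · W)) := B :* (4 · S) :- ♯ 1) refl (B n) (W n) (S (suc n)))
    (null-+ (null-* (λ n → ι 4 * B n) (λ n → ∣∣-*-≤ {ι 4} ℚ.≤-refl (∣B∣≤1 n)) (null-neg W-S-null))
      (null-neg (null-dominated {δ} 0 (λ n _ → δ-bound n) null-1/)))
    where
    -- Exactly 1/(2n+1)², by `bW` and (2n+1)² - 4n(n+1) = 1.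
    δ : ℕ → ℚ
    δ n = 1ℚ - B n * (ι 4 * W n)
    δ-eq : ∀ n → (ι 2 * ι n + 1ℚ) * (ι 2 * ι n + 1ℚ) * δ n ≡ 1ℚ
    δ-eq n = begin
      (ι 2 * ι n + 1ℚ) * (ι 2 * ι n + 1ℚ) * (1ℚ - ι n * b n * (ι 4 * W n))
        ≡⟨ solve 3 (λ n b w → (2 · n :+ ♯ 1) :* (2 · n :+ ♯ 1) :* (♯ 1 :- n :* b :* (4 · w))
             := (2 · n :+ ♯ 1) :* (2 · n :+ ♯ 1) :- 4 · n :* ((2 · n :+ ♯ 1) :* (2 · n :+ ♯ 1) :* (b :* w))) refl (ι n) (b n) (W n) ⟩
      (ι 2 * ι n + 1ℚ) * (ι 2 * ι n + 1ℚ) - ι 4 * ι n * ((ι 2 * ι n + 1ℚ) * (ι 2 * ι n + 1ℚ) * (b n * W n))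
        ≡⟨ cong (λ x → (ι 2 * ι n + 1ℚ) * (ι 2 * ι n + 1ℚ) - ι 4 * ι n * x) (bW n) ⟩
      (ι 2 * ι n + 1ℚ) * (ι 2 * ι n + 1ℚ) - ι 4 * ι n * (ι n + 1ℚ)
        ≡⟨ solve 1 (λ n → (2 · n :+ ♯ 1) :* (2 · n :+ ♯ 1) :- 4 · n :* (n :+ ♯ 1) := ♯ 1) refl (ι n) ⟩
      1ℚ ∎
      where open ≡-Reasoning
    0<p : ∀ n → 0ℚ < (ι 2 * ι n + 1ℚ) * (ι 2 * ι n + 1ℚ)
    0<p n = 0<-* (ℚ.+-mono-≤-< (0≤-* (0≤ι 2) (0≤ι n)) Rational.0<1) (ℚ.+-mono-≤-< (0≤-* (0≤ι 2) (0≤ι n)) Rational.0<1)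
    0≤δ : ∀ n → 0ℚ ≤ δ n
    0≤δ n = 0≤-cancelˡ _ (0<p n) (subst (0ℚ ≤_) (sym (δ-eq n)) 0≤1)
    δ-bound : ∀ n → ∣ δ n ∣ ≤ + 1 / suc n
    δ-bound n = subst (_≤ + 1 / suc n) (sym (∣∣-nonNeg (0≤δ n))) (*-cancelˡ-≤ (ι (suc n)) (0<ι n) (begin
      ι (suc n) * δ n         ≡⟨ cong (_* δ n) (ι-suc n) ⟩
      (ι n + 1ℚ) * δ n        ≤⟨ *-monoʳ (0≤δ n) (≤-add {ι n + 1ℚ} {r = ι 4 * (ι n * ι n) + ι 3 * ι n}
                                   (solve 1 (λ n → (n :+ ♯ 1) :+ (4 · (n :* n) :+ 3 · n) := (2 · n :+ ♯ 1) :* (2 · n :+ ♯ 1)) refl (ι n))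
                                   (0≤-+ (0≤-* (0≤ι 4) (0≤-* (0≤ι n) (0≤ι n))) (0≤-* (0≤ι 3) (0≤ι n)))) ⟩
      (ι 2 * ι n + 1ℚ) * (ι 2 * ι n + 1ℚ) * δ n ≡⟨ δ-eq n ⟩
      1ℚ                      ≡⟨ ι*1/ n ⟨
      ι (suc n) * (+ 1 / suc n) ∎))
      where open ℚ.≤-Reasoning

  nα-double-null : Null (λ n → nα (double n) - nα n)
  nα-double-null = null-dominated {λ n → nα (double n) - nα n} 0 (λ n _ → subst (_≤ + 1 / suc n)
    (sym (∣∣-nonNeg (0≤-diff (nα-mono (n≤double n))))) (bound n)) null-1/
    where
    bound : ∀ n → nα (double n) - nα n ≤ + 1 / suc n
    bound n = ℚ.≤-trans (nα-increment≤α (n≤double n)) (α≤1/[1+n] n)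

  T-T₃-null : Null (λ n → T n - T (triple n))
  T-T₃-null = null-dominated {λ n → T n - T (triple n)} 0 (λ n _ → bound n) (null-scale {λ n → + 1 / suc n} (ι 4) null-1/)
    where
    bound : ∀ n → ∣ T n - T (triple n) ∣ ≤ ι 4 * (+ 1 / suc n)
    bound n = subst (_≤ ι 4 * (+ 1 / suc n)) (cong ∣_∣ (solve 2 (λ a b → 4 · (a :- b) := 4 · a :- 4 · b) refl (S (suc n)) (S (suc (triple n)))))
      (∣∣-*-≤ {ι 4} ℚ.≤-refl (ℚ.≤-trans (Leibniz.close (suc n) (suc (triple n)) (ℕ.s≤s (n≤triple n))) (Rational.1/-antitone (ℕ.n≤1+n n))))

  ∣BT∣≤4 : ∀ n → ∣ B n * T n ∣ ≤ ι 4
  ∣BT∣≤4 n = ∣∣-*-≤ {B n} (∣B∣≤1 n) (∣T∣≤4 n)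

  B₃T-null : Null (λ n → B (triple n) * T n - 1ℚ)
  B₃T-null = null-cong {u = λ n → B (triple n) * (T n - T (triple n)) + (B (triple n) * T (triple n) - 1ℚ)}
    (λ n → solve 3 (λ B T T₃ → B :* (T :- T₃) :+ (B :* T₃ :- ♯ 1) := B :* T :- ♯ 1) refl (B (triple n)) (T n) (T (triple n)))
    (null-+ (null-* (λ n → B (triple n)) (λ n → ∣B∣≤1 (triple n)) T-T₃-null) (null-∘ {λ n → B n * T n - 1ℚ} triple n≤triple BT-null))

  -- `α⁴b≡α²b³` multiplied by 12n⁵, the indices 2n and 3n supplying 2² and 3. If n α n tends to a
  -- and n b n to 1/π, the limit reads 4a⁴/π = 3a²/π³, hence (2aπ)² = 3.
  4A⁴B₃≡3A₂²B³ : ∀ n → ι 4 * (nα n ^ 4 * B (triple n)) ≡ ι 3 * (nα (double n) ^ 2 * B n ^ 3)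
  4A⁴B₃≡3A₂²B³ n = begin
    ι 4 * ((ι n * α n) ^ 4 * (ι (triple n) * b₃))
      ≡⟨ cong (λ x → ι 4 * ((ι n * α n) ^ 4 * (x * b₃))) (ι-triple n) ⟩
    ι 4 * ((ι n * α n) ^ 4 * (ι 3 * ι n * b₃))
      ≡⟨ solve 3 (λ n a b → 4 · ((n :* a) :^ 4 :* (3 · n :* b)) := 12 · (n :^ 5) :* (a :^ 4 :* b)) refl (ι n) (α n) b₃ ⟩
    ι 12 * ι n ^ 5 * (α n ^ 4 * b₃)
      ≡⟨ cong (ι 12 * ι n ^ 5 *_) (α⁴b≡α²b³ n) ⟩
    ι 12 * ι n ^ 5 * (α (double n) ^ 2 * b n ^ 3)
      ≡⟨ solve 3 (λ n a b → 12 · (n :^ 5) :* (a :^ 2 :* b :^ 3) := 3 · ((2 · n :* a) :^ 2 :* (n :* b) :^ 3)) refl (ι n) (α (double n)) (b n) ⟩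
    ι 3 * ((ι 2 * ι n * α (double n)) ^ 2 * B n ^ 3)
      ≡⟨ cong (λ x → ι 3 * ((x * α (double n)) ^ 2 * B n ^ 3)) (ι-double n) ⟨
    ι 3 * (nα (double n) ^ 2 * B n ^ 3) ∎
    where
    open ≡-Reasoning
    b₃ = b (triple n)

  [2AT]²-null : Null (λ n → ι 4 * (nα n * nα n) * (T n * T n) - ι 3)
  [2AT]²-null = null-dominated {E} 1 E-bound (null-scale {λ n → ∣ F n ∣} (ι 81) (null-∣∣ {F} F-null))
    where
    E F : ℕ → ℚ
    E n = ι 4 * (nα n * nα n) * (T n * T n) - ι 3
    F n = nα n * nα n * E n
    -- With A, A₂, B and B₃ for the scaled coefficients, A² times the quantity in question is a
    -- combination of the null differences B₃T - 1, A₂ - A and BT - 1, up to a multiple of the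
    -- identity `4A⁴B₃≡3A₂²B³`.
    F≡ : ∀ n → ι 4 * (nα n ^ 4 * T n ^ 2) * - (B (triple n) * T n - 1ℚ)
             + (ι 3 * (B n * T n) ^ 3 * (nα (double n) + nα n) * (nα (double n) - nα n)
             + ι 3 * nα n ^ 2 * ((B n * T n) ^ 2 + B n * T n + 1ℚ) * (B n * T n - 1ℚ)) ≡ F n
    F≡ n = trans
      (solve 5 (λ A A₂ B B₃ T → 4 · (A :^ 4 :* T :^ 2) :* :- (B₃ :* T :- ♯ 1)
             :+ (3 · ((B :* T) :^ 3) :* (A₂ :+ A) :* (A₂ :- A)
             :+ 3 · (A :^ 2) :* ((B :* T) :^ 2 :+ B :* T :+ ♯ 1) :* (B :* T :- ♯ 1))
           := A :* A :* (4 · (A :* A) :* (T :* T) :- ♯ 3) :+ T :^ 3 :* (3 · (A₂ :^ 2 :* B :^ 3) :- 4 · (A :^ 4 :* B₃)))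
         refl (nα n) (nα (double n)) (B n) (B (triple n)) (T n))
      (trans (cong (λ x → F n + T n ^ 3 * (x - ι 4 * (nα n ^ 4 * B (triple n)))) (sym (4A⁴B₃≡3A₂²B³ n)))
        (solve 3 (λ f t x → f :+ t :* (x :- x) := f) refl (F n) (T n ^ 3) (ι 4 * (nα n ^ 4 * B (triple n)))))
    F-null : Null F
    F-null = null-cong F≡ (null-+
      (null-* (λ n → ι 4 * (nα n ^ 4 * T n ^ 2))
        (λ n → ∣∣-*-≤ {ι 4} ℚ.≤-refl (∣∣-*-≤ {nα n ^ 4} (∣^∣-≤ {nα n} 4 (∣nα∣≤1 n)) (∣^∣-≤ {T n} 2 (∣T∣≤4 n)))) (null-neg B₃T-null))
      (null-+
        (null-* (λ n → ι 3 * (B n * T n) ^ 3 * (nα (double n) + nα n))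
          (λ n → ∣∣-*-≤ {ι 3 * (B n * T n) ^ 3} (∣∣-*-≤ {ι 3} ℚ.≤-refl (∣^∣-≤ {B n * T n} 3 (∣BT∣≤4 n))) (∣∣-+-≤ {nα (double n)} (∣nα∣≤1 (double n)) (∣nα∣≤1 n)))
          nα-double-null)
        (null-* (λ n → ι 3 * nα n ^ 2 * ((B n * T n) ^ 2 + B n * T n + 1ℚ))
          (λ n → ∣∣-*-≤ {ι 3 * nα n ^ 2} (∣∣-*-≤ {ι 3} ℚ.≤-refl (∣^∣-≤ {nα n} 2 (∣nα∣≤1 n)))
                   (∣∣-+-≤ {(B n * T n) ^ 2 + B n * T n} (∣∣-+-≤ {(B n * T n) ^ 2} (∣^∣-≤ {B n * T n} 2 (∣BT∣≤4 n)) (∣BT∣≤4 n)) ℚ.≤-refl))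
          BT-null)))
    -- Dividing by A² costs a factor 81, because 9A ≥ 9 α 1 = 2 for n ≥ 1.
    E-bound : ∀ n → 1 ℕ.≤ n → ∣ E n ∣ ≤ ι 81 * ∣ F n ∣
    E-bound n 1≤n = begin
      ∣ E n ∣                              ≡⟨ ℚ.*-identityˡ ∣ E n ∣ ⟨
      1ℚ * ∣ E n ∣                         ≤⟨ *-monoʳ (ℚ.0≤∣p∣ (E n)) 1≤81A² ⟩
      ι 81 * ∣ nα n * nα n ∣ * ∣ E n ∣       ≡⟨ ℚ.*-assoc (ι 81) ∣ nα n * nα n ∣ ∣ E n ∣ ⟩
      ι 81 * (∣ nα n * nα n ∣ * ∣ E n ∣)     ≡⟨ cong (ι 81 *_) (∣∣-* (nα n * nα n) (E n)) ⟨
      ι 81 * ∣ F n ∣                       ∎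
      where
      open ℚ.≤-Reasoning
      1≤81A² : 1ℚ ≤ ι 81 * ∣ nα n * nα n ∣
      1≤81A² = begin
        1ℚ                         ≤⟨ *≤* (ℤ.+≤+ (ℕ.s≤s ℕ.z≤n)) ⟩
        ι 2 * ι 2                  ≤⟨ *-mono (0≤ι 2) (0≤ι 2) (nα≥2/9 n 1≤n) (nα≥2/9 n 1≤n) ⟩
        ι 9 * nα n * (ι 9 * nα n)    ≡⟨ solve 1 (λ a → 9 · a :* (9 · a) := 81 · (a :* a)) refl (nα n) ⟩
        ι 81 * (nα n * nα n)         ≡⟨ cong (ι 81 *_) (∣∣-nonNeg (0≤-² (nα n))) ⟨
        ι 81 * ∣ nα n * nα n ∣       ∎

  √3ₙ : ℕ → ℚ
  √3ₙ = Sqrt.approx 3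

  √3-scaled : ∀ n → ι (suc n) * √3ₙ n ≡ ι (Sqrt.r 3 n)
  √3-scaled n = trans (cong (ι (suc n) *_) (r/s (Sqrt.r 3 n)))
    (trans (solve 3 (λ s r i → s :* (r :* i) := r :* (s :* i)) refl (ι (suc n)) (ι (Sqrt.r 3 n)) (+ 1 / suc n))
      (trans (cong (ι (Sqrt.r 3 n) *_) (ι*1/ n)) (ℚ.*-identityʳ (ι (Sqrt.r 3 n)))))
    where
    r/s : ∀ r → + r / suc n ≡ ι r * (+ 1 / suc n)
    r/s zero    = trans (ℚ.0/n≡0 (suc n)) (sym (ℚ.*-zeroˡ (+ 1 / suc n)))
    r/s (suc r) = trans (Rational.suc/ r n) (trans (cong (_+ (+ 1 / suc n)) (r/s r))
      (trans (solve 2 (λ r i → r :* i :+ i := (r :+ ♯ 1) :* i) refl (ι r) (+ 1 / suc n)) (cong (_* (+ 1 / suc n)) (sym (ι-suc r)))))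

  1≤√3 : ∀ n → 1ℚ ≤ √3ₙ n
  1≤√3 n = *-cancelˡ-≤ (ι (suc n)) (0<ι n) (subst₂ _≤_ (sym (ℚ.*-identityʳ (ι (suc n)))) (sym (√3-scaled n)) (ι-mono s≤r))
    where
    s≤r : suc n ℕ.≤ Sqrt.r 3 n
    s≤r = ℕ.≮⇒≥ λ r<s → ℕ.<-irrefl refl (ℕ.<-≤-trans (Sqrt.upper (3 ℕ.* (suc n ℕ.* suc n)))
      (ℕ.≤-trans (ℕ.*-mono-≤ r<s r<s) (ℕ.m≤n*m (suc n ℕ.* suc n) 3)))

  √3²-null : Null (λ n → ι 3 - √3ₙ n * √3ₙ n)
  √3²-null = null-dominated {λ n → ι 3 - √3ₙ n * √3ₙ n} 0 (λ n _ → subst (_≤ ι 9 * (+ 1 / suc n)) (sym (∣∣-nonNeg (0≤d n))) (bound n))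
    (null-scale {λ n → + 1 / suc n} (ι 9) null-1/)
    where
    0<s² : ∀ n → 0ℚ < ι (suc n) * ι (suc n)
    0<s² n = 0<-* (0<ι n) (0<ι n)
    expand : ∀ n → ι (suc n) * ι (suc n) * (ι 3 - √3ₙ n * √3ₙ n) ≡ ι (3 ℕ.* (suc n ℕ.* suc n)) - ι (Sqrt.r 3 n) * ι (Sqrt.r 3 n)
    expand n = trans (solve 2 (λ s r → s :* s :* (♯ 3 :- r :* r) := 3 · (s :* s) :- (s :* r) :* (s :* r)) refl (ι (suc n)) (√3ₙ n))
      (cong₂ (λ x y → x - y * y) (sym (trans (ι-* 3 (suc n ℕ.* suc n)) (cong (ι 3 *_) (ι-* (suc n) (suc n))))) (√3-scaled n))
    0≤d : ∀ n → 0ℚ ≤ ι 3 - √3ₙ n * √3ₙ n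
    0≤d n = 0≤-cancelˡ _ (0<s² n) (subst (0ℚ ≤_) (sym (expand n))
      (0≤-diff (subst (_≤ ι (3 ℕ.* (suc n ℕ.* suc n))) (ι-* (Sqrt.r 3 n) (Sqrt.r 3 n)) (ι-mono (Sqrt.lower (3 ℕ.* (suc n ℕ.* suc n)))))))
    r≤ : ∀ n → Sqrt.r 3 n ℕ.≤ 2 ℕ.* suc n
    r≤ n = ℕ.≮⇒≥ λ 2s<r → ℕ.<-irrefl refl (ℕ.<-≤-trans (ℕ.*-mono-< 2s<r 2s<r)
      (ℕ.≤-trans (Sqrt.lower (3 ℕ.* (suc n ℕ.* suc n))) (ℕ.≤-trans (ℕ.*-monoˡ-≤ (suc n ℕ.* suc n) {3} {4} (ℕ.s≤s (ℕ.s≤s (ℕ.s≤s ℕ.z≤n))))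
        (ℕ.≤-reflexive (ℕ-lemma (suc n))))))
      where
      open import Data.Nat.Solver using (module +-*-Solver)
      ℕ-lemma : ∀ s → 4 ℕ.* (s ℕ.* s) ≡ (2 ℕ.* s) ℕ.* (2 ℕ.* s)
      ℕ-lemma = N.solve 1 (λ s → N.con 4 N.:* (s N.:* s) N.:= (N.con 2 N.:* s) N.:* (N.con 2 N.:* s)) refl
        where module N = +-*-Solver
    bound : ∀ n → ι 3 - √3ₙ n * √3ₙ n ≤ ι 9 * (+ 1 / suc n)
    bound n = *-cancelˡ-≤ _ (0<s² n) (begin
      s * s * (ι 3 - √3ₙ n * √3ₙ n)
        ≡⟨ expand n ⟩
      ι (3 ℕ.* (suc n ℕ.* suc n)) - r * r
        ≤⟨ ℚ.+-monoˡ-≤ (- (r * r)) (ι-mono (ℕ.<⇒≤ (Sqrt.upper (3 ℕ.* (suc n ℕ.* suc n))))) ⟩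
      ι (suc (Sqrt.r 3 n) ℕ.* suc (Sqrt.r 3 n)) - r * r
        ≡⟨ cong (_- r * r) (trans (ι-* (suc (Sqrt.r 3 n)) (suc (Sqrt.r 3 n))) (cong (λ x → x * x) (ι-suc (Sqrt.r 3 n)))) ⟩
      (r + 1ℚ) * (r + 1ℚ) - r * r
        ≡⟨ solve 1 (λ r → (r :+ ♯ 1) :* (r :+ ♯ 1) :- r :* r := 2 · r :+ ♯ 1) refl r ⟩
      ι 2 * r + 1ℚ
        ≤⟨ ℚ.+-mono-≤ (*-monoˡ (0≤ι 2) (ℚ.≤-trans (ι-mono (r≤ n)) (ℚ.≤-reflexive (ι-* 2 (suc n))))) (ι-mono {1} {suc n} (ℕ.s≤s ℕ.z≤n)) ⟩
      ι 2 * (ι 2 * s) + s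
        ≤⟨ ≤-add {r = ι 4 * s} (solve 1 (λ s → 2 · (2 · s) :+ s :+ 4 · s := s :* 9 · ♯ 1) refl s) (0≤-* (0≤ι 4) (0≤ι (suc n))) ⟩
      s * (ι 9 * 1ℚ)
        ≡⟨ cong (λ x → s * (ι 9 * x)) (ι*1/ n) ⟨
      s * (ι 9 * (s * (+ 1 / suc n)))
        ≡⟨ solve 2 (λ s i → s :* (9 · (s :* i)) := s :* s :* (9 · i)) refl s (+ 1 / suc n) ⟩
      s * s * (ι 9 * (+ 1 / suc n)) ∎)
      where
      open ℚ.≤-Reasoning
      s = ι (suc n)
      r = ι (Sqrt.r 3 n)

  -- For x ≥ 0 and r ≥ 1 the distance of x and r is at most that of x² and r², so convergence of the
  -- squares suffices.
  2nαπ-√3-null : Null (λ n → ι 2 * nα n * T n - √3ₙ n)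
  2nαπ-√3-null = null-dominated {λ n → ι 2 * nα n * T n - √3ₙ n} 0 (λ n _ → bound n) (null-∣∣ {G} G-null)
    where
    G : ℕ → ℚ
    G n = (ι 4 * (nα n * nα n) * (T n * T n) - ι 3) + (ι 3 - √3ₙ n * √3ₙ n)
    G-null : Null G
    G-null = null-+ {λ n → ι 4 * (nα n * nα n) * (T n * T n) - ι 3} {λ n → ι 3 - √3ₙ n * √3ₙ n} [2AT]²-null √3²-null
    0≤T : ∀ n → 0ℚ ≤ T n
    0≤T zero    = 0≤-* (0≤ι 4) 0≤1
    0≤T (suc n) = 0≤-* (0≤ι 4) (ℚ.≤-trans (*≤* (ℤ.+≤+ ℕ.z≤n)) (Leibniz.S-lower (suc (suc n)) (ℕ.s≤s (ℕ.s≤s ℕ.z≤n))))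
    bound : ∀ n → ∣ ι 2 * nα n * T n - √3ₙ n ∣ ≤ ∣ G n ∣
    bound n = begin
      ∣ x - r ∣                   ≡⟨ ℚ.*-identityʳ ∣ x - r ∣ ⟨
      ∣ x - r ∣ * 1ℚ              ≤⟨ *-monoˡ (ℚ.0≤∣p∣ (x - r)) (ℚ.≤-trans (1≤√3 n)
                                       (ℚ.≤-trans (≤-add (ℚ.+-comm r x) (0≤-* (0≤-* (0≤ι 2) (0≤nα n)) (0≤T n))) (Rational.p≤∣p∣ (x + r)))) ⟩
      ∣ x - r ∣ * ∣ x + r ∣       ≡⟨ ∣∣-* (x - r) (x + r) ⟨
      ∣ (x - r) * (x + r) ∣       ≡⟨ cong ∣_∣ (solve 3 (λ a t r → (2 · a :* t :- r) :* (2 · a :* t :+ r) := (4 · (a :* a) :* (t :* t) :- ♯ 3) :+ (♯ 3 :- r :* r)) refl (nα n) (T n) r) ⟩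
      ∣ G n ∣                     ∎
      where
      open ℚ.≤-Reasoning
      x = ι 2 * nα n * T n
      r = √3ₙ n

-- Bounds on the solutions of the Legendre recurrence in terms of its characteristic roots.

module ThreeTermRecurrence where

  open import Data.Integer.Base using (ℤ; +_; -[1+_])
  open import Data.Rational.Base
  open Arithmetic
  open Sequences

  -- Q X Y n = zⁿ Pₙ(X/z) for Y = z², by the three-term recurrence; Q₋ X Y n is the
  -- preceding term Q X Y (n-1), with the junk value 0 at n = 0.
  mutual
    Q Q₋ : ℚ → ℚ → ℕ → ℚ
    Q X Y zero    = 1ℚ
    Q X Y (suc n) = (+ 1 / suc n) * ((ι 2 * ι n + 1ℚ) * X * Q X Y n - ι n * Y * Q₋ X Y n)

    Q₋ X Y zero    = 0ℚ
    Q₋ X Y (suc n) = Q X Y n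

  Q-rec : ∀ X Y n → (ι n + 1ℚ) * Q X Y (suc n) ≡ (ι 2 * ι n + 1ℚ) * X * Q X Y n - ι n * Y * Q₋ X Y n
  Q-rec X Y n = trans (cong (_* Q X Y (suc n)) (sym (ι-suc n)))
    (trans (sym (ℚ.*-assoc (ι (suc n)) (+ 1 / suc n) R)) (trans (cong (_* R) (ι*1/ n)) (ℚ.*-identityˡ R)))
    where R = (ι 2 * ι n + 1ℚ) * X * Q X Y n - ι n * Y * Q₋ X Y n

  0<1+ι : ∀ n → 0ℚ < ι n + 1ℚ
  0<1+ι n = subst (0ℚ <_) (ι-suc n) (0<ι n)

  -- When l and m are the roots of t² - 2Xt + Y, the successive ratios of Q X Y lie
  -- between m and l.
  module Ratio {X Y l m : ℚ} (sum : ι 2 * X ≡ l + m) (prod : Y ≡ l * m) (0≤m : 0ℚ ≤ m) (m≤l : m ≤ l) where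

    private
      q q₋ : ℕ → ℚ
      q = Q X Y
      q₋ = Q₋ X Y

    0≤l : 0ℚ ≤ l
    0≤l = ℚ.≤-trans 0≤m m≤l

    0≤l-m : 0ℚ ≤ l - m
    0≤l-m = 0≤-diff m≤l

    2rec : ∀ n → ι 2 * ((ι n + 1ℚ) * q (suc n)) ≡ (ι 2 * ι n + 1ℚ) * (l + m) * q n - ι 2 * (ι n * (l * m) * q₋ n)
    2rec n = trans (cong (ι 2 *_) (Q-rec X Y n)) (trans
      (solve 5 (λ n X Y q p → 2 · ((2 · n :+ ♯ 1) :* X :* q :- n :* Y :* p) := (2 · n :+ ♯ 1) :* (2 · X) :* q :- 2 · (n :* Y :* p)) refl (ι n) X Y (q n) (q₋ n))
      (cong₂ (λ s p → (ι 2 * ι n + 1ℚ) * s * q n - ι 2 * (ι n * p * q₋ n)) sum prod))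

    private
      -- Written in the roots, the recurrence expresses the deviation of q (n+1) from m q n through
      -- the same deviation one step earlier and q n, with nonnegative coefficients; so positivity
      -- propagates. `down≡` is the mirror image for l, and the doubling avoids halving l+m.
      up≡ : ∀ n → ι 2 * ((ι n + 1ℚ) * (q (suc n) - m * q n)) ≡ ι 2 * (l * (ι n * (q n - m * q₋ n))) + (l - m) * q n
      up≡ n = trans (solve 4 (λ n m q' q → 2 · ((n :+ ♯ 1) :* (q' :- m :* q)) := 2 · ((n :+ ♯ 1) :* q') :- 2 · ((n :+ ♯ 1) :* (m :* q))) refl (ι n) m (q (suc n)) (q n))
        (trans (cong (_- ι 2 * ((ι n + 1ℚ) * (m * q n))) (2rec n))
          (solve 5 (λ n l m q p → (2 · n :+ ♯ 1) :* (l :+ m) :* q :- 2 · (n :* (l :* m) :* p) :- 2 · ((n :+ ♯ 1) :* (m :* q))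
            := 2 · (l :* (n :* (q :- m :* p))) :+ (l :- m) :* q) refl (ι n) l m (q n) (q₋ n)))
      down≡ : ∀ n → ι 2 * ((ι n + 1ℚ) * (l * q n - q (suc n))) ≡ ι 2 * (m * (ι n * (l * q₋ n - q n))) + (l - m) * q n
      down≡ n = trans (solve 4 (λ n l q' q → 2 · ((n :+ ♯ 1) :* (l :* q :- q')) := 2 · ((n :+ ♯ 1) :* (l :* q)) :- 2 · ((n :+ ♯ 1) :* q')) refl (ι n) l (q (suc n)) (q n))
        (trans (cong (λ x → ι 2 * ((ι n + 1ℚ) * (l * q n)) - x) (2rec n))
          (solve 5 (λ n l m q p → 2 · ((n :+ ♯ 1) :* (l :* q)) :- ((2 · n :+ ♯ 1) :* (l :+ m) :* q :- 2 · (n :* (l :* m) :* p))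
            := 2 · (m :* (n :* (l :* p :- q))) :+ (l :- m) :* q) refl (ι n) l m (q n) (q₋ n)))

      cancel : ∀ n {x} → 0ℚ ≤ ι 2 * ((ι n + 1ℚ) * x) → 0ℚ ≤ x
      cancel n h = 0≤-cancelˡ (ι n + 1ℚ) (0<1+ι n) (0≤-cancelˡ (ι 2) (0<ι 1) h)

      bounds : ∀ n → 0ℚ ≤ q n × 0ℚ ≤ ι n * (q n - m * q₋ n) × 0ℚ ≤ ι n * (l * q₋ n - q n)
      -- The factor ι n makes the last two bounds trivial at n = 0, where `q₋` has its junk value.
      bounds zero    = 0≤1 , ℚ.≤-reflexive (sym (ℚ.*-zeroˡ (1ℚ - m * 0ℚ))) , ℚ.≤-reflexive (sym (ℚ.*-zeroˡ (l * 0ℚ - 1ℚ)))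
      bounds (suc n) =
        let 0≤q , 0≤u , 0≤d = bounds n
            up   = cancel n (subst (0ℚ ≤_) (sym (up≡ n)) (0≤-+ (0≤-* (0≤ι 2) (0≤-* 0≤l 0≤u)) (0≤-* 0≤l-m 0≤q)))
            down = cancel n (subst (0ℚ ≤_) (sym (down≡ n)) (0≤-+ (0≤-* (0≤ι 2) (0≤-* 0≤m 0≤d)) (0≤-* 0≤l-m 0≤q)))
        in subst (0ℚ ≤_) (solve 3 (λ q' q m → (q' :- m :* q) :+ m :* q := q') refl (q (suc n)) (q n) m) (0≤-+ up (0≤-* 0≤m 0≤q))
         , 0≤-* (0≤ι (suc n)) up , 0≤-* (0≤ι (suc n)) down

    0≤q : ∀ n → 0ℚ ≤ q n
    0≤q n = proj₁ (bounds n)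

    q-suc-≤ : ∀ n → q (suc n) ≤ l * q n
    q-suc-≤ n = ≤-add {r = l * q n - q (suc n)} (solve 2 (λ a b → a :+ (b :- a) := b) refl (q (suc n)) (l * q n))
      (0≤-cancelˡ (ι (suc n)) (0<ι n) (proj₂ (proj₂ (bounds (suc n)))))

    q-≤ : ∀ n → q n ≤ l ^ n
    q-≤ zero    = ℚ.≤-refl
    q-≤ (suc n) = ℚ.≤-trans (q-suc-≤ n) (*-monoˡ 0≤l (q-≤ n))

    -- If X were z, then z would be a double root and q n = zⁿ. The deviation e n = (n+1)(q (n+1) -
    -- z q n) is multiplied by z at each step and receives (2n+1)(X-z) q n. As the odd numbers sum
    -- to squares, e n ≤ (n+1)² (X-z) lⁿ.
    module _ {z : ℚ} (Y≡z² : Y ≡ z * z) (0≤z : 0ℚ ≤ z) (z≤X : z ≤ X) (z≤l : z ≤ l) where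

      private
        e : ℕ → ℚ
        e n = (ι n + 1ℚ) * (q (suc n) - z * q n)

        e₋ : ℕ → ℚ
        e₋ n = ι n * (q n - z * q₋ n)

        e≡ : ∀ n → e n ≡ z * e₋ n + (ι 2 * ι n + 1ℚ) * (X - z) * q n
        e≡ n = trans (solve 4 (λ n z q' q → (n :+ ♯ 1) :* (q' :- z :* q) := (n :+ ♯ 1) :* q' :- (n :+ ♯ 1) :* (z :* q)) refl (ι n) z (q (suc n)) (q n))
          (trans (cong (_- (ι n + 1ℚ) * (z * q n)) (trans (Q-rec X Y n) (cong (λ y → (ι 2 * ι n + 1ℚ) * X * q n - ι n * y * q₋ n) Y≡z²)))
            (solve 5 (λ n z X q p → (2 · n :+ ♯ 1) :* X :* q :- n :* (z :* z) :* p :- (n :+ ♯ 1) :* (z :* q)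
              := z :* (n :* (q :- z :* p)) :+ (2 · n :+ ♯ 1) :* (X :- z) :* q) refl (ι n) z X (q n) (q₋ n)))

        e₋-suc : ∀ n → e₋ (suc n) ≡ e n
        e₋-suc n = cong (_* (q (suc n) - z * q n)) (ι-suc n)

        0≤X-z : 0ℚ ≤ X - z
        0≤X-z = 0≤-diff z≤X

        term-0≤ : ∀ n → 0ℚ ≤ (ι 2 * ι n + 1ℚ) * (X - z) * q n
        term-0≤ n = 0≤-* (0≤-* (0≤-+ (0≤-* (0≤ι 2) (0≤ι n)) 0≤1) 0≤X-z) (0≤q n)

        0≤e : ∀ n → 0ℚ ≤ e n
        0≤e zero    = subst (0ℚ ≤_) (sym (e≡ 0)) (0≤-+ (ℚ.≤-reflexive (sym (trans (cong (z *_) (ℚ.*-zeroˡ (1ℚ - z * 0ℚ))) (ℚ.*-zeroʳ z)))) (term-0≤ 0))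
        0≤e (suc n) = subst (0ℚ ≤_) (sym (trans (e≡ (suc n)) (cong (λ x → z * x + (ι 2 * ι (suc n) + 1ℚ) * (X - z) * q (suc n)) (e₋-suc n))))
          (0≤-+ (0≤-* 0≤z (0≤e n)) (term-0≤ (suc n)))

        e-≤ : ∀ n → e n ≤ (ι n + 1ℚ) * (ι n + 1ℚ) * (X - z) * l ^ n
        e-≤ zero    = ℚ.≤-reflexive (trans (e≡ 0) (solve 2 (λ z d → z :* (♯ 0 :* (♯ 1 :- z :* ♯ 0)) :+ (♯ 2 :* ♯ 0 :+ ♯ 1) :* d :* ♯ 1 := (♯ 0 :+ ♯ 1) :* (♯ 0 :+ ♯ 1) :* d :* ♯ 1) refl z (X - z)))
        e-≤ (suc n) = begin
          e (suc n)
            ≡⟨ trans (e≡ (suc n)) (cong (λ x → z * x + (ι 2 * ι (suc n) + 1ℚ) * (X - z) * q (suc n)) (e₋-suc n)) ⟩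
          z * e n + (ι 2 * ι (suc n) + 1ℚ) * (X - z) * q (suc n)
            ≤⟨ ℚ.+-mono-≤ (*-mono 0≤z (0≤e n) z≤l (e-≤ n)) (*-monoˡ (0≤-* (0≤-+ (0≤-* (0≤ι 2) (0≤ι (suc n))) 0≤1) 0≤X-z) (q-≤ (suc n))) ⟩
          l * ((ι n + 1ℚ) * (ι n + 1ℚ) * (X - z) * l ^ n) + (ι 2 * ι (suc n) + 1ℚ) * (X - z) * (l * l ^ n)
            ≡⟨ cong (λ x → l * (x * x * (X - z) * l ^ n) + (ι 2 * ι (suc n) + 1ℚ) * (X - z) * (l * l ^ n)) (ι-suc n) ⟨
          l * (s * s * (X - z) * l ^ n) + (ι 2 * s + 1ℚ) * (X - z) * (l * l ^ n)
            ≡⟨ solve 4 (λ s l d p → l :* (s :* s :* d :* p) :+ (2 · s :+ ♯ 1) :* d :* (l :* p) := (s :+ ♯ 1) :* (s :+ ♯ 1) :* d :* (l :* p)) refl s l (X - z) (l ^ n) ⟩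
          (s + 1ℚ) * (s + 1ℚ) * (X - z) * (l * l ^ n) ∎
          where
          open ℚ.≤-Reasoning
          s = ι (suc n)

      0≤q-zq : ∀ n → 0ℚ ≤ q (suc n) - z * q n
      0≤q-zq n = 0≤-cancelˡ (ι n + 1ℚ) (0<1+ι n) (0≤e n)

      q-zq-≤ : ∀ n → q (suc n) - z * q n ≤ (X - z) * (ι (suc n) * l ^ n)
      q-zq-≤ n = *-cancelˡ-≤ (ι n + 1ℚ) (0<1+ι n) (ℚ.≤-trans (e-≤ n) (ℚ.≤-reflexive
        (trans (solve 3 (λ n d p → (n :+ ♯ 1) :* (n :+ ♯ 1) :* d :* p := (n :+ ♯ 1) :* (d :* ((n :+ ♯ 1) :* p))) refl (ι n) (X - z) (l ^ n))
          (cong (λ x → (ι n + 1ℚ) * ((X - z) * (x * l ^ n))) (sym (ι-suc n))))))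

-- Bonnet's recurrence derived from the hypergeometric definition.

module LegendrePolynomials where

  open import Data.Integer.Base using (ℤ; +_; -[1+_])
  open import Data.Rational.Base
  open Arithmetic
  open Hypergeometric
  open Sequences
  open ThreeTermRecurrence

  pochhammer-shift : ∀ a m → pochhammer a (suc m) ≡ a * pochhammer (a + 1ℚ) m
  pochhammer-shift a zero    = solve 1 (λ a → ♯ 1 :* (a :+ ♯ 0) := a :* ♯ 1) refl a
  pochhammer-shift a (suc m) = trans (cong₂ (λ p s → p * (a + s)) (pochhammer-shift a m) (ι-suc m))
    (solve 3 (λ a p m → a :* p :* (a :+ (m :+ ♯ 1)) := a :* (p :* ((a :+ ♯ 1) :+ m))) refl a (pochhammer (a + 1ℚ) m) (ι m))

  pochhammer-vanishes : ∀ n i → pochhammer (- ι n) (suc (n ℕ.+ i)) ≡ 0ℚ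
  pochhammer-vanishes n zero    = trans (cong (λ m → pochhammer (- ι n) (n ℕ.+ 0) * (- ι n + ι m)) (ℕ.+-identityʳ n))
    (solve 2 (λ p n → p :* (:- n :+ n) := ♯ 0) refl (pochhammer (- ι n) (n ℕ.+ 0)) (ι n))
  pochhammer-vanishes n (suc i) = trans
    (cong (_* (- ι n + ι (n ℕ.+ suc i))) (trans (cong (pochhammer (- ι n)) (ℕ.+-suc n i)) (pochhammer-vanishes n i)))
    (ℚ.*-zeroˡ (- ι n + ι (n ℕ.+ suc i)))

  -- With ν a rational variable, its neighbours ν+1 and ν-1 in Bonnet's recurrence are covered by
  -- one formula without case distinction.
  C : ℚ → ℕ → ℚ
  C ν m = ₂F₁-coeff (- ν) (ν + 1ℚ) m

  -- Bonnet's recurrence read off coefficientwise in y = (1-x)/2. In the case m+1 every Pochhammer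
  -- symbol contains (1-ν)ₘ or (ν+2)ₘ; with these split off, a polynomial identity in ν and m
  -- remains.
  C-rec : ∀ ν m → (ν + 1ℚ) * C (ν + 1ℚ) (suc m) + ν * C (ν - 1ℚ) (suc m) ≡ (ι 2 * ν + 1ℚ) * (C ν (suc m) - ι 2 * C ν m)
  C-rec ν zero    = solve 1 (λ ν → let c = λ ν → ♯ 1 :* (:- ν :+ ♯ 0) :* (♯ 1 :* (ν :+ ♯ 1 :+ ♯ 0)) :* ♯ 1 in
    (ν :+ ♯ 1) :* c (ν :+ ♯ 1) :+ ν :* c (ν :- ♯ 1) := (2 · ν :+ ♯ 1) :* (c ν :- 2 · (♯ 1 :* ♯ 1 :* ♯ 1))) refl ν
  C-rec ν (suc m) = begin
    (ν + 1ℚ) * C (ν + 1ℚ) (suc (suc m)) + ν * C (ν - 1ℚ) (suc (suc m))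
      ≡⟨ cong₂ (λ x y → (ν + 1ℚ) * (x * r) + ν * (y * r)) (cong₂ _*_ lower₊ upper₊) (cong₂ _*_ lower₋ upper₋) ⟩
    (ν + 1ℚ) * (- (ν + 1ℚ) * (- ν * q) * (q′ * (ν + ι 2 + ι m) * (ν + ι 2 + (ι m + 1ℚ))) * r)
      + ν * (q * (1ℚ - ν + ι m) * (1ℚ - ν + (ι m + 1ℚ)) * (ν * ((ν + 1ℚ) * q′)) * r)
      ≡⟨ solve 5 (λ ν m q q′ r →
           (ν :+ ♯ 1) :* (:- (ν :+ ♯ 1) :* (:- ν :* q) :* (q′ :* (ν :+ ♯ 2 :+ m) :* (ν :+ ♯ 2 :+ (m :+ ♯ 1))) :* r)
             :+ ν :* (q :* (♯ 1 :- ν :+ m) :* (♯ 1 :- ν :+ (m :+ ♯ 1)) :* (ν :* ((ν :+ ♯ 1) :* q′)) :* r)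
           := (2 · ν :+ ♯ 1) :* (:- ν :* (q :* (♯ 1 :- ν :+ m)) :* ((ν :+ ♯ 1) :* (q′ :* (ν :+ ♯ 2 :+ m))) :* r
                :- 2 · (:- ν :* q :* ((ν :+ ♯ 1) :* q′) :* ((m :+ ♯ 1 :+ ♯ 1) :* (m :+ ♯ 1 :+ ♯ 1) :* r))))
           refl ν (ι m) q q′ r ⟩
    (ι 2 * ν + 1ℚ) * (- ν * (q * (1ℚ - ν + ι m)) * ((ν + 1ℚ) * (q′ * (ν + ι 2 + ι m))) * r
       - ι 2 * (- ν * q * ((ν + 1ℚ) * q′) * ((ι m + 1ℚ + 1ℚ) * (ι m + 1ℚ + 1ℚ) * r)))
      ≡⟨ cong (λ x → (ι 2 * ν + 1ℚ) * (- ν * (q * (1ℚ - ν + ι m)) * ((ν + 1ℚ) * (q′ * (ν + ι 2 + ι m))) * r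
           - ι 2 * (- ν * q * ((ν + 1ℚ) * q′) * x)))
           (trans (cong (λ s → s * s * r) (sym (trans (ι-suc (suc m)) (cong (_+ 1ℚ) (ι-suc m))))) (1/!²-suc (suc m))) ⟩
    (ι 2 * ν + 1ℚ) * (- ν * (q * (1ℚ - ν + ι m)) * ((ν + 1ℚ) * (q′ * (ν + ι 2 + ι m))) * r
       - ι 2 * (- ν * q * ((ν + 1ℚ) * q′) * 1/!² (suc m)))
      ≡⟨ cong₂ (λ x y → (ι 2 * ν + 1ℚ) * (x * r - ι 2 * (y * 1/!² (suc m))))
           (cong₂ _*_ (trans (cong (λ p → - ν * (p * (1ℚ - ν + ι m))) (q≡ (- ν + 1ℚ) (solve 1 (λ ν → ♯ 1 :- ν := :- ν :+ ♯ 1) refl ν)))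
                        (trans (cong (λ p → - ν * (pochhammer (- ν + 1ℚ) m * (p + ι m))) (solve 1 (λ ν → ♯ 1 :- ν := :- ν :+ ♯ 1) refl ν)) (sym (pochhammer-shift (- ν) (suc m)))))
                      (trans (cong (λ p → (ν + 1ℚ) * (p * (ν + ι 2 + ι m))) (q′≡ (ν + 1ℚ + 1ℚ) (solve 1 (λ ν → ν :+ ♯ 2 := ν :+ ♯ 1 :+ ♯ 1) refl ν)))
                        (trans (cong (λ p → (ν + 1ℚ) * (pochhammer (ν + 1ℚ + 1ℚ) m * (p + ι m))) (solve 1 (λ ν → ν :+ ♯ 2 := ν :+ ♯ 1 :+ ♯ 1) refl ν)) (sym (pochhammer-shift (ν + 1ℚ) (suc m))))))
           (cong₂ _*_ (trans (cong (- ν *_) (q≡ (- ν + 1ℚ) (solve 1 (λ ν → ♯ 1 :- ν := :- ν :+ ♯ 1) refl ν))) (sym (pochhammer-shift (- ν) m)))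
                      (trans (cong ((ν + 1ℚ) *_) (q′≡ (ν + 1ℚ + 1ℚ) (solve 1 (λ ν → ν :+ ♯ 2 := ν :+ ♯ 1 :+ ♯ 1) refl ν))) (sym (pochhammer-shift (ν + 1ℚ) m)))) ⟩
    (ι 2 * ν + 1ℚ) * (C ν (suc (suc m)) - ι 2 * C ν (suc m)) ∎
    where
    open ≡-Reasoning
    r  = 1/!² (suc (suc m))
    q  = pochhammer (1ℚ - ν) m
    q′ = pochhammer (ν + ι 2) m
    q≡ : ∀ a → 1ℚ - ν ≡ a → q ≡ pochhammer a m
    q≡ _ refl = refl
    q′≡ : ∀ a → ν + ι 2 ≡ a → q′ ≡ pochhammer a m
    q′≡ _ refl = refl
    lower₊ : pochhammer (- (ν + 1ℚ)) (suc (suc m)) ≡ - (ν + 1ℚ) * (- ν * q)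
    lower₊ = trans (pochhammer-shift (- (ν + 1ℚ)) (suc m)) (cong (- (ν + 1ℚ) *_)
      (trans (cong (λ a → pochhammer a (suc m)) (solve 1 (λ ν → :- (ν :+ ♯ 1) :+ ♯ 1 := :- ν) refl ν))
        (trans (pochhammer-shift (- ν) m) (cong (- ν *_) (sym (q≡ (- ν + 1ℚ) (solve 1 (λ ν → ♯ 1 :- ν := :- ν :+ ♯ 1) refl ν)))))))
    upper₊ : pochhammer (ν + 1ℚ + 1ℚ) (suc (suc m)) ≡ q′ * (ν + ι 2 + ι m) * (ν + ι 2 + (ι m + 1ℚ))
    upper₊ = trans (cong (λ a → pochhammer a (suc (suc m))) (solve 1 (λ ν → ν :+ ♯ 1 :+ ♯ 1 := ν :+ ♯ 2) refl ν))
      (cong (λ s → q′ * (ν + ι 2 + ι m) * (ν + ι 2 + s)) (ι-suc m))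
    lower₋ : pochhammer (- (ν - 1ℚ)) (suc (suc m)) ≡ q * (1ℚ - ν + ι m) * (1ℚ - ν + (ι m + 1ℚ))
    lower₋ = trans (cong (λ a → pochhammer a (suc (suc m))) (solve 1 (λ ν → :- (ν :- ♯ 1) := ♯ 1 :- ν) refl ν))
      (cong (λ s → q * (1ℚ - ν + ι m) * (1ℚ - ν + s)) (ι-suc m))
    upper₋ : pochhammer (ν - 1ℚ + 1ℚ) (suc (suc m)) ≡ ν * ((ν + 1ℚ) * q′)
    upper₋ = trans (cong (λ a → pochhammer a (suc (suc m))) (solve 1 (λ ν → ν :- ♯ 1 :+ ♯ 1 := ν) refl ν))
      (trans (pochhammer-shift ν (suc m)) (cong (ν *_)
        (trans (pochhammer-shift (ν + 1ℚ) m) (cong ((ν + 1ℚ) *_) (sym (q′≡ (ν + 1ℚ + 1ℚ) (solve 1 (λ ν → ν :+ ♯ 2 := ν :+ ♯ 1 :+ ♯ 1) refl ν)))))))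

  partial : ℕ → ℚ → ℚ → ℚ
  partial N ν y = ∑ N λ m → C ν m * y ^ m

  -- The factor y raises the degree by one, so the last sum stops one term earlier; `partial-stable`
  -- later makes the different cut-offs agree.
  partial-rec : ∀ N ν y → (ν + 1ℚ) * partial (suc N) (ν + 1ℚ) y + ν * partial (suc N) (ν - 1ℚ) y
    ≡ (ι 2 * ν + 1ℚ) * (partial (suc N) ν y - ι 2 * y * partial N ν y)
  partial-rec zero ν y = solve 2 (λ ν y → let one = ♯ 0 :+ ♯ 1 :* ♯ 1 :* ♯ 1 :* ♯ 1 in
    (ν :+ ♯ 1) :* one :+ ν :* one := (2 · ν :+ ♯ 1) :* (one :- 2 · y :* ♯ 0)) refl ν y
  partial-rec (suc N) ν y = begin
    (ν + 1ℚ) * (P₊ + c₊ * (y * p)) + ν * (P₋ + c₋ * (y * p))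
      ≡⟨ solve 7 (λ ν P₊ P₋ c₊ c₋ y p → (ν :+ ♯ 1) :* (P₊ :+ c₊ :* (y :* p)) :+ ν :* (P₋ :+ c₋ :* (y :* p))
           := ((ν :+ ♯ 1) :* P₊ :+ ν :* P₋) :+ ((ν :+ ♯ 1) :* c₊ :+ ν :* c₋) :* (y :* p)) refl ν P₊ P₋ c₊ c₋ y p ⟩
    ((ν + 1ℚ) * P₊ + ν * P₋) + ((ν + 1ℚ) * c₊ + ν * c₋) * (y * p)
      ≡⟨ cong₂ (λ a b → a + b * (y * p)) (partial-rec N ν y) (C-rec ν N) ⟩
    (ι 2 * ν + 1ℚ) * (partial (suc N) ν y - ι 2 * y * partial N ν y) + (ι 2 * ν + 1ℚ) * (C ν (suc N) - ι 2 * C ν N) * (y * p)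
      ≡⟨ solve 6 (λ ν P y c′ c p → (2 · ν :+ ♯ 1) :* ((P :+ c :* p) :- 2 · y :* P) :+ (2 · ν :+ ♯ 1) :* (c′ :- 2 · c) :* (y :* p)
           := (2 · ν :+ ♯ 1) :* ((P :+ c :* p) :+ c′ :* (y :* p) :- 2 · y :* (P :+ c :* p))) refl ν (partial N ν y) y (C ν (suc N)) (C ν N) p ⟩
    (ι 2 * ν + 1ℚ) * (partial (suc (suc N)) ν y - ι 2 * y * partial (suc N) ν y) ∎
    where
    open ≡-Reasoning
    p  = y ^ N
    P₊ = partial (suc N) (ν + 1ℚ) y
    P₋ = partial (suc N) (ν - 1ℚ) y
    c₊ = C (ν + 1ℚ) (suc N)
    c₋ = C (ν - 1ℚ) (suc N)

  partial-stable : ∀ n y i → partial (suc n ℕ.+ i) (ι n) y ≡ partial (suc n) (ι n) y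
  partial-stable n y zero    = cong (λ N → partial (suc N) (ι n) y) (ℕ.+-identityʳ n)
  partial-stable n y (suc i) = begin
    partial (suc (n ℕ.+ suc i)) (ι n) y      ≡⟨ cong (λ N → partial (suc N) (ι n) y) (ℕ.+-suc n i) ⟩
    partial (suc (n ℕ.+ i)) (ι n) y + pochhammer (- ι n) (suc (n ℕ.+ i)) * s * t * p
                                             ≡⟨ cong₂ (λ a b → a + b * s * t * p) (partial-stable n y i) (pochhammer-vanishes n i) ⟩
    partial (suc n) (ι n) y + 0ℚ * s * t * p ≡⟨ solve 4 (λ P s t p → P :+ ♯ 0 :* s :* t :* p := P) refl (partial (suc n) (ι n) y) s t p ⟩
    partial (suc n) (ι n) y                  ∎
    where
    open ≡-Reasoning
    s = pochhammer (ι n + 1ℚ) (suc (n ℕ.+ i))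
    t = 1/!² (suc (n ℕ.+ i))
    p = y ^ suc (n ℕ.+ i)

  legendreℚ : ℕ → ℚ → ℚ
  legendreℚ n x = ∑ (suc n) λ m → ₂F₁-coeff (- ι n) (ι (suc n)) m * (½ * (1ℚ - x)) ^ m

  legendreℚ≡partial : ∀ n x → legendreℚ n x ≡ partial (suc n) (ι n) (½ * (1ℚ - x))
  legendreℚ≡partial n x = ∑-cong (suc n) λ m → cong (λ b → ₂F₁-coeff (- ι n) b m * (½ * (1ℚ - x)) ^ m) (ι-suc n)

  legendreℚ-rec : ∀ n x → (ι (suc n) + 1ℚ) * legendreℚ (suc (suc n)) x
    ≡ (ι 2 * ι (suc n) + 1ℚ) * x * legendreℚ (suc n) x - ι (suc n) * legendreℚ n x
  legendreℚ-rec n x = begin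
    (ν + 1ℚ) * legendreℚ (suc (suc n)) x
      ≡⟨ cong ((ν + 1ℚ) *_) (trans (legendreℚ≡partial (suc (suc n)) x) (cong (λ m → partial (suc (suc (suc n))) m y) (ι-suc (suc n)))) ⟩
    (ν + 1ℚ) * L₊
      ≡⟨ solve 3 (λ ν a b → (ν :+ ♯ 1) :* a := ((ν :+ ♯ 1) :* a :+ ν :* b) :- ν :* b) refl ν L₊ L₋ ⟩
    ((ν + 1ℚ) * L₊ + ν * L₋) - ν * L₋
      ≡⟨ cong₂ (λ a b → a - ν * b) (partial-rec (suc (suc n)) ν y) (trans (cong (λ m → partial (suc (suc (suc n))) m y) ν-1)
           (trans (cong (λ N → partial N (ι n) y) (sym (ℕ.+-comm (suc n) 2))) (partial-stable n y 2))) ⟩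
    (ι 2 * ν + 1ℚ) * (partial (suc (suc (suc n))) ν y - ι 2 * y * L) - ν * partial (suc n) (ι n) y
      ≡⟨ cong (λ a → (ι 2 * ν + 1ℚ) * (a - ι 2 * y * L) - ν * partial (suc n) (ι n) y)
           (trans (cong (λ N → partial N ν y) (sym (ℕ.+-comm (suc (suc n)) 1))) (partial-stable (suc n) y 1)) ⟩
    (ι 2 * ν + 1ℚ) * (L - ι 2 * y * L) - ν * partial (suc n) (ι n) y
      ≡⟨ solve 4 (λ ν L y L₀ → (2 · ν :+ ♯ 1) :* (L :- 2 · y :* L) :- ν :* L₀ := (2 · ν :+ ♯ 1) :* (♯ 1 :- 2 · y) :* L :- ν :* L₀) refl ν L y (partial (suc n) (ι n) y) ⟩
    (ι 2 * ν + 1ℚ) * (1ℚ - ι 2 * y) * L - ν * partial (suc n) (ι n) y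
      ≡⟨ cong₂ (λ a b → (ι 2 * ν + 1ℚ) * a * L - ν * b) x≡ (sym (legendreℚ≡partial n x)) ⟩
    (ι 2 * ν + 1ℚ) * x * L - ν * legendreℚ n x
      ≡⟨ cong (λ a → (ι 2 * ν + 1ℚ) * x * a - ν * legendreℚ n x) (legendreℚ≡partial (suc n) x) ⟨
    (ι 2 * ν + 1ℚ) * x * legendreℚ (suc n) x - ν * legendreℚ n x ∎
    where
    open ≡-Reasoning
    ν = ι (suc n)
    y = ½ * (1ℚ - x)
    L₊ = partial (suc (suc (suc n))) (ν + 1ℚ) y
    L₋ = partial (suc (suc (suc n))) (ν - 1ℚ) y
    L  = partial (suc (suc n)) ν y
    ν-1 : ν - 1ℚ ≡ ι n
    ν-1 = trans (cong (_- 1ℚ) (ι-suc n)) (solve 1 (λ n → n :+ ♯ 1 :- ♯ 1 := n) refl (ι n))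
    x≡ : 1ℚ - ι 2 * y ≡ x
    -- To the solver ½ is a variable h; between the two calls 2 · ½ computes to 1.
    x≡ = trans (solve 2 (λ h x → ♯ 1 :- 2 · (h :* (♯ 1 :- x)) := ♯ 1 :- 2 · h :* (♯ 1 :- x)) refl ½ x)
      (solve 1 (λ x → ♯ 1 :- ♯ 1 :* (♯ 1 :- x) := x) refl x)

  legendreℚ-1 : ∀ x → legendreℚ 1 x ≡ x
  legendreℚ-1 x = trans (solve 2 (λ h x → ♯ 0 :+ ♯ 1 :* ♯ 1 :+ con -[1+ 1 ] :* (h :* (♯ 1 :- x) :* ♯ 1) := ♯ 1 :- 2 · h :* (♯ 1 :- x)) refl ½ x)
    (solve 1 (λ x → ♯ 1 :- ♯ 1 :* (♯ 1 :- x) := x) refl x)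

  -- Two consecutive indices are carried along because the recurrence has order two. Writing x z for
  -- X avoids a division by z.
  legendreℚ*z^n : ∀ n x z → legendreℚ n x * z ^ n ≡ Q (x * z) (z * z) n × legendreℚ (suc n) x * z ^ suc n ≡ Q (x * z) (z * z) (suc n)
  legendreℚ*z^n zero    x z = refl , (begin
    legendreℚ 1 x * (z * 1ℚ)   ≡⟨ cong (_* (z * 1ℚ)) (legendreℚ-1 x) ⟩
    x * (z * 1ℚ)               ≡⟨ solve 2 (λ x z → x :* (z :* ♯ 1) := ♯ 1 :* ((2 · ♯ 0 :+ ♯ 1) :* (x :* z) :* ♯ 1 :- ♯ 0 :* (z :* z) :* ♯ 0)) refl x z ⟩
    Q (x * z) (z * z) 1        ∎)
    where open ≡-Reasoning
  legendreℚ*z^n (suc n) x z = let h₀ , h₁ = legendreℚ*z^n n x z in h₁ , *-cancelˡ-≡ (ν + 1ℚ) (0<1+ι (suc n)) (begin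
    (ν + 1ℚ) * (legendreℚ (suc (suc n)) x * (z * (z * p)))
      ≡⟨ solve 4 (λ ν L z p → (ν :+ ♯ 1) :* (L :* (z :* (z :* p))) := (ν :+ ♯ 1) :* L :* (z :* (z :* p))) refl ν (legendreℚ (suc (suc n)) x) z p ⟩
    (ν + 1ℚ) * legendreℚ (suc (suc n)) x * (z * (z * p))
      ≡⟨ cong (_* (z * (z * p))) (legendreℚ-rec n x) ⟩
    ((ι 2 * ν + 1ℚ) * x * legendreℚ (suc n) x - ν * legendreℚ n x) * (z * (z * p))
      ≡⟨ solve 6 (λ ν x L L₀ z p → ((2 · ν :+ ♯ 1) :* x :* L :- ν :* L₀) :* (z :* (z :* p))
           := (2 · ν :+ ♯ 1) :* (x :* z) :* (L :* (z :* p)) :- ν :* (z :* z) :* (L₀ :* p)) refl ν x (legendreℚ (suc n) x) (legendreℚ n x) z p ⟩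
    (ι 2 * ν + 1ℚ) * (x * z) * (legendreℚ (suc n) x * (z * p)) - ν * (z * z) * (legendreℚ n x * p)
      ≡⟨ cong₂ (λ a b → (ι 2 * ν + 1ℚ) * (x * z) * a - ν * (z * z) * b) h₁ h₀ ⟩
    (ι 2 * ν + 1ℚ) * (x * z) * Q (x * z) (z * z) (suc n) - ν * (z * z) * Q (x * z) (z * z) n
      ≡⟨ Q-rec (x * z) (z * z) (suc n) ⟨
    (ν + 1ℚ) * Q (x * z) (z * z) (suc (suc n)) ∎)
    where
    open ≡-Reasoning
    ν = ι (suc n)
    p = z ^ n

-- Differential calculus on the rational unit interval.

module Differentiation where

  open import Data.Integer.Base using (ℤ; +_; -[1+_])
  open import Data.Rational.Base
  open Arithmetic
  open Sequences

  Unit : ℚ → Set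
  Unit x = 0ℚ ≤ x × x ≤ 1ℚ

  ∣p+q+r∣ : ∀ {p q r a b c} → ∣ p ∣ ≤ a → ∣ q ∣ ≤ b → ∣ r ∣ ≤ c → ∣ p + q + r ∣ ≤ a + b + c
  ∣p+q+r∣ {p} {q} {r} h₁ h₂ h₃ = ∣∣-+-≤ {p + q} (∣∣-+-≤ {p} h₁ h₂) h₃

  unit-dist : ∀ {x y} → Unit x → Unit y → ∣ y - x ∣ ≤ 1ℚ
  unit-dist {x} {y} (0≤x , x≤1) (0≤y , y≤1) = ∣∣-≤ {y - x}
    (≤-diff {y} {x} {1ℚ} (≤-add {y} {r = 1ℚ - y + x} (solve 2 (λ x y → y :+ (♯ 1 :- y :+ x) := ♯ 1 :+ x) refl x y) (0≤-+ (0≤-diff y≤1) 0≤x)))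
    (≤-add { - (y - x)} {r = 1ℚ - x + y} (solve 2 (λ x y → :- (y :- x) :+ (♯ 1 :- x :+ y) := ♯ 1) refl x y) (0≤-+ (0≤-diff x≤1) 0≤y))

  -- A uniform second-order bound in place of the ε-δ notion of derivative.
  record Derivative (f f′ : ℚ → ℚ) : Set where
    constructor derivative
    field
      B         : ℚ
      bounded   : ∀ {x} → Unit x → ∣ f x ∣ ≤ B
      bounded′  : ∀ {x} → Unit x → ∣ f′ x ∣ ≤ B
      remainder : ∀ {x y} → Unit x → Unit y → ∣ f y - f x - f′ x * (y - x) ∣ ≤ B * ((y - x) * (y - x))

    0≤B : 0ℚ ≤ B
    0≤B = 0≤∣∣-≤ {f 0ℚ} (bounded (ℚ.≤-refl , 0≤1))

    Lipschitz : ∀ {x y} → Unit x → Unit y → ∣ f y - f x ∣ ≤ ι 2 * B * ∣ y - x ∣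
    Lipschitz {x} {y} ux uy = begin
      ∣ f y - f x ∣
        ≡⟨ cong ∣_∣ (solve 3 (λ a b c → a :- b := (a :- b :- c) :+ c) refl (f y) (f x) (f′ x * h)) ⟩
      ∣ (f y - f x - f′ x * h) + f′ x * h ∣
        ≤⟨ ∣∣-+-≤ {f y - f x - f′ x * h} (remainder ux uy) (∣∣-*-≤ {f′ x} (bounded′ ux) ℚ.≤-refl) ⟩
      B * (h * h) + B * ∣ h ∣
        ≡⟨ cong (λ z → B * z + B * ∣ h ∣) (trans (sym (∣∣-nonNeg (0≤-² h))) (∣∣-* h h)) ⟩
      B * (∣ h ∣ * ∣ h ∣) + B * ∣ h ∣
        ≤⟨ ℚ.+-monoˡ-≤ (B * ∣ h ∣) (*-monoˡ 0≤B (subst (∣ h ∣ * ∣ h ∣ ≤_) (ℚ.*-identityˡ ∣ h ∣) (*-monoʳ (ℚ.0≤∣p∣ h) (unit-dist ux uy)))) ⟩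
      B * ∣ h ∣ + B * ∣ h ∣
        ≡⟨ solve 2 (λ B h → B :* h :+ B :* h := 2 · B :* h) refl B ∣ h ∣ ⟩
      ι 2 * B * ∣ h ∣ ∎
      where
      open ℚ.≤-Reasoning
      h = y - x

  open Derivative

  derivative-cong : ∀ {f g f′ g′} → (∀ {x} → Unit x → f x ≡ g x) → (∀ {x} → Unit x → f′ x ≡ g′ x) → Derivative f f′ → Derivative g g′
  derivative-cong e e′ d = derivative (B d)
    (λ {x} ux → subst (λ z → ∣ z ∣ ≤ B d) (e ux) (bounded d ux))
    (λ {x} ux → subst (λ z → ∣ z ∣ ≤ B d) (e′ ux) (bounded′ d ux))
    (λ {x} {y} ux uy → subst (_≤ B d * ((y - x) * (y - x)))
      (cong₂ (λ a b → ∣ a - b * (y - x) ∣) (cong₂ _-_ (e uy) (e ux)) (e′ ux)) (remainder d ux uy))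

  derivative-const : ∀ c → Derivative (λ _ → c) (λ _ → 0ℚ)
  derivative-const c = derivative ∣ c ∣ (λ _ → ℚ.≤-refl) (λ _ → ℚ.0≤∣p∣ c)
    (λ {x} {y} _ _ → subst (λ z → ∣ z ∣ ≤ ∣ c ∣ * ((y - x) * (y - x))) (solve 2 (λ c h → ♯ 0 := c :- c :- ♯ 0 :* h) refl c (y - x))
      (0≤-* (ℚ.0≤∣p∣ c) (0≤-² (y - x))))

  derivative-id : Derivative (λ x → x) (λ _ → 1ℚ)
  derivative-id = derivative 1ℚ (λ {x} (0≤x , x≤1) → subst (_≤ 1ℚ) (sym (∣∣-nonNeg 0≤x)) x≤1) (λ _ → ℚ.≤-refl)
    (λ {x} {y} _ _ → subst (λ z → ∣ z ∣ ≤ 1ℚ * ((y - x) * (y - x))) (solve 2 (λ x y → ♯ 0 := y :- x :- ♯ 1 :* (y :- x)) refl x y)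
      (0≤-* 0≤1 (0≤-² (y - x))))

  derivative-+ : ∀ {f g f′ g′} → Derivative f f′ → Derivative g g′ → Derivative (λ x → f x + g x) (λ x → f′ x + g′ x)
  derivative-+ {f} {g} {f′} {g′} d e = derivative (B d + B e)
    (λ {x} ux → ∣∣-+-≤ {f x} (bounded d ux) (bounded e ux))
    (λ {x} ux → ∣∣-+-≤ {f′ x} (bounded′ d ux) (bounded′ e ux))
    (λ {x} {y} ux uy → subst₂ (λ a b → ∣ a ∣ ≤ b)
      (solve 7 (λ fy fx f′ gy gx g′ h → (fy :- fx :- f′ :* h) :+ (gy :- gx :- g′ :* h) := (fy :+ gy) :- (fx :+ gx) :- (f′ :+ g′) :* h)
        refl (f y) (f x) (f′ x) (g y) (g x) (g′ x) (y - x))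
      (sym (ℚ.*-distribʳ-+ ((y - x) * (y - x)) (B d) (B e)))
      (∣∣-+-≤ {f y - f x - f′ x * (y - x)} (remainder d ux uy) (remainder e ux uy)))

  derivative-* : ∀ {f g f′ g′} → Derivative f f′ → Derivative g g′ → Derivative (λ x → f x * g x) (λ x → f′ x * g x + f x * g′ x)
  derivative-* {f} {g} {f′} {g′} d e = derivative (ι 4 * (b * c))
    (λ {x} ux → ℚ.≤-trans (∣∣-*-≤ {f x} (bounded d ux) (bounded e ux))
      (≤-add {r = ι 3 * (b * c)} (solve 1 (λ p → p :+ 3 · p := 4 · p) refl (b * c)) (0≤-* (0≤ι 3) 0≤bc)))
    (λ {x} ux → ℚ.≤-trans (∣∣-+-≤ {f′ x * g x} (∣∣-*-≤ {f′ x} (bounded′ d ux) (bounded e ux)) (∣∣-*-≤ {f x} (bounded d ux) (bounded′ e ux)))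
      (≤-add {r = ι 2 * (b * c)} (solve 1 (λ p → p :+ p :+ 2 · p := 4 · p) refl (b * c)) (0≤-* (0≤ι 2) 0≤bc)))
    (λ {x} {y} ux uy → let h = y - x in begin
      ∣ f y * g y - f x * g x - (f′ x * g x + f x * g′ x) * h ∣
        ≡⟨ cong ∣_∣ (solve 7 (λ fy fx f′ gy gx g′ h → fy :* gy :- fx :* gx :- (f′ :* gx :+ fx :* g′) :* h
             := fy :* (gy :- gx :- g′ :* h) :+ gx :* (fy :- fx :- f′ :* h) :+ (fy :- fx) :* (g′ :* h)) refl (f y) (f x) (f′ x) (g y) (g x) (g′ x) h) ⟩
      ∣ f y * (g y - g x - g′ x * h) + g x * (f y - f x - f′ x * h) + (f y - f x) * (g′ x * h) ∣
        ≤⟨ ∣p+q+r∣ {f y * (g y - g x - g′ x * h)} (∣∣-*-≤ {f y} (bounded d uy) (remainder e ux uy))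
             (∣∣-*-≤ {g x} (bounded e ux) (remainder d ux uy))
             (∣∣-*-≤ {f y - f x} (Lipschitz d ux uy) (∣∣-*-≤ {g′ x} (bounded′ e ux) ℚ.≤-refl)) ⟩
      b * (c * (h * h)) + c * (b * (h * h)) + ι 2 * b * ∣ h ∣ * (c * ∣ h ∣)
        ≡⟨ solve 4 (λ b c h² ∣h∣ → b :* (c :* h²) :+ c :* (b :* h²) :+ 2 · b :* ∣h∣ :* (c :* ∣h∣) := 2 · (b :* c) :* h² :+ 2 · (b :* c) :* (∣h∣ :* ∣h∣)) refl b c (h * h) ∣ h ∣ ⟩
      ι 2 * (b * c) * (h * h) + ι 2 * (b * c) * (∣ h ∣ * ∣ h ∣)
        ≡⟨ cong (λ z → ι 2 * (b * c) * (h * h) + ι 2 * (b * c) * z) (trans (sym (∣∣-* h h)) (∣∣-nonNeg (0≤-² h))) ⟩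
      ι 2 * (b * c) * (h * h) + ι 2 * (b * c) * (h * h)
        ≡⟨ solve 2 (λ p q → 2 · p :* q :+ 2 · p :* q := 4 · p :* q) refl (b * c) (h * h) ⟩
      ι 4 * (b * c) * (h * h) ∎)
    where
    open ℚ.≤-Reasoning
    b = B d
    c = B e
    0≤bc = 0≤-* (0≤B d) (0≤B e)

  derivative-recip : ∀ {f f′ g c} → (∀ {x} → Unit x → f x * g x ≡ 1ℚ) → (∀ {x} → Unit x → ∣ g x ∣ ≤ c) →
                     Derivative f f′ → Derivative g (λ x → - (f′ x * (g x * g x)))
  derivative-recip {f} {f′} {g} {c} inverse g≤c d = derivative (c + b * c² + (ι 2 * (b * b) * (c² * c) + b * c²))
    (λ ux → ℚ.≤-trans (g≤c ux) (≤-add {r = b * c² + (ι 2 * (b * b) * (c² * c) + b * c²)} (sym (ℚ.+-assoc c (b * c²) _)) (0≤-+ 0≤bc² (0≤-+ 0≤bbccc 0≤bc²))))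
    (λ {x} ux → ∣∣-neg-≤ {f′ x * (g x * g x)} (ℚ.≤-trans (∣∣-*-≤ {f′ x} (bounded′ d ux) (∣∣-*-≤ {g x} (g≤c ux) (g≤c ux)))
      (≤-add {r = c + (ι 2 * (b * b) * (c² * c) + b * c²)} (solve 3 (λ p q r → p :+ (q :+ r) := q :+ p :+ r) refl (b * c²) c _) (0≤-+ 0≤c (0≤-+ 0≤bbccc 0≤bc²)))))
    (λ {x} {y} ux uy → let h = y - x in begin
      ∣ g y - g x - - (f′ x * (g x * g x)) * h ∣
        ≡⟨ cong ∣_∣ (expand (f x) (f y) (g x) (g y) (f′ x) h (inverse ux) (inverse uy)) ⟩
      ∣ f′ x * h * ((f y - f x) * (g x * g x * g y)) - (f y - f x - f′ x * h) * (g x * g y) ∣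
        ≤⟨ ∣∣-minus-≤ {f′ x * h * ((f y - f x) * (g x * g x * g y))}
             (∣∣-*-≤ {f′ x * h} (∣∣-*-≤ {f′ x} (bounded′ d ux) ℚ.≤-refl)
               (∣∣-*-≤ {f y - f x} (Lipschitz d ux uy) (∣∣-*-≤ {g x * g x} (∣∣-*-≤ {g x} (g≤c ux) (g≤c ux)) (g≤c uy))))
             (∣∣-*-≤ {f y - f x - f′ x * h} (remainder d ux uy) (∣∣-*-≤ {g x} (g≤c ux) (g≤c uy))) ⟩
      b * ∣ h ∣ * (ι 2 * b * ∣ h ∣ * (c² * c)) + b * (h * h) * c²
        ≡⟨ solve 5 (λ b h c² c h² → b :* h :* (2 · b :* h :* (c² :* c)) :+ b :* h² :* c² := 2 · (b :* b) :* (c² :* c) :* (h :* h) :+ b :* c² :* h²) refl b ∣ h ∣ c² c (h * h) ⟩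
      ι 2 * (b * b) * (c² * c) * (∣ h ∣ * ∣ h ∣) + b * c² * (h * h)
        ≡⟨ cong (λ z → ι 2 * (b * b) * (c² * c) * z + b * c² * (h * h)) (trans (sym (∣∣-* h h)) (∣∣-nonNeg (0≤-² h))) ⟩
      ι 2 * (b * b) * (c² * c) * (h * h) + b * c² * (h * h)
        ≡⟨ ℚ.*-distribʳ-+ (h * h) (ι 2 * (b * b) * (c² * c)) (b * c²) ⟨
      (ι 2 * (b * b) * (c² * c) + b * c²) * (h * h)
        ≤⟨ *-monoʳ {ι 2 * (b * b) * (c² * c) + b * c²} (0≤-² h) (≤-add {ι 2 * (b * b) * (c² * c) + b * c²} (ℚ.+-comm (ι 2 * (b * b) * (c² * c) + b * c²) (c + b * c²)) (0≤-+ 0≤c 0≤bc²)) ⟩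
      (c + b * c² + (ι 2 * (b * b) * (c² * c) + b * c²)) * (h * h) ∎)
    where
    open ℚ.≤-Reasoning
    b = B d
    c² = c * c
    0≤c : 0ℚ ≤ c
    0≤c = 0≤∣∣-≤ {g 0ℚ} (g≤c (ℚ.≤-refl , 0≤1))
    0≤bc² : 0ℚ ≤ b * c²
    0≤bc² = 0≤-* (0≤B d) (0≤-* 0≤c 0≤c)
    0≤bbccc : 0ℚ ≤ ι 2 * (b * b) * (c² * c)
    0≤bbccc = 0≤-* (0≤-* (0≤ι 2) (0≤-* (0≤B d) (0≤B d))) (0≤-* (0≤-* 0≤c 0≤c) 0≤c)
    expand : ∀ fx fy gx gy f′ h → fx * gx ≡ 1ℚ → fy * gy ≡ 1ℚ →
      gy - gx - - (f′ * (gx * gx)) * h ≡ f′ * h * ((fy - fx) * (gx * gx * gy)) - (fy - fx - f′ * h) * (gx * gy)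
    expand fx fy gx gy f′ h ex ey = begin-equality
      gy - gx - - (f′ * (gx * gx)) * h
        ≡⟨ solve 4 (λ gx gy f′ h → gy :- gx :- :- (f′ :* (gx :* gx)) :* h := ♯ 1 :* gy :- gx :* ♯ 1 :+ f′ :* h :* (gx :* (gx :* ♯ 1))  :+ f′ :* h :* (gx :* gy :* (♯ 1 :- ♯ 1))) refl gx gy f′ h ⟩
      -- The ones on display, including a vanishing 1 - 1, are the places where f x · g x and f y ·
      -- g y are put in next.
      1ℚ * gy - gx * 1ℚ + f′ * h * (gx * (gx * 1ℚ)) + f′ * h * (gx * gy * (1ℚ - 1ℚ))
        ≡⟨ cong₂ (λ a b → a * gy - gx * b + f′ * h * (gx * (gx * b)) + f′ * h * (gx * gy * (1ℚ - a))) (sym ex) (sym ey) ⟩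
      fx * gx * gy - gx * (fy * gy) + f′ * h * (gx * (gx * (fy * gy))) + f′ * h * (gx * gy * (1ℚ - fx * gx))
        ≡⟨ solve 6 (λ fx fy gx gy f′ h → fx :* gx :* gy :- gx :* (fy :* gy) :+ f′ :* h :* (gx :* (gx :* (fy :* gy))) :+ f′ :* h :* (gx :* gy :* (♯ 1 :- fx :* gx))
             := f′ :* h :* ((fy :- fx) :* (gx :* gx :* gy)) :- (fy :- fx :- f′ :* h) :* (gx :* gy)) refl fx fy gx gy f′ h ⟩
      f′ * h * ((fy - fx) * (gx * gx * gy)) - (fy - fx - f′ * h) * (gx * gy) ∎

  derivative-scale : ∀ c {f f′} → Derivative f f′ → Derivative (λ x → c * f x) (λ x → c * f′ x)
  derivative-scale c {f} {f′} d = derivative-cong (λ _ → refl) (λ {x} _ → solve 3 (λ c f f′ → ♯ 0 :* f :+ c :* f′ := c :* f′) refl c (f x) (f′ x))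
    (derivative-* (derivative-const c) d)

  derivative-minus : ∀ {f g f′ g′} → Derivative f f′ → Derivative g g′ → Derivative (λ x → f x - g x) (λ x → f′ x - g′ x)
  derivative-minus {f} {g} {f′} {g′} d e = derivative-cong
    (λ {x} _ → solve 2 (λ a b → a :+ :- ♯ 1 :* b := a :- b) refl (f x) (g x))
    (λ {x} _ → solve 2 (λ a b → a :+ :- ♯ 1 :* b := a :- b) refl (f′ x) (g′ x))
    (derivative-+ d (derivative-scale (- 1ℚ) e))

  derivative-∑ : ∀ {f f′ : ℕ → ℚ → ℚ} n → (∀ i → Derivative (f i) (f′ i)) → Derivative (λ x → ∑ n (λ i → f i x)) (λ x → ∑ n (λ i → f′ i x))
  derivative-∑ zero    d = derivative-const 0ℚ
  derivative-∑ (suc n) d = derivative-+ (derivative-∑ n d) (d n)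

  -- In place of an intermediate point there are n+1 equal steps of length s. Each costs at most M s
  -- + B s², together M (y-x) + B (y-x)²/(n+1), and n is arbitrary.
  mean-value : ∀ {f f′ x y M} → Derivative f f′ → 0ℚ ≤ x → x ≤ y → y ≤ 1ℚ →
               (∀ {t} → x ≤ t → t ≤ y → ∣ f′ t ∣ ≤ M) → ∣ f y - f x ∣ ≤ M * (y - x)
  mean-value {f} {f′} {x} {y} {M} d 0≤x x≤y y≤1 f′≤M = ≤-limit (B d * (h * h)) λ n →
    subst₂ (λ a b → ∣ f a - f x ∣ ≤ b) (end n) (total n) (walk n (suc n) ℕ.≤-refl)
    where
    h = y - x
    0≤h : 0ℚ ≤ h
    0≤h = 0≤-diff x≤y
    module _ (n : ℕ) where
      r = + 1 / suc n
      s = h * r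
      0≤s : 0ℚ ≤ s
      0≤s = 0≤-* 0≤h (1/≥0 n)
      node : ℕ → ℚ
      node j = x + ι j * s
      end : node (suc n) ≡ y
      end = trans (solve 4 (λ x y i r → x :+ i :* ((y :- x) :* r) := x :+ (y :- x) :* (i :* r)) refl x y (ι (suc n)) r)
        (trans (cong (λ z → x + (y - x) * z) (ι*1/ n)) (solve 2 (λ x y → x :+ (y :- x) :* ♯ 1 := y) refl x y))
      x≤node : ∀ j → x ≤ node j
      x≤node j = ≤-add refl (0≤-* (0≤ι j) 0≤s)
      node≤y : ∀ {j} → j ℕ.≤ suc n → node j ≤ y
      node≤y {j} j≤ = subst (node j ≤_) end (ℚ.+-monoʳ-≤ x (*-monoʳ 0≤s (ι-mono j≤)))
      unit : ∀ {j} → j ℕ.≤ suc n → Unit (node j)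
      unit {j} j≤ = ℚ.≤-trans 0≤x (x≤node j) , ℚ.≤-trans (node≤y j≤) y≤1
      walk : ∀ j → j ℕ.≤ suc n → ∣ f (node j) - f x ∣ ≤ ι j * (M * s + B d * (s * s))
      walk zero j≤ = subst₂ (λ a b → ∣ a ∣ ≤ b)
        (trans (sym (ℚ.+-inverseʳ (f x))) (cong (λ z → f z - f x) (solve 2 (λ x s → x := x :+ ♯ 0 :* s) refl x s)))
        (sym (ℚ.*-zeroˡ (M * s + B d * (s * s)))) ℚ.≤-refl
      walk (suc j) j< = begin
        ∣ f b′ - f x ∣
          ≡⟨ cong ∣_∣ (solve 4 (λ fb fa fx t → fb :- fx := (fa :- fx) :+ t :+ (fb :- fa :- t)) refl (f b′) (f a) (f x) (f′ a * (b′ - a))) ⟩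
        ∣ (f a - f x) + f′ a * (b′ - a) + (f b′ - f a - f′ a * (b′ - a)) ∣
          ≤⟨ ∣p+q+r∣ {f a - f x} (walk j (ℕ.<⇒≤ j<))
               (∣∣-*-≤ {f′ a} (f′≤M (x≤node j) (node≤y (ℕ.<⇒≤ j<))) ℚ.≤-refl)
               (remainder d (unit (ℕ.<⇒≤ j<)) (unit j<)) ⟩
        ι j * (M * s + B d * (s * s)) + M * ∣ b′ - a ∣ + B d * ((b′ - a) * (b′ - a))
          ≡⟨ cong (λ z → ι j * (M * s + B d * (s * s)) + M * ∣ z ∣ + B d * (z * z)) step ⟩
        ι j * (M * s + B d * (s * s)) + M * ∣ s ∣ + B d * (s * s)
          ≡⟨ cong (λ z → ι j * (M * s + B d * (s * s)) + M * z + B d * (s * s)) (∣∣-nonNeg 0≤s) ⟩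
        ι j * (M * s + B d * (s * s)) + M * s + B d * (s * s)
          ≡⟨ solve 3 (λ j p q → j :* (p :+ q) :+ p :+ q := (j :+ ♯ 1) :* (p :+ q)) refl (ι j) (M * s) (B d * (s * s)) ⟩
        (ι j + 1ℚ) * (M * s + B d * (s * s))
          ≡⟨ cong (_* (M * s + B d * (s * s))) (ι-suc j) ⟨
        ι (suc j) * (M * s + B d * (s * s)) ∎
        where
        open ℚ.≤-Reasoning
        a = node j
        b′ = node (suc j)
        step : b′ - a ≡ s
        step = trans (cong (λ i → x + i * s - a) (ι-suc j)) (solve 3 (λ x j s → x :+ (j :+ ♯ 1) :* s :- (x :+ j :* s) := s) refl x (ι j) s)
      total : ι (suc n) * (M * s + B d * (s * s)) ≡ M * h + B d * (h * h) * r
      total = trans (solve 5 (λ i M h r b → i :* (M :* (h :* r) :+ b :* ((h :* r) :* (h :* r))) := (i :* r) :* (M :* h :+ b :* (h :* h) :* r)) refl (ι (suc n)) M h r (B d))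
        (trans (cong (_* (M * h + B d * (h * h) * r)) (ι*1/ n)) (ℚ.*-identityˡ _))

-- The functions X, Y of k and the derivative of q n along them.

module Curve where

  open import Data.Integer.Base using (ℤ; +_; -[1+_])
  open import Data.Rational.Base
  open Arithmetic
  open ThreeTermRecurrence
  open Differentiation

  infix 8 ⊖_

  ⊖_ : ℕ → ℤ
  ⊖ n = ℤ.- (+ n)

  -- Polynomials in k with integer coefficients, constant term first.
  Poly : Set
  Poly = List ℤ

  eval eval′ : Poly → ℚ → ℚ
  eval []      x = 0ℚ
  eval (a ∷ p) x = fromℤ a + x * eval p x

  eval′ []      x = 0ℚ
  eval′ (a ∷ p) x = eval p x + x * eval′ p x

  -- The recursion of `eval` repeated on solver expressions; both unfold in the same way, so a
  -- solved identity is literally one about `eval`.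
  evalₛ evalₛ′ : ∀ {n} → Poly → Polynomial n → Polynomial n
  evalₛ []      x = ♯ 0
  evalₛ (a ∷ p) x = con a :+ x :* evalₛ p x

  evalₛ′ []      x = ♯ 0
  evalₛ′ (a ∷ p) x = evalₛ p x :+ x :* evalₛ′ p x

  size : Poly → ℚ
  size []      = 0ℚ
  size (a ∷ p) = ∣ fromℤ a ∣ + size p

  eval-bounded : ∀ p {x} → Unit x → ∣ eval p x ∣ ≤ size p
  eval-bounded []      _  = ℚ.≤-refl
  eval-bounded (a ∷ p) {x} ux@(0≤x , x≤1) = ∣∣-+-≤ {fromℤ a} ℚ.≤-refl
    (subst (∣ x * eval p x ∣ ≤_) (ℚ.*-identityˡ (size p))
      (∣∣-*-≤ {x} (subst (_≤ 1ℚ) (sym (∣∣-nonNeg 0≤x)) x≤1) (eval-bounded p ux)))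

  0≤size : ∀ p → 0ℚ ≤ size p
  0≤size p = 0≤∣∣-≤ {eval p 0ℚ} (eval-bounded p (ℚ.≤-refl , 0≤1))

  eval-derivative : ∀ p → Derivative (eval p) (eval′ p)
  eval-derivative []      = derivative-const 0ℚ
  eval-derivative (a ∷ p) = derivative-cong (λ _ → refl)
    (λ {x} _ → solve 3 (λ x e e′ → ♯ 0 :+ (♯ 1 :* e :+ x :* e′) := e :+ x :* e′) refl x (eval p x) (eval′ p x))
    (derivative-+ (derivative-const (fromℤ a)) (derivative-* derivative-id (eval-derivative p)))

  -- `cₚ`, `Dₚ` and `Eₚ` are the factors of the numerator of the base, `wₚ` is the cubed factor of
  -- its denominator, and `Aₚ` is the numerator of the Legendre argument.
  cₚ Dₚ Eₚ wₚ Aₚ : Poly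
  cₚ = + 1 ∷ + 1 ∷ + 1 ∷ []
  Dₚ = + 1 ∷ ⊖ 2 ∷ ⊖ 2 ∷ []
  Eₚ = + 1 ∷ ⊖ 2 ∷ + 4 ∷ []
  wₚ = + 1 ∷ + 2 ∷ []
  Aₚ = + 1 ∷ ⊖ 4 ∷ + 6 ∷ ⊖ 4 ∷ + 10 ∷ []

  c D E w A t : ℚ → ℚ
  c = eval cₚ
  D = eval Dₚ
  E = eval Eₚ
  w = eval wₚ
  A = eval Aₚ
  t k = k * (1ℚ - k)

  -- z is the base of the series and X / z the argument of its Legendre polynomials.
  v e u ρ X z Y : ℚ → ℚ
  v k = inv (w k)
  e k = inv (E k)
  u k = inv (c k)
  ρ k = c k * (v k * (v k * v k))
  X k = ρ k * A k
  z k = ρ k * (D k * E k)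
  Y k = z k * z k

  1≤c : ∀ {k} → 0ℚ ≤ k → 1ℚ ≤ c k
  1≤c {k} 0≤k = ≤-add {r = k + k * k} (solve 1 (λ k → ♯ 1 :+ (k :+ k :* k) := evalₛ cₚ k) refl k) (0≤-+ 0≤k (0≤-² k))

  1≤w : ∀ {k} → 0ℚ ≤ k → 1ℚ ≤ w k
  1≤w {k} 0≤k = ≤-add {r = ι 2 * k} (solve 1 (λ k → ♯ 1 :+ 2 · k := evalₛ wₚ k) refl k) (0≤-* (0≤ι 2) 0≤k)

  1≤4E : ∀ k → 1ℚ ≤ E k * ι 4
  1≤4E k = ≤-add {r = ι 2 + (ι 4 * k - 1ℚ) * (ι 4 * k - 1ℚ)}
    (solve 1 (λ k → ♯ 1 :+ (♯ 2 :+ (4 · k :- ♯ 1) :* (4 · k :- ♯ 1)) := evalₛ Eₚ k :* ♯ 4) refl k)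
    (0≤-+ (0≤ι 2) (0≤-² (ι 4 * k - 1ℚ)))

  0<c : ∀ {k} → 0ℚ ≤ k → 0ℚ < c k
  0<c 0≤k = ℚ.<-≤-trans Rational.0<1 (1≤c 0≤k)

  0<w : ∀ {k} → 0ℚ ≤ k → 0ℚ < w k
  0<w 0≤k = ℚ.<-≤-trans Rational.0<1 (1≤w 0≤k)

  0<E : ∀ k → 0ℚ < E k
  0<E k = ℚ.*-cancelʳ-<-nonNeg (ι 4) {{nonNegative (0≤ι 4)}}
    (subst (_< E k * ι 4) (sym (ℚ.*-zeroˡ (ι 4))) (ℚ.<-≤-trans Rational.0<1 (1≤4E k)))

  wv : ∀ {k} → 0ℚ ≤ k → w k * v k ≡ 1ℚ
  wv 0≤k = *-inv (0<w 0≤k)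

  cu : ∀ {k} → 0ℚ ≤ k → c k * u k ≡ 1ℚ
  cu 0≤k = *-inv (0<c 0≤k)

  Ee : ∀ k → E k * e k ≡ 1ℚ
  Ee k = *-inv (0<E k)

  0≤v : ∀ {k} → 0ℚ ≤ k → 0ℚ ≤ v k
  0≤v 0≤k = inv-0≤ (0<w 0≤k)

  0≤u : ∀ {k} → 0ℚ ≤ k → 0ℚ ≤ u k
  0≤u 0≤k = inv-0≤ (0<c 0≤k)

  0≤e : ∀ k → 0ℚ ≤ e k
  0≤e k = inv-0≤ (0<E k)

  v≤1 : ∀ {k} → 0ℚ ≤ k → v k ≤ 1ℚ
  v≤1 {k} 0≤k = inv-≤ (0<w 0≤k) (subst (1ℚ ≤_) (sym (ℚ.*-identityʳ (w k))) (1≤w 0≤k))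

  u≤1 : ∀ {k} → 0ℚ ≤ k → u k ≤ 1ℚ
  u≤1 {k} 0≤k = inv-≤ (0<c 0≤k) (subst (1ℚ ≤_) (sym (ℚ.*-identityʳ (c k))) (1≤c 0≤k))

  e≤4 : ∀ k → e k ≤ ι 4
  e≤4 k = inv-≤ (0<E k) (1≤4E k)

  ∣v∣≤1 : ∀ {k} → Unit k → ∣ v k ∣ ≤ 1ℚ
  ∣v∣≤1 (0≤k , _) = subst (_≤ 1ℚ) (sym (∣∣-nonNeg (0≤v 0≤k))) (v≤1 0≤k)

  ∣u∣≤1 : ∀ {k} → Unit k → ∣ u k ∣ ≤ 1ℚ
  ∣u∣≤1 (0≤k , _) = subst (_≤ 1ℚ) (sym (∣∣-nonNeg (0≤u 0≤k))) (u≤1 0≤k)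

  ∣e∣≤4 : ∀ {k} → Unit k → ∣ e k ∣ ≤ ι 4
  ∣e∣≤4 {k} _ = subst (_≤ ι 4) (sym (∣∣-nonNeg (0≤e k))) (e≤4 k)

  v′ e′ u′ ρ′ X′ z′ Y′ : ℚ → ℚ
  v′ k = - (eval′ wₚ k * (v k * v k))
  e′ k = - (eval′ Eₚ k * (e k * e k))
  u′ k = - (eval′ cₚ k * (u k * u k))
  ρ′ k = eval′ cₚ k * (v k * (v k * v k)) + c k * (v′ k * (v k * v k) + v k * (v′ k * v k + v k * v′ k))
  X′ k = ρ′ k * A k + ρ k * eval′ Aₚ k
  z′ k = ρ′ k * (D k * E k) + ρ k * (eval′ Dₚ k * E k + D k * eval′ Eₚ k)
  Y′ k = z′ k * z k + z k * z′ k

  v-derivative : Derivative v v′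
  v-derivative = derivative-recip (λ (0≤k , _) → wv 0≤k) ∣v∣≤1 (eval-derivative wₚ)

  e-derivative : Derivative e e′
  e-derivative = derivative-recip (λ {k} _ → Ee k) ∣e∣≤4 (eval-derivative Eₚ)

  u-derivative : Derivative u u′
  u-derivative = derivative-recip (λ (0≤k , _) → cu 0≤k) ∣u∣≤1 (eval-derivative cₚ)

  ρ-derivative : Derivative ρ ρ′
  ρ-derivative = derivative-* (eval-derivative cₚ) (derivative-* v-derivative (derivative-* v-derivative v-derivative))

  X-derivative : Derivative X X′
  X-derivative = derivative-* ρ-derivative (eval-derivative Aₚ)

  z-derivative : Derivative z z′
  z-derivative = derivative-* ρ-derivative (derivative-* (eval-derivative Dₚ) (eval-derivative Eₚ))

  Y-derivative : Derivative Y Y′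
  Y-derivative = derivative-* z-derivative z-derivative

  q q₋ q′ q₋′ : ℕ → ℚ → ℚ
  q n k  = Q (X k) (Y k) n
  q₋ n k = Q₋ (X k) (Y k) n

  q′ zero    k = 0ℚ
  q′ (suc n) k = (+ 1 / suc n) * (((ι 2 * ι n + 1ℚ) * X′ k * q n k + (ι 2 * ι n + 1ℚ) * X k * q′ n k)
                                 - (ι n * Y′ k * q₋ n k + ι n * Y k * q₋′ n k))

  q₋′ zero    k = 0ℚ
  q₋′ (suc n) k = q′ n k

  q-derivative : ∀ n → Derivative (q n) (q′ n)
  q₋-derivative : ∀ n → Derivative (q₋ n) (q₋′ n)

  q-derivative zero    = derivative-const 1ℚ
  q-derivative (suc n) = derivative-scale (+ 1 / suc n) (derivative-minus
    (derivative-* (derivative-scale (ι 2 * ι n + 1ℚ) X-derivative) (q-derivative n))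
    (derivative-* (derivative-scale (ι n) Y-derivative) (q₋-derivative n)))

  q₋-derivative zero    = derivative-const 0ℚ
  q₋-derivative (suc n) = q-derivative n

  -- The vector field t d/dk acts on (X, Y) as the dilation by a plus the translation by β
  -- of both roots of T² - 2XT + Y; this is how it differentiates q n.
  a β : ℚ → ℚ
  a k = ι 2 * (1ℚ - ι 2 * k) + t k * (w k * u k - ι 6 * v k)
  β k = - (ι 2 * z k)

  -- The solver treats the reciprocals `v` and `u` as free variables. Their relation to the
  -- polynomials is brought in by displaying a factor 1 and replacing it, here by c u; the same
  -- device recurs in all identities with reciprocals.
  tX′ : ∀ {k} → 0ℚ ≤ k → t k * X′ k ≡ a k * X k + β k
  tX′ {k} 0≤k = begin
    t k * X′ k
      ≡⟨ solve 2 (λ k v → let w = evalₛ wₚ k; c = evalₛ cₚ k; A = evalₛ Aₚ k; ρ = c :* (v :* (v :* v))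
                              v′ = :- (evalₛ′ wₚ k :* (v :* v))
                              ρ′ = evalₛ′ cₚ k :* (v :* (v :* v)) :+ c :* (v′ :* (v :* v) :+ v :* (v′ :* v :+ v :* v′)) in
           k :* (♯ 1 :- k) :* (ρ′ :* A :+ ρ :* evalₛ′ Aₚ k)
           := (2 · (♯ 1 :- 2 · k) :- k :* (♯ 1 :- k) :* 6 · v) :* (ρ :* A) :+ :- (2 · (ρ :* (evalₛ Dₚ k :* evalₛ Eₚ k)))
                :+ k :* (♯ 1 :- k) :* w :* (v :* (v :* v)) :* ♯ 1 :* A) refl k (v k) ⟩
    (ι 2 * (1ℚ - ι 2 * k) - t k * (ι 6 * v k)) * X k + β k + t k * w k * (v k * (v k * v k)) * 1ℚ * A k
      ≡⟨ cong (λ x → (ι 2 * (1ℚ - ι 2 * k) - t k * (ι 6 * v k)) * X k + β k + t k * w k * (v k * (v k * v k)) * x * A k) (cu 0≤k) ⟨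
    (ι 2 * (1ℚ - ι 2 * k) - t k * (ι 6 * v k)) * X k + β k + t k * w k * (v k * (v k * v k)) * (c k * u k) * A k
      ≡⟨ solve 8 (λ g t v w u c A β → (g :- t :* (6 · v)) :* (c :* (v :* (v :* v)) :* A) :+ β :+ t :* w :* (v :* (v :* v)) :* (c :* u) :* A
           := (g :+ t :* (w :* u :- 6 · v)) :* (c :* (v :* (v :* v)) :* A) :+ β) refl (ι 2 * (1ℚ - ι 2 * k)) (t k) (v k) (w k) (u k) (c k) (A k) (β k) ⟩
    a k * X k + β k ∎
    where open ≡-Reasoning

  tz′ : ∀ {k} → 0ℚ ≤ k → t k * z′ k ≡ a k * z k - ι 2 * X k
  tz′ {k} 0≤k = begin
    t k * z′ k
      ≡⟨ solve 2 (λ k v → let w = evalₛ wₚ k; c = evalₛ cₚ k; D = evalₛ Dₚ k; E = evalₛ Eₚ k; ρ = c :* (v :* (v :* v))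
                              v′ = :- (evalₛ′ wₚ k :* (v :* v))
                              ρ′ = evalₛ′ cₚ k :* (v :* (v :* v)) :+ c :* (v′ :* (v :* v) :+ v :* (v′ :* v :+ v :* v′)) in
           k :* (♯ 1 :- k) :* (ρ′ :* (D :* E) :+ ρ :* (evalₛ′ Dₚ k :* E :+ D :* evalₛ′ Eₚ k))
           := (2 · (♯ 1 :- 2 · k) :- k :* (♯ 1 :- k) :* 6 · v) :* (ρ :* (D :* E)) :- 2 · (ρ :* evalₛ Aₚ k)
                :+ k :* (♯ 1 :- k) :* w :* (v :* (v :* v)) :* ♯ 1 :* (D :* E)) refl k (v k) ⟩
    (ι 2 * (1ℚ - ι 2 * k) - t k * (ι 6 * v k)) * z k - ι 2 * X k + t k * w k * (v k * (v k * v k)) * 1ℚ * (D k * E k)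
      ≡⟨ cong (λ x → (ι 2 * (1ℚ - ι 2 * k) - t k * (ι 6 * v k)) * z k - ι 2 * X k + t k * w k * (v k * (v k * v k)) * x * (D k * E k)) (cu 0≤k) ⟨
    (ι 2 * (1ℚ - ι 2 * k) - t k * (ι 6 * v k)) * z k - ι 2 * X k + t k * w k * (v k * (v k * v k)) * (c k * u k) * (D k * E k)
      ≡⟨ solve 8 (λ g t v w u c A β → (g :- t :* (6 · v)) :* (c :* (v :* (v :* v)) :* A) :- β :+ t :* w :* (v :* (v :* v)) :* (c :* u) :* A
           := (g :+ t :* (w :* u :- 6 · v)) :* (c :* (v :* (v :* v)) :* A) :- β) refl (ι 2 * (1ℚ - ι 2 * k)) (t k) (v k) (w k) (u k) (c k) (D k * E k) (ι 2 * X k) ⟩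
    a k * z k - ι 2 * X k ∎
    where open ≡-Reasoning

  tq′ : ∀ n {k} → 0ℚ ≤ k → t k * q′ n k ≡ ι n * (a k * q n k + β k * q₋ n k)
  -- `tq′` at n-1, with q (n-2) removed by running the recurrence backwards. The factor n Y spares
  -- the division by Y and makes n = 0 trivial.
  tq₋′ : ∀ n {k} → 0ℚ ≤ k → ι n * Y k * (t k * q₋′ n k)
       ≡ ι n * (a k * (ι n - 1ℚ) * Y k * q₋ n k + β k * ((ι 2 * ι n - 1ℚ) * X k * q₋ n k - ι n * q n k))

  tq′ zero    {k} 0≤k = solve 2 (λ t x → t :* ♯ 0 := ♯ 0 :* x) refl (t k) (a k * 1ℚ + β k * 0ℚ)
  tq′ (suc n) {k} 0≤k = begin
    tk * (r * ((2n+1 * X′ k * q n k + 2n+1 * X k * q′ n k) - (ν * Y′ k * q₋ n k + ν * Y k * q₋′ n k)))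
      ≡⟨ solve 11 (λ t r o X′ q X q′ ν Y′ p s → t :* (r :* ((o :* X′ :* q :+ o :* X :* q′) :- (ν :* Y′ :* p :+ s)))
           := r :* ((o :* (t :* X′) :* q :+ o :* X :* (t :* q′)) :- (ν :* (t :* Y′) :* p :+ t :* s))) refl
           tk r 2n+1 (X′ k) (q n k) (X k) (q′ n k) ν (Y′ k) (q₋ n k) (ν * Y k * q₋′ n k) ⟩
    r * ((2n+1 * (tk * X′ k) * q n k + 2n+1 * X k * (tk * q′ n k)) - (ν * (tk * Y′ k) * q₋ n k + tk * (ν * Y k * q₋′ n k)))
      ≡⟨ cong₂ (λ x y → r * ((2n+1 * x * q n k + 2n+1 * X k * (tk * q′ n k)) - (ν * (tk * Y′ k) * q₋ n k + y))) (tX′ 0≤k)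
           (trans (solve 4 (λ t ν Y p → t :* (ν :* Y :* p) := ν :* Y :* (t :* p)) refl tk ν (Y k) (q₋′ n k)) (tq₋′ n 0≤k)) ⟩
    r * ((2n+1 * (a k * X k + β k) * q n k + 2n+1 * X k * (tk * q′ n k)) - (ν * (tk * Y′ k) * q₋ n k + R))
      ≡⟨ cong₂ (λ x y → r * ((2n+1 * (a k * X k + β k) * q n k + 2n+1 * X k * x) - (ν * y * q₋ n k + R))) (tq′ n 0≤k) tY′ ⟩
    r * ((2n+1 * (a k * X k + β k) * q n k + 2n+1 * X k * (ν * (a k * q n k + β k * q₋ n k))) - (ν * (ι 2 * a k * Y k + ι 2 * β k * X k) * q₋ n k + R))
      ≡⟨ solve 8 (λ r ν a β X Y q p → let o = 2 · ν :+ ♯ 1 in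
           r :* ((o :* (a :* X :+ β) :* q :+ o :* X :* (ν :* (a :* q :+ β :* p)))
             :- (ν :* (2 · a :* Y :+ 2 · β :* X) :* p :+ ν :* (a :* (ν :- ♯ 1) :* Y :* p :+ β :* ((2 · ν :- ♯ 1) :* X :* p :- ν :* q))))
           := (ν :+ ♯ 1) :* (a :* (r :* (o :* X :* q :- ν :* Y :* p)) :+ (r :* (ν :+ ♯ 1)) :* (β :* q))) refl r ν (a k) (β k) (X k) (Y k) (q n k) (q₋ n k) ⟩
    (ν + 1ℚ) * (a k * q (suc n) k + (r * (ν + 1ℚ)) * (β k * q n k))
      ≡⟨ cong₂ (λ x y → x * (a k * q (suc n) k + y)) (sym (ι-suc n))
           (trans (cong (_* (β k * q n k)) (trans (trans (ℚ.*-comm r (ν + 1ℚ)) (cong (_* r) (sym (ι-suc n)))) (ι*1/ n))) (ℚ.*-identityˡ (β k * q n k))) ⟩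
    ι (suc n) * (a k * q (suc n) k + β k * q n k) ∎
    where
    open ≡-Reasoning
    tk = t k
    r = + 1 / suc n
    ν = ι n
    2n+1 = ι 2 * ν + 1ℚ
    R = ν * (a k * (ν - 1ℚ) * Y k * q₋ n k + β k * ((ι 2 * ν - 1ℚ) * X k * q₋ n k - ν * q n k))
    tY′ : tk * Y′ k ≡ ι 2 * a k * Y k + ι 2 * β k * X k
    tY′ = trans (solve 3 (λ t z z′ → t :* (z′ :* z :+ z :* z′) := 2 · z :* (t :* z′)) refl tk (z k) (z′ k))
      (trans (cong (ι 2 * z k *_) (tz′ 0≤k))
        (solve 3 (λ z a X → 2 · z :* (a :* z :- 2 · X) := 2 · a :* (z :* z) :+ 2 · (:- (2 · z)) :* X) refl (z k) (a k) (X k)))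

  tq₋′ zero    {k} 0≤k = solve 3 (λ Y t x → ♯ 0 :* Y :* (t :* ♯ 0) := ♯ 0 :* x) refl (Y k) (t k)
    (a k * (0ℚ - 1ℚ) * Y k * 0ℚ + β k * ((ι 2 * 0ℚ - 1ℚ) * X k * 0ℚ - 0ℚ * 1ℚ))
  tq₋′ (suc n) {k} 0≤k = begin
    ι (suc n) * Y k * (t k * q′ n k)
      ≡⟨ cong₂ (λ m x → m * Y k * x) (ι-suc n) (tq′ n 0≤k) ⟩
    (ν + 1ℚ) * Y k * (ν * (a k * q n k + β k * q₋ n k))
      ≡⟨ solve 7 (λ ν Y a β q p X → (ν :+ ♯ 1) :* Y :* (ν :* (a :* q :+ β :* p))
           := (ν :+ ♯ 1) :* (a :* (ν :+ ♯ 1 :- ♯ 1) :* Y :* q :+ β :* ((2 · (ν :+ ♯ 1) :- ♯ 1) :* X :* q :- ((2 · ν :+ ♯ 1) :* X :* q :- ν :* Y :* p)))) refl ν (Y k) (a k) (β k) (q n k) (q₋ n k) (X k) ⟩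
    (ν + 1ℚ) * (a k * (ν + 1ℚ - 1ℚ) * Y k * q n k + β k * ((ι 2 * (ν + 1ℚ) - 1ℚ) * X k * q n k - ((ι 2 * ν + 1ℚ) * X k * q n k - ν * Y k * q₋ n k)))
      ≡⟨ cong (λ x → (ν + 1ℚ) * (a k * (ν + 1ℚ - 1ℚ) * Y k * q n k + β k * ((ι 2 * (ν + 1ℚ) - 1ℚ) * X k * q n k - x))) (Q-rec (X k) (Y k) n) ⟨
    (ν + 1ℚ) * (a k * (ν + 1ℚ - 1ℚ) * Y k * q n k + β k * ((ι 2 * (ν + 1ℚ) - 1ℚ) * X k * q n k - (ν + 1ℚ) * q (suc n) k))
      ≡⟨ cong (λ m → m * (a k * (m - 1ℚ) * Y k * q n k + β k * ((ι 2 * m - 1ℚ) * X k * q n k - m * q (suc n) k))) (ι-suc n) ⟨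
    ι (suc n) * (a k * (ι (suc n) - 1ℚ) * Y k * q n k + β k * ((ι 2 * ι (suc n) - 1ℚ) * X k * q n k - ι (suc n) * q (suc n) k)) ∎
    where
    open ≡-Reasoning
    ν = ι n

-- The telescoping certificate and the constancy of R.

module Telescoping where

  open import Data.Integer.Base using (ℤ; +_; -[1+_])
  open import Data.Rational.Base
  open Arithmetic
  open Hypergeometric
  open Sequences
  open ThreeTermRecurrence
  open Differentiation
  open Curve

  -- The coefficients C₃, …, C₀ of the series, multiplied by c.
  C₃ₚ C₂ₚ C₁ₚ C₀ₚ : Poly
  C₃ₚ = + 0 ∷ + 0 ∷ + 729 ∷ + 1458 ∷ + 2025 ∷ + 324 ∷ ⊖ 2340 ∷ ⊖ 4104 ∷ ⊖ 2700 ∷ + 144 ∷ + 2160 ∷ + 1728 ∷ + 576 ∷ []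
  C₂ₚ = + 0 ∷ ⊖ 243 ∷ + 486 ∷ ⊖ 270 ∷ ⊖ 81 ∷ ⊖ 2106 ∷ ⊖ 4050 ∷ ⊖ 6156 ∷ ⊖ 3564 ∷ + 2592 ∷ + 6480 ∷ + 5184 ∷ + 1728 ∷ []
  C₁ₚ = + 9 ∷ ⊖ 135 ∷ + 405 ∷ ⊖ 188 ∷ + 270 ∷ ⊖ 498 ∷ ⊖ 1170 ∷ ⊖ 2556 ∷ ⊖ 1560 ∷ + 2256 ∷ + 4608 ∷ + 3840 ∷ + 1280 ∷ []
  C₀ₚ = + 2 ∷ ⊖ 26 ∷ + 78 ∷ ⊖ 52 ∷ + 48 ∷ ⊖ 72 ∷ ⊖ 168 ∷ ⊖ 432 ∷ ⊖ 288 ∷ + 448 ∷ + 896 ∷ + 768 ∷ + 256 ∷ []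

  C C′ : ℚ → ℚ → ℚ
  C ν k  = eval C₃ₚ k * ν ^ 3 + eval C₂ₚ k * ν ^ 2 + eval C₁ₚ k * ν + eval C₀ₚ k
  C′ ν k = eval′ C₃ₚ k * ν ^ 3 + eval′ C₂ₚ k * ν ^ 2 + eval′ C₁ₚ k * ν + eval′ C₀ₚ k

  C-derivative : ∀ ν → Derivative (C ν) (C′ ν)
  C-derivative ν = derivative-+ (derivative-+ (derivative-+ (times C₃ₚ (ν ^ 3)) (times C₂ₚ (ν ^ 2))) (times C₁ₚ ν)) (eval-derivative C₀ₚ)
    where
    times : ∀ p s → Derivative (λ k → eval p k * s) (λ k → eval′ p k * s)
    times p s = derivative-cong (λ _ → refl) (λ {k} _ → solve 3 (λ p′ s p → p′ :* s :+ p :* ♯ 0 := p′ :* s) refl (eval′ p k) s (eval p k))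
      (derivative-* (eval-derivative p) (derivative-const s))

  -- `C` carries an extra factor c, which `u` removes; v⁴ e is the division by (1+2k)⁴(1-2k+4k²).
  g g′ f f′ : ℕ → ℚ → ℚ
  g n k  = v k * (v k * (v k * v k)) * (e k * u k) * C (ι n) k
  g′ n k = ((v′ k * (v k * (v k * v k)) + v k * (v′ k * (v k * v k) + v k * (v′ k * v k + v k * v′ k))) * (e k * u k)
           + v k * (v k * (v k * v k)) * (e′ k * u k + e k * u′ k)) * C (ι n) k
           + v k * (v k * (v k * v k)) * (e k * u k) * C′ (ι n) k
  f n k  = α n * (q n k * g n k)
  f′ n k = α n * (q′ n k * g n k + q n k * g′ n k)

  g-derivative : ∀ n → Derivative (g n) (g′ n)
  g-derivative n = derivative-* (derivative-* (derivative-* v-derivative (derivative-* v-derivative (derivative-* v-derivative v-derivative)))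
    (derivative-* e-derivative u-derivative)) (C-derivative (ι n))

  f-derivative : ∀ n → Derivative (f n) (f′ n)
  f-derivative n = derivative-scale (α n) (derivative-* (q-derivative n) (g-derivative n))

  p₀ₚ p₁ₚ r₀ₚ r₁ₚ r₂ₚ : Poly
  p₀ₚ = + 18 ∷ ⊖ 81 ∷ ⊖ 27 ∷ ⊖ 162 ∷ + 198 ∷ + 144 ∷ + 792 ∷ + 288 ∷ + 288 ∷ []
  p₁ₚ = + 0 ∷ ⊖ 81 ∷ + 81 ∷ ⊖ 234 ∷ ⊖ 126 ∷ ⊖ 288 ∷ + 72 ∷ + 288 ∷ + 288 ∷ []
  r₀ₚ = + 0 ∷ ⊖ 18 ∷ + 90 ∷ ⊖ 72 ∷ + 0 ∷ ⊖ 180 ∷ ⊖ 36 ∷ + 72 ∷ + 144 ∷ []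
  r₁ₚ = ⊖ 18 ∷ ⊖ 99 ∷ + 333 ∷ ⊖ 450 ∷ ⊖ 288 ∷ ⊖ 1152 ∷ ⊖ 504 ∷ + 144 ∷ + 576 ∷ []
  r₂ₚ = + 0 ∷ + 81 ∷ + 729 ∷ + 234 ∷ + 36 ∷ ⊖ 972 ∷ ⊖ 612 ∷ + 72 ∷ + 432 ∷ []

  p r : ℚ → ℚ → ℚ
  p ν k = eval p₀ₚ k + ν * eval p₁ₚ k
  r ν k = eval r₀ₚ k + ν * (eval r₁ₚ k + ν * eval r₂ₚ k)

  -- The telescoping certificate. It was found by solving the linear system
  -- t f′ n = γ (n+1) - γ n for polynomials p and r in n.
  γ : ℕ → ℚ → ℚ
  γ n k = α n * (ι n * ι n) * (D k * v k) * ((e k * e k) * (u k * u k) * (ι n * p (ι n) k) * q n k + (v k * v k) * (v k * v k) * r (ι n) k * q₋ n k)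

  -- `Θ` and `Ξ` are t f′ n and 9(γ (n+1) - γ n) with α n · V · v e u taken out. The letters q and P
  -- stand for q n and ρ q (n-1), which may be regarded as independent variables, so `certificate`
  -- is a polynomial identity.
  Θ : (k ν q P C C′ : ℚ) → ℚ
  Θ k ν q P C C′ = C′ * (t k * w k * c k * E k * q) + C * (w k * c k * E k * (ι 2 * (ν * ((1ℚ - ι 2 * k) * q - D k * E k * P))))
    + C * q * t k * ((ν - 1ℚ) * w k * w k * E k - (ι 3 * ν + ι 4) * (ι 2 * (c k * E k)) - eval′ Eₚ k * w k * c k)

  Ξ : (k ν q P : ℚ) → ℚ
  Ξ k ν q P = (ι 9 * (ν * ν) + ι 9 * ν + ι 2) * (c k * D k)
      * (((ι 2 * ν + 1ℚ) * A k * q - ν * (D k * D k * (E k * E k)) * P) * (w k * p (ν + 1ℚ) k) + c k * (E k * E k) * r (ν + 1ℚ) k * q)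
    - ι 9 * (ν * ν) * (w k * w k * w k * D k) * (ν * q * (w k * p ν k) + c k * (E k * E k) * r ν k * P)

  Cₛ Cₛ′ pₛ rₛ : ∀ {n} → Polynomial n → Polynomial n → Polynomial n
  Cₛ ν k  = evalₛ C₃ₚ k :* ν :^ 3 :+ evalₛ C₂ₚ k :* ν :^ 2 :+ evalₛ C₁ₚ k :* ν :+ evalₛ C₀ₚ k
  Cₛ′ ν k = evalₛ′ C₃ₚ k :* ν :^ 3 :+ evalₛ′ C₂ₚ k :* ν :^ 2 :+ evalₛ′ C₁ₚ k :* ν :+ evalₛ′ C₀ₚ k
  pₛ ν k = evalₛ p₀ₚ k :+ ν :* evalₛ p₁ₚ k
  rₛ ν k = evalₛ r₀ₚ k :+ ν :* (evalₛ r₁ₚ k :+ ν :* evalₛ r₂ₚ k)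

  certificate : ∀ k ν q P → ι 9 * Θ k ν q P (C ν k) (C′ ν k) ≡ Ξ k ν q P
  certificate = solve 4 (λ k ν q P →
    let c = evalₛ cₚ k; D = evalₛ Dₚ k; E = evalₛ Eₚ k; w = evalₛ wₚ k; A = evalₛ Aₚ k; t = k :* (♯ 1 :- k)
        C = Cₛ ν k; C′ = Cₛ′ ν k in
    9 · (C′ :* (t :* w :* c :* E :* q) :+ C :* (w :* c :* E :* (2 · (ν :* ((♯ 1 :- 2 · k) :* q :- D :* E :* P))))
      :+ C :* q :* t :* ((ν :- ♯ 1) :* w :* w :* E :- (3 · ν :+ ♯ 4) :* (2 · (c :* E)) :- evalₛ′ Eₚ k :* w :* c))
    := (9 · (ν :* ν) :+ 9 · ν :+ ♯ 2) :* (c :* D)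
         :* (((2 · ν :+ ♯ 1) :* A :* q :- ν :* (D :* D :* (E :* E)) :* P) :* (w :* pₛ (ν :+ ♯ 1) k) :+ c :* (E :* E) :* rₛ (ν :+ ♯ 1) k :* q)
       :- 9 · (ν :* ν) :* (w :* w :* w :* D) :* (ν :* q :* (w :* pₛ ν k) :+ c :* (E :* E) :* rₛ ν k :* P)) refl

  V : ℚ → ℚ
  V k = v k * (v k * (v k * v k)) * (e k * u k)

  module Certificate (n : ℕ) {k : ℚ} (0≤k : 0ℚ ≤ k) where

    open ≡-Reasoning

    ν = ι n
    qₙ = q n k
    pₙ = q₋ n k
    Pₙ = ρ k * pₙ
    Cₙ = C ν k
    Cₙ′ = C′ ν k

    bracket : ℚ
    bracket = ν * ((ι 2 * (1ℚ - ι 2 * k) + t k * (w k * u k - ι 6 * v k)) * qₙ - ι 2 * (D k * E k) * Pₙ) * Cₙ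
      + qₙ * t k * (- (ι 8 * v k) - eval′ Eₚ k * e k - w k * u k) * Cₙ + t k * qₙ * Cₙ′

    bracket≡ : bracket ≡ v k * e k * u k * Θ k ν qₙ Pₙ Cₙ Cₙ′
    bracket≡ = begin
      bracket
        ≡⟨ solve 13 (λ k t ν q P C C′ w v u e E′ D →
             ν :* ((2 · (♯ 1 :- 2 · k) :+ t :* (w :* u :- 6 · v)) :* q :- 2 · D :* P) :* C
               :+ q :* t :* (:- (8 · v) :- E′ :* e :- w :* u) :* C :+ t :* q :* C′
             := ♯ 1 :* ♯ 1 :* ♯ 1 :* (C′ :* t :* q :+ C :* (2 · (ν :* ((♯ 1 :- 2 · k) :* q :- D :* P))))
               :+ C :* q :* t :* ((ν :- ♯ 1) :* w :* u :* (♯ 1 :* ♯ 1) :- (3 · ν :+ ♯ 4) :* (2 · v) :* (♯ 1 :* ♯ 1) :- E′ :* e :* (♯ 1 :* ♯ 1)))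
             refl k (t k) ν qₙ Pₙ Cₙ Cₙ′ (w k) (v k) (u k) (e k) (eval′ Eₚ k) (D k * E k) ⟩
      -- The three ones become w v, c u and E e, which brings all fractions to the common
      -- denominator w c E.
      F 1ℚ 1ℚ 1ℚ
        ≡⟨ cong (λ x → F x 1ℚ 1ℚ) (wv 0≤k) ⟨
      F (w k * v k) 1ℚ 1ℚ
        ≡⟨ cong₂ (λ y z → F (w k * v k) y z) (cu 0≤k) (Ee k) ⟨
      F (w k * v k) (c k * u k) (E k * e k)
        ≡⟨ solve 15 (λ k t ν q P C C′ w v u e E′ D c E →
             w :* v :* (c :* u) :* (E :* e) :* (C′ :* t :* q :+ C :* (2 · (ν :* ((♯ 1 :- 2 · k) :* q :- D :* P))))
               :+ C :* q :* t :* ((ν :- ♯ 1) :* w :* u :* (w :* v :* (E :* e)) :- (3 · ν :+ ♯ 4) :* (2 · v) :* (c :* u :* (E :* e)) :- E′ :* e :* (w :* v :* (c :* u)))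
             := v :* e :* u :* (C′ :* (t :* w :* c :* E :* q) :+ C :* (w :* c :* E :* (2 · (ν :* ((♯ 1 :- 2 · k) :* q :- D :* P))))
               :+ C :* q :* t :* ((ν :- ♯ 1) :* w :* w :* E :- (3 · ν :+ ♯ 4) :* (2 · (c :* E)) :- E′ :* w :* c)))
             refl k (t k) ν qₙ Pₙ Cₙ Cₙ′ (w k) (v k) (u k) (e k) (eval′ Eₚ k) (D k * E k) (c k) (E k) ⟩
      v k * e k * u k * Θ k ν qₙ Pₙ Cₙ Cₙ′ ∎
      where
      F : ℚ → ℚ → ℚ → ℚ
      F x y z = x * y * z * (Cₙ′ * t k * qₙ + Cₙ * (ι 2 * (ν * ((1ℚ - ι 2 * k) * qₙ - D k * E k * Pₙ))))
        + Cₙ * qₙ * t k * ((ν - 1ℚ) * w k * u k * (x * z) - (ι 3 * ν + ι 4) * (ι 2 * v k) * (y * z) - eval′ Eₚ k * e k * (x * y))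

    tf′ : t k * f′ n k ≡ α n * (V k * bracket)
    tf′ = begin
      t k * (α n * (q′ n k * g n k + qₙ * g′ n k))
        ≡⟨ solve 6 (λ t a q′ g q g′ → t :* (a :* (q′ :* g :+ q :* g′)) := a :* ((t :* q′) :* g :+ q :* (t :* g′))) refl (t k) (α n) (q′ n k) (g n k) qₙ (g′ n k) ⟩
      α n * ((t k * q′ n k) * g n k + qₙ * (t k * g′ n k))
        ≡⟨ cong₂ (λ x y → α n * (x * g n k + qₙ * y)) (tq′ n 0≤k) tg′ ⟩
      α n * ((ν * (a k * qₙ + β k * pₙ)) * (V k * Cₙ) + qₙ * (V k * (t k * (- (ι 8 * v k) - eval′ Eₚ k * e k - w k * u k) * Cₙ + t k * Cₙ′)))
        ≡⟨ solve 11 (λ A ν a q DE ρ p V C h t → A :* ((ν :* (a :* q :+ :- (2 · (ρ :* DE)) :* p)) :* (V :* C) :+ q :* (V :* h))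
             := A :* (V :* (ν :* (a :* q :- 2 · DE :* (ρ :* p)) :* C :+ q :* h))) refl (α n) ν (a k) qₙ (D k * E k) (ρ k) pₙ (V k) Cₙ
             (t k * (- (ι 8 * v k) - eval′ Eₚ k * e k - w k * u k) * Cₙ + t k * Cₙ′) (t k) ⟩
      α n * (V k * (ν * (a k * qₙ - ι 2 * (D k * E k) * Pₙ) * Cₙ + qₙ * (t k * (- (ι 8 * v k) - eval′ Eₚ k * e k - w k * u k) * Cₙ + t k * Cₙ′)))
        ≡⟨ cong (λ x → α n * (V k * x)) (solve 6 (λ x q t h C C′ → x :+ q :* (t :* h :* C :+ t :* C′) := x :+ q :* t :* h :* C :+ t :* q :* C′) refl
             (ν * (a k * qₙ - ι 2 * (D k * E k) * Pₙ) * Cₙ) qₙ (t k) (- (ι 8 * v k) - eval′ Eₚ k * e k - w k * u k) Cₙ Cₙ′) ⟩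
      α n * (V k * bracket) ∎
      where
      tg′ : t k * g′ n k ≡ V k * (t k * (- (ι 8 * v k) - eval′ Eₚ k * e k - w k * u k) * Cₙ + t k * Cₙ′)
      tg′ = solve 6 (λ k v e u C C′ →
        let w = evalₛ wₚ k; E′ = evalₛ′ Eₚ k; t = k :* (♯ 1 :- k)
            v′ = :- (evalₛ′ wₚ k :* (v :* v)); e′ = :- (E′ :* (e :* e)); u′ = :- (evalₛ′ cₚ k :* (u :* u))
            V = v :* (v :* (v :* v)) :* (e :* u) in
        t :* (((v′ :* (v :* (v :* v)) :+ v :* (v′ :* (v :* v) :+ v :* (v′ :* v :+ v :* v′))) :* (e :* u)
           :+ v :* (v :* (v :* v)) :* (e′ :* u :+ e :* u′)) :* C :+ V :* C′)
        := V :* (t :* (:- (8 · v) :- E′ :* e :- w :* u) :* C :+ t :* C′)) refl k (v k) (e k) (u k) Cₙ Cₙ′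

    R̂ : ℚ
    R̂ = (ι 2 * ν + 1ℚ) * A k * qₙ - ν * (D k * D k * (E k * E k)) * Pₙ

    rec : (ν + 1ℚ) * q (suc n) k ≡ ρ k * R̂
    rec = trans (Q-rec (X k) (Y k) n) (solve 7 (λ ν ρ A q D E p → (2 · ν :+ ♯ 1) :* (ρ :* A) :* q :- ν :* (ρ :* (D :* E) :* (ρ :* (D :* E))) :* p
      := ρ :* ((2 · ν :+ ♯ 1) :* A :* q :- ν :* (D :* D :* (E :* E)) :* (ρ :* p))) refl ν (ρ k) (A k) qₙ (D k) (E k) pₙ)

    s : ℚ
    s = ι 9 * (ν * ν) + ι 9 * ν + ι 2

    -- The shape of `γ` pays off here: its n² meets the left side of `α-suc`, and the n in front of
    -- `p` clears the denominator of the recurrence for q (n+1).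
    9γ-suc : ι 9 * γ (suc n) k ≡ s * α n * (D k * v k) * ((e k * e k) * (u k * u k) * p (ν + 1ℚ) k * (ρ k * R̂) + (v k * v k) * (v k * v k) * r (ν + 1ℚ) k * qₙ)
    9γ-suc = begin
      ι 9 * (α (suc n) * (ι (suc n) * ι (suc n)) * (D k * v k) * ((e k * e k) * (u k * u k) * (ι (suc n) * p (ι (suc n)) k) * q (suc n) k + (v k * v k) * (v k * v k) * r (ι (suc n)) k * qₙ))
        ≡⟨ solve 8 (λ α m Dv eu p q v r → 9 · (α :* (m :* m) :* Dv :* (eu :* (m :* p) :* q :+ v :* r))
             := (9 · (m :* m) :* α) :* Dv :* (eu :* p :* (m :* q) :+ v :* r)) refl
             (α (suc n)) (ι (suc n)) (D k * v k) ((e k * e k) * (u k * u k)) (p (ι (suc n)) k) (q (suc n) k) ((v k * v k) * (v k * v k) * r (ι (suc n)) k) qₙ ⟩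
      (ι 9 * (ι (suc n) * ι (suc n)) * α (suc n)) * (D k * v k) * ((e k * e k) * (u k * u k) * p (ι (suc n)) k * (ι (suc n) * q (suc n) k) + (v k * v k) * (v k * v k) * r (ι (suc n)) k * qₙ)
        ≡⟨ cong₂ (λ x m → x * (D k * v k) * ((e k * e k) * (u k * u k) * p m k * (m * q (suc n) k) + (v k * v k) * (v k * v k) * r m k * qₙ)) (α-suc n) (ι-suc n) ⟩
      s * α n * (D k * v k) * ((e k * e k) * (u k * u k) * p (ν + 1ℚ) k * ((ν + 1ℚ) * q (suc n) k) + (v k * v k) * (v k * v k) * r (ν + 1ℚ) k * qₙ)
        ≡⟨ cong (λ x → s * α n * (D k * v k) * ((e k * e k) * (u k * u k) * p (ν + 1ℚ) k * x + (v k * v k) * (v k * v k) * r (ν + 1ℚ) k * qₙ)) rec ⟩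
      s * α n * (D k * v k) * ((e k * e k) * (u k * u k) * p (ν + 1ℚ) k * (ρ k * R̂) + (v k * v k) * (v k * v k) * r (ν + 1ℚ) k * qₙ) ∎

    VΞ≡ : α n * (V k * (v k * e k * u k * Ξ k ν qₙ Pₙ)) ≡ ι 9 * γ (suc n) k - ι 9 * γ n k
    VΞ≡ = sym (begin
      ι 9 * γ (suc n) k - ι 9 * γ n k
        ≡⟨ cong (_- ι 9 * γ n k) 9γ-suc ⟩
      s * α n * (D k * v k) * (ee * uu * p⁺ * (ρ k * R̂) + vv * vv * r⁺ * qₙ) - ι 9 * γ n k
        ≡⟨ solve 17 (λ s α D v e u p⁺ c R r⁺ q ν p r pₙ w E →
             s :* α :* (D :* v) :* (e :* e :* (u :* u) :* p⁺ :* (c :* (v :* (v :* v)) :* R) :+ v :* v :* (v :* v) :* r⁺ :* q)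
               :- 9 · (α :* (ν :* ν) :* (D :* v) :* (e :* e :* (u :* u) :* (ν :* p) :* q :+ v :* v :* (v :* v) :* r :* pₙ))
             := s :* α :* (D :* v) :* (♯ 1 :* (e :* e :* (u :* u) :* p⁺ :* (c :* (v :* (v :* v)) :* R)) :+ ♯ 1 :* ♯ 1 :* ♯ 1 :* ♯ 1 :* (v :* v :* (v :* v) :* r⁺ :* q))
               :- 9 · (α :* (ν :* ν) :* (D :* v) :* (♯ 1 :* ♯ 1 :* ♯ 1 :* ♯ 1 :* (e :* e :* (u :* u) :* (ν :* p) :* q) :+ ♯ 1 :* ♯ 1 :* ♯ 1 :* (♯ 1 :* ♯ 1 :* ♯ 1 :* ♯ 1) :* (v :* v :* (v :* v) :* r :* pₙ))))
             refl s (α n) (D k) (v k) (e k) (u k) p⁺ (c k) R̂ r⁺ qₙ ν (p ν k) (r ν k) pₙ (w k) (E k) ⟩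
      F 1ℚ 1ℚ 1ℚ
        ≡⟨ cong (λ x → F x 1ℚ 1ℚ) (wv 0≤k) ⟨
      F (w k * v k) 1ℚ 1ℚ
        ≡⟨ cong₂ (λ y z → F (w k * v k) y z) (cu 0≤k) (Ee k) ⟨
      F (w k * v k) (c k * u k) (E k * e k)
        ≡⟨ solve 17 (λ s α D v e u p⁺ c R r⁺ q ν p r pₙ w E →
             let x = w :* v; y = c :* u; z = E :* e in
             s :* α :* (D :* v) :* (x :* (e :* e :* (u :* u) :* p⁺ :* (c :* (v :* (v :* v)) :* R)) :+ y :* y :* z :* z :* (v :* v :* (v :* v) :* r⁺ :* q))
               :- 9 · (α :* (ν :* ν) :* (D :* v) :* (x :* x :* x :* x :* (e :* e :* (u :* u) :* (ν :* p) :* q) :+ x :* x :* x :* (y :* y :* z :* z) :* (v :* v :* (v :* v) :* r :* pₙ)))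
             := α :* (v :* (v :* (v :* v)) :* (e :* u) :* (v :* e :* u :* (s :* (c :* D) :* (R :* (w :* p⁺) :+ c :* (E :* E) :* r⁺ :* q)
                  :- 9 · (ν :* ν) :* (w :* w :* w :* D) :* (ν :* q :* (w :* p) :+ c :* (E :* E) :* r :* (c :* (v :* (v :* v)) :* pₙ))))))
             refl s (α n) (D k) (v k) (e k) (u k) p⁺ (c k) R̂ r⁺ qₙ ν (p ν k) (r ν k) pₙ (w k) (E k) ⟩
      α n * (V k * (v k * e k * u k * Ξ k ν qₙ Pₙ)) ∎)
      where
      p⁺ = p (ν + 1ℚ) k
      r⁺ = r (ν + 1ℚ) k
      ee = e k * e k
      uu = u k * u k
      vv = v k * v k
      F : ℚ → ℚ → ℚ → ℚ
      F x y z = s * α n * (D k * v k) * (x * (ee * uu * p⁺ * (ρ k * R̂)) + y * y * z * z * (vv * vv * r⁺ * qₙ))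
        - ι 9 * (α n * (ν * ν) * (D k * v k) * (x * x * x * x * (ee * uu * (ν * p ν k) * qₙ) + x * x * x * (y * y * z * z) * (vv * vv * r ν k * pₙ)))

    telescopes : t k * f′ n k ≡ γ (suc n) k - γ n k
    telescopes = *-cancelˡ-≡ (ι 9) (0<ι 8) (begin
      ι 9 * (t k * f′ n k)
        ≡⟨ cong (ι 9 *_) (trans tf′ (cong (λ x → α n * (V k * x)) bracket≡)) ⟩
      ι 9 * (α n * (V k * (v k * e k * u k * Θ k ν qₙ Pₙ Cₙ Cₙ′)))
        ≡⟨ solve 4 (λ α V veu Θ → 9 · (α :* (V :* (veu :* Θ))) := α :* (V :* (veu :* (9 · Θ)))) refl (α n) (V k) (v k * e k * u k) (Θ k ν qₙ Pₙ Cₙ Cₙ′) ⟩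
      α n * (V k * (v k * e k * u k * (ι 9 * Θ k ν qₙ Pₙ Cₙ Cₙ′)))
        ≡⟨ cong (λ x → α n * (V k * (v k * e k * u k * x))) (certificate k ν qₙ Pₙ) ⟩
      α n * (V k * (v k * e k * u k * Ξ k ν qₙ Pₙ))
        ≡⟨ VΞ≡ ⟩
      ι 9 * γ (suc n) k - ι 9 * γ n k
        ≡⟨ solve 2 (λ a b → 9 · a :- 9 · b := 9 · (a :- b)) refl (γ (suc n) k) (γ n k) ⟩
      ι 9 * (γ (suc n) k - γ n k) ∎)

  Bₚ : Poly
  Bₚ = + 3 ∷ + 2 ∷ + 4 ∷ []

  l m B : ℚ → ℚ
  l k = ρ k * (E k * E k)
  m k = ρ k * (D k * D k)
  B = eval Bₚ

  0≤ρ : ∀ {k} → 0ℚ ≤ k → 0ℚ ≤ ρ k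
  0≤ρ 0≤k = 0≤-* (ℚ.<⇒≤ (0<c 0≤k)) (0≤-* (0≤v 0≤k) (0≤-* (0≤v 0≤k) (0≤v 0≤k)))

  -- Because D² + E² = 2A, the characteristic polynomial splits over the rationals.
  2X≡l+m : ∀ k → ι 2 * X k ≡ l k + m k
  2X≡l+m k = solve 2 (λ k ρ → 2 · (ρ :* evalₛ Aₚ k) := ρ :* (evalₛ Eₚ k :* evalₛ Eₚ k) :+ ρ :* (evalₛ Dₚ k :* evalₛ Dₚ k)) refl k (ρ k)

  Y≡lm : ∀ k → Y k ≡ l k * m k
  Y≡lm k = solve 3 (λ ρ D E → ρ :* (D :* E) :* (ρ :* (D :* E)) := ρ :* (E :* E) :* (ρ :* (D :* D))) refl (ρ k) (D k) (E k)

  0≤m : ∀ {k} → 0ℚ ≤ k → 0ℚ ≤ m k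
  0≤m {k} 0≤k = 0≤-* (0≤ρ 0≤k) (0≤-² (D k))

  -- E - D = 6k² and E + D = 2(1-k)², so the difference of the squares is 12t².
  m≤l : ∀ {k} → 0ℚ ≤ k → m k ≤ l k
  m≤l {k} 0≤k = ≤-add {r = ρ k * (ι 12 * (t k * t k))}
    (solve 2 (λ k ρ → let t = k :* (♯ 1 :- k) in ρ :* (evalₛ Dₚ k :* evalₛ Dₚ k) :+ ρ :* (12 · (t :* t)) := ρ :* (evalₛ Eₚ k :* evalₛ Eₚ k)) refl k (ρ k))
    (0≤-* (0≤ρ 0≤k) (0≤-* (0≤ι 12) (0≤-² (t k))))

  module Terms {k : ℚ} (0≤k : 0ℚ ≤ k) = Ratio {X k} {Y k} {l k} {m k} (2X≡l+m k) (Y≡lm k) (0≤m 0≤k) (m≤l 0≤k)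

  -- Rests on w³ - cE² = k(1-k)B², where B is also a factor of C₃. It shows that l < 1 on (0,1) and
  -- that 1-l vanishes to first order at both ends.
  1-l≡ : ∀ {k} → 0ℚ ≤ k → 1ℚ - l k ≡ t k * (B k * B k) * (v k * (v k * v k))
  1-l≡ {k} 0≤k = begin
    1ℚ - l k                                          ≡⟨ solve 1 (λ l → ♯ 1 :- l := ♯ 1 :* (♯ 1 :* ♯ 1) :- l) refl (l k) ⟩
    1ℚ * (1ℚ * 1ℚ) - l k                              ≡⟨ cong (λ x → x * (x * x) - l k) (wv 0≤k) ⟨
    w k * v k * (w k * v k * (w k * v k)) - l k       ≡⟨ solve 2 (λ k v → let w = evalₛ wₚ k; E = evalₛ Eₚ k; B = evalₛ Bₚ k in
                                                           w :* v :* (w :* v :* (w :* v)) :- evalₛ cₚ k :* (v :* (v :* v)) :* (E :* E)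
                                                           := k :* (♯ 1 :- k) :* (B :* B) :* (v :* (v :* v))) refl k (v k) ⟩
    t k * (B k * B k) * (v k * (v k * v k))           ∎
    where open ≡-Reasoning

  0≤t : ∀ {k} → Unit k → 0ℚ ≤ t k
  0≤t (0≤k , k≤1) = 0≤-* 0≤k (0≤-diff k≤1)

  3≤B : ∀ {k} → 0ℚ ≤ k → ι 3 ≤ B k
  3≤B {k} 0≤k = ≤-add {r = ι 2 * k + ι 4 * (k * k)} (solve 1 (λ k → ♯ 3 :+ (2 · k :+ 4 · (k :* k)) := evalₛ Bₚ k) refl k)
    (0≤-+ (0≤-* (0≤ι 2) 0≤k) (0≤-* (0≤ι 4) (0≤-² k)))

  1≤3v : ∀ {k} → Unit k → 1ℚ ≤ ι 3 * v k
  1≤3v {k} (0≤k , k≤1) = subst (_≤ ι 3 * v k) (wv 0≤k) (*-monoʳ (0≤v 0≤k)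
    (≤-add {w k} {r = ι 2 * (1ℚ - k)} (solve 1 (λ k → evalₛ wₚ k :+ 2 · (♯ 1 :- k) := ♯ 3) refl k) (0≤-* (0≤ι 2) (0≤-diff k≤1))))

  -- Insert 9 ≤ B² and 1 ≤ 27v³ into `1-l≡`. On [x, y] this turns a lower bound of t into one of
  -- 1-l.
  t≤3[1-l] : ∀ {k} → Unit k → t k ≤ ι 3 * (1ℚ - l k)
  t≤3[1-l] {k} uk@(0≤k , _) = begin
    t k                                               ≡⟨ solve 1 (λ t → t := t :* (♯ 1 :* (♯ 1 :* ♯ 1))) refl (t k) ⟩
    t k * (1ℚ * (1ℚ * 1ℚ))                            ≤⟨ *-monoˡ (0≤t uk) (*-mono 0≤1 (0≤-* 0≤1 0≤1) (1≤3v uk) (*-mono 0≤1 0≤1 (1≤3v uk) (1≤3v uk))) ⟩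
    t k * (ι 3 * v k * (ι 3 * v k * (ι 3 * v k)))     ≡⟨ solve 2 (λ t v → t :* (3 · v :* (3 · v :* (3 · v))) := (♯ 3 :* ♯ 3) :* (t :* 3 · (v :* (v :* v)))) refl (t k) (v k) ⟩
    ι 3 * ι 3 * (t k * (ι 3 * (v k * (v k * v k))))   ≤⟨ *-monoʳ (0≤-* (0≤t uk) (0≤-* (0≤ι 3) (0≤-* (0≤v 0≤k) (0≤-* (0≤v 0≤k) (0≤v 0≤k))))) (*-mono (0≤ι 3) (0≤ι 3) (3≤B 0≤k) (3≤B 0≤k)) ⟩
    B k * B k * (t k * (ι 3 * (v k * (v k * v k))))   ≡⟨ solve 3 (λ B t v → B :* (t :* 3 · v) := 3 · (t :* B :* v)) refl (B k * B k) (t k) (v k * (v k * v k)) ⟩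
    ι 3 * (t k * (B k * B k) * (v k * (v k * v k)))   ≡⟨ cong (ι 3 *_) (1-l≡ 0≤k) ⟨
    ι 3 * (1ℚ - l k)                                  ∎
    where open ℚ.≤-Reasoning

  ∣p∣-≤ : ∀ n {k} → Unit k → ∣ p (ι n) k ∣ ≤ (size p₀ₚ + size p₁ₚ) * ι (suc n)
  ∣p∣-≤ n {k} uk = ℚ.≤-trans
    (∣∣-+-≤ {eval p₀ₚ k} (eval-bounded p₀ₚ uk) (∣∣-*-≤ {ι n} (ℚ.≤-reflexive (∣∣-nonNeg (0≤ι n))) (eval-bounded p₁ₚ uk)))
    (≤-add {size p₀ₚ + ι n * size p₁ₚ} {r = size p₁ₚ + ι n * size p₀ₚ}
      (trans (solve 3 (λ a b n → a :+ n :* b :+ (b :+ n :* a) := (a :+ b) :* (n :+ ♯ 1)) refl (size p₀ₚ) (size p₁ₚ) (ι n)) (cong ((size p₀ₚ + size p₁ₚ) *_) (sym (ι-suc n))))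
      (0≤-+ (0≤size p₁ₚ) (0≤-* (0≤ι n) (0≤size p₀ₚ))))

  ∣r∣-≤ : ∀ n {k} → Unit k → ∣ r (ι n) k ∣ ≤ (size r₀ₚ + size r₁ₚ + size r₂ₚ) * (ι (suc n) * ι (suc n))
  ∣r∣-≤ n {k} uk = ℚ.≤-trans
    (∣∣-+-≤ {eval r₀ₚ k} (eval-bounded r₀ₚ uk) (∣∣-*-≤ {ι n} ∣ν∣ (∣∣-+-≤ {eval r₁ₚ k} (eval-bounded r₁ₚ uk) (∣∣-*-≤ {ι n} ∣ν∣ (eval-bounded r₂ₚ uk)))))
    (≤-add {size r₀ₚ + ι n * (size r₁ₚ + ι n * size r₂ₚ)}
      {r = size r₁ₚ + size r₂ₚ + ι n * (ι 2 * size r₀ₚ + size r₁ₚ + ι 2 * size r₂ₚ) + ι n * ι n * (size r₀ₚ + size r₁ₚ)}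
      (trans (solve 4 (λ a b c n → a :+ n :* (b :+ n :* c) :+ (b :+ c :+ n :* (2 · a :+ b :+ 2 · c) :+ n :* n :* (a :+ b))
        := (a :+ b :+ c) :* ((n :+ ♯ 1) :* (n :+ ♯ 1))) refl (size r₀ₚ) (size r₁ₚ) (size r₂ₚ) (ι n))
        (cong (λ x → (size r₀ₚ + size r₁ₚ + size r₂ₚ) * (x * x)) (sym (ι-suc n))))
      (0≤-+ (0≤-+ (0≤-+ (0≤size r₁ₚ) (0≤size r₂ₚ)) (0≤-* (0≤ι n) (0≤-+ (0≤-+ (0≤-* (0≤ι 2) (0≤size r₀ₚ)) (0≤size r₁ₚ)) (0≤-* (0≤ι 2) (0≤size r₂ₚ)))))
        (0≤-* (0≤-* (0≤ι n) (0≤ι n)) (0≤-+ (0≤size r₀ₚ) (0≤size r₁ₚ)))))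
    where
    ∣ν∣ : ∣ ι n ∣ ≤ ι n
    ∣ν∣ = ℚ.≤-reflexive (∣∣-nonNeg (0≤ι n))

  K : ℚ
  K = size Dₚ * (ι 16 * (size p₀ₚ + size p₁ₚ) + (size r₀ₚ + size r₁ₚ + size r₂ₚ))

  -- Stated at n+1 so that lⁿ bounds both q (n+1) and q n. The bound on n α n removes one of the
  -- four powers of n.
  γ-bound : ∀ n {k} → Unit k → ∣ γ (suc n) k ∣ ≤ K * (ι (suc (suc n)) ^ 3 * l k ^ n)
  γ-bound n {k} uk@(0≤k , k≤1) = begin
    ∣ γ N k ∣
      ≤⟨ ∣∣-*-≤ {α N * (ι N * ι N) * (D k * v k)}
           (∣∣-*-≤ {α N * (ι N * ι N)} α-≤ (∣∣-*-≤ {D k} (eval-bounded Dₚ uk) (∣v∣≤1 uk)))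
           (∣∣-+-≤ {(e k * e k) * (u k * u k) * (ι N * p (ι N) k) * q N k}
             (∣∣-*-≤ {(e k * e k) * (u k * u k) * (ι N * p (ι N) k)}
               (∣∣-*-≤ {(e k * e k) * (u k * u k)}
                 (∣∣-*-≤ {e k * e k} (∣∣-*-≤ {e k} (∣e∣≤4 uk) (∣e∣≤4 uk)) (∣∣-*-≤ {u k} (∣u∣≤1 uk) (∣u∣≤1 uk)))
                 (∣∣-*-≤ {ι N} N≤ (∣p∣-≤ N uk)))
               q-≤ᴺ)
             (∣∣-*-≤ {(v k * v k) * (v k * v k) * r (ι N) k}
               (∣∣-*-≤ {(v k * v k) * (v k * v k)}
                 (∣∣-*-≤ {v k * v k} (∣∣-*-≤ {v k} (∣v∣≤1 uk) (∣v∣≤1 uk)) (∣∣-*-≤ {v k} (∣v∣≤1 uk) (∣v∣≤1 uk)))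
                 (∣r∣-≤ N uk))
               q₋-≤ᴺ)) ⟩
    ι N' * (size Dₚ * 1ℚ) * ((ι 4 * ι 4) * (1ℚ * 1ℚ) * (ι N' * ((size p₀ₚ + size p₁ₚ) * ι N')) * l k ^ n
      + (1ℚ * 1ℚ) * (1ℚ * 1ℚ) * ((size r₀ₚ + size r₁ₚ + size r₂ₚ) * (ι N' * ι N')) * l k ^ n)
      ≡⟨ solve 5 (λ x d a b y → x :* (d :* ♯ 1) :* ((♯ 4 :* ♯ 4) :* (♯ 1 :* ♯ 1) :* (x :* (a :* x)) :* y :+ (♯ 1 :* ♯ 1) :* (♯ 1 :* ♯ 1) :* (b :* (x :* x)) :* y)
           := d :* (16 · a :+ b) :* (x :^ 3 :* y)) refl (ι N') (size Dₚ) (size p₀ₚ + size p₁ₚ) (size r₀ₚ + size r₁ₚ + size r₂ₚ) (l k ^ n) ⟩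
    K * (ι N' ^ 3 * l k ^ n) ∎
    where
    open ℚ.≤-Reasoning
    N = suc n
    N' = suc (suc n)
    open Terms 0≤k
    N≤ : ∣ ι N ∣ ≤ ι N'
    N≤ = subst (_≤ ι N') (sym (∣∣-nonNeg (0≤ι N))) (ι-mono (ℕ.n≤1+n N))
    α-≤ : ∣ α N * (ι N * ι N) ∣ ≤ ι N'
    α-≤ = subst (_≤ ι N') (sym (∣∣-nonNeg (0≤-* (0≤α N) (0≤-* (0≤ι N) (0≤ι N))))) (begin
      α N * (ι N * ι N)     ≡⟨ solve 2 (λ a n → a :* (n :* n) := n :* a :* n) refl (α N) (ι N) ⟩
      ι N * α N * ι N       ≤⟨ *-monoʳ (0≤ι N) (nα≤1 N) ⟩
      1ℚ * ι N              ≡⟨ ℚ.*-identityˡ (ι N) ⟩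
      ι N                   ≤⟨ ι-mono (ℕ.n≤1+n N) ⟩
      ι N'                  ∎)
    l≤1 : l k ≤ 1ℚ
    l≤1 = ≤-add {r = 1ℚ - l k} (solve 1 (λ l → l :+ (♯ 1 :- l) := ♯ 1) refl (l k)) (0≤-cancelˡ (ι 3) (0<ι 2) (ℚ.≤-trans (0≤t uk) (t≤3[1-l] uk)))
    q-≤ᴺ : ∣ q N k ∣ ≤ l k ^ n
    q-≤ᴺ = subst (_≤ l k ^ n) (sym (∣∣-nonNeg (0≤q N))) (ℚ.≤-trans (q-≤ N) (subst (l k * l k ^ n ≤_) (ℚ.*-identityˡ (l k ^ n)) (*-monoʳ (^-0≤ n 0≤l) l≤1)))
    q₋-≤ᴺ : ∣ q₋ N k ∣ ≤ l k ^ n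
    q₋-≤ᴺ = subst (_≤ l k ^ n) (sym (∣∣-nonNeg (0≤q n))) (q-≤ n)

  R R′ : ℕ → ℚ → ℚ
  R n k  = ∑ n λ i → f i k
  R′ n k = ∑ n λ i → f′ i k

  R-derivative : ∀ n → Derivative (R n) (R′ n)
  R-derivative n = derivative-∑ n f-derivative

  tR′ : ∀ n {k} → 0ℚ ≤ k → t k * R′ n k ≡ γ n k
  tR′ n {k} 0≤k = begin
    t k * R′ n k                            ≡⟨ ∑-* n (t k) ⟨
    ∑ n (λ i → t k * f′ i k)                ≡⟨ ∑-cong n (λ i → Certificate.telescopes i 0≤k) ⟩
    ∑ n (λ i → γ (suc i) k - γ i k)         ≡⟨ ∑-telescope n (λ i → γ i k) ⟩
    -- γ 0 vanishes through its factor n².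
    γ n k - γ 0 k                           ≡⟨ solve 3 (λ g d x → g :- ♯ 1 :* ♯ 1 :* ♯ 1 :* (♯ 0 :* ♯ 0) :* d :* x := g) refl (γ n k) (D k * v k)
                                                 ((e k * e k) * (u k * u k) * (ι 0 * p (ι 0) k) * q 0 k + (v k * v k) * (v k * v k) * r (ι 0) k * q₋ 0 k) ⟩
    γ n k                                   ∎
    where open ≡-Reasoning

  -- This is the constancy of R, stated for partial sums: telescoping leaves t R′ n = γ n, and on
  -- [x, y] one has t ≥ κ and l ≤ Λ < 1 with constants that depend on x and y alone.
  drift : ∀ {x y} → 0ℚ < x → x ≤ y → y < 1ℚ → ∃ λ (b : ℕ → ℚ) → Null b ×
          (∀ n → 2 ℕ.≤ n → ∀ {k j} → x ≤ k → k ≤ j → j ≤ y → ∣ R n j - R n k ∣ ≤ b n)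
  drift {x} {y} 0<x x≤y y<1 = (λ n → b (ℕ.pred n)) , b-null , bound
    where
    κ = x * (1ℚ - y)
    0<1-y : 0ℚ < 1ℚ - y
    0<1-y = subst (_< 1ℚ - y) (ℚ.+-inverseʳ y) (ℚ.+-monoˡ-< (- y) y<1)
    0<κ : 0ℚ < κ
    0<κ = 0<-* 0<x 0<1-y
    Λ = 1ℚ - κ * (+ 1 / 3)
    -- 27 = 3³ comes from n+2 ≤ 3n for n ≥ 1. The index n+1 in `γ-bound` accounts for `ℕ.pred`
    -- above.
    b : ℕ → ℚ
    b n = inv κ * (K * ι 27) * (ι n ^ 3 * Λ ^ n)
    Λ<1 : Λ < 1ℚ
    Λ<1 = subst (Λ <_) (solve 1 (λ k → ♯ 1 :- k :+ k := ♯ 1) refl (κ * (+ 1 / 3)))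
      (subst (_< Λ + κ * (+ 1 / 3)) (ℚ.+-identityʳ Λ) (ℚ.+-monoʳ-< Λ (0<-* 0<κ (ℚ.positive⁻¹ (+ 1 / 3)))))
    module _ {k : ℚ} (x≤k : x ≤ k) (k≤y : k ≤ y) where
      0≤k : 0ℚ ≤ k
      0≤k = ℚ.≤-trans (ℚ.<⇒≤ 0<x) x≤k
      uk : Unit k
      uk = 0≤k , ℚ.≤-trans k≤y (ℚ.<⇒≤ y<1)
      κ≤t : κ ≤ t k
      κ≤t = *-mono (ℚ.<⇒≤ 0<x) (ℚ.<⇒≤ 0<1-y) x≤k (ℚ.+-monoʳ-≤ 1ℚ (ℚ.neg-antimono-≤ k≤y))
      l≤Λ : l k ≤ Λ
      l≤Λ = ≤-add {r = (+ 1 / 3) * (ι 3 * (1ℚ - l k) - κ)}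
        (trans (solve 3 (λ l κ h → l :+ h :* (♯ 3 :* (♯ 1 :- l) :- κ) := l :+ (h :* ♯ 3) :* (♯ 1 :- l) :- κ :* h) refl (l k) κ (+ 1 / 3))
          (solve 2 (λ l y → l :+ ♯ 1 :* (♯ 1 :- l) :- y := ♯ 1 :- y) refl (l k) (κ * (+ 1 / 3))))
        (0≤-* (ℚ.<⇒≤ (ℚ.positive⁻¹ (+ 1 / 3))) (0≤-diff (ℚ.≤-trans κ≤t (t≤3[1-l] uk))))
      0≤l : 0ℚ ≤ l k
      0≤l = Terms.0≤l 0≤k
      derivative-bound : ∀ n → 1 ℕ.≤ n → ∣ R′ (suc n) k ∣ ≤ b n
      derivative-bound n 1≤n = *-cancelˡ-≤ κ 0<κ (begin
        κ * ∣ R′ (suc n) k ∣            ≤⟨ *-monoʳ (ℚ.0≤∣p∣ (R′ (suc n) k)) κ≤t ⟩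
        t k * ∣ R′ (suc n) k ∣          ≡⟨ cong (_* ∣ R′ (suc n) k ∣) (∣∣-nonNeg (0≤t uk)) ⟨
        ∣ t k ∣ * ∣ R′ (suc n) k ∣      ≡⟨ ∣∣-* (t k) (R′ (suc n) k) ⟨
        ∣ t k * R′ (suc n) k ∣          ≡⟨ cong ∣_∣ (tR′ (suc n) 0≤k) ⟩
        ∣ γ (suc n) k ∣                 ≤⟨ γ-bound n uk ⟩
        K * (ι (suc (suc n)) ^ 3 * l k ^ n)
          ≤⟨ *-monoˡ 0≤K (*-mono (^-0≤ 3 (0≤ι (suc (suc n)))) (^-0≤ n 0≤l) (^-mono 3 (0≤ι (suc (suc n))) n+2≤3n) (^-mono n 0≤l l≤Λ)) ⟩
        K * ((ι 3 * ι n) ^ 3 * Λ ^ n)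
          ≡⟨ solve 3 (λ K n y → K :* ((3 · n) :^ 3 :* y) := ♯ 1 :* (K :* ♯ 27 :* (n :^ 3 :* y))) refl K (ι n) (Λ ^ n) ⟩
        1ℚ * (K * ι 27 * (ι n ^ 3 * Λ ^ n))
          ≡⟨ cong (_* (K * ι 27 * (ι n ^ 3 * Λ ^ n))) (*-inv 0<κ) ⟨
        κ * inv κ * (K * ι 27 * (ι n ^ 3 * Λ ^ n))
          ≡⟨ solve 4 (λ κ i K y → κ :* i :* (K :* y) := κ :* (i :* K :* y)) refl κ (inv κ) (K * ι 27) (ι n ^ 3 * Λ ^ n) ⟩
        κ * b n                         ∎)
        where
        open ℚ.≤-Reasoning
        0≤K : 0ℚ ≤ K
        0≤K = 0≤-* (0≤size Dₚ) (0≤-+ (0≤-* (0≤ι 16) (0≤-+ (0≤size p₀ₚ) (0≤size p₁ₚ))) (0≤-+ (0≤-+ (0≤size r₀ₚ) (0≤size r₁ₚ)) (0≤size r₂ₚ)))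
        n+2≤3n : ι (suc (suc n)) ≤ ι 3 * ι n
        n+2≤3n = ℚ.≤-trans (ι-mono {suc (suc n)} {3 ℕ.* n} (ℕ.≤-trans (ℕ.≤-reflexive (ℕ.+-comm 2 n)) (ℕ.+-monoʳ-≤ n (ℕ.*-monoʳ-≤ 2 1≤n)))) (ℚ.≤-reflexive (ι-* 3 n))
    0≤Λ : 0ℚ ≤ Λ
    0≤Λ = ℚ.≤-trans (0≤l {x} ℚ.≤-refl x≤y) (l≤Λ {x} ℚ.≤-refl x≤y)
    b-null : Null (λ n → b (ℕ.pred n))
    b-null ε 0<ε = let N , h = null-scale {λ n → ι n ^ 3 * Λ ^ n} (inv κ * (K * ι 27)) (null-power 3 0≤Λ Λ<1) ε 0<ε in
      suc N , λ { (suc n) (ℕ.s≤s N≤n) → h n N≤n }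
    bound : ∀ n → 2 ℕ.≤ n → ∀ {k j} → x ≤ k → k ≤ j → j ≤ y → ∣ R n j - R n k ∣ ≤ b (ℕ.pred n)
    bound (suc n) (ℕ.s≤s 1≤n) {k} {j} x≤k k≤j j≤y = begin
      ∣ R (suc n) j - R (suc n) k ∣
        ≤⟨ mean-value (R-derivative (suc n)) (ℚ.≤-trans (ℚ.<⇒≤ 0<x) x≤k) k≤j (ℚ.≤-trans j≤y (ℚ.<⇒≤ y<1))
             (λ k≤t t≤j → derivative-bound (ℚ.≤-trans x≤k k≤t) (ℚ.≤-trans t≤j j≤y) n 1≤n) ⟩
      b n * (j - k)
        ≤⟨ *-monoˡ (0≤∣∣-≤ {R′ (suc n) k} (derivative-bound x≤k (ℚ.≤-trans k≤j j≤y) n 1≤n))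
             (ℚ.≤-trans (Rational.p≤∣p∣ (j - k)) (unit-dist (ℚ.≤-trans (ℚ.<⇒≤ 0<x) x≤k , ℚ.≤-trans (ℚ.≤-trans k≤j j≤y) (ℚ.<⇒≤ y<1))
               (ℚ.≤-trans (ℚ.<⇒≤ 0<x) (ℚ.≤-trans x≤k k≤j) , ℚ.≤-trans j≤y (ℚ.<⇒≤ y<1)))) ⟩
      b n * 1ℚ
        ≡⟨ ℚ.*-identityʳ (b n) ⟩
      b n ∎
      where open ℚ.≤-Reasoning

-- The partial sums at a small rational square k = κ².

module NearZero where

  open import Data.Integer.Base using (ℤ; +_; -[1+_])
  open import Data.Rational.Base
  open Arithmetic
  open Hypergeometric
  open Sequences
  open Differentiation
  open Curve
  open Telescoping

  -- The terms of degree 3 and 2 in n are removed by telescoping 9n² α q (h₁ n + h₀). The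
  -- polynomials h₁ and h₀ are those of least degree for which the remainder
  -- k⁴ ε₃ n³ + k³ ε₂ n² + k² ε₁ n + k ε₀ is negligible at the scale n ~ 1/k.
  h₁ₚ h₀ₚ ε₃ₚ ε₂ₚ ε₁ₚ ε₀ₚ ζₚ : Poly
  h₁ₚ = + 0 ∷ ⊖ 9 ∷ ⊖ 63 ∷ []
  h₀ₚ = + 1 ∷ + 3 ∷ []
  ε₃ₚ = + 13608 ∷ + 29646 ∷ + 31194 ∷ ⊖ 5508 ∷ ⊖ 57348 ∷ ⊖ 84024 ∷ ⊖ 62208 ∷ ⊖ 5184 ∷ + 38016 ∷ + 41472 ∷ + 20736 ∷ + 4608 ∷ []
  ε₂ₚ = ⊖ 2853 ∷ + 5589 ∷ ⊖ 4914 ∷ ⊖ 28170 ∷ ⊖ 71064 ∷ ⊖ 115020 ∷ ⊖ 125064 ∷ ⊖ 69984 ∷ + 46656 ∷ + 131328 ∷ + 124416 ∷ + 62208 ∷ + 13824 ∷ []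
  ε₁ₚ = + 9 ∷ ⊖ 1639 ∷ + 3805 ∷ ⊖ 2072 ∷ ⊖ 12712 ∷ ⊖ 31404 ∷ ⊖ 52320 ∷ ⊖ 59616 ∷ ⊖ 32928 ∷ + 35328 ∷ + 89728 ∷ + 86528 ∷ + 45056 ∷ + 10240 ∷ []
  ε₀ₚ = + 4 ∷ + 30 ∷ ⊖ 218 ∷ + 830 ∷ ⊖ 84 ∷ ⊖ 1324 ∷ ⊖ 3528 ∷ ⊖ 6480 ∷ ⊖ 7808 ∷ ⊖ 3328 ∷ + 9216 ∷ + 19200 ∷ + 17920 ∷ + 9216 ∷ + 2048 ∷ []
  ζₚ = + 9 ∷ + 9 ∷ + 10 ∷ + 6 ∷ + 12 ∷ + 8 ∷ []

  h : ℚ → ℚ → ℚ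
  h ν k = eval h₁ₚ k * ν + eval h₀ₚ k

  W : ℚ → ℚ
  W k = w k ^ 4 * E k

  s : ℚ → ℚ
  s ν = ι 9 * (ν * ν) + ι 9 * ν + ι 2

  ε : ℚ → ℚ → ℚ
  ε ν k = k ^ 4 * eval ε₃ₚ k * ν ^ 3 + k ^ 3 * eval ε₂ₚ k * ν ^ 2 + k ^ 2 * eval ε₁ₚ k * ν + k * eval ε₀ₚ k

  v³ : ℚ → ℚ
  v³ k = v k * (v k * v k)

  reduction-poly : ∀ k ν → w k ^ 3 * C ν k - c k * (D k * E k) * (s ν * h (ν + 1ℚ) k) + w k ^ 3 * (ι 9 * (ν * ν) * h ν k)
    ≡ ι 2 * (W k * c k) * (w k ^ 3 - c k * (D k * E k)) * ν + ε ν k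
  reduction-poly = solve 2 (λ k ν →
    let w = evalₛ wₚ k; c = evalₛ cₚ k; D = evalₛ Dₚ k; E = evalₛ Eₚ k; h = λ ν → evalₛ h₁ₚ k :* ν :+ evalₛ h₀ₚ k in
    w :^ 3 :* Cₛ ν k :- c :* (D :* E) :* ((9 · (ν :* ν) :+ 9 · ν :+ ♯ 2) :* h (ν :+ ♯ 1)) :+ w :^ 3 :* (9 · (ν :* ν) :* h ν)
    := 2 · (w :^ 4 :* E :* c) :* (w :^ 3 :- c :* (D :* E)) :* ν
       :+ (k :^ 4 :* evalₛ ε₃ₚ k :* ν :^ 3 :+ k :^ 3 :* evalₛ ε₂ₚ k :* ν :^ 2 :+ k :^ 2 :* evalₛ ε₁ₚ k :* ν :+ k :* evalₛ ε₀ₚ k)) refl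

  v³w³ : ∀ {k} → 0ℚ ≤ k → v³ k * w k ^ 3 ≡ 1ℚ
  v³w³ {k} 0≤k = trans (solve 2 (λ v w → v :* (v :* v) :* w :^ 3 := (w :* v) :^ 3) refl (v k) (w k)) (cong (_^ 3) (wv 0≤k))

  -- Multiplied by α n q n, the first two terms become H (n+1) - H n once z q n is replaced by q
  -- (n+1), since s n · α n = 9(n+1)² α (n+1). The term linear in ν is the main one.
  reduction : ∀ {k} → 0ℚ ≤ k → ∀ ν → C ν k ≡ z k * (s ν * h (ν + 1ℚ) k) - ι 9 * (ν * ν) * h ν k + (ι 2 * (W k * c k) * (1ℚ - z k) * ν + v³ k * ε ν k)
  reduction {k} 0≤k ν = begin
    C ν k
      ≡⟨ solve 3 (λ C a b → C := (♯ 1 :* C :- a :+ ♯ 1 :* b) :+ a :- b) refl (C ν k) (z k * (s ν * h (ν + 1ℚ) k)) (ι 9 * (ν * ν) * h ν k) ⟩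
    (1ℚ * C ν k - za + 1ℚ * b) + za - b
      ≡⟨ cong (λ x → (x * C ν k - za + x * b) + za - b) (v³w³ 0≤k) ⟨
    (v³ k * w k ^ 3 * C ν k - za + v³ k * w k ^ 3 * b) + za - b
      ≡⟨ cong (λ x → x + za - b) (solve 7 (λ v w C c DE a b → v :* (v :* v) :* w :* C :- c :* (v :* (v :* v)) :* DE :* a :+ v :* (v :* v) :* w :* b
           := v :* (v :* v) :* (w :* C :- c :* DE :* a :+ w :* b)) refl (v k) (w k ^ 3) (C ν k) (c k) (D k * E k) (s ν * h (ν + 1ℚ) k) b) ⟩
    v³ k * (w k ^ 3 * C ν k - c k * (D k * E k) * (s ν * h (ν + 1ℚ) k) + w k ^ 3 * b) + za - b
      ≡⟨ cong (λ x → v³ k * x + za - b) (reduction-poly k ν) ⟩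
    v³ k * (ι 2 * (W k * c k) * (w k ^ 3 - c k * (D k * E k)) * ν + ε ν k) + za - b
      ≡⟨ solve 9 (λ v w³ c DE W ν ε za b → v :* (v :* v) :* (2 · (W :* c) :* (w³ :- c :* DE) :* ν :+ ε) :+ za :- b
           := za :- b :+ (2 · (W :* c) :* (v :* (v :* v) :* w³ :- c :* (v :* (v :* v)) :* DE) :* ν :+ v :* (v :* v) :* ε)) refl (v k) (w k ^ 3) (c k) (D k * E k) (W k) ν (ε ν k) za b ⟩
    za - b + (ι 2 * (W k * c k) * (v³ k * w k ^ 3 - z k) * ν + v³ k * ε ν k)
      ≡⟨ cong (λ x → za - b + (ι 2 * (W k * c k) * (x - z k) * ν + v³ k * ε ν k)) (v³w³ 0≤k) ⟩
    za - b + (ι 2 * (W k * c k) * (1ℚ - z k) * ν + v³ k * ε ν k) ∎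
    where
    open ≡-Reasoning
    za = z k * (s ν * h (ν + 1ℚ) k)
    b  = ι 9 * (ν * ν) * h ν k

  1-z≡ : ∀ {k} → 0ℚ ≤ k → 1ℚ - z k ≡ k * (eval ζₚ k * v³ k)
  1-z≡ {k} 0≤k = trans (cong (_- z k) (sym (v³w³ 0≤k)))
    (solve 2 (λ k v → v :* (v :* v) :* evalₛ wₚ k :^ 3 :- evalₛ cₚ k :* (v :* (v :* v)) :* (evalₛ Dₚ k :* evalₛ Eₚ k) := k :* (evalₛ ζₚ k :* (v :* (v :* v)))) refl k (v k))

  -- Comparison with the telescoping sum of 1/(n+1) - 1/(n+2). Square summability is what `kαL≤`
  -- exploits, as the sum of the α n diverges.
  ∑α²≤2 : ∀ n → ∑ n (λ i → α i * α i) ≤ ι 2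
  ∑α²≤2 zero    = 0≤ι 2
  ∑α²≤2 (suc n) = ℚ.≤-trans (bound n) (≤-add {ι 2 - rec n} {r = rec n} (solve 1 (λ r → ♯ 2 :- r :+ r := ♯ 2) refl (rec n)) (1/≥0 n))
    where
    rec : ℕ → ℚ
    rec n = + 1 / suc n
    bound : ∀ n → ∑ (suc n) (λ i → α i * α i) ≤ ι 2 - rec n
    bound zero    = ℚ.≤-refl
    bound (suc n) = begin
      ∑ (suc n) (λ i → α i * α i) + α (suc n) * α (suc n)
        ≤⟨ ℚ.+-mono-≤ (bound n) (*-mono (0≤α (suc n)) (0≤α (suc n)) (ℚ.≤-trans (α≤1/[1+n] (suc n)) (Rational.1/-antitone (ℕ.n≤1+n n))) (α≤1/[1+n] (suc n))) ⟩
      ι 2 - rec n + rec n * rec (suc n)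
        ≡⟨ cong (λ x → ι 2 - rec n + x) diff ⟩
      ι 2 - rec n + (rec n - rec (suc n))
        ≡⟨ solve 2 (λ a b → ♯ 2 :- a :+ (a :- b) := ♯ 2 :- b) refl (rec n) (rec (suc n)) ⟩
      ι 2 - rec (suc n) ∎
      where
      open ℚ.≤-Reasoning
      diff : rec n * rec (suc n) ≡ rec n - rec (suc n)
      diff = begin-equality
        rec n * rec (suc n)
          ≡⟨ solve 3 (λ s a b → a :* b := a :* ((s :+ ♯ 1) :* b) :- (s :* a) :* b) refl (ι (suc n)) (rec n) (rec (suc n)) ⟩
        rec n * ((ι (suc n) + 1ℚ) * rec (suc n)) - (ι (suc n) * rec n) * rec (suc n)
          ≡⟨ cong₂ (λ x y → rec n * x - y * rec (suc n)) (trans (cong (_* rec (suc n)) (sym (ι-suc (suc n)))) (ι*1/ (suc n))) (ι*1/ n) ⟩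
        rec n * 1ℚ - 1ℚ * rec (suc n)
          ≡⟨ solve 2 (λ a b → a :* ♯ 1 :- ♯ 1 :* b := a :- b) refl (rec n) (rec (suc n)) ⟩
        rec n - rec (suc n) ∎

  -- `M` bounds 2Wc on [0,1]. `N` dominates each of the five coefficients arising in `err-≤`; 39366
  -- exceeds the numbers 34992 and 1944 found there.
  M N : ℚ
  M = ι 2 * (size wₚ ^ 4 * size Eₚ * size cₚ)
  N = ι 39366 + size ε₃ₚ + size ε₂ₚ + size ε₁ₚ + size ε₀ₚ + ι 54 * M + M * size ζₚ

  -- The error at k turns out to be of order √k, so the point is taken to be a rational square. The
  -- bound on κ gives 4k ≤ 1, which keeps D and hence z from being negative.
  module Point {κ : ℚ} (0<κ : 0ℚ < κ) (2κ≤1 : ι 2 * κ ≤ 1ℚ) where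

    0≤κ : 0ℚ ≤ κ
    0≤κ = ℚ.<⇒≤ 0<κ

    k : ℚ
    k = κ * κ

    0≤k : 0ℚ ≤ k
    0≤k = 0≤-* 0≤κ 0≤κ

    4k≤1 : ι 4 * k ≤ 1ℚ
    4k≤1 = subst (_≤ 1ℚ) (solve 1 (λ κ → 2 · κ :* 2 · κ := 4 · (κ :* κ)) refl κ)
      (*-mono (0≤-* (0≤ι 2) 0≤κ) (0≤-* (0≤ι 2) 0≤κ) 2κ≤1 2κ≤1)

    k≤1 : k ≤ 1ℚ
    k≤1 = ℚ.≤-trans (≤-add {r = ι 3 * k} (solve 1 (λ k → k :+ 3 · k := 4 · k) refl k) (0≤-* (0≤ι 3) 0≤k)) 4k≤1

    κ≤1 : κ ≤ 1ℚ
    κ≤1 = ℚ.≤-trans (≤-add {r = κ} (solve 1 (λ k → k :+ k := 2 · k) refl κ) 0≤κ) 2κ≤1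

    uk : Unit k
    uk = 0≤k , k≤1

    open Terms 0≤k

    k≤1-l : k ≤ 1ℚ - l k
    -- The product of 3k ≤ 4t, 9 ≤ B² and 8 ≤ (3v)³ is 216k ≤ 108(1-l), by `1-l≡`.
    k≤1-l = *-cancelˡ-≤ (ι 108) (0<ι 107) (begin
      ι 108 * k
        ≤⟨ ≤-add {r = ι 108 * k} (solve 1 (λ k → 108 · k :+ 108 · k := 3 · k :* (♯ 3 :* ♯ 3 :* (♯ 2 :* (♯ 2 :* ♯ 2)))) refl k) (0≤-* (0≤ι 108) 0≤k) ⟩
      ι 3 * k * (ι 3 * ι 3 * (ι 2 * (ι 2 * ι 2)))
        ≤⟨ *-mono (0≤-* (0≤ι 3) 0≤k) (0≤-* (0≤-* (0≤ι 3) (0≤ι 3)) (0≤-* (0≤ι 2) (0≤-* (0≤ι 2) (0≤ι 2)))) 3k≤4t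
             (*-mono (0≤-* (0≤ι 3) (0≤ι 3)) (0≤-* (0≤ι 2) (0≤-* (0≤ι 2) (0≤ι 2))) (*-mono (0≤ι 3) (0≤ι 3) (3≤B 0≤k) (3≤B 0≤k))
               (*-mono (0≤ι 2) (0≤-* (0≤ι 2) (0≤ι 2)) 2≤3v (*-mono (0≤ι 2) (0≤ι 2) 2≤3v 2≤3v))) ⟩
      ι 4 * t k * (B k * B k * (ι 3 * v k * (ι 3 * v k * (ι 3 * v k))))
        ≡⟨ solve 3 (λ t B v → 4 · t :* (B :* B :* (3 · v :* (3 · v :* 3 · v))) := 108 · (t :* (B :* B) :* (v :* (v :* v)))) refl (t k) (B k) (v k) ⟩
      ι 108 * (t k * (B k * B k) * (v k * (v k * v k)))
        ≡⟨ cong (ι 108 *_) (1-l≡ 0≤k) ⟨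
      ι 108 * (1ℚ - l k) ∎)
      where
      open ℚ.≤-Reasoning
      3k≤4t : ι 3 * k ≤ ι 4 * t k
      3k≤4t = ≤-add {r = k * (1ℚ - ι 4 * k)} (solve 1 (λ k → 3 · k :+ k :* (♯ 1 :- 4 · k) := 4 · (k :* (♯ 1 :- k))) refl k) (0≤-* 0≤k (0≤-diff 4k≤1))
      2≤3v : ι 2 ≤ ι 3 * v k
      2≤3v = begin
        ι 2                  ≡⟨ ℚ.*-identityʳ (ι 2) ⟨
        ι 2 * 1ℚ             ≡⟨ cong (ι 2 *_) (wv 0≤k) ⟨
        ι 2 * (w k * v k)    ≡⟨ ℚ.*-assoc (ι 2) (w k) (v k) ⟨
        ι 2 * w k * v k      ≤⟨ *-monoʳ (0≤v 0≤k) (≤-add {ι 2 * w k} {r = 1ℚ - ι 4 * k} (solve 1 (λ k → 2 · evalₛ wₚ k :+ (♯ 1 :- 4 · k) := ♯ 3) refl k) (0≤-diff 4k≤1)) ⟩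
        ι 3 * v k            ∎

    l≤1 : l k ≤ 1ℚ
    l≤1 = ≤-add {r = 1ℚ - l k} (solve 1 (λ l → l :+ (♯ 1 :- l) := ♯ 1) refl (l k)) (ℚ.≤-trans 0≤k k≤1-l)

    l<1 : l k < 1ℚ
    l<1 = subst₂ _<_ (ℚ.+-identityʳ (l k)) (solve 1 (λ l → l :+ (♯ 1 :- l) := ♯ 1) refl (l k))
      (ℚ.+-monoʳ-< (l k) (ℚ.<-≤-trans (0<-* 0<κ 0<κ) k≤1-l))

    0≤D : 0ℚ ≤ D k
    0≤D = subst (0ℚ ≤_) (solve 1 (λ k → (♯ 1 :- 4 · k) :+ 2 · (k :* (♯ 1 :- k)) := evalₛ Dₚ k) refl k) (0≤-+ (0≤-diff 4k≤1) (0≤-* (0≤ι 2) (0≤t uk)))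

    0≤z : 0ℚ ≤ z k
    0≤z = 0≤-* (0≤ρ 0≤k) (0≤-* 0≤D (ℚ.<⇒≤ (0<E k)))

    X-z≡ : X k - z k ≡ ι 18 * (k ^ 4 * ρ k)
    X-z≡ = solve 2 (λ k ρ → ρ :* evalₛ Aₚ k :- ρ :* (evalₛ Dₚ k :* evalₛ Eₚ k) := 18 · (k :^ 4 :* ρ)) refl k (ρ k)

    z≤X : z k ≤ X k
    z≤X = ≤-add {r = X k - z k} (solve 2 (λ z x → z :+ (x :- z) := x) refl (z k) (X k)) (subst (0ℚ ≤_) (sym X-z≡) (0≤-* (0≤ι 18) (0≤-* (^-0≤ 4 0≤k) (0≤ρ 0≤k))))

    z≤l : z k ≤ l k
    z≤l = ≤-add {r = ρ k * (ι 6 * (k * k) * E k)}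
      (solve 2 (λ k ρ → ρ :* (evalₛ Dₚ k :* evalₛ Eₚ k) :+ ρ :* (6 · (k :* k) :* evalₛ Eₚ k) := ρ :* (evalₛ Eₚ k :* evalₛ Eₚ k)) refl k (ρ k))
      (0≤-* (0≤ρ 0≤k) (0≤-* (0≤-* (0≤ι 6) (0≤-² k)) (ℚ.<⇒≤ (0<E k))))

    qₙ d L : ℕ → ℚ
    qₙ n = q n k
    d n = qₙ (suc n) - z k * qₙ n
    L n = l k ^ n

    0≤L : ∀ n → 0ℚ ≤ L n
    0≤L n = ^-0≤ n 0≤l

    L≤1 : ∀ n → L n ≤ 1ℚ
    L≤1 zero    = ℚ.≤-refl
    L≤1 (suc n) = ℚ.≤-trans (*-mono 0≤l (0≤L n) l≤1 (L≤1 n)) ℚ.≤-refl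

    ∣q∣≤L : ∀ n → ∣ qₙ n ∣ ≤ L n
    ∣q∣≤L n = subst (_≤ L n) (sym (∣∣-nonNeg (0≤q n))) (q-≤ n)

    ∣v³∣≤1 : ∣ v³ k ∣ ≤ 1ℚ
    ∣v³∣≤1 = ∣∣-*-≤ {v k} (∣v∣≤1 uk) (∣∣-*-≤ {v k} (∣v∣≤1 uk) (∣v∣≤1 uk))

    ρ≤3 : ρ k ≤ ι 3
    ρ≤3 = ℚ.≤-trans (Rational.p≤∣p∣ (ρ k)) (∣∣-*-≤ {c k} (eval-bounded cₚ uk) ∣v³∣≤1)

    ∣d∣≤ : ∀ n → ∣ d n ∣ ≤ ι 54 * (k ^ 4 * (ι (suc n) * L n))
    ∣d∣≤ n = subst (_≤ ι 54 * (k ^ 4 * (ι (suc n) * L n))) (sym (∣∣-nonNeg (0≤q-zq refl 0≤z z≤X z≤l n))) (begin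
      d n                                             ≤⟨ q-zq-≤ refl 0≤z z≤X z≤l n ⟩
      (X k - z k) * (ι (suc n) * L n)                 ≡⟨ cong (_* (ι (suc n) * L n)) X-z≡ ⟩
      ι 18 * (k ^ 4 * ρ k) * (ι (suc n) * L n)        ≤⟨ *-monoʳ (0≤-* (0≤ι (suc n)) (0≤L n)) (*-monoˡ (0≤ι 18) (*-monoˡ (^-0≤ 4 0≤k) ρ≤3)) ⟩
      ι 18 * (k ^ 4 * ι 3) * (ι (suc n) * L n)        ≡⟨ solve 2 (λ k y → 18 · (k :* ♯ 3) :* y := 54 · (k :* y)) refl (k ^ 4) (ι (suc n) * L n) ⟩
      ι 54 * (k ^ 4 * (ι (suc n) * L n))              ∎)
      where open ℚ.≤-Reasoning

    H : ℕ → ℚ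
    H n = ι 9 * (ι n * ι n) * α n * qₙ n * h (ι n) k

    H-suc : ∀ n → H (suc n) ≡ s (ι n) * α n * h (ι n + 1ℚ) k * (z k * qₙ n + d n)
    H-suc n = begin
      ι 9 * (ι (suc n) * ι (suc n)) * α (suc n) * qₙ (suc n) * h (ι (suc n)) k
        ≡⟨ cong₂ (λ x m → x * qₙ (suc n) * h m k) (α-suc n) (ι-suc n) ⟩
      s (ι n) * α n * qₙ (suc n) * h (ι n + 1ℚ) k
        ≡⟨ solve 4 (λ sa q′ h zq → sa :* q′ :* h := sa :* h :* (zq :+ (q′ :- zq))) refl (s (ι n) * α n) (qₙ (suc n)) (h (ι n + 1ℚ) k) (z k * qₙ n) ⟩
      s (ι n) * α n * h (ι n + 1ℚ) k * (z k * qₙ n + d n) ∎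
      where open ≡-Reasoning

    module _ (m : ℕ) where

      -- There are three sources: H (n+1) contains q (n+1) and not z q n; the remainder ε; and in
      -- the main term n α n is replaced by its value at the last index m and z q n by q (n+1),
      -- after which the differences of q telescope.
      err : ℕ → ℚ
      err n = - (s (ι n) * α n * h (ι n + 1ℚ) k * d n) + v³ k * (α n * ε (ι n) k * qₙ n)
            + ι 2 * (W k * c k) * (nα m * d n - (1ℚ - z k) * ((nα m - nα n) * qₙ n))

      term≡ : ∀ n → α n * qₙ n * C (ι n) k ≡ (H (suc n) - H n) + ι 2 * (W k * c k) * nα m * - (qₙ (suc n) - qₙ n) + err n
      term≡ n = trans (cong (α n * qₙ n *_) (reduction 0≤k (ι n))) (trans
        (solve 14 (λ α q z s h⁺ ν h W c v ε d A q′ →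
           α :* q :* (z :* (s :* h⁺) :- 9 · (ν :* ν) :* h :+ (2 · (W :* c) :* (♯ 1 :- z) :* ν :+ v :* ε))
           := (s :* α :* h⁺ :* (z :* q :+ d) :- 9 · (ν :* ν) :* α :* q :* h) :+ 2 · (W :* c) :* A :* :- (z :* q :+ d :- q)
              :+ (:- (s :* α :* h⁺ :* d) :+ v :* (α :* ε :* q) :+ 2 · (W :* c) :* (A :* d :- (♯ 1 :- z) :* ((A :- ν :* α) :* q))))
           refl (α n) (qₙ n) (z k) (s (ι n)) (h (ι n + 1ℚ) k) (ι n) (h (ι n) k) (W k) (c k) (v³ k) (ε (ι n) k) (d n) (nα m) (qₙ (suc n)))
        (cong₂ (λ x y → (x - H n) + ι 2 * (W k * c k) * nα m * - (y - qₙ n) + err n) (sym (H-suc n))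
          (solve 2 (λ zq q′ → zq :+ (q′ :- zq) := q′) refl (z k * qₙ n) (qₙ (suc n)))))

      sum≡ : ∑ m (λ n → α n * qₙ n * C (ι n) k) ≡ H m + ι 2 * (W k * c k) * nα m * (1ℚ - qₙ m) + ∑ m err
      sum≡ = begin
        ∑ m (λ n → α n * qₙ n * C (ι n) k)
          ≡⟨ ∑-cong m term≡ ⟩
        ∑ m (λ n → (H (suc n) - H n) + b * - (qₙ (suc n) - qₙ n) + err n)
          ≡⟨ trans (∑-+ m) (cong (_+ ∑ m err) (∑-+ m)) ⟩
        ∑ m (λ n → H (suc n) - H n) + ∑ m (λ n → b * - (qₙ (suc n) - qₙ n)) + ∑ m err
          ≡⟨ cong₂ (λ x y → x + y + ∑ m err) (∑-telescope m H)
               (trans (∑-* m b {λ n → - (qₙ (suc n) - qₙ n)}) (cong (b *_) (trans (∑-neg m {λ n → qₙ (suc n) - qₙ n}) (cong (λ x → - x) (∑-telescope m qₙ))))) ⟩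
        H m - H 0 + b * - (qₙ m - 1ℚ) + ∑ m err
          ≡⟨ solve 5 (λ H h b q e → H :- ♯ 9 :* (♯ 0 :* ♯ 0) :* ♯ 1 :* ♯ 1 :* h :+ b :* :- (q :- ♯ 1) :+ e := H :+ b :* (♯ 1 :- q) :+ e) refl (H m) (h (ι 0) k) b (qₙ m) (∑ m err) ⟩
        H m + b * (1ℚ - qₙ m) + ∑ m err ∎
        where
        open ≡-Reasoning
        b = ι 2 * (W k * c k) * nα m

    -- The first four terms have the form k^(j+2) (n+1)^j lⁿ and sum to at most j! k each by
    -- `weighted-≤`, as k ≤ 1-l. The last one decays too slowly for that and sets the order √k of
    -- the error.
    G : ℕ → ℚ
    G n = k ^ 5 * (ι (suc n) ^ 3 * L n) + k ^ 4 * (ι (suc n) ^ 2 * L n) + k ^ 3 * (ι (suc n) ^ 1 * L n) + k ^ 2 * (ι (suc n) ^ 0 * L n) + k * (α n * L n)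

  0≤M : 0ℚ ≤ M
  0≤M = 0≤-* (0≤ι 2) (0≤-* (0≤-* (^-0≤ 4 (0≤size wₚ)) (0≤size Eₚ)) (0≤size cₚ))

  ∣2Wc∣≤M : ∀ {k} → Unit k → ∣ ι 2 * (W k * c k) ∣ ≤ M
  ∣2Wc∣≤M {k} uk = ∣∣-*-≤ {ι 2} ℚ.≤-refl (∣∣-*-≤ {W k} (∣∣-*-≤ {w k ^ 4} (∣^∣-≤ {w k} 4 (eval-bounded wₚ uk)) (eval-bounded Eₚ uk)) (eval-bounded cₚ uk))

  VWc : ∀ {k} → 0ℚ ≤ k → V k * (W k * c k) ≡ 1ℚ
  VWc {k} 0≤k = begin
    V k * (W k * c k)
      ≡⟨ solve 6 (λ v e u w E c → v :* (v :* (v :* v)) :* (e :* u) :* (w :^ 4 :* E :* c) := (w :* v) :^ 4 :* (E :* e) :* (c :* u)) refl (v k) (e k) (u k) (w k) (E k) (c k) ⟩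
    (w k * v k) ^ 4 * (E k * e k) * (c k * u k)
      ≡⟨ cong₂ (λ x y → x ^ 4 * (E k * e k) * y) (wv 0≤k) (cu 0≤k) ⟩
    1ℚ ^ 4 * (E k * e k) * 1ℚ
      ≡⟨ cong (λ x → 1ℚ ^ 4 * x * 1ℚ) (Ee k) ⟩
    1ℚ ∎
    where open ≡-Reasoning

  R≡VS : ∀ n k → R n k ≡ V k * ∑ n (λ i → α i * q i k * C (ι i) k)
  R≡VS n k = trans (∑-cong n λ i → solve 4 (λ a q V C → a :* (q :* (V :* C)) := V :* (a :* q :* C)) refl (α i) (q i k) (V k) (C (ι i) k))
    (∑-* n (V k))

  ∣V∣≤4 : ∀ {k} → Unit k → ∣ V k ∣ ≤ ι 4
  ∣V∣≤4 {k} uk = ∣∣-*-≤ {v k * (v k * (v k * v k))} (∣∣-*-≤ {v k} (∣v∣≤1 uk) (∣∣-*-≤ {v k} (∣v∣≤1 uk) (∣∣-*-≤ {v k} (∣v∣≤1 uk) (∣v∣≤1 uk))))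
    (∣∣-*-≤ {e k} (∣e∣≤4 uk) (∣u∣≤1 uk))

  module Anchor {κ : ℚ} (0<κ : 0ℚ < κ) (2κ≤1 : ι 2 * κ ≤ 1ℚ) where

    open Point 0<κ 2κ≤1
    open Terms 0≤k

    ∣h₁∣ : ∣ eval h₁ₚ k ∣ ≤ k * ι 72
    ∣h₁∣ = subst (λ x → ∣ x ∣ ≤ k * ι 72) (solve 1 (λ k → k :* (con (⊖ 9) :+ k :* (con (⊖ 63) :+ k :* ♯ 0)) := evalₛ h₁ₚ k) refl k)
      (∣∣-*-≤ {k} (ℚ.≤-reflexive (∣∣-nonNeg 0≤k)) (eval-bounded (⊖ 9 ∷ ⊖ 63 ∷ []) uk))

    ∣h∣ : ∀ ν → 0ℚ ≤ ν → ∣ h ν k ∣ ≤ k * ι 72 * ν + ι 4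
    ∣h∣ ν 0≤ν = ∣∣-+-≤ {eval h₁ₚ k * ν} (∣∣-*-≤ {eval h₁ₚ k} ∣h₁∣ (ℚ.≤-reflexive (∣∣-nonNeg 0≤ν))) (eval-bounded h₀ₚ uk)

    module _ (n : ℕ) where

      ν x αₙ y : ℚ
      ν = ι n
      x = ι (suc n)
      αₙ = α n
      y = L n

      0≤x : 0ℚ ≤ x
      0≤x = 0≤ι (suc n)

      ν≤x : ν ≤ x
      ν≤x = ι-mono (ℕ.n≤1+n n)

      sα≤ : ∣ s ν * αₙ ∣ ≤ ι 9 * x
      sα≤ = subst (_≤ ι 9 * x) (sym (∣∣-nonNeg (0≤-* 0≤s (0≤α n)))) (begin
        s ν * αₙ                 ≤⟨ *-monoʳ (0≤α n) (≤-add {s ν} {r = ι 9 * ν + ι 7}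
                                     (trans (solve 1 (λ n → 9 · (n :* n) :+ 9 · n :+ ♯ 2 :+ (9 · n :+ ♯ 7) := 9 · ((n :+ ♯ 1) :* (n :+ ♯ 1))) refl ν) (cong (λ x → ι 9 * (x * x)) (sym (ι-suc n))))
                                     (0≤-+ (0≤-* (0≤ι 9) (0≤ι n)) (0≤ι 7))) ⟩
        ι 9 * (x * x) * αₙ       ≡⟨ solve 2 (λ x αₙ → 9 · (x :* x) :* αₙ := 9 · x :* (x :* αₙ)) refl x αₙ ⟩
        ι 9 * x * (x * αₙ)       ≤⟨ *-monoˡ (0≤-* (0≤ι 9) 0≤x) ([1+n]α≤1 n) ⟩
        ι 9 * x * 1ℚ            ≡⟨ ℚ.*-identityʳ (ι 9 * x) ⟩
        ι 9 * x                 ∎)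
        where
        open ℚ.≤-Reasoning
        0≤s : 0ℚ ≤ s ν
        0≤s = 0≤-+ (0≤-+ (0≤-* (0≤ι 9) (0≤-* (0≤ι n) (0≤ι n))) (0≤-* (0≤ι 9) (0≤ι n))) (0≤ι 2)

      first-≤ : ∣ - (s ν * αₙ * h (ν + 1ℚ) k * d n) ∣ ≤ ι 9 * x * (k * ι 72 * x + ι 4) * (ι 54 * (k ^ 4 * (x * y)))
      first-≤ = ∣∣-neg-≤ {s ν * αₙ * h (ν + 1ℚ) k * d n} (∣∣-*-≤ {s ν * αₙ * h (ν + 1ℚ) k} (∣∣-*-≤ {s ν * αₙ} sα≤
        (subst (λ z → ∣ h z k ∣ ≤ k * ι 72 * x + ι 4) (ι-suc n) (∣h∣ x 0≤x))) (∣d∣≤ n))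

      α∣ε∣ : ∣ αₙ * ε ν k * qₙ n ∣ ≤ (k ^ 4 * size ε₃ₚ * x ^ 2 + k ^ 3 * size ε₂ₚ * x + k ^ 2 * size ε₁ₚ + k * size ε₀ₚ * αₙ) * y
      α∣ε∣ = ∣∣-*-≤ {αₙ * ε ν k} (subst (λ z → ∣ z ∣ ≤ k ^ 4 * size ε₃ₚ * x ^ 2 + k ^ 3 * size ε₂ₚ * x + k ^ 2 * size ε₁ₚ + k * size ε₀ₚ * αₙ)
        (solve 7 (λ k ν αₙ e₃ e₂ e₁ e₀ → k :^ 4 :* e₃ :* (ν :* αₙ :* ν :^ 2) :+ k :^ 3 :* e₂ :* (ν :* αₙ :* ν) :+ k :^ 2 :* e₁ :* (ν :* αₙ) :+ k :* e₀ :* αₙ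
          := αₙ :* (k :^ 4 :* e₃ :* ν :^ 3 :+ k :^ 3 :* e₂ :* ν :^ 2 :+ k :^ 2 :* e₁ :* ν :+ k :* e₀)) refl k ν αₙ (eval ε₃ₚ k) (eval ε₂ₚ k) (eval ε₁ₚ k) (eval ε₀ₚ k))
        (∣∣-+-≤ {k ^ 4 * eval ε₃ₚ k * (ν * αₙ * ν ^ 2) + k ^ 3 * eval ε₂ₚ k * (ν * αₙ * ν) + k ^ 2 * eval ε₁ₚ k * (ν * αₙ)}
          (∣p+q+r∣ {k ^ 4 * eval ε₃ₚ k * (ν * αₙ * ν ^ 2)}
            (∣∣-*-≤ {k ^ 4 * eval ε₃ₚ k} (coeff 4 ε₃ₚ) (nonneg-≤ (0≤-* 0≤νa (^-0≤ 2 (0≤ι n))) νaν²≤))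
            (∣∣-*-≤ {k ^ 3 * eval ε₂ₚ k} (coeff 3 ε₂ₚ) (nonneg-≤ (0≤-* 0≤νa (0≤ι n)) νaν≤))
            (subst (∣ k ^ 2 * eval ε₁ₚ k * (ν * αₙ) ∣ ≤_) (ℚ.*-identityʳ (k ^ 2 * size ε₁ₚ)) (∣∣-*-≤ {k ^ 2 * eval ε₁ₚ k} (coeff 2 ε₁ₚ) (nonneg-≤ 0≤νa (nα≤1 n)))))
          (∣∣-*-≤ {k * eval ε₀ₚ k} (∣∣-*-≤ {k} ∣k∣ (eval-bounded ε₀ₚ uk)) (ℚ.≤-reflexive (∣∣-nonNeg (0≤α n)))))) (∣q∣≤L n)
        where
        ∣k∣ : ∣ k ∣ ≤ k
        ∣k∣ = ℚ.≤-reflexive (∣∣-nonNeg 0≤k)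
        coeff : ∀ j p → ∣ k ^ j * eval p k ∣ ≤ k ^ j * size p
        coeff j p = ∣∣-*-≤ {k ^ j} (∣^∣-≤ {k} j ∣k∣) (eval-bounded p uk)
        nonneg-≤ : ∀ {p b} → 0ℚ ≤ p → p ≤ b → ∣ p ∣ ≤ b
        nonneg-≤ 0≤p p≤b = subst (_≤ _) (sym (∣∣-nonNeg 0≤p)) p≤b
        0≤νa : 0ℚ ≤ ν * αₙ
        0≤νa = 0≤-* (0≤ι n) (0≤α n)
        νaν≤ : ν * αₙ * ν ≤ x
        νaν≤ = subst (ν * αₙ * ν ≤_) (ℚ.*-identityˡ x) (*-mono 0≤νa (0≤ι n) (nα≤1 n) ν≤x)
        νaν²≤ : ν * αₙ * ν ^ 2 ≤ x ^ 2
        νaν²≤ = subst (ν * αₙ * ν ^ 2 ≤_) (ℚ.*-identityˡ (x ^ 2)) (*-mono 0≤νa (^-0≤ 2 (0≤ι n)) (nα≤1 n) (^-mono 2 (0≤ι n) ν≤x))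

      module _ (m : ℕ) (n≤m : n ℕ.≤ m) where

        third-≤ : ∣ ι 2 * (W k * c k) * (nα m * d n - (1ℚ - z k) * ((nα m - nα n) * qₙ n)) ∣
                ≤ M * (1ℚ * (ι 54 * (k ^ 4 * (x * y))) + k * size ζₚ * (αₙ * y))
        third-≤ = ∣∣-*-≤ {ι 2 * (W k * c k)} (∣2Wc∣≤M uk) (∣∣-minus-≤ {nα m * d n}
          (∣∣-*-≤ {nα m} (∣nα∣≤1 m) (∣d∣≤ n))
          (∣∣-*-≤ {1ℚ - z k} (subst (λ p → ∣ p ∣ ≤ k * size ζₚ) (sym (1-z≡ 0≤k)) (∣∣-*-≤ {k} (ℚ.≤-reflexive (∣∣-nonNeg 0≤k))
              (subst (∣ eval ζₚ k * v³ k ∣ ≤_) (ℚ.*-identityʳ (size ζₚ)) (∣∣-*-≤ {eval ζₚ k} (eval-bounded ζₚ uk) ∣v³∣≤1))))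
            (∣∣-*-≤ {nα m - nα n} (subst (_≤ αₙ) (sym (∣∣-nonNeg (0≤-diff (nα-mono n≤m)))) (nα-increment≤α n≤m)) (∣q∣≤L n))))

        err-≤ : ∣ err m n ∣ ≤ N * G n
        err-≤ = begin
          ∣ err m n ∣
            ≤⟨ ∣p+q+r∣ { - (s ν * αₙ * h (ν + 1ℚ) k * d n)} first-≤ (∣∣-*-≤ {v³ k} ∣v³∣≤1 α∣ε∣) third-≤ ⟩
          ι 9 * x * (k * ι 72 * x + ι 4) * (ι 54 * (k ^ 4 * (x * y)))
            + 1ℚ * ((k ^ 4 * size ε₃ₚ * x ^ 2 + k ^ 3 * size ε₂ₚ * x + k ^ 2 * size ε₁ₚ + k * size ε₀ₚ * αₙ) * y)
            + M * (1ℚ * (ι 54 * (k ^ 4 * (x * y))) + k * size ζₚ * (αₙ * y))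
            -- Here x ≤ x² lets the contribution of d in the third part join the terms k⁴x².
            ≤⟨ ℚ.+-monoʳ-≤ (ι 9 * x * (k * ι 72 * x + ι 4) * (ι 54 * (k ^ 4 * (x * y)))
                 + 1ℚ * ((k ^ 4 * size ε₃ₚ * x ^ 2 + k ^ 3 * size ε₂ₚ * x + k ^ 2 * size ε₁ₚ + k * size ε₀ₚ * αₙ) * y))
                 (*-monoˡ 0≤M (ℚ.+-monoˡ-≤ (k * size ζₚ * (αₙ * y)) (*-monoˡ 0≤1 (*-monoˡ (0≤ι 54) (*-monoˡ (^-0≤ 4 0≤k) (*-monoʳ (0≤L n) x≤x²)))))) ⟩
          ι 9 * x * (k * ι 72 * x + ι 4) * (ι 54 * (k ^ 4 * (x * y)))
            + 1ℚ * ((k ^ 4 * size ε₃ₚ * x ^ 2 + k ^ 3 * size ε₂ₚ * x + k ^ 2 * size ε₁ₚ + k * size ε₀ₚ * αₙ) * y)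
            + M * (1ℚ * (ι 54 * (k ^ 4 * (x ^ 2 * y))) + k * size ζₚ * (αₙ * y))
            ≡⟨ solve 10 (λ x k y αₙ s₃ s₂ s₁ s₀ M ζ →
                 9 · x :* (k :* ♯ 72 :* x :+ ♯ 4) :* (54 · (k :^ 4 :* (x :* y)))
                 :+ ♯ 1 :* ((k :^ 4 :* s₃ :* x :^ 2 :+ k :^ 3 :* s₂ :* x :+ k :^ 2 :* s₁ :+ k :* s₀ :* αₙ) :* y)
                 :+ M :* (♯ 1 :* (54 · (k :^ 4 :* (x :^ 2 :* y))) :+ k :* ζ :* (αₙ :* y))
                 := ♯ 34992 :* (k :^ 5 :* (x :^ 3 :* y)) :+ (♯ 1944 :+ s₃ :+ 54 · M) :* (k :^ 4 :* (x :^ 2 :* y)) :+ s₂ :* (k :^ 3 :* (x :^ 1 :* y))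
                    :+ s₁ :* (k :^ 2 :* (x :^ 0 :* y)) :+ (s₀ :+ M :* ζ) :* (k :* (αₙ :* y))) refl
                 x k y αₙ (size ε₃ₚ) (size ε₂ₚ) (size ε₁ₚ) (size ε₀ₚ) M (size ζₚ) ⟩
          ι 34992 * (k ^ 5 * (x ^ 3 * y)) + (ι 1944 + size ε₃ₚ + ι 54 * M) * (k ^ 4 * (x ^ 2 * y)) + size ε₂ₚ * (k ^ 3 * (x ^ 1 * y))
            + size ε₁ₚ * (k ^ 2 * (x ^ 0 * y)) + (size ε₀ₚ + M * size ζₚ) * (k * (αₙ * y))
            ≤⟨ ≤-add {ι 34992 * (k ^ 5 * (x ^ 3 * y)) + (ι 1944 + size ε₃ₚ + ι 54 * M) * (k ^ 4 * (x ^ 2 * y)) + size ε₂ₚ * (k ^ 3 * (x ^ 1 * y))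
                      + size ε₁ₚ * (k ^ 2 * (x ^ 0 * y)) + (size ε₀ₚ + M * size ζₚ) * (k * (αₙ * y))} {r = rest}
                 (solve 11 (λ g₅ g₄ g₃ g₂ g₁ s₃ s₂ s₁ s₀ M ζ →
                   ♯ 34992 :* g₅ :+ (♯ 1944 :+ s₃ :+ 54 · M) :* g₄ :+ s₂ :* g₃ :+ s₁ :* g₂ :+ (s₀ :+ M :* ζ) :* g₁
                   :+ ((♯ 4374 :+ s₃ :+ s₂ :+ s₁ :+ s₀ :+ 54 · M :+ M :* ζ) :* g₅ :+ (♯ 37422 :+ s₂ :+ s₁ :+ s₀ :+ M :* ζ) :* g₄
                     :+ (♯ 39366 :+ s₃ :+ s₁ :+ s₀ :+ 54 · M :+ M :* ζ) :* g₃ :+ (♯ 39366 :+ s₃ :+ s₂ :+ s₀ :+ 54 · M :+ M :* ζ) :* g₂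
                     :+ (♯ 39366 :+ s₃ :+ s₂ :+ s₁ :+ 54 · M) :* g₁)
                   := (♯ 39366 :+ s₃ :+ s₂ :+ s₁ :+ s₀ :+ 54 · M :+ M :* ζ) :* (g₅ :+ g₄ :+ g₃ :+ g₂ :+ g₁)) refl
                   (k ^ 5 * (x ^ 3 * y)) (k ^ 4 * (x ^ 2 * y)) (k ^ 3 * (x ^ 1 * y)) (k ^ 2 * (x ^ 0 * y)) (k * (αₙ * y))
                   (size ε₃ₚ) (size ε₂ₚ) (size ε₁ₚ) (size ε₀ₚ) M (size ζₚ)) 0≤rest ⟩
          N * G n ∎
          where
          open ℚ.≤-Reasoning
          x≤x² : x ≤ x ^ 2
          x≤x² = subst (_≤ x ^ 2) (ℚ.*-identityʳ x) (*-monoˡ 0≤x (subst (1ℚ ≤_) (sym (ℚ.*-identityʳ x)) (ι-mono {1} {suc n} (ℕ.s≤s ℕ.z≤n))))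
          s₃ = size ε₃ₚ
          s₂ = size ε₂ₚ
          s₁ = size ε₁ₚ
          s₀ = size ε₀ₚ
          Mζ = M * size ζₚ
          rest : ℚ
          rest = (ι 4374 + s₃ + s₂ + s₁ + s₀ + ι 54 * M + Mζ) * (k ^ 5 * (x ^ 3 * y)) + (ι 37422 + s₂ + s₁ + s₀ + Mζ) * (k ^ 4 * (x ^ 2 * y))
            + (ι 39366 + s₃ + s₁ + s₀ + ι 54 * M + Mζ) * (k ^ 3 * (x ^ 1 * y)) + (ι 39366 + s₃ + s₂ + s₀ + ι 54 * M + Mζ) * (k ^ 2 * (x ^ 0 * y))
            + (ι 39366 + s₃ + s₂ + s₁ + ι 54 * M) * (k * (αₙ * y))
          0≤s : ∀ p → 0ℚ ≤ size p
          0≤s = 0≤size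
          0≤54M : 0ℚ ≤ ι 54 * M
          0≤54M = 0≤-* (0≤ι 54) 0≤M
          0≤Mζ : 0ℚ ≤ Mζ
          0≤Mζ = 0≤-* 0≤M (0≤s ζₚ)
          0≤g : ∀ i j → 0ℚ ≤ k ^ i * (x ^ j * y)
          0≤g i j = 0≤-* (^-0≤ i 0≤k) (0≤-* (^-0≤ j 0≤x) (0≤L n))
          0≤rest : 0ℚ ≤ rest
          0≤rest = 0≤-+ (0≤-+ (0≤-+ (0≤-+
            (0≤-* (0≤-+ (0≤-+ (0≤-+ (0≤-+ (0≤-+ (0≤-+ (0≤ι 4374) (0≤s ε₃ₚ)) (0≤s ε₂ₚ)) (0≤s ε₁ₚ)) (0≤s ε₀ₚ)) 0≤54M) 0≤Mζ) (0≤g 5 3))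
            (0≤-* (0≤-+ (0≤-+ (0≤-+ (0≤-+ (0≤ι 37422) (0≤s ε₂ₚ)) (0≤s ε₁ₚ)) (0≤s ε₀ₚ)) 0≤Mζ) (0≤g 4 2)))
            (0≤-* (0≤-+ (0≤-+ (0≤-+ (0≤-+ (0≤-+ (0≤ι 39366) (0≤s ε₃ₚ)) (0≤s ε₁ₚ)) (0≤s ε₀ₚ)) 0≤54M) 0≤Mζ) (0≤g 3 1)))
            (0≤-* (0≤-+ (0≤-+ (0≤-+ (0≤-+ (0≤-+ (0≤ι 39366) (0≤s ε₃ₚ)) (0≤s ε₂ₚ)) (0≤s ε₀ₚ)) 0≤54M) 0≤Mζ) (0≤g 2 0)))
            (0≤-* (0≤-+ (0≤-+ (0≤-+ (0≤-+ (0≤ι 39366) (0≤s ε₃ₚ)) (0≤s ε₂ₚ)) (0≤s ε₁ₚ)) 0≤54M) (0≤-* 0≤k (0≤-* (0≤α n) (0≤L n))))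

      -- κα ≤ κ² + α² trades the slowly convergent ∑ α lⁿ for ∑ α² at the price of κ = √k.
      kαL≤ : k * (αₙ * y) ≤ κ * (k * (x ^ 0 * y) + αₙ * αₙ)
      kαL≤ = begin
        k * (αₙ * y)                                ≡⟨ solve 3 (λ κ αₙ y → κ :* κ :* (αₙ :* y) := κ :* (κ :* αₙ :* y)) refl κ αₙ y ⟩
        κ * (κ * αₙ * y)                            ≤⟨ *-monoˡ 0≤κ (*-monoʳ (0≤L n) κa≤) ⟩
        κ * ((κ * κ + αₙ * αₙ) * y)                  ≡⟨ solve 4 (λ κ k αₙ y → κ :* ((k :+ αₙ :* αₙ) :* y) := κ :* (k :* (♯ 1 :* y) :+ αₙ :* αₙ :* y)) refl κ k αₙ y ⟩
        κ * (k * (1ℚ * y) + αₙ * αₙ * y)             ≤⟨ *-monoˡ 0≤κ (ℚ.+-monoʳ-≤ (k * (1ℚ * y)) (*-monoˡ (0≤-² αₙ) (L≤1 n))) ⟩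
        κ * (k * (1ℚ * y) + αₙ * αₙ * 1ℚ)            ≡⟨ cong (λ z → κ * (k * (1ℚ * y) + z)) (ℚ.*-identityʳ (αₙ * αₙ)) ⟩
        κ * (k * (x ^ 0 * y) + αₙ * αₙ)              ∎
        where
        open ℚ.≤-Reasoning
        κa≤ : κ * αₙ ≤ κ * κ + αₙ * αₙ
        κa≤ = ≤-add {κ * αₙ} {r = (κ - αₙ) * (κ - αₙ) + κ * αₙ} (solve 2 (λ κ αₙ → κ :* αₙ :+ ((κ :- αₙ) :* (κ :- αₙ) :+ κ :* αₙ) := κ :* κ :+ αₙ :* αₙ) refl κ αₙ)
          (0≤-+ (0≤-² (κ - αₙ)) (0≤-* 0≤κ (0≤α n)))

    open WeightedGeometric 0≤l

    ∑G≤ : ∀ m → ∑ m G ≤ ι 13 * κ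
    ∑G≤ m = begin
      ∑ m G
        ≤⟨ ∑-≤ m (λ n _ → ℚ.+-monoʳ-≤ (k ^ 5 * (ι (suc n) ^ 3 * L n) + k ^ 4 * (ι (suc n) ^ 2 * L n) + k ^ 3 * (ι (suc n) ^ 1 * L n) + k ^ 2 * (ι (suc n) ^ 0 * L n)) (kαL≤ n)) ⟩
      ∑ m (λ n → k ^ 5 * (ι (suc n) ^ 3 * L n) + k ^ 4 * (ι (suc n) ^ 2 * L n) + k ^ 3 * (ι (suc n) ^ 1 * L n) + k ^ 2 * (ι (suc n) ^ 0 * L n) + κ * (k * (ι (suc n) ^ 0 * L n) + α n * α n))
        ≡⟨ trans (∑-+ m) (cong₂ _+_ (trans (∑-+ m) (cong₂ _+_ (trans (∑-+ m) (cong₂ _+_ (trans (∑-+ m) (cong₂ _+_ (∑-* m (k ^ 5)) (∑-* m (k ^ 4)))) (∑-* m (k ^ 3)))) (∑-* m (k ^ 2))))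
             (trans (∑-* m κ) (cong (κ *_) (trans (∑-+ m) (cong (_+ ∑ m (λ n → α n * α n)) (∑-* m k)))))) ⟩
      k ^ 5 * weighted 3 m + k ^ 4 * weighted 2 m + k ^ 3 * weighted 1 m + k ^ 2 * weighted 0 m + κ * (k * weighted 0 m + ∑ m (λ n → α n * α n))
        ≡⟨ solve 7 (λ k κ w₃ w₂ w₁ w₀ s → k :^ 5 :* w₃ :+ k :^ 4 :* w₂ :+ k :^ 3 :* w₁ :+ k :^ 2 :* w₀ :+ κ :* (k :* w₀ :+ s)
             := k :* (k :^ 4 :* w₃ :+ k :^ 3 :* w₂ :+ k :^ 2 :* w₁ :+ k :^ 1 :* w₀) :+ κ :* (k :^ 1 :* w₀ :+ s)) refl k κ (weighted 3 m) (weighted 2 m) (weighted 1 m) (weighted 0 m) (∑ m (λ n → α n * α n)) ⟩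
      k * (k ^ 4 * weighted 3 m + k ^ 3 * weighted 2 m + k ^ 2 * weighted 1 m + k ^ 1 * weighted 0 m) + κ * (k ^ 1 * weighted 0 m + ∑ m (λ n → α n * α n))
        ≤⟨ ℚ.+-mono-≤ (*-monoˡ 0≤k (ℚ.+-mono-≤ (ℚ.+-mono-≤ (ℚ.+-mono-≤ (bound 3) (bound 2)) (bound 1)) (bound 0)))
             (*-monoˡ 0≤κ (ℚ.+-mono-≤ (bound 0) (∑α²≤2 m))) ⟩
      -- 6, 2, 1 and 1 are the factorials j!, and the final 2 is from `∑α²≤2`; with k ≤ κ all of
      -- them add up to 13.
      k * (ι 6 + ι 2 + ι 1 + ι 1) + κ * (ι 1 + ι 2)
        ≤⟨ ℚ.+-monoˡ-≤ (κ * (ι 1 + ι 2)) (*-monoʳ (0≤ι 10) (subst (k ≤_) (ℚ.*-identityʳ κ) (*-monoˡ 0≤κ κ≤1))) ⟩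
      κ * (ι 6 + ι 2 + ι 1 + ι 1) + κ * (ι 1 + ι 2)
        ≡⟨ solve 1 (λ κ → κ :* ♯ 10 :+ κ :* ♯ 3 := 13 · κ) refl κ ⟩
      ι 13 * κ ∎
      where
      open ℚ.≤-Reasoning
      bound : ∀ j → k ^ suc j * weighted j m ≤ ι (j ℕ.!)
      bound j = weighted-≤ 0≤k k≤1-l j m

    ∣∑err∣≤ : ∀ m → ∣ ∑ m (err m) ∣ ≤ N * (ι 13 * κ)
    ∣∑err∣≤ m = ℚ.≤-trans (∑-∣∣ m λ n n<m → err-≤ n m (ℕ.<⇒≤ n<m))
      (subst (_≤ N * (ι 13 * κ)) (sym (∑-* m N)) (*-monoˡ 0≤N (∑G≤ m)))
      where
      0≤N : 0ℚ ≤ N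
      0≤N = 0≤-+ (0≤-+ (0≤-+ (0≤-+ (0≤-+ (0≤-+ (0≤ι 39366) (0≤size ε₃ₚ)) (0≤size ε₂ₚ)) (0≤size ε₁ₚ)) (0≤size ε₀ₚ)) (0≤-* (0≤ι 54) 0≤M)) (0≤-* 0≤M (0≤size ζₚ))

    ∣H∣≤ : ∀ m → ∣ H m ∣ ≤ ι 648 * (ι m ^ 2 * L m) + ι 36 * (ι m ^ 1 * L m)
    ∣H∣≤ m = begin
      ∣ H m ∣
        ≡⟨ cong ∣_∣ (solve 4 (λ n a q h → 9 · (n :* n) :* a :* q :* h := 9 · n :* (n :* a) :* (q :* h)) refl (ι m) (α m) (qₙ m) (h (ι m) k)) ⟩
      ∣ ι 9 * ι m * nα m * (qₙ m * h (ι m) k) ∣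
        ≤⟨ ∣∣-*-≤ {ι 9 * ι m * nα m} (∣∣-*-≤ {ι 9 * ι m} (ℚ.≤-reflexive (∣∣-nonNeg (0≤-* (0≤ι 9) (0≤ι m)))) (∣nα∣≤1 m))
             (∣∣-*-≤ {qₙ m} (∣q∣≤L m) (ℚ.≤-trans (∣h∣ (ι m) (0≤ι m)) (ℚ.+-monoˡ-≤ (ι 4) (*-monoʳ (0≤ι m) (*-monoʳ (0≤ι 72) k≤1))))) ⟩
      ι 9 * ι m * 1ℚ * (L m * (1ℚ * ι 72 * ι m + ι 4))
        ≡⟨ solve 2 (λ n y → 9 · n :* ♯ 1 :* (y :* (♯ 1 :* ♯ 72 :* n :+ ♯ 4)) := 648 · (n :^ 2 :* y) :+ 36 · (n :^ 1 :* y)) refl (ι m) (L m) ⟩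
      ι 648 * (ι m ^ 2 * L m) + ι 36 * (ι m ^ 1 * L m) ∎
      where open ℚ.≤-Reasoning

    boundary : ℕ → ℚ
    boundary m = ι 4 * (ι 648 * (ι m ^ 2 * L m) + ι 36 * (ι m ^ 1 * L m) + M * (ι m ^ 0 * L m))

    boundary-null : Null boundary
    boundary-null = null-scale {λ m → ι 648 * (ι m ^ 2 * L m) + ι 36 * (ι m ^ 1 * L m) + M * (ι m ^ 0 * L m)} (ι 4)
      (null-+ {λ m → ι 648 * (ι m ^ 2 * L m) + ι 36 * (ι m ^ 1 * L m)} {λ m → M * (ι m ^ 0 * L m)}
        (null-+ {λ m → ι 648 * (ι m ^ 2 * L m)} {λ m → ι 36 * (ι m ^ 1 * L m)}
          (null-scale {λ m → ι m ^ 2 * L m} (ι 648) (null-power 2 0≤l l<1)) (null-scale {λ m → ι m ^ 1 * L m} (ι 36) (null-power 1 0≤l l<1)))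
        (null-scale {λ m → ι m ^ 0 * L m} M (null-power 0 0≤l l<1)))

    -- The first error term is uniform in m and the second is null for fixed κ, so κ has to be
    -- chosen before m. The main term is V · 2Wc · m α m, which `VWc` reduces to 2 m α m.
    anchor : ∀ m → ∣ R m k - ι 2 * nα m ∣ ≤ ι 52 * N * κ + boundary m
    anchor m = begin
      ∣ R m k - ι 2 * nα m ∣
        ≡⟨ cong ∣_∣ (cong₂ _-_ (R≡VS m k) (trans (solve 1 (λ x → x := ♯ 1 :* x) refl (ι 2 * nα m)) (cong (_* (ι 2 * nα m)) (sym (VWc 0≤k))))) ⟩
      ∣ V k * Ŝ - V k * (W k * c k) * (ι 2 * nα m) ∣
        ≡⟨ cong ∣_∣ (trans (cong (λ x → V k * x - V k * (W k * c k) * (ι 2 * nα m)) (sum≡ m))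
             (solve 6 (λ V H Wc A q s → V :* (H :+ 2 · Wc :* A :* (♯ 1 :- q) :+ s) :- V :* Wc :* (2 · A) := V :* (H :- 2 · Wc :* (A :* q) :+ s)) refl
               (V k) (H m) (W k * c k) (nα m) (qₙ m) (∑ m (err m)))) ⟩
      ∣ V k * (H m - ι 2 * (W k * c k) * (nα m * qₙ m) + ∑ m (err m)) ∣
        ≤⟨ ∣∣-*-≤ {V k} (∣V∣≤4 uk) (∣∣-+-≤ {H m - ι 2 * (W k * c k) * (nα m * qₙ m)} (∣∣-minus-≤ {H m} (∣H∣≤ m)
             (∣∣-*-≤ {ι 2 * (W k * c k)} (∣2Wc∣≤M uk) (∣∣-*-≤ {nα m} (∣nα∣≤1 m) (∣q∣≤L m)))) (∣∑err∣≤ m)) ⟩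
      ι 4 * (ι 648 * (ι m ^ 2 * L m) + ι 36 * (ι m ^ 1 * L m) + M * (1ℚ * L m) + N * (ι 13 * κ))
        ≡⟨ solve 4 (λ b M N κ → 4 · (b :+ M :+ N :* (13 · κ)) := 52 · N :* κ :+ 4 · (b :+ M)) refl
             (ι 648 * (ι m ^ 2 * L m) + ι 36 * (ι m ^ 1 * L m)) (M * (1ℚ * L m)) N κ ⟩
      ι 52 * N * κ + boundary m ∎
      where
      open ℚ.≤-Reasoning
      Ŝ = ∑ m (λ i → α i * q i k * C (ι i) k)

-- Uniform convergence on [x, y] to the approximants of the right-hand side.

module Limit where

  open import Data.Integer.Base using (ℤ; +_; -[1+_])
  open import Data.Rational.Base
  open Arithmetic
  open Hypergeometric
  open Sequences
  open Differentiation
  open Curve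
  open Telescoping
  open NearZero
  open Wallis using (T; √3ₙ; 2nαπ-√3-null; ∣S∣≤1)
  open Leibniz using (S)

  -- n is the number of terms of the series, i the index of the rational approximants of π and √3.
  -- Passing from the former to the latter costs 8/(n+1) for π and 1/(n+1) for √3.
  π√3-limit : ∀ {δ} → 0ℚ < δ → ∃ λ N → ∀ n → N ℕ.≤ n → ∀ i → suc n ℕ.≤ i → ∣ ι 2 * nα n * (ι 4 * S i) - √3ₙ i ∣ ≤ ι 2 * δ
  π√3-limit {δ} 0<δ =
    let N₁ , h₁ = 2nαπ-√3-null δ 0<δ
        N₂ , h₂ = null-scale {λ n → + 1 / suc n} (ι 9) null-1/ δ 0<δ
    in N₁ ℕ.⊔ N₂ , λ n N≤n i n<i → begin
      ∣ ι 2 * nα n * (ι 4 * S i) - √3ₙ i ∣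
        ≡⟨ cong ∣_∣ (solve 5 (λ a s s′ r r′ → 2 · a :* (4 · s′) :- r′ := (2 · a :* (4 · s) :- r) :+ 2 · a :* (4 · (s′ :- s)) :+ (r :- r′)) refl (nα n) (S (suc n)) (S i) (√3ₙ n) (√3ₙ i)) ⟩
      ∣ (ι 2 * nα n * T n - √3ₙ n) + ι 2 * nα n * (ι 4 * (S i - S (suc n))) + (√3ₙ n - √3ₙ i) ∣
        ≤⟨ ∣p+q+r∣ {ι 2 * nα n * T n - √3ₙ n} (h₁ n (ℕ.m⊔n≤o⇒m≤o N₁ N₂ N≤n))
             (∣∣-*-≤ {ι 2 * nα n} (∣∣-*-≤ {ι 2} ℚ.≤-refl (∣nα∣≤1 n)) (∣∣-*-≤ {ι 4} ℚ.≤-refl (S-close n i n<i)))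
             (Sqrt.approx-close 3 n i (ℕ.≤-trans (ℕ.n≤1+n n) n<i)) ⟩
      δ + ι 2 * 1ℚ * (ι 4 * (+ 1 / suc n)) + (+ 1 / suc n)
        ≡⟨ solve 2 (λ δ r → δ :+ ♯ 2 :* ♯ 1 :* (4 · r) :+ r := δ :+ 9 · r) refl δ (+ 1 / suc n) ⟩
      δ + ι 9 * (+ 1 / suc n)
        ≤⟨ ℚ.+-monoʳ-≤ δ (ℚ.≤-trans (Rational.p≤∣p∣ _) (h₂ n (ℕ.m⊔n≤o⇒n≤o N₁ N₂ N≤n))) ⟩
      δ + δ
        ≡⟨ solve 1 (λ δ → δ :+ δ := 2 · δ) refl δ ⟩
      ι 2 * δ ∎
    where
    open ℚ.≤-Reasoning
    S-close : ∀ n i → suc n ℕ.≤ i → ∣ S i - S (suc n) ∣ ≤ + 1 / suc n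
    S-close n i n<i = subst (_≤ + 1 / suc n) (Rational.∣p-q∣≡∣q-p∣ (S (suc n)) (S i))
      (ℚ.≤-trans (Leibniz.close (suc n) i n<i) (Rational.1/-antitone (ℕ.n≤1+n n)))

  -- The value at κ² is carried to all of [x, y] by `drift` on the larger interval [κ², y].
  R-anchored : ∀ {x y κ} → 0ℚ < κ → ι 2 * κ ≤ 1ℚ → κ ≤ x → x ≤ y → y < 1ℚ → ∃ λ (b : ℕ → ℚ) → Null b ×
               (∀ n → 2 ℕ.≤ n → ∀ k → x ≤ k → k ≤ y → ∣ R n k - ι 2 * nα n ∣ ≤ ι 52 * N * κ + b n)
  R-anchored {x} {y} {κ} 0<κ 2κ≤1 κ≤x x≤y y<1 = combine (drift (0<-* 0<κ 0<κ) (ℚ.≤-trans κ²≤x x≤y) y<1)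
    where
    open ℚ.≤-Reasoning
    κ²≤x : κ * κ ≤ x
    κ²≤x = ℚ.≤-trans (subst (κ * κ ≤_) (ℚ.*-identityʳ κ) (*-monoˡ (ℚ.<⇒≤ 0<κ)
      (ℚ.≤-trans (≤-add {r = κ} (solve 1 (λ k → k :+ k := 2 · k) refl κ) (ℚ.<⇒≤ 0<κ)) 2κ≤1))) κ≤x
    combine : (∃ λ (b : ℕ → ℚ) → Null b × (∀ n → 2 ℕ.≤ n → ∀ {k j} → κ * κ ≤ k → k ≤ j → j ≤ y → ∣ R n j - R n k ∣ ≤ b n)) →
      ∃ λ (b : ℕ → ℚ) → Null b × (∀ n → 2 ℕ.≤ n → ∀ k → x ≤ k → k ≤ y → ∣ R n k - ι 2 * nα n ∣ ≤ ι 52 * N * κ + b n)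
    combine (b , b-null , hb) = (λ n → b n + Anchor.boundary 0<κ 2κ≤1 n) , null-+ b-null (Anchor.boundary-null 0<κ 2κ≤1) , λ n 2≤n k x≤k k≤y → begin
      ∣ R n k - ι 2 * nα n ∣
        ≡⟨ cong ∣_∣ (solve 3 (λ a b c → a :- c := (a :- b) :+ (b :- c)) refl (R n k) (R n (κ * κ)) (ι 2 * nα n)) ⟩
      ∣ (R n k - R n (κ * κ)) + (R n (κ * κ) - ι 2 * nα n) ∣
        ≤⟨ ∣∣-+-≤ {R n k - R n (κ * κ)} (hb n 2≤n ℚ.≤-refl (ℚ.≤-trans κ²≤x x≤k) k≤y) (Anchor.anchor 0<κ 2κ≤1 n) ⟩
      b n + (ι 52 * N * κ + Anchor.boundary 0<κ 2κ≤1 n)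
        ≡⟨ solve 3 (λ b s c → b :+ (s :+ c) := s :+ (b :+ c)) refl (b n) (ι 52 * N * κ) (Anchor.boundary 0<κ 2κ≤1 n) ⟩
      ι 52 * N * κ + (b n + Anchor.boundary 0<κ 2κ≤1 n) ∎

  0<1/ : ∀ n → 0ℚ < + 1 / suc n
  0<1/ n = ℚ.*-cancelˡ-<-nonNeg (ι (suc n)) {{nonNegative (0≤ι (suc n))}}
    (subst₂ _<_ (sym (ℚ.*-zeroʳ (ι (suc n)))) (sym (ι*1/ n)) Rational.0<1)

  small-κ : ∀ {x δ} c → 0ℚ < x → 0ℚ < δ → ∃ λ κ → 0ℚ < κ × ι 2 * κ ≤ 1ℚ × κ ≤ x × c * κ ≤ δ
  small-κ {x} {δ} c 0<x 0<δ = pick (null-scale {λ n → + 1 / suc n} c null-1/ δ 0<δ) (archimedean 0<x)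
    where
    pick : (∃ λ N → ∀ n → N ℕ.≤ n → ∣ c * (+ 1 / suc n) ∣ ≤ δ) → (∃ λ N → ∀ n → N ℕ.≤ n → + 1 / suc n < x) →
           ∃ λ κ → 0ℚ < κ × ι 2 * κ ≤ 1ℚ × κ ≤ x × c * κ ≤ δ
    pick (N₁ , h₁) (N₂ , h₂) = + 1 / suc j , 0<1/ j
      , *-monoˡ {+ 1 / suc j} {½} {ι 2} (0≤ι 2) (Rational.1/-antitone {1} {j} (ℕ.s≤s ℕ.z≤n))
      , ℚ.<⇒≤ (h₂ j (ℕ.m≤n⇒m≤1+n (ℕ.m≤n⊔m N₁ N₂)))
      , ℚ.≤-trans (Rational.p≤∣p∣ (c * (+ 1 / suc j))) (h₁ j (ℕ.m≤n⇒m≤1+n (ℕ.m≤m⊔n N₁ N₂)))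
      where
      -- The successor gives j ≥ 1, so that κ = 1/(j+1) is at most ½.
      j = suc (N₁ ℕ.⊔ N₂)

  R-limit : ∀ {x y δ} → 0ℚ < x → x ≤ y → y < 1ℚ → 0ℚ < δ →
            ∃ λ N → ∀ n → N ℕ.≤ n → ∀ k → x ≤ k → k ≤ y → ∣ R n k - ι 2 * nα n ∣ ≤ ι 2 * δ
  R-limit {x} {y} {δ} 0<x x≤y y<1 0<δ = choose (small-κ (ι 52 * N) 0<x 0<δ)
    where
    open ℚ.≤-Reasoning
    Result : Set
    Result = ∃ λ N → ∀ n → N ℕ.≤ n → ∀ k → x ≤ k → k ≤ y → ∣ R n k - ι 2 * nα n ∣ ≤ ι 2 * δ
    choose : (∃ λ κ → 0ℚ < κ × ι 2 * κ ≤ 1ℚ × κ ≤ x × ι 52 * N * κ ≤ δ) → Result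
    choose (κ , 0<κ , 2κ≤1 , κ≤x , Nκ≤δ) = finish (R-anchored 0<κ 2κ≤1 κ≤x x≤y y<1)
      where
      finish : (∃ λ (b : ℕ → ℚ) → Null b × (∀ n → 2 ℕ.≤ n → ∀ k → x ≤ k → k ≤ y → ∣ R n k - ι 2 * nα n ∣ ≤ ι 52 * N * κ + b n)) → Result
      finish (b , b-null , hb) = let N₁ , h₁ = b-null δ 0<δ in 2 ℕ.⊔ N₁ , λ n N≤n k x≤k k≤y → begin
        ∣ R n k - ι 2 * nα n ∣
          ≤⟨ hb n (ℕ.m⊔n≤o⇒m≤o 2 N₁ N≤n) k x≤k k≤y ⟩
        ι 52 * N * κ + b n
          ≤⟨ ℚ.+-mono-≤ Nκ≤δ (ℚ.≤-trans (Rational.p≤∣p∣ (b n)) (h₁ n (ℕ.m⊔n≤o⇒n≤o 2 N₁ N≤n))) ⟩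
        δ + δ
          ≡⟨ solve 1 (λ δ → δ :+ δ := 2 · δ) refl δ ⟩
        ι 2 * δ ∎

  W≤ : ℚ
  W≤ = size wₚ ^ 4 * size Eₚ

  0≤W≤ : 0ℚ ≤ W≤
  0≤W≤ = 0≤-* (^-0≤ 4 (0≤size wₚ)) (0≤size Eₚ)

  ∣W∣≤ : ∀ {k} → Unit k → ∣ W k ∣ ≤ W≤
  ∣W∣≤ {k} uk = ∣∣-*-≤ {w k ^ 4} (∣^∣-≤ {w k} 4 (eval-bounded wₚ uk)) (eval-bounded Eₚ uk)

  -- With p in the role of π, the error is W/p times (R-A)p + (Ap-r), where 1/p ≤ 1 and p ≤ 4; hence
  -- 10 = 2·4 + 2.
  quotient-close : ∀ {W r R A p δ Ŵ} → ∣ W ∣ ≤ Ŵ → 1ℚ ≤ p → p ≤ ι 4 → ∣ R - A ∣ ≤ ι 2 * δ → ∣ A * p - r ∣ ≤ ι 2 * δ →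
                   ∣ W * R - r * W * inv p ∣ ≤ ι 10 * Ŵ * δ
  quotient-close {W} {r} {R} {A} {p} {δ} {Ŵ} ∣W∣≤ 1≤p p≤4 R≈A Ap≈r = begin
    ∣ W * R - r * W * inv p ∣
      ≡⟨ cong ∣_∣ (trans (cong (_- r * W * inv p) (trans (sym (ℚ.*-identityʳ (W * R))) (cong (W * R *_) (sym (*-inv 0<p)))))
           (solve 6 (λ W R s p i a → W :* R :* (p :* i) :- s :* W :* i := W :* i :* ((R :- a) :* p :+ (a :* p :- s))) refl W R r p (inv p) A)) ⟩
    ∣ W * inv p * ((R - A) * p + (A * p - r)) ∣
      ≤⟨ ∣∣-*-≤ {W * inv p} (∣∣-*-≤ {W} ∣W∣≤ (subst (_≤ 1ℚ) (sym (∣∣-nonNeg (inv-0≤ 0<p))) (inv-≤ 0<p (subst (1ℚ ≤_) (sym (ℚ.*-identityʳ p)) 1≤p))))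
           (∣∣-+-≤ {(R - A) * p} (∣∣-*-≤ {R - A} R≈A (subst (_≤ ι 4) (sym (∣∣-nonNeg (ℚ.<⇒≤ 0<p))) p≤4)) Ap≈r) ⟩
    Ŵ * 1ℚ * (ι 2 * δ * ι 4 + ι 2 * δ)
      ≡⟨ solve 2 (λ W δ → W :* ♯ 1 :* (2 · δ :* ♯ 4 :+ 2 · δ) := 10 · W :* δ) refl Ŵ δ ⟩
    ι 10 * Ŵ * δ ∎
    where
    open ℚ.≤-Reasoning
    0<p : 0ℚ < p
    0<p = ℚ.<-≤-trans Rational.0<1 1≤p

  1≤4S : ∀ i → 2 ℕ.≤ i → 1ℚ ≤ ι 4 * S i
  1≤4S i 2≤i = ℚ.≤-trans (*≤* (ℤ.+≤+ (ℕ.s≤s (ℕ.s≤s (ℕ.s≤s ℕ.z≤n))))) (*-monoˡ {+ 2 / 3} {S i} {ι 4} (0≤ι 4) (Leibniz.S-lower i 2≤i))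

  4S≤4 : ∀ i → ι 4 * S i ≤ ι 4
  4S≤4 i = *-monoˡ {S i} {1ℚ} {ι 4} (0≤ι 4) (ℚ.≤-trans (Rational.p≤∣p∣ (S i)) (∣S∣≤1 i))

  WR-limit : ∀ {x y ε} → 0ℚ < x → x ≤ y → y < 1ℚ → 0ℚ < ε →
             ∃ λ N → ∀ n → N ℕ.≤ n → ∀ i → suc (suc n) ℕ.≤ i → ∀ k → x ≤ k → k ≤ y →
             ∣ W k * R n k - √3ₙ i * W k * inv (ι 4 * S i) ∣ ≤ ε
  WR-limit {x} {y} {ε} 0<x x≤y y<1 0<ε = choose (Cauchy.scale (0<-* (0<ι 9) (ℚ.+-mono-<-≤ Rational.0<1 0≤W≤)) 0<ε)
    where
    Result : Set
    Result = ∃ λ N → ∀ n → N ℕ.≤ n → ∀ i → suc (suc n) ℕ.≤ i → ∀ k → x ≤ k → k ≤ y → ∣ W k * R n k - √3ₙ i * W k * inv (ι 4 * S i) ∣ ≤ ε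
    choose : (∃ λ δ → 0ℚ < δ × ι 10 * (1ℚ + W≤) * δ ≡ ε) → Result
    choose (δ , 0<δ , e) = finish (R-limit 0<x x≤y y<1 0<δ) (π√3-limit 0<δ)
      where
      finish : (∃ λ N → ∀ n → N ℕ.≤ n → ∀ k → x ≤ k → k ≤ y → ∣ R n k - ι 2 * nα n ∣ ≤ ι 2 * δ) →
               (∃ λ N → ∀ n → N ℕ.≤ n → ∀ i → suc n ℕ.≤ i → ∣ ι 2 * nα n * (ι 4 * S i) - √3ₙ i ∣ ≤ ι 2 * δ) → Result
      finish (N₁ , h₁) (N₂ , h₂) = N₁ ℕ.⊔ N₂ , λ n N≤n i n<i k x≤k k≤y → ℚ.≤-trans
        (quotient-close {W k} {√3ₙ i} {R n k} {ι 2 * nα n} {ι 4 * S i} {δ}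
          (ℚ.≤-trans (∣W∣≤ (ℚ.≤-trans (ℚ.<⇒≤ 0<x) x≤k , ℚ.≤-trans k≤y (ℚ.<⇒≤ y<1))) (≤-add (ℚ.+-comm W≤ 1ℚ) 0≤1))
          -- This is why i starts at n+2: the lower bound on S i requires i ≥ 2.
          (1≤4S i (ℕ.≤-trans (ℕ.s≤s (ℕ.s≤s ℕ.z≤n)) n<i)) (4S≤4 i)
          (h₁ n (ℕ.m⊔n≤o⇒m≤o N₁ N₂ N≤n) k x≤k k≤y)
          (h₂ n (ℕ.m⊔n≤o⇒n≤o N₁ N₂ N≤n) i (ℕ.≤-trans (ℕ.n≤1+n (suc n)) n<i)))
        (ℚ.≤-reflexive e)

  -- Returns from the normalised sum R to the series of the theorem, whose coefficient is u C; both
  -- VWc = 1 and cu = 1 enter.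
  uC*α≡WR : ∀ n {k} → 0ℚ ≤ k → ∑ n (λ i → α i * q i k * (u k * C (ι i) k)) ≡ W k * R n k
  uC*α≡WR n {k} 0≤k = trans (∑-cong n λ i → begin-equality
    α i * q i k * (u k * C (ι i) k)
      ≡⟨ solve 4 (λ a q u C → a :* q :* (u :* C) := ♯ 1 :* (a :* q :* (u :* C))) refl (α i) (q i k) (u k) (C (ι i) k) ⟩
    1ℚ * (α i * q i k * (u k * C (ι i) k))
      ≡⟨ cong (_* (α i * q i k * (u k * C (ι i) k))) (VWc 0≤k) ⟨
    V k * (W k * c k) * (α i * q i k * (u k * C (ι i) k))
      ≡⟨ solve 7 (λ V W c a q u C → V :* (W :* c) :* (a :* q :* (u :* C)) := c :* u :* (W :* (a :* (q :* (V :* C))))) refl (V k) (W k) (c k) (α i) (q i k) (u k) (C (ι i) k) ⟩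
    c k * u k * (W k * f i k)
      ≡⟨ cong (_* (W k * f i k)) (cu 0≤k) ⟩
    1ℚ * (W k * f i k)
      ≡⟨ ℚ.*-identityˡ (W k * f i k) ⟩
    W k * f i k ∎) (∑-* n (W k))
    where open ℚ.≤-Reasoning

-- The given expressions at a rational point, matched with the polynomials used above.

module Forms where

  open import Data.Integer.Base using (ℤ; +_; -[1+_])
  open import Data.Rational.Base
  open Arithmetic
  open Sequences
  open ThreeTermRecurrence
  open Curve
  open Telescoping
  open NearZero using (v³; v³w³; W)
  open LegendrePolynomials using (legendreℚ; legendreℚ*z^n)

  inv-w³ : ∀ {x} → 0ℚ ≤ x → inv ((ι 1 + ι 2 * x) ^ 3) ≡ v³ x
  inv-w³ {x} 0≤x = trans
    (cong (λ w → inv (w ^ 3)) (solve 1 (λ x → ♯ 1 :+ 2 · x := evalₛ wₚ x) refl x))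
    (inv-unique (0<-* (0<w 0≤x) (0<-* (0<w 0≤x) (0<-* (0<w 0≤x) Rational.0<1)))
      (trans (ℚ.*-comm (w x ^ 3) (v³ x)) (v³w³ 0≤x)))

  -- Spelled as the real-valued definitions reduce on a rational approximant, with literals read as
  -- `ι`; the lemmas about `seq` rely on this agreement by computation.
  D̂ Ê ĉ numerator base X̂ : ℚ → ℚ
  D̂ x = ι 1 - ι 2 * x - ι 2 * x ^ 2
  Ê x = ι 1 - ι 2 * x + ι 4 * x ^ 2
  ĉ x = ι 1 + x + x ^ 2
  numerator x = ι 1 - ι 4 * x + ι 6 * x ^ 2 - ι 4 * x ^ 3 + ι 10 * x ^ 4
  base x = ĉ x * D̂ x * Ê x * inv ((ι 1 + ι 2 * x) ^ 3)
  X̂ x = numerator x * ĉ x * inv ((ι 1 + ι 2 * x) ^ 3)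

  base≡z : ∀ {x} → 0ℚ ≤ x → base x ≡ z x
  base≡z {x} 0≤x = trans (cong (ĉ x * D̂ x * Ê x *_) (inv-w³ 0≤x))
    (solve 2 (λ x y → (♯ 1 :+ x :+ x :^ 2) :* (♯ 1 :- 2 · x :- 2 · (x :^ 2)) :* (♯ 1 :- 2 · x :+ 4 · (x :^ 2)) :* y
      := evalₛ cₚ x :* y :* (evalₛ Dₚ x :* evalₛ Eₚ x)) refl x (v³ x))

  X̂≡X : ∀ {x} → 0ℚ ≤ x → X̂ x ≡ X x
  X̂≡X {x} 0≤x = trans (cong (numerator x * ĉ x *_) (inv-w³ 0≤x))
    (solve 2 (λ x y → (♯ 1 :- 4 · x :+ 6 · (x :^ 2) :- 4 · (x :^ 3) :+ 10 · (x :^ 4)) :* (♯ 1 :+ x :+ x :^ 2) :* y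
      := evalₛ cₚ x :* y :* evalₛ Aₚ x) refl x (v³ x))

  Q̂≡q : ∀ n {x} → 0ℚ ≤ x → Q (X̂ x) (base x * base x) n ≡ q n x
  Q̂≡q n 0≤x = cong₂ (λ X z → Q X (z * z) n) (X̂≡X 0≤x) (base≡z 0≤x)

  legendre*base : ∀ n {x} → 0ℚ ≤ x → 0ℚ < ∣ D̂ x ∣ → legendreℚ n (numerator x * inv (D̂ x * Ê x)) * base x ^ n ≡ q n x
  legendre*base n {x} 0≤x 0<∣D∣ = begin
    legendreℚ n y * base x ^ n      ≡⟨ cong (λ b → legendreℚ n y * b ^ n) (base≡z 0≤x) ⟩
    legendreℚ n y * z x ^ n         ≡⟨ proj₁ (legendreℚ*z^n n y (z x)) ⟩
    Q (y * z x) (z x * z x) n             ≡⟨ cong (λ X → Q X (z x * z x) n) yz≡X ⟩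
    q n x                                 ∎
    where
    open ≡-Reasoning
    DE = D̂ x * Ê x
    y = numerator x * inv DE
    0<∣DE∣ : 0ℚ < ∣ DE ∣
    0<∣DE∣ = subst (0ℚ <_) (sym (∣∣-* (D̂ x) (Ê x)))
      (0<-* 0<∣D∣ (ℚ.<-≤-trans (ℚ.positive⁻¹ Rational.¾) (Rational.¾≤∣1-2q+4q²∣ x)))
    yz≡X : y * z x ≡ X x
    yz≡X = begin
      numerator x * inv DE * z x
        ≡⟨ solve 3 (λ x j ρ → let A = ♯ 1 :- 4 · x :+ 6 · (x :^ 2) :- 4 · (x :^ 3) :+ 10 · (x :^ 4) in
             A :* j :* (ρ :* (evalₛ Dₚ x :* evalₛ Eₚ x))
             := ((♯ 1 :- 2 · x :- 2 · (x :^ 2)) :* (♯ 1 :- 2 · x :+ 4 · (x :^ 2)) :* j) :* (ρ :* evalₛ Aₚ x)) refl x (inv DE) (ρ x) ⟩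
      DE * inv DE * X x
        ≡⟨ cong (_* X x) (Rational.inv-inverse 0<∣DE∣) ⟩
      1ℚ * X x
        ≡⟨ ℚ.*-identityˡ (X x) ⟩
      X x ∎

  Ĉ₃ Ĉ₂ Ĉ₁ Ĉ₀ : ℚ → ℚ
  Ĉ₃ x = ι 9 * (x - ι 1) ^ 2 * x ^ 2 * inv (ĉ x) * (ι 3 + ι 4 * x + ι 2 * x ^ 2) ^ 2 * (ι 3 + ι 2 * x + ι 4 * x ^ 2) ^ 2
  Ĉ₂ x = ι 27 * (x - ι 1) * x *
    (ι 9 - ι 18 * x + ι 10 * x ^ 2 + ι 12 * x ^ 3 + ι 60 * x ^ 4 + ι 160 * x ^ 5 + ι 240 * x ^ 6 + ι 192 * x ^ 7 + ι 64 * x ^ 8)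
  Ĉ₁ x = ι 9 - ι 144 * x + ι 540 * x ^ 2 - ι 584 * x ^ 3 + ι 314 * x ^ 4 - ι 228 * x ^ 5
    - ι 1256 * x ^ 6 - ι 1072 * x ^ 7 + ι 768 * x ^ 8 + ι 2560 * x ^ 9 + ι 1280 * x ^ 10
  Ĉ₀ x = ι 2 * D̂ x ^ 2 * (ι 1 - ι 10 * x + ι 12 * x ^ 2 - ι 24 * x ^ 3 + ι 16 * x ^ 4 + ι 32 * x ^ 6)

  Ĉ : ℚ → ℚ → ℚ
  Ĉ ν x = Ĉ₃ x * ν ^ 3 + Ĉ₂ x * ν ^ 2 + Ĉ₁ x * ν + Ĉ₀ x

  Ĉ≡uC : ∀ ν {x} → 0ℚ ≤ x → Ĉ ν x ≡ u x * C ν x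
  Ĉ≡uC ν {x} 0≤x = begin
    Ĉ ν x
      ≡⟨ cong (λ j → ι 9 * (x - ι 1) ^ 2 * x ^ 2 * inv j * (ι 3 + ι 4 * x + ι 2 * x ^ 2) ^ 2 * (ι 3 + ι 2 * x + ι 4 * x ^ 2) ^ 2 * ν ^ 3
           + Ĉ₂ x * ν ^ 2 + Ĉ₁ x * ν + Ĉ₀ x) (solve 1 (λ x → ♯ 1 :+ x :+ x :^ 2 := evalₛ cₚ x) refl x) ⟩
    ι 9 * (x - ι 1) ^ 2 * x ^ 2 * u x * (ι 3 + ι 4 * x + ι 2 * x ^ 2) ^ 2 * (ι 3 + ι 2 * x + ι 4 * x ^ 2) ^ 2 * ν ^ 3
      + Ĉ₂ x * ν ^ 2 + Ĉ₁ x * ν + Ĉ₀ x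
      -- C₃ alone contains the reciprocal of c. The other coefficients stay variables until they are
      -- multiplied by 1 = c u.
      ≡⟨ solve 6 (λ x u ν C₂ C₁ C₀ →
           9 · ((x :- ♯ 1) :^ 2) :* x :^ 2 :* u :* (♯ 3 :+ 4 · x :+ 2 · (x :^ 2)) :^ 2 :* (♯ 3 :+ 2 · x :+ 4 · (x :^ 2)) :^ 2 :* ν :^ 3
             :+ C₂ :* ν :^ 2 :+ C₁ :* ν :+ C₀
           := u :* evalₛ C₃ₚ x :* ν :^ 3 :+ ♯ 1 :* (C₂ :* ν :^ 2 :+ C₁ :* ν :+ C₀)) refl x (u x) ν (Ĉ₂ x) (Ĉ₁ x) (Ĉ₀ x) ⟩
    u x * eval C₃ₚ x * ν ^ 3 + 1ℚ * (Ĉ₂ x * ν ^ 2 + Ĉ₁ x * ν + Ĉ₀ x)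
      ≡⟨ cong (λ y → u x * eval C₃ₚ x * ν ^ 3 + y * (Ĉ₂ x * ν ^ 2 + Ĉ₁ x * ν + Ĉ₀ x)) (cu 0≤x) ⟨
    u x * eval C₃ₚ x * ν ^ 3 + c x * u x * (Ĉ₂ x * ν ^ 2 + Ĉ₁ x * ν + Ĉ₀ x)
      ≡⟨ solve 3 (λ x u ν →
           u :* evalₛ C₃ₚ x :* ν :^ 3 :+ evalₛ cₚ x :* u :* (C₂ₛ x :* ν :^ 2 :+ C₁ₛ x :* ν :+ C₀ₛ x)
           := u :* Cₛ ν x) refl x (u x) ν ⟩
    u x * C ν x ∎
    where
    open ≡-Reasoning
    C₂ₛ C₁ₛ C₀ₛ : ∀ {n} → Polynomial n → Polynomial n
    C₂ₛ x = 27 · (x :- ♯ 1) :* x :* (♯ 9 :- 18 · x :+ 10 · (x :^ 2) :+ 12 · (x :^ 3) :+ 60 · (x :^ 4) :+ 160 · (x :^ 5) :+ 240 · (x :^ 6) :+ 192 · (x :^ 7) :+ 64 · (x :^ 8))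
    C₁ₛ x = ♯ 9 :- 144 · x :+ 540 · (x :^ 2) :- 584 · (x :^ 3) :+ 314 · (x :^ 4) :- 228 · (x :^ 5) :- 1256 · (x :^ 6) :- 1072 · (x :^ 7) :+ 768 · (x :^ 8) :+ 2560 · (x :^ 9) :+ 1280 · (x :^ 10)
    C₀ₛ x = 2 · ((♯ 1 :- 2 · x :- 2 · (x :^ 2)) :^ 2) :* (♯ 1 :- 10 · x :+ 12 · (x :^ 2) :- 24 · (x :^ 3) :+ 16 · (x :^ 4) :+ 32 · (x :^ 6))

  W≡ : ∀ r x i → r * (ι 1 + ι 2 * x) ^ 4 * Ê x * i ≡ r * W x * i
  W≡ = solve 3 (λ r x i → r :* (♯ 1 :+ 2 · x) :^ 4 :* (♯ 1 :- 2 · x :+ 4 · (x :^ 2)) :* i := r :* (evalₛ wₚ x :^ 4 :* evalₛ Eₚ x) :* i) refl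

  triangle : ∀ x y z → x - y ≡ (x - z) - (y - z)
  triangle = solve 3 (λ x y z → x :- y := (x :- z) :- (y :- z)) refl

  add-sub : ∀ x y → x + y - y ≡ x
  add-sub = solve 2 (λ x y → x :+ y :- y := x) refl

-- Transfer of the rational estimates to Cauchy reals.

open import Defs
open import Data.Integer.Base using (+_)
open Arithmetic using (ι; inv)
open Hypergeometric using (α)

seq-^ : ∀ x n i → seq (x ^ n) i ≡ seq x i Sequences.^ n
seq-^ x zero    i = refl
seq-^ x (suc n) i = cong (seq x i ℚ.*_) (seq-^ x n i)

seq-∑< : ∀ n (a : ℕ → ℝ) i → seq (∑< n a) i ≡ Sequences.∑ n (λ j → seq (a j) i)
seq-∑< zero    a i = refl
seq-∑< (suc n) a i = cong (ℚ._+ seq (a n) i) (seq-∑< n a i)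

seq-legendre : ∀ n x i → seq (legendre n x) i ≡ LegendrePolynomials.legendreℚ n (seq x i)
seq-legendre n x i = trans (seq-∑< (suc n) _ i)
  (Sequences.∑-cong (suc n) λ m → cong (₂F₁-coeff (ℚ.- ι n) (ι (suc n)) m ℚ.*_) (seq-^ (fromℚ ½ * (1 - x)) m i))

-- The recurrence is repeated in real arithmetic so that the Cauchy property comes with the
-- construction.
mutual
  Q Q₋ : ℝ → ℝ → ℕ → ℝ
  Q X Y zero    = 1
  Q X Y (suc n) = fromℚ (+ 1 ℚ./ suc n) * (fromℚ (ι 2 ℚ.* ι n ℚ.+ 1ℚ) * X * Q X Y n - fromℚ (ι n) * Y * Q₋ X Y n)

  Q₋ X Y zero    = 0
  Q₋ X Y (suc n) = Q X Y n

seq-Q : ∀ X Y n i → seq (Q X Y n) i ≡ ThreeTermRecurrence.Q (seq X i) (seq Y i) n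
seq-Q₋ : ∀ X Y n i → seq (Q₋ X Y n) i ≡ ThreeTermRecurrence.Q₋ (seq X i) (seq Y i) n
seq-Q X Y zero    i = refl
seq-Q X Y (suc n) i = cong₂ (λ p q → (+ 1 ℚ./ suc n) ℚ.* ((ι 2 ℚ.* ι n ℚ.+ 1ℚ) ℚ.* seq X i ℚ.* p ℚ.- ι n ℚ.* seq Y i ℚ.* q)) (seq-Q X Y n i) (seq-Q₋ X Y n i)
seq-Q₋ X Y zero    i = refl
seq-Q₋ X Y (suc n) i = seq-Q X Y n i

-- Multiplying argument by base cancels D, so this formula makes sense at k₀ too.
q : ∀ k → 0 < k → ℕ → ℝ
q k 0<k = Q ((1 - 4 * k + 6 * k ^ 2 - 4 * k ^ 3 + 10 * k ^ 4) * (1 + k + k ^ 2)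
    / (1 + 2 * k) ^ 3 [ ^-nonZero (1 + 2 * k) 3 (1+2k≢0 k 0<k) ]) (base k 0<k * base k 0<k)

seq-q : ∀ k 0<k n i → 0ℚ ℚ.≤ seq k i → seq (q k 0<k n) i ≡ Curve.q n (seq k i)
seq-q k 0<k n i 0≤x = trans (seq-Q _ _ n i) (Forms.Q̂≡q n 0≤x)

seq-product : ∀ n k 0<k D≢0 i → 0ℚ ℚ.≤ seq k i → 0ℚ ℚ.< ℚ.∣ seq (D k) i ∣ → seq (product n k 0<k D≢0) i ≡ Curve.q n (seq k i)
seq-product n k 0<k D≢0 i 0≤x 0<∣D∣ = trans
  (cong₂ ℚ._*_ (seq-legendre n (argument k D≢0) i) (seq-^ (base k 0<k) n i))
  (Forms.legendre*base n 0≤x 0<∣D∣)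

seq-coefficient : ∀ k n i → 0ℚ ℚ.≤ seq k i → seq (coefficient k n) i ≡ Curve.u (seq k i) ℚ.* Telescoping.C (ι n) (seq k i)
seq-coefficient k n i = Forms.Ĉ≡uC (ι n)

Eventually : (ℕ → Set) → Set
Eventually P = ∃ λ N → ∀ i → N ℕ.≤ i → P i

eventually₂ : ∀ {P Q R : ℕ → Set} → Eventually P → Eventually Q → (∀ i → P i → Q i → R i) → Eventually R
eventually₂ (M , p) (N , q) h = M ℕ.⊔ N , λ i MN≤i →
  h i (p i (ℕ.m⊔n≤o⇒m≤o M N MN≤i)) (q i (ℕ.m⊔n≤o⇒n≤o M N MN≤i))

positive-bound : ∀ {x} → 0 < x → ∃ λ ε → 0ℚ ℚ.< ε × Eventually λ i → ε ℚ.≤ seq x i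
positive-bound {x} (ε , 0<ε , N , h) = ε , 0<ε , N , λ i N≤i → subst (ℚ._≤ seq x i) (ℚ.+-identityˡ ε) (h i N≤i)

<1-bound : ∀ {x} → x < 1 → ∃ λ y → y ℚ.< 1ℚ × Eventually λ i → seq x i ℚ.≤ y
<1-bound {x} (ε , 0<ε , N , h) = 1ℚ ℚ.- ε
  , subst (1ℚ ℚ.- ε ℚ.<_) (ℚ.+-identityʳ 1ℚ) (ℚ.+-monoʳ-< 1ℚ (ℚ.neg-antimono-< 0<ε))
  , N , λ i N≤i → subst (ℚ._≤ 1ℚ ℚ.- ε) (Forms.add-sub (seq x i) ε) (ℚ.+-monoˡ-≤ (ℚ.- ε) (h i N≤i))

<-by-half : ∀ {x ε e} → 0ℚ ℚ.< e → (Eventually λ i → e ℚ.≤ seq ε i) → (Eventually λ i → seq x i ℚ.≤ ½ ℚ.* e) → x < ε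
<-by-half {x} {ε} {e} 0<e e≤ε x≤½e = ½ ℚ.* e , Rational.*-pos Rational.0<½ 0<e , eventually₂ e≤ε x≤½e λ i e≤ x≤ →
  ℚ.≤-trans (ℚ.+-monoˡ-≤ (½ ℚ.* e) x≤) (subst (ℚ._≤ seq ε i) (sym (Rational.half+half e)) e≤)

≈-eventually-≡ : ∀ {x y} → (Eventually λ i → seq x i ≡ seq y i) → x ≈ y
≈-eventually-≡ {x} {y} (N , h) ε 0<ε = N , λ i N≤i →
  subst (λ z → ℚ.∣ z ∣ ℚ.< ε) (sym (trans (cong (ℚ._- seq y i) (h i N≤i)) (ℚ.+-inverseʳ (seq y i)))) 0<ε

eventually-unit : ∀ {k} → 0 < k → k < 1 → Eventually λ i → Differentiation.Unit (seq k i)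
eventually-unit {k} 0<k k<1 =
  let ε , 0<ε , lower = positive-bound {k} 0<k
      y , y<1 , upper = <1-bound {k} k<1
  in eventually₂ lower upper λ i ε≤x x≤y → ℚ.≤-trans (ℚ.<⇒≤ 0<ε) ε≤x , ℚ.≤-trans x≤y (ℚ.<⇒≤ y<1)

product-eventually : ∀ n k 0<k → k < 1 → ∀ D≢0 → Eventually λ i → seq (product n k 0<k D≢0) i ≡ Curve.q n (seq k i)
product-eventually n k 0<k k<1 D≢0 =
  let c , 0<c , away = away-from-0 (D k) D≢0
  in eventually₂ (eventually-unit {k} 0<k k<1) away λ i (0≤x , _) c≤∣D∣ →
    seq-product n k 0<k D≢0 i 0≤x (ℚ.<-≤-trans 0<c c≤∣D∣)

-- Away from k₀, D cancels in all late approximants. At k₀, q n is Lipschitz on [0,1] because it is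
-- differentiable there, and j and k are compared through their distances to k₀.
isProduct : ∀ n k 0<k → k < 1 → IsProduct n k 0<k (q k 0<k n)
isProduct n k 0<k k<1 = regular , limit
  where
  unit = eventually-unit {k} 0<k k<1
  regular : (D≢0 : NonZero (D k)) → q k 0<k n ≈ product n k 0<k D≢0
  regular D≢0 = ≈-eventually-≡ {q k 0<k n} {product n k 0<k D≢0} (eventually₂ unit (product-eventually n k 0<k k<1 D≢0)
    λ i (0≤x , _) e → trans (seq-q k 0<k n i 0≤x) (sym e))
  limit : k ≈ k₀ → IsLimitAtk₀ n (q k 0<k n)
  limit k≈k₀ ε 0<ε = choose (positive-bound {ε} 0<ε)
    where
    L : ℚ
    L = ι 2 ℚ.* Differentiation.Derivative.B (Curve.q-derivative n)
    0≤L : 0ℚ ℚ.≤ L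
    0≤L = Arithmetic.0≤-* (Arithmetic.0≤ι 2) (Differentiation.Derivative.0≤B (Curve.q-derivative n))
    Goal : Set
    Goal = ∃ λ δ → 0 < δ × (∀ j (0<j : 0 < j) → j < 1 → (D≢0 : NonZero (D j)) →
      ∣ j - k₀ ∣ < δ → ∣ product n j 0<j D≢0 - q k 0<k n ∣ < ε)
    choose : (∃ λ e → 0ℚ ℚ.< e × Eventually λ i → e ℚ.≤ seq ε i) → Goal
    -- j and k are each within d of k₀, so a quarter of e for each gives e/2; the other half of e is
    -- the gap that the strict order demands. The 1 in 1+L keeps the divisor positive.
    choose (e , 0<e , e≤ε) = finish (Cauchy.scale {1ℚ ℚ.+ L} (ℚ.+-mono-<-≤ Rational.0<1 0≤L) (Rational.*-pos Rational.0<½ (Rational.*-pos Rational.0<½ 0<e)))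
      where
      finish : (∃ λ d → 0ℚ ℚ.< d × (1ℚ ℚ.+ L) ℚ.* d ≡ ½ ℚ.* (½ ℚ.* e)) → Goal
      finish (d , 0<d , scaled) = fromℚ d , (d , 0<d , zero , λ i _ → ℚ.≤-reflexive (ℚ.+-identityˡ d)) , λ j 0<j j<1 D≢0 j≈k₀ →
        <-by-half {∣ product n j 0<j D≢0 - q k 0<k n ∣} {ε} 0<e e≤ε
          (eventually₂ (eventually₂ (eventually-unit {j} 0<j j<1) (product-eventually n j 0<j j<1 D≢0) λ _ → _,_)
            (eventually₂ (eventually₂ unit (k≈k₀ d 0<d) λ _ → _,_) (near j j≈k₀) λ _ → _,_)
            λ i (uj , ej) ((uk , k≈) , j≈) → close j 0<j D≢0 i uj uk ej j≈ k≈)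
        where
        near : ∀ j → ∣ j - k₀ ∣ < fromℚ d → Eventually λ i → ℚ.∣ seq j i ℚ.- seq k₀ i ∣ ℚ.≤ d
        near j (c , 0<c , N , h) = N , λ i N≤i → ℚ.≤-trans (Arithmetic.≤-add refl (ℚ.<⇒≤ 0<c)) (h i N≤i)
        close : ∀ j 0<j D≢0 i → Differentiation.Unit (seq j i) → Differentiation.Unit (seq k i) → seq (product n j 0<j D≢0) i ≡ Curve.q n (seq j i) →
                ℚ.∣ seq j i ℚ.- seq k₀ i ∣ ℚ.≤ d → ℚ.∣ seq k i ℚ.- seq k₀ i ∣ ℚ.< d →
                ℚ.∣ seq (product n j 0<j D≢0) i ℚ.- seq (q k 0<k n) i ∣ ℚ.≤ ½ ℚ.* e
        close j 0<j D≢0 i uj uk ej j≈ k≈ = begin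
          ℚ.∣ seq (product n j 0<j D≢0) i ℚ.- seq (q k 0<k n) i ∣
            ≡⟨ cong₂ (λ a b → ℚ.∣ a ℚ.- b ∣) ej (seq-q k 0<k n i (proj₁ uk)) ⟩
          ℚ.∣ Curve.q n x ℚ.- Curve.q n y ∣
            ≤⟨ Differentiation.Derivative.Lipschitz (Curve.q-derivative n) uk uj ⟩
          L ℚ.* ℚ.∣ x ℚ.- y ∣
            ≤⟨ Arithmetic.*-mono 0≤L (ℚ.0≤∣p∣ (x ℚ.- y)) (Arithmetic.≤-add (ℚ.+-comm L 1ℚ) Arithmetic.0≤1)
                 (ℚ.≤-trans (ℚ.≤-reflexive (cong ℚ.∣_∣ (Forms.triangle x y z))) (Arithmetic.∣∣-minus-≤ {x ℚ.- z} j≈ (ℚ.<⇒≤ k≈))) ⟩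
          (1ℚ ℚ.+ L) ℚ.* (d ℚ.+ d)
            ≡⟨ ℚ.*-distribˡ-+ (1ℚ ℚ.+ L) d d ⟩
          (1ℚ ℚ.+ L) ℚ.* d ℚ.+ (1ℚ ℚ.+ L) ℚ.* d
            ≡⟨ cong₂ ℚ._+_ scaled scaled ⟩
          ½ ℚ.* (½ ℚ.* e) ℚ.+ ½ ℚ.* (½ ℚ.* e)
            ≡⟨ Rational.half+half (½ ℚ.* e) ⟩
          ½ ℚ.* e ∎
          where
          open ℚ.≤-Reasoning
          x = seq j i
          y = seq k i
          z = seq k₀ i

summand : ∀ k → 0 < k → ℕ → ℝ
summand k 0<k n = fromℚ (₂F₁-coeff (+ 1 ℚ./ 3) (+ 2 ℚ./ 3) n) * q k 0<k n * coefficient k n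

seq-summand : ∀ k 0<k n i → 0ℚ ℚ.≤ seq k i → seq (∑< n (summand k 0<k)) i ≡ NearZero.W (seq k i) ℚ.* Telescoping.R n (seq k i)
seq-summand k 0<k n i 0≤x = trans (seq-∑< n (summand k 0<k) i) (trans
  (Sequences.∑-cong n λ j → cong₂ (λ a b → α j ℚ.* a ℚ.* b) (seq-q k 0<k j i 0≤x) (seq-coefficient k j i 0≤x))
  (Limit.uC*α≡WR n 0≤x))

value : ℝ → ℝ
value k = (√ 3 * (1 + 2 * k) ^ 4 * (1 - 2 * k + 4 * k ^ 2)) / π [ π≢0 ]

seq-value : ∀ k i → seq (value k) i ≡ Sqrt.approx 3 i ℚ.* NearZero.W (seq k i) ℚ.* inv (ι 4 ℚ.* Leibniz.S i)
seq-value k i = Forms.W≡ (Sqrt.approx 3 i) (seq k i) (inv (ι 4 ℚ.* Leibniz.S i))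

sum-estimate : ∀ k 0<k n i {d} → 0ℚ ℚ.≤ seq k i →
  ℚ.∣ NearZero.W (seq k i) ℚ.* Telescoping.R n (seq k i) ℚ.- Sqrt.approx 3 i ℚ.* NearZero.W (seq k i) ℚ.* inv (ι 4 ℚ.* Leibniz.S i) ∣ ℚ.≤ d →
  ℚ.∣ seq (∑< n (summand k 0<k)) i ℚ.- seq (value k) i ∣ ℚ.≤ d
sum-estimate k 0<k n i {d} 0≤x h = subst₂ (λ a b → ℚ.∣ a ℚ.- b ∣ ℚ.≤ d)
  (sym (seq-summand k 0<k n i 0≤x)) (sym (seq-value k i)) h

-- The order of the reals concerns late indices only, so for each n the approximants before i = n+2
-- may be discarded, although this threshold grows with n.
sums-close : ∀ k 0<k ε {x y e} → 0ℚ ℚ.< x → 0ℚ ℚ.< e →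
  (Eventually λ i → x ℚ.≤ seq k i × seq k i ℚ.≤ y) → (Eventually λ i → e ℚ.≤ seq ε i) →
  ∀ n → (∀ i → suc (suc n) ℕ.≤ i → ∀ k → x ℚ.≤ k → k ℚ.≤ y →
             ℚ.∣ NearZero.W k ℚ.* Telescoping.R n k ℚ.- Sqrt.approx 3 i ℚ.* NearZero.W k ℚ.* inv (ι 4 ℚ.* Leibniz.S i) ∣ ℚ.≤ ½ ℚ.* e) →
  ∣ ∑< n (summand k 0<k) - value k ∣ < ε
sums-close k 0<k ε {x} {y} {e} 0<x 0<e between e≤ε n h = <-by-half {∣ ∑< n (summand k 0<k) - value k ∣} {ε} 0<e e≤ε
    (eventually₂ {λ i → x ℚ.≤ seq k i × seq k i ℚ.≤ y} {λ i → suc (suc n) ℕ.≤ i} {λ i → seq ∣ ∑< n (summand k 0<k) - value k ∣ i ℚ.≤ ½ ℚ.* e} between (suc (suc n) , λ _ n<i → n<i) λ i (x≤ , ≤y) n<i →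
      sum-estimate k 0<k n i (ℚ.≤-trans (ℚ.<⇒≤ 0<x) x≤) (h i n<i (seq k i) x≤ ≤y))

sums-limit : ∀ k 0<k ε {x y e} → 0ℚ ℚ.< x → y ℚ.< 1ℚ → 0ℚ ℚ.< e →
  (Eventually λ i → x ℚ.≤ seq k i × seq k i ℚ.≤ y) → (Eventually λ i → e ℚ.≤ seq ε i) →
  ∃ λ N → ∀ n → N ℕ.≤ n → ∣ ∑< n (summand k 0<k) - value k ∣ < ε
sums-limit k 0<k ε {x} {y} {e} 0<x y<1 0<e between e≤ε = finish (Limit.WR-limit 0<x x≤y y<1 (Rational.*-pos Rational.0<½ 0<e))
  where
  x≤y : x ℚ.≤ y
  x≤y = let N , h = between; x≤ , ≤y = h N ℕ.≤-refl in ℚ.≤-trans x≤ ≤y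
  finish : (∃ λ N → ∀ n → N ℕ.≤ n → ∀ i → suc (suc n) ℕ.≤ i → ∀ k → x ℚ.≤ k → k ℚ.≤ y →
             ℚ.∣ NearZero.W k ℚ.* Telescoping.R n k ℚ.- Sqrt.approx 3 i ℚ.* NearZero.W k ℚ.* inv (ι 4 ℚ.* Leibniz.S i) ∣ ℚ.≤ ½ ℚ.* e) →
           ∃ λ N → ∀ n → N ℕ.≤ n → ∣ ∑< n (summand k 0<k) - value k ∣ < ε
  finish (N , h) = N , λ n N≤n → sums-close k 0<k ε 0<x 0<e between e≤ε n (h n N≤n)

theorem4 : ∀ (k : ℝ) (0<k : 0 < k) → k < 1 →
    ∃ λ (q : ℕ → ℝ) →
    (∀ n → IsProduct n k 0<k (q n)) ×
    (∑ (λ n → fromℚ (₂F₁-coeff (+ 1 ℚ./ 3) (+ 2 ℚ./ 3) n) * q n * coefficient k n)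
    ≈ (√ 3 * (1 + 2 * k) ^ 4 * (1 - 2 * k + 4 * k ^ 2)) / π [ π≢0 ])
theorem4 k 0<k k<1 = q k 0<k , (λ n → isProduct n k 0<k k<1) , λ ε 0<ε →
  -- Almost all approximants of k lie in one rational interval [x, y] inside (0,1), where the
  -- estimates are uniform.
  let x , 0<x , x≤k = positive-bound {k} 0<k
      y , y<1 , k≤y = <1-bound {k} k<1
      e , 0<e , e≤ε = positive-bound {ε} 0<ε
  in sums-limit k 0<k ε 0<x y<1 0<e (eventually₂ x≤k k≤y λ _ → _,_) e≤ε
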